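{- Let $\mathcal{P}_1,\dots,\mathcal{P}_r$ be vertex problems, for each $i\in[r]$ let $(\mathfrak{C}_i,\rho_i)$ be a pair consisting of a monotone dynamic programming core and a $\mathfrak{C}_i$-vertex-membership function that solves $\mathcal{P}_i$, and let $d\in\mathbb{N}$. Then the problem $DivMin^d(\mathcal{P}_1,\dots,\mathcal{P}_r)$ on a graph $G$ with a given cliquewidth decomposition $\mathcal{D}$ (i.e., deciding whether there exist $S_1,\dots,S_r\subseteq V(G)$ with $(G,S_i)\in\mathcal{P}_i$ for all $i$ and $DivMin(S_1,\dots,S_r)\ge d$) can be solved in time \[\mathcal{O}\left(\sum_{i=1}^r\tau(\mathfrak{C}_i,\mathcal{D}) + |V(\mathcal{D})|\cdot\prod_{i=1}^r Size_{\mathfrak{C}_i,\mathcal{D}}\cdot d^{r^2}\right).\]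
   Context: All graphs are finite, simple and undirected; $[r]=\{1,\dots,r\}$. A vertex problem is a set of pairs $(G,S)$ with $G$ a graph and $S\subseteq V(G)$. $HamDist(S,S')=|(S\setminus S')\cup(S'\setminus S)|$ and $DivMin(S_1,\dots,S_r)=\min_{1\le i<j\le r}HamDist(S_i,S_j)$. $DivMin^d(\mathcal{P}_1,\dots,\mathcal{P}_r)=\{(G,S_1,\dots,S_r):(G,S_i)\in\mathcal{P}_i\ \forall i,\ DivMin(S_1,\dots,S_r)\ge d\}$. Cliquewidth decomposition: a rooted tree $\mathcal{D}$ of width $\omega$ in which every node $t$ is $intro(v,a)$ with $a\in[\omega]$ (a leaf; builds the one-vertex graph with vertex $v$ of color $a$; we write $t=Leaf_{\mathcal{D}}(v)$), $t_1\oplus t_2$ (disjoint union of the colored graphs of the two children), $recolor(t',a\to b)$ (recolor color $a$ to $b$) or $addEdges(t',a,b)$ (add all edges between colors $a$ and $b$). $\delta(t)$ is the number of children of $t$; $\mathcal{D}$ is a decomposition of $G$ if $G$ is isomorphic to the graph built at the root. A dynamic programming core is an algorithm $\mathfrak{C}$ that, given a cliquewidth decomposition $\mathcal{D}$ of $G$, produces a finite set $Accept_{\mathfrak{C},\mathcal{D}}\subseteq\{0,1\}^*$ and for each node $t$ a finite set $Process_{\mathfrak{C},\mathcal{D}}(t)\subseteq(\{0,1\}^*)^{\delta(t)+1}$; $\tau(\mathfrak{C},\mathcal{D})$ is the time to construct these data and $Size_{\mathfrak{C},\mathcal{D}}=\max_t|Process_{\mathfrak{C},\mathcal{D}}(t)|$.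 A $(\mathfrak{C},\mathcal{D},w)$-witness is a map $\alpha:V(\mathcal{D})\to\{0,1\}^*$ with $(\alpha(t),\alpha(t_1),\dots,\alpha(t_{\delta(t)}))\in Process_{\mathfrak{C},\mathcal{D}}(t)$ for every node $t$ with children $t_1,\dots,t_{\delta(t)}$, and $\alpha(\text{root})=w$; it is a $(\mathfrak{C},\mathcal{D})$-witness if additionally $w\in Accept_{\mathfrak{C},\mathcal{D}}$. A core $\mathfrak{C}$ is monotone (for vertex problem $\mathcal{P}$) if there is $\rho:\{0,1\}^*\to\{0,1\}$ such that for every graph $G$, every cliquewidth decomposition $\mathcal{D}$ of $G$ and every $S\subseteq V(G)$: $(G,S)\in\mathcal{P}$ iff there is a $(\mathfrak{C},\mathcal{D})$-witness $\alpha$ with $S=\{v:\rho(\alpha(Leaf_{\mathcal{D}}(v)))=1\}$. Such $\rho$ is a $\mathfrak{C}$-vertex-membership function and $(\mathfrak{C},\rho)$ solves $\mathcal{P}$. -}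

module Defs where

open import Data.Bool using (Bool; true; false; T; if_then_else_)
open import Data.Fin using (Fin; toℕ) renaming (_≟_ to _≟ᶠ_; _<?_ to _<ᶠ?_)
open import Data.Fin.Subset using (Subset; _∪_; _─_; ∣_∣) renaming (_∈_ to _∈ˢ_)
open import Data.List using (List; []; _∷_; _++_; map; concatMap; foldr; length;
  filter; cartesianProduct; allFin; tabulate)
open import Data.List.Membership.Propositional using (_∈_)
open import Data.List.Relation.Unary.Unique.Propositional using (Unique)
open import Data.Nat using (ℕ; zero; suc; _+_; _*_; _∸_; _⊓_; _⊔_; _≤_; _≡ᵇ_)
open import Data.Nat.ListAction using (sum; product)
open import Data.Product using (∃-syntax; _×_; _,_; proj₁; proj₂)
open import Data.Sum using (_⊎_; inj₁; inj₂)
open import Data.Empty using (⊥)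
open import Data.Unit using (⊤)
open import Data.Vec as Vec using (Vec; []; _∷_)
open import Function using (_⇔_; _↔_; Inverse; Injective)
open import Level using (Level) renaming (suc to lsuc)
open import Relation.Binary.Construct.Add.Supremum.NonStrict _≤_ using (_≤⁺_)
open import Relation.Binary.PropositionalEquality using (_≡_; _≢_)
open import Relation.Nullary using (yes; no)
open import Relation.Nullary.Construct.Add.Supremum using (_⁺; ⊤⁺; [_])

Bits : Set
Bits = List Bool

------------------------------------------------------------------------
-- Graphs, vertex problems, diversity

record Graph : Set where
  field
    order      : ℕ
    adj        : Fin order → Fin order → Bool
    adj-sym    : ∀ u v → adj u v ≡ adj v u
    adj-irrefl : ∀ u → adj u u ≡ false

open Graph public

VertexProblem : (ℓ : Level) → Set (lsuc ℓ)
VertexProblem ℓ = (G : Graph) → Subset (order G) → Set ℓ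

HamDist : ∀ {n} → Subset n → Subset n → ℕ
HamDist S S′ = ∣ (S ─ S′) ∪ (S′ ─ S) ∣

infixr 7 _⊓⁺_

_⊓⁺_ : ℕ ⁺ → ℕ ⁺ → ℕ ⁺
⊤⁺    ⊓⁺ y     = y
[ m ] ⊓⁺ ⊤⁺    = [ m ]
[ m ] ⊓⁺ [ n ] = [ m ⊓ n ]

indexPairs : (r : ℕ) → List (Fin r × Fin r)
indexPairs r =
  filter (λ ij → proj₁ ij <ᶠ? proj₂ ij) (cartesianProduct (allFin r) (allFin r))

-- For r ≤ 1 this is the minimum of the empty set, taken to be ⊤⁺.
DivMin : ∀ {r n} → (Fin r → Subset n) → ℕ ⁺
DivMin {r} S =
  foldr _⊓⁺_ ⊤⁺ (map (λ ij → [ HamDist (S (proj₁ ij)) (S (proj₂ ij)) ]) (indexPairs r))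

DivMinProblem : ∀ {ℓ r} → ℕ → (Fin r → VertexProblem ℓ) →
                (G : Graph) → (Fin r → Subset (order G)) → Set ℓ
DivMinProblem d P G S = (∀ i → P i G (S i)) × [ d ] ≤⁺ DivMin S

------------------------------------------------------------------------
-- Cliquewidth decompositions

data Decomp (ω : ℕ) : Set where
  intro    : (v : ℕ) (a : Fin ω) → Decomp ω
  _⊕_      : (t₁ t₂ : Decomp ω) → Decomp ω
  recolor  : (t : Decomp ω) (a b : Fin ω) → Decomp ω
  addEdges : (t : Decomp ω) (a b : Fin ω) → Decomp ω

private variable
  ω : ℕ

-- The coloured graph built by a decomposition has the intro leaves as its
-- vertices; the name v in intro v a is recovered by vertexName.

BuiltVertex : Decomp ω → Set
BuiltVertex (intro v a)      = ⊤
BuiltVertex (t₁ ⊕ t₂)        = BuiltVertex t₁ ⊎ BuiltVertex t₂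
BuiltVertex (recolor t a b)  = BuiltVertex t
BuiltVertex (addEdges t a b) = BuiltVertex t

vertexName : (D : Decomp ω) → BuiltVertex D → ℕ
vertexName (intro v a)      x        = v
vertexName (t₁ ⊕ t₂)        (inj₁ x) = vertexName t₁ x
vertexName (t₁ ⊕ t₂)        (inj₂ x) = vertexName t₂ x
vertexName (recolor t a b)  x        = vertexName t x
vertexName (addEdges t a b) x        = vertexName t x

color : (D : Decomp ω) → BuiltVertex D → Fin ω
color (intro v a)      x        = a
color (t₁ ⊕ t₂)        (inj₁ x) = color t₁ x
color (t₁ ⊕ t₂)        (inj₂ x) = color t₂ x
color (recolor t a b)  x with color t x ≟ᶠ a
... | yes _ = b
... | no  _ = color t x
color (addEdges t a b) x        = color t x

BuiltEdge : (D : Decomp ω) → BuiltVertex D → BuiltVertex D → Set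
BuiltEdge (intro v a)      x        y        = ⊥
BuiltEdge (t₁ ⊕ t₂)        (inj₁ x) (inj₁ y) = BuiltEdge t₁ x y
BuiltEdge (t₁ ⊕ t₂)        (inj₁ x) (inj₂ y) = ⊥
BuiltEdge (t₁ ⊕ t₂)        (inj₂ x) (inj₁ y) = ⊥
BuiltEdge (t₁ ⊕ t₂)        (inj₂ x) (inj₂ y) = BuiltEdge t₂ x y
BuiltEdge (recolor t a b)  x        y        = BuiltEdge t x y
BuiltEdge (addEdges t a b) x        y        =
  BuiltEdge t x y ⊎
  (x ≢ y × ((color t x ≡ a × color t y ≡ b) ⊎ (color t x ≡ b × color t y ≡ a)))

-- No vertex name is introduced twice, i.e. every ⊕ is a disjoint union.
WellFormed : Decomp ω → Set
WellFormed D = Injective _≡_ _≡_ (vertexName D)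

record _IsDecompositionOf_ (D : Decomp ω) (G : Graph) : Set where
  field
    wellFormed : WellFormed D
    iso        : Fin (order G) ↔ BuiltVertex D
    iso-edge   : ∀ u v → T (adj G u v) ⇔ BuiltEdge D (Inverse.to iso u) (Inverse.to iso v)

-- V(𝒟), as positions in the tree.
data Node {ω : ℕ} : Decomp ω → Set where
  root       : ∀ {D} → Node D
  left       : ∀ {t₁ t₂} → Node t₁ → Node (t₁ ⊕ t₂)
  right      : ∀ {t₁ t₂} → Node t₂ → Node (t₁ ⊕ t₂)
  inRecolor  : ∀ {t a b} → Node t → Node (recolor t a b)
  inAddEdges : ∀ {t a b} → Node t → Node (addEdges t a b)

δ : {D : Decomp ω} → Node D → ℕ
δ {D = intro v a}      root = 0
δ {D = t₁ ⊕ t₂}        root = 2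
δ {D = recolor t a b}  root = 1
δ {D = addEdges t a b} root = 1
δ (left t)       = δ t
δ (right t)      = δ t
δ (inRecolor t)  = δ t
δ (inAddEdges t) = δ t

children : {D : Decomp ω} (t : Node D) → Vec (Node D) (δ t)
children {D = intro v a}      root = []
children {D = t₁ ⊕ t₂}        root = left root ∷ right root ∷ []
children {D = recolor t a b}  root = inRecolor root ∷ []
children {D = addEdges t a b} root = inAddEdges root ∷ []
children (left t)       = Vec.map left (children t)
children (right t)      = Vec.map right (children t)
children (inRecolor t)  = Vec.map inRecolor (children t)
children (inAddEdges t) = Vec.map inAddEdges (children t)

leafNode : (D : Decomp ω) → BuiltVertex D → Node D
leafNode (intro v a)      x        = root
leafNode (t₁ ⊕ t₂)        (inj₁ x) = left (leafNode t₁ x)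
leafNode (t₁ ⊕ t₂)        (inj₂ x) = right (leafNode t₂ x)
leafNode (recolor t a b)  x        = inRecolor (leafNode t x)
leafNode (addEdges t a b) x        = inAddEdges (leafNode t x)

Leaf : {D : Decomp ω} {G : Graph} → D IsDecompositionOf G → Fin (order G) → Node D
Leaf {D = D} isD v = leafNode D (Inverse.to (_IsDecompositionOf_.iso isD) v)

-- In postorder.
nodes : (D : Decomp ω) → List (Node D)
nodes (intro v a)      = root ∷ []
nodes (t₁ ⊕ t₂)        = map left (nodes t₁) ++ map right (nodes t₂) ++ root ∷ []
nodes (recolor t a b)  = map inRecolor (nodes t) ++ root ∷ []
nodes (addEdges t a b) = map inAddEdges (nodes t) ++ root ∷ []

∣V_∣ : Decomp ω → ℕ
∣V D ∣ = length (nodes D)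

------------------------------------------------------------------------
-- Model of computation: unit-cost random access machines with addition and
-- truncated subtraction (no multiplication), programmed in a while language.
-- The input is a random-access read-only sequence of naturals, the output a
-- write-only one.  Work memory consists of arrays named by naturals, of which a
-- program mentions finitely many; it is initially 0.  A program may use q
-- functions on bit strings as oracles: the argument is written to a query buffer
-- one bit per step, so that a query takes time at least its length.

data Expr : Set where
  const : ℕ → Expr
  inp   : Expr → Expr
  cell  : (a : ℕ) → Expr → Expr
  _⊞_   : Expr → Expr → Expr
  _⊟_   : Expr → Expr → Expr

data Prog (q : ℕ) : Set where
  skip            : Prog q
  assign          : (a : ℕ) (addr e : Expr) → Prog q
  emit            : Expr → Prog q
  feed            : Expr → Prog q
  ask             : (a : ℕ) (addr : Expr) (i : Fin q) → Prog q
  _⨾_             : Prog q → Prog q → Prog q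
  ifnz_then_else_ : Expr → Prog q → Prog q → Prog q
  whilenz_loop_   : Expr → Prog q → Prog q

record State : Set where
  constructor ⟨_,_,_⟩
  field
    memory : ℕ → ℕ → ℕ
    query  : Bits
    output : List ℕ

open State public

initial : State
initial = ⟨ (λ _ _ → 0) , [] , [] ⟩

nth : List ℕ → ℕ → ℕ
nth []       _       = 0
nth (x ∷ xs) zero    = x
nth (x ∷ xs) (suc k) = nth xs k

eval : List ℕ → (ℕ → ℕ → ℕ) → Expr → ℕ
eval xs m (const k)  = k
eval xs m (inp e)    = nth xs (eval xs m e)
eval xs m (cell a e) = m a (eval xs m e)
eval xs m (e ⊞ f)    = eval xs m e + eval xs m f
eval xs m (e ⊟ f)    = eval xs m e ∸ eval xs m f

cost : Expr → ℕ
cost (const k)  = 1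
cost (inp e)    = suc (cost e)
cost (cell a e) = suc (cost e)
cost (e ⊞ f)    = suc (cost e + cost f)
cost (e ⊟ f)    = suc (cost e + cost f)

write : (ℕ → ℕ → ℕ) → ℕ → ℕ → ℕ → (ℕ → ℕ → ℕ)
write m a k x a′ k′ =
  if a ≡ᵇ a′ then (if k ≡ᵇ k′ then x else m a′ k′) else m a′ k′

nonzero : ℕ → Bool
nonzero zero    = false
nonzero (suc _) = true

bit : Bool → ℕ
bit false = 0
bit true  = 1

module Semantics {q : ℕ} (oracle : Fin q → Bits → Bool) (xs : List ℕ) where

  infix 4 _,_⇓[_]_

  -- p , s ⇓[ k ] s′ : started in s, p halts in s′ after k steps.
  data _,_⇓[_]_ : Prog q → State → ℕ → State → Set where
    skip   : ∀ {s} → skip , s ⇓[ 1 ] s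
    assign : ∀ {m b o a addr e} →
      assign a addr e , ⟨ m , b , o ⟩
        ⇓[ suc (cost addr + cost e) ]
      ⟨ write m a (eval xs m addr) (eval xs m e) , b , o ⟩
    emit   : ∀ {m b o e} →
      emit e , ⟨ m , b , o ⟩
        ⇓[ suc (cost e) ]
      ⟨ m , b , o ++ eval xs m e ∷ [] ⟩
    feed   : ∀ {m b o e} →
      feed e , ⟨ m , b , o ⟩
        ⇓[ suc (cost e) ]
      ⟨ m , b ++ nonzero (eval xs m e) ∷ [] , o ⟩
    ask    : ∀ {m b o a addr i} →
      ask a addr i , ⟨ m , b , o ⟩
        ⇓[ suc (cost addr) ]
      ⟨ write m a (eval xs m addr) (bit (oracle i b)) , [] , o ⟩
    seq    : ∀ {p p′ s s′ s″ k l} →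
      p , s ⇓[ k ] s′ → p′ , s′ ⇓[ l ] s″ → (p ⨾ p′) , s ⇓[ k + l ] s″
    if-nz  : ∀ {e p p′ s s′ k} → eval xs (memory s) e ≢ 0 →
      p , s ⇓[ k ] s′ → (ifnz e then p else p′) , s ⇓[ suc (cost e + k) ] s′
    if-z   : ∀ {e p p′ s s′ k} → eval xs (memory s) e ≡ 0 →
      p′ , s ⇓[ k ] s′ → (ifnz e then p else p′) , s ⇓[ suc (cost e + k) ] s′
    while-nz : ∀ {e p s s′ s″ k l} → eval xs (memory s) e ≢ 0 →
      p , s ⇓[ k ] s′ → (whilenz e loop p) , s′ ⇓[ l ] s″ →
      (whilenz e loop p) , s ⇓[ suc (cost e + k + l) ] s″
    while-z  : ∀ {e p s} → eval xs (memory s) e ≡ 0 →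
      (whilenz e loop p) , s ⇓[ suc (cost e) ] s

-- On input xs, p halts after exactly k steps with output ys.
Computes : ∀ {q} → (Fin q → Bits → Bool) → Prog q → List ℕ → ℕ → List ℕ → Set
Computes oracle p xs k ys = ∃[ s ] (p , initial ⇓[ k ] s) × output s ≡ ys
  where open Semantics oracle xs

noOracle : Fin 0 → Bits → Bool
noOracle ()

------------------------------------------------------------------------
-- Encodings

encodeNodes : Decomp ω → List ℕ
encodeNodes (intro v a)      = 0 ∷ v ∷ toℕ a ∷ []
encodeNodes (t₁ ⊕ t₂)        = encodeNodes t₁ ++ encodeNodes t₂ ++ 1 ∷ []
encodeNodes (recolor t a b)  = encodeNodes t ++ 2 ∷ toℕ a ∷ toℕ b ∷ []
encodeNodes (addEdges t a b) = encodeNodes t ++ 3 ∷ toℕ a ∷ toℕ b ∷ []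

encodeDecomp : Decomp ω → List ℕ
encodeDecomp {ω} D = ω ∷ ∣V D ∣ ∷ encodeNodes D

-- 2 ends a bit string, 3 ends a list.
encodeBits : Bits → List ℕ
encodeBits w = map bit w ++ 2 ∷ []

encodeTuples : ∀ {k} → List (Vec Bits k) → List ℕ
encodeTuples ws = concatMap (λ w → concatMap encodeBits (Vec.toList w)) ws ++ 3 ∷ []

encodeCoreData : (D : Decomp ω) → ((t : Node D) → List (Vec Bits (suc (δ t)))) →
                 List Bits → List ℕ
encodeCoreData D process accept =
  concatMap (λ t → encodeTuples (process t)) (nodes D) ++
  concatMap encodeBits accept ++ 3 ∷ []

------------------------------------------------------------------------
-- Dynamic programming cores

-- Finite sets are given by duplicate-free lists of their elements.  The values of
-- the fields at decompositions that are not well-formed are irrelevant.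
record Core : Set where
  field
    program : Prog 0
    Accept  : (D : Decomp ω) → List Bits
    Process : (D : Decomp ω) (t : Node D) → List (Vec Bits (suc (δ t)))
    τ       : Decomp ω → ℕ
    Accept-unique  : (D : Decomp ω) → Unique (Accept D)
    Process-unique : (D : Decomp ω) (t : Node D) → Unique (Process D t)
    computes : (D : Decomp ω) → WellFormed D →
      Computes noOracle program (encodeDecomp D) (τ D)
               (encodeCoreData D (Process D) (Accept D))

open Core public

Size : Core → Decomp ω → ℕ
Size C D = foldr _⊔_ 0 (map (λ t → length (Process C D t)) (nodes D))

IsRootedWitness : (C : Core) (D : Decomp ω) → Bits → (Node D → Bits) → Set
IsRootedWitness C D w α =
  (∀ t → (α t ∷ Vec.map α (children t)) ∈ Process C D t) × α root ≡ w

IsWitness : (C : Core) (D : Decomp ω) → (Node D → Bits) → Set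
IsWitness C D α = ∃[ w ] IsRootedWitness C D w α × w ∈ Accept C D

-- (C , ρ) solves P; thus C is monotone for P, with vertex-membership function ρ.
Solves : ∀ {ℓ} → Core → (Bits → Bool) → VertexProblem ℓ → Set ℓ
Solves C ρ P =
  ∀ (G : Graph) {ω} (D : Decomp ω) (isD : D IsDecompositionOf G) (S : Subset (order G)) →
  P G S ⇔
  (∃[ α ] IsWitness C D α × (∀ v → v ∈ˢ S ⇔ ρ (α (Leaf isD v)) ≡ true))

Σ[τ] : ∀ {r} → (Fin r → Core) → Decomp ω → ℕ
Σ[τ] C D = sum (tabulate (λ i → τ (C i) D))

∏[Size] : ∀ {r} → (Fin r → Core) → Decomp ω → ℕ
∏[Size] C D = product (tabulate (λ i → Size (C i) D))

{-# OPTIONS --safe #-}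
module Submission where

-- Bit strings are turned into numbers that are multiples of a scale exceeding all
-- earlier numbers, so that sums of states of different cores determine the summands
-- and every array access takes constant time.  For each pair i < j of indices an
-- additional core selects d vertices on which S_i and S_j must differ; its states
-- 0 ≤ a ≤ d count the selected vertices, and at a join it has (d + 1)² tuples, which
-- gives (d + 1)^(r(r - 1)) for all pairs.  The Cartesian product of all cores is
-- evaluated bottom-up; its leaf labels record the membership bits and the selections
-- and are looked up in a table of size depending on r only.  Before that each core is
-- evaluated alone, in time linear in its output: afterwards all sizes are known to be
-- positive, and the case d = 0, in which the product term vanishes, is settled.

open import Defs
open import Data.Bool using (Bool; true; false; T; if_then_else_; _∨_; _∧_; _xor_)
open import Data.Empty using (⊥; ⊥-elim)
open import Data.Fin using (Fin; zero; suc; toℕ; fromℕ<) renaming (_<?_ to _<ᶠ?_)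
open import Data.Fin.Properties using (toℕ<n; toℕ-fromℕ<)
open import Data.Fin.Subset using (Subset) renaming (_∈_ to _∈ˢ_)
open import Data.List using (List; []; _∷_; _++_; foldr; length; map; concatMap; zipWith;
  allFin; tabulate; replicate; upTo; cartesianProduct)
open import Data.List.Membership.Propositional using (_∈_)
open import Data.List.Membership.Propositional.Properties using (∈-++⁻; ∈-++⁺ˡ; ∈-++⁺ʳ; ∈-map⁺;
  ∈-map⁻; ∈-allFin; ∈-filter⁺; ∈-filter⁻; ∈-cartesianProduct⁺; ∈-upTo⁺; ∈-upTo⁻)
open import Data.List.Membership.Propositional.Properties.WithK using (unique∧set⇒bag)
open import Data.List.Properties using (++-assoc; ++-identityʳ; length-++; length-map; map-++;
  concatMap-++; concatMap-map; map-∘; map-tabulate; tabulate-cong; length-upTo; length-tabulate;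
  length-replicate)
open import Data.List.Relation.Binary.BagAndSetEquality using (∼bag⇒↭)
open import Data.List.Relation.Binary.Permutation.Propositional using (_↭_)
open import Data.List.Relation.Binary.Permutation.Propositional.Properties using (map⁺)
open import Data.List.Relation.Binary.Pointwise using (Pointwise; []; _∷_)
open import Data.List.Relation.Unary.All using (All; []; _∷_)
open import Data.List.Relation.Unary.All.Properties using (++⁺; replicate⁺; tabulate⁺; tabulate⁻)
open import Data.List.Relation.Unary.AllPairs using ([]; _∷_)
open import Data.List.Relation.Unary.Any using (here; there)
open import Data.List.Relation.Unary.Unique.Propositional using (Unique)
import Data.List.Relation.Unary.Unique.Propositional.Properties as Unique
open import Data.Nat
open import Data.Nat.DivMod using (_%_; m<n⇒m%n≡m; [m+kn]%n≡m%n)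
open import Data.Nat.Divisibility using (_∣_; divides)
open import Data.Nat.ListAction using (sum; product)
open import Data.Nat.ListAction.Properties using (sum-↭; sum-++; product-++)
open import Data.Nat.Properties
open import Algebra.Properties.CommutativeSemigroup +-commutativeSemigroup using (interchange)
open import Data.Product using (Σ; ∃-syntax; _×_; _,_; proj₁; proj₂)
open import Data.Sum using (_⊎_; inj₁; inj₂; [_,_]′)
open import Data.Sum.Properties using (inj₁-injective; inj₂-injective)
open import Data.Unit using (⊤; tt)
open import Data.Vec as Vec using (Vec; []; _∷_)
open import Data.Vec.Properties using ([]=⇒lookup; lookup⇒[]=; lookup∘tabulate)
  renaming (map-∘ to vec-map-∘)
open import Function using (_∘_; id; Inverse; mk⇔; _↔_; _⇔_; Equivalence)
open import Level using (Level)
open import Relation.Binary.Construct.Add.Supremum.NonStrict _≤_ using (_≤⁺_; [_]; _≤⊤⁺)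
open import Relation.Binary.PropositionalEquality hiding ([_]; J)
open import Relation.Nullary using (yes; no; ¬_)
open import Relation.Nullary.Construct.Add.Supremum using (_⁺; ⊤⁺; [_])

-- States become numbers that may be exponential in the length of their strings, so a table indexed
-- by states can be neither cleared nor traversed. Hence no cell is reused: memory is initially 0,
-- every node of every evaluation gets a new range of `SC` cells by advancing one base, and scales
-- only grow. Acceptance is expressed by an additional unary root whose entries lead from the
-- accepted states to the state 0. A sum is 0 only if all summands are, so the product accepts
-- exactly when all factors do. Selecting exactly `d` vertices, instead of measuring a distance,
-- turns the distance condition into a local condition on leaf labels and a counter that is
-- independent of the cores. Positive sizes matter because factors are multiplied one after the
-- other: an intermediate product is bounded by the final one only if no later factor is empty. The
-- exponent r^2 results from (d + 1)^2 ≤ 4 d^2 for d > 0 and twice the number of pairs being at most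
-- r^2. For d = 0 only the sum of the running times is available; it dominates the number of nodes,
-- because a core prints an end mark for each node.

infixl 6 _:+_
infixl 7 _:*_

-- Linear inequalities over the naturals, decided by comparing coefficients

data Linear (n : ℕ) : Set where
  #_   : ℕ → Linear n
  !_   : Fin n → Linear n
  _:+_ : Linear n → Linear n → Linear n
  _:*_ : ℕ → Linear n → Linear n

v₀ : ∀ {n} → Linear (1 + n)
v₀ = ! zero

v₁ : ∀ {n} → Linear (2 + n)
v₁ = ! suc zero

v₂ : ∀ {n} → Linear (3 + n)
v₂ = ! suc (suc zero)

v₃ : ∀ {n} → Linear (4 + n)
v₃ = ! suc (suc (suc zero))

⟦_⟧ : ∀ {n} → Linear n → Vec ℕ n → ℕ
⟦ # k ⟧ ρ    = k
⟦ ! i ⟧ ρ    = Vec.lookup ρ i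
⟦ e :+ f ⟧ ρ = ⟦ e ⟧ ρ + ⟦ f ⟧ ρ
⟦ k :* e ⟧ ρ = k * ⟦ e ⟧ ρ

constant : ∀ {n} → Linear n → ℕ
constant (# k)    = k
constant (! i)    = 0
constant (e :+ f) = constant e + constant f
constant (k :* e) = k * constant e

coefficients : ∀ {n} → Linear n → Vec ℕ n
coefficients (# k)    = Vec.replicate _ 0
coefficients (! i)    = Vec.replicate _ 0 Vec.[ i ]≔ 1
coefficients (e :+ f) = Vec.zipWith _+_ (coefficients e) (coefficients f)
coefficients (k :* e) = Vec.map (k *_) (coefficients e)

dot : ∀ {n} → Vec ℕ n → Vec ℕ n → ℕ
dot []       []       = 0
dot (c ∷ cs) (x ∷ xs) = c * x + dot cs xs

dot-0 : ∀ {n} (ρ : Vec ℕ n) → dot (Vec.replicate n 0) ρ ≡ 0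
dot-0 []      = refl
dot-0 (x ∷ ρ) = dot-0 ρ

dot-unit : ∀ {n} (i : Fin n) (ρ : Vec ℕ n) →
  dot (Vec.replicate n 0 Vec.[ i ]≔ 1) ρ ≡ Vec.lookup ρ i
dot-unit zero    (x ∷ ρ) = trans (cong₂ _+_ (*-identityˡ x) (dot-0 ρ)) (+-identityʳ x)
dot-unit (suc i) (x ∷ ρ) = dot-unit i ρ

dot-+ : ∀ {n} (c c′ ρ : Vec ℕ n) → dot (Vec.zipWith _+_ c c′) ρ ≡ dot c ρ + dot c′ ρ
dot-+ []      []        []      = refl
dot-+ (a ∷ c) (a′ ∷ c′) (x ∷ ρ) =
  trans (cong₂ _+_ (*-distribʳ-+ x a a′) (dot-+ c c′ ρ))
        (interchange (a * x) (a′ * x) (dot c ρ) (dot c′ ρ))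

dot-* : ∀ {n} k (c ρ : Vec ℕ n) → dot (Vec.map (k *_) c) ρ ≡ k * dot c ρ
dot-* k []      []      = sym (*-zeroʳ k)
dot-* k (a ∷ c) (x ∷ ρ) =
  trans (cong₂ _+_ (*-assoc k a x) (dot-* k c ρ)) (sym (*-distribˡ-+ k (a * x) (dot c ρ)))

normal-form : ∀ {n} (e : Linear n) (ρ : Vec ℕ n) → ⟦ e ⟧ ρ ≡ constant e + dot (coefficients e) ρ
normal-form (# k)    ρ = sym (trans (cong (k +_) (dot-0 ρ)) (+-identityʳ k))
normal-form (! i)    ρ = sym (dot-unit i ρ)
normal-form (e :+ f) ρ = begin
  ⟦ e ⟧ ρ + ⟦ f ⟧ ρ
    ≡⟨ cong₂ _+_ (normal-form e ρ) (normal-form f ρ) ⟩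
  (constant e + dot (coefficients e) ρ) + (constant f + dot (coefficients f) ρ)
    ≡⟨ interchange (constant e) _ (constant f) _ ⟩
  (constant e + constant f) + (dot (coefficients e) ρ + dot (coefficients f) ρ)
    ≡⟨ cong (constant e + constant f +_) (sym (dot-+ (coefficients e) (coefficients f) ρ)) ⟩
  (constant e + constant f) + dot (coefficients (e :+ f)) ρ ∎
  where open ≡-Reasoning
normal-form (k :* e) ρ = begin
  k * ⟦ e ⟧ ρ                                        ≡⟨ cong (k *_) (normal-form e ρ) ⟩
  k * (constant e + dot (coefficients e) ρ)          ≡⟨ *-distribˡ-+ k (constant e) _ ⟩
  k * constant e + k * dot (coefficients e) ρ        ≡⟨ cong (k * constant e +_) (sym (dot-* k (coefficients e) ρ)) ⟩
  k * constant e + dot (coefficients (k :* e)) ρ     ∎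
  where open ≡-Reasoning

_≤ᵛ_ : ∀ {n} → Vec ℕ n → Vec ℕ n → Bool
[]      ≤ᵛ []        = true
(a ∷ c) ≤ᵛ (a′ ∷ c′) = (a ≤ᵇ a′) ∧ (c ≤ᵛ c′)

T-∧ : ∀ {a b} → T (a ∧ b) → T a × T b
T-∧ {true} {true} _ = tt , tt

dot-mono : ∀ {n} (c c′ ρ : Vec ℕ n) → T (c ≤ᵛ c′) → dot c ρ ≤ dot c′ ρ
dot-mono []      []        []      _ = z≤n
dot-mono (a ∷ c) (a′ ∷ c′) (x ∷ ρ) h =
  +-mono-≤ (*-monoˡ-≤ x (≤ᵇ⇒≤ a a′ (proj₁ (T-∧ h))))
           (dot-mono c c′ ρ (proj₂ (T-∧ {a ≤ᵇ a′} h)))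

-- Variables range over naturals, so comparing constants and coefficients suffices. Both tests
-- evaluate to `true` on concrete terms and their proofs are found by unification; a cost estimate
-- is thus proved by writing down its two sides.
linear : ∀ {n} (e f : Linear n) (ρ : Vec ℕ n) →
  {_ : T (constant e ≤ᵇ constant f)} {_ : T (coefficients e ≤ᵛ coefficients f)} →
  ⟦ e ⟧ ρ ≤ ⟦ f ⟧ ρ
linear e f ρ {h} {h′} =
  subst₂ _≤_ (sym (normal-form e ρ)) (sym (normal-form f ρ))
    (+-mono-≤ (≤ᵇ⇒≤ _ _ h) (dot-mono (coefficients e) (coefficients f) ρ h′))

-- Program logic

Memory : Set
Memory = ℕ → ℕ → ℕ

record Assignment : Set where
  constructor _[_]≔_
  field
    array : ℕ
    index value : Expr

infix 6 _[_]≔_ _≔_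

_≔_ : ℕ → Expr → Assignment
a ≔ e = a [ const 0 ]≔ e

var : ℕ → Expr
var a = cell a (const 0)

block : ∀ {q} → List Assignment → Prog q
block []                   = skip
block ((a [ i ]≔ e) ∷ as)  = assign a i e ⨾ block as

block-cost : List Assignment → ℕ
block-cost []                  = 1
block-cost ((a [ i ]≔ e) ∷ as) = suc (cost i + cost e) + block-cost as

-- Straight-line code has its final memory as a function of the initial one, so most facts about
-- such code hold by `refl`.
run-block : List ℕ → Memory → List Assignment → Memory
run-block xs m []                  = m
run-block xs m ((a [ i ]≔ e) ∷ as) = run-block xs (write m a (eval xs m i) (eval xs m e)) as

-- A syntactic over-approximation of the arrays written to. On concrete programs it evaluates, and
-- the side conditions of the frame rule are then `refl`; the same holds for `queries` and `emits`.
modifies : ∀ {q} → Prog q → ℕ → Bool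
modifies skip                    a = false
modifies (assign b _ _)          a = b ≡ᵇ a
modifies (emit _)                a = false
modifies (feed _)                a = false
modifies (ask b _ _)             a = b ≡ᵇ a
modifies (p ⨾ p′)                a = modifies p a ∨ modifies p′ a
modifies (ifnz _ then p else p′) a = modifies p a ∨ modifies p′ a
modifies (whilenz _ loop p)      a = modifies p a

queries : ∀ {q} → Prog q → Bool
queries skip                    = false
queries (assign _ _ _)          = false
queries (emit _)                = false
queries (feed _)                = true
queries (ask _ _ _)             = true
queries (p ⨾ p′)                = queries p ∨ queries p′
queries (ifnz _ then p else p′) = queries p ∨ queries p′
queries (whilenz _ loop p)      = queries p

emits : ∀ {q} → Prog q → Bool
emits skip                    = false
emits (assign _ _ _)          = false
emits (emit _)                = true
emits (feed _)                = false
emits (ask _ _ _)             = false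
emits (p ⨾ p′)                = emits p ∨ emits p′
emits (ifnz _ then p else p′) = emits p ∨ emits p′
emits (whilenz _ loop p)      = emits p

∨-false : ∀ {a b} → a ∨ b ≡ false → a ≡ false × b ≡ false
∨-false {false} {false} _ = refl , refl

if-≡ : ∀ {A : Set} k {x y : A} → (if k ≡ᵇ k then x else y) ≡ x
if-≡ zero    = refl
if-≡ (suc k) = if-≡ k

if-≢ : ∀ {A : Set} {k k′} {x y : A} → k ≢ k′ → (if k ≡ᵇ k′ then x else y) ≡ y
if-≢ {k = k} {k′} k≢k′ with k ≡ᵇ k′ | ≡ᵇ⇒≡ k k′
... | false | _ = refl
... | true  | h = ⊥-elim (k≢k′ (h tt))

write-array : ∀ (m : Memory) {a k x} b → (a ≡ᵇ b) ≡ false → ∀ j → write m a k x b j ≡ m b j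
write-array m b h j rewrite h = refl

-- Exceeds the cost of every straight-line part of the programs below.
abstract
  stepFactor : ℕ
  stepFactor = 1000

  ≤stepFactor : ∀ k → T (k ≤ᵇ 1000) → k ≤ stepFactor
  ≤stepFactor k h = ≤ᵇ⇒≤ k 1000 h

≤stepFactor*1 : ∀ k → T (k ≤ᵇ 1000) → k ≤ stepFactor * 1
≤stepFactor*1 k h = subst (k ≤_) (sym (*-identityʳ stepFactor)) (≤stepFactor k h)

module Logic {q : ℕ} (oracle : Fin q → Bits → Bool) (xs : List ℕ) where
  open Semantics oracle xs public

  record Frame (p : Prog q) (s s′ : State) : Set where
    field
      same-memory : ∀ a → modifies p a ≡ false → ∀ k → memory s′ a k ≡ memory s a k
      same-query  : queries p ≡ false → query s′ ≡ query s
      same-output : emits p ≡ false → output s′ ≡ output s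

  open Frame public

  -- Separates what a program leaves alone from what it does: the postconditions below mention only
  -- changes, everything else is recovered from the program text.
  frame : ∀ {p s s′ k} → p , s ⇓[ k ] s′ → Frame p s s′
  frame skip = record { same-memory = λ _ _ _ → refl ; same-query = λ _ → refl ; same-output = λ _ → refl }
  frame (assign {m = m} {a = a} {addr = addr} {e = e}) = record
    { same-memory = write-array m {a} {eval xs m addr} {eval xs m e} ; same-query = λ _ → refl ; same-output =
        λ _ → refl }
  frame emit = record { same-memory = λ _ _ _ → refl ; same-query = λ _ → refl ; same-output = λ () }
  frame feed = record { same-memory = λ _ _ _ → refl ; same-query = λ () ; same-output = λ _ → refl }
  frame (ask {m = m} {b = b} {a = a} {addr = addr} {i = i}) = record
    { same-memory = write-array m {a} {eval xs m addr} {bit (oracle i b)} ; same-query = λ () ; same-output =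
        λ _ → refl }
  frame (seq e e′) = record
    { same-memory = λ a h k → trans (same-memory (frame e′) a (proj₂ (∨-false h)) k)
                                    (same-memory (frame e) a (proj₁ (∨-false h)) k)
    ; same-query  = λ h → trans (same-query (frame e′) (proj₂ (∨-false h))) (same-query (frame e) (proj₁ (∨-false h)))
    ; same-output = λ h → trans (same-output (frame e′) (proj₂ (∨-false h)))
        (same-output (frame e) (proj₁ (∨-false h))) }
  frame (if-nz _ e) = record
    { same-memory = λ a h → same-memory (frame e) a (proj₁ (∨-false h))
    ; same-query  = λ h → same-query (frame e) (proj₁ (∨-false h))
    ; same-output = λ h → same-output (frame e) (proj₁ (∨-false h)) }
  frame (if-z {p = p} _ e) = record
    { same-memory = λ a h → same-memory (frame e) a (proj₂ (∨-false {modifies p a} h))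
    ; same-query  = λ h → same-query (frame e) (proj₂ (∨-false {queries p} h))
    ; same-output = λ h → same-output (frame e) (proj₂ (∨-false {emits p} h)) }
  frame (while-nz _ e e′) = record
    { same-memory = λ a h k → trans (same-memory (frame e′) a h k) (same-memory (frame e) a h k)
    ; same-query  = λ h → trans (same-query (frame e′) h) (same-query (frame e) h)
    ; same-output = λ h → trans (same-output (frame e′) h) (same-output (frame e) h) }
  frame (while-z _) = record { same-memory = λ _ _ _ → refl ; same-query = λ _ → refl ; same-output = λ _ → refl }

  -- Time is counted in units of `stepFactor` steps. A straight-line part then costs 1 whatever its
  -- exact cost, and only numbers of iterations enter the estimates. A postcondition may itself be a
  -- `Run` of the next program, which is how `seq-run` chains programs without naming intermediate
  -- states.
  record Run {ℓ : Level} (p : Prog q) (s : State) (w : ℕ) (Q : State → Set ℓ) : Set ℓ where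
    constructor run
    field
      {final}   : State
      {steps}   : ℕ
      execution : p , s ⇓[ steps ] final
      bound     : steps ≤ stepFactor * w
      post      : Q final

  open Run public

  map-run : ∀ {ℓ ℓ′ p s w} {Q : State → Set ℓ} {Q′ : State → Set ℓ′} → (∀ s′ → Q s′ → Q′ s′) → Run p s w Q →
      Run p s w Q′
  map-run f (run e b h) = run e b (f _ h)

  weaken : ∀ {ℓ p s w w′} {Q : State → Set ℓ} → w ≤ w′ → Run p s w Q → Run p s w′ Q
  weaken w≤w′ (run e b h) = run e (≤-trans b (*-monoʳ-≤ stepFactor w≤w′)) h

  framed : ∀ {ℓ p s w} {Q : State → Set ℓ} → Run p s w Q → Run p s w (λ s′ → Q s′ × Frame p s s′)
  framed (run e b h) = run e b (h , frame e)

  bound-+ : ∀ {k k′ w w′} → k ≤ stepFactor * w → k′ ≤ stepFactor * w′ → k + k′ ≤ stepFactor * (w + w′)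
  bound-+ {k} {k′} {w} {w′} b b′ =
    subst (k + k′ ≤_) (sym (*-distribˡ-+ stepFactor w w′)) (+-mono-≤ b b′)

  seq-run : ∀ {ℓ p p′ s w w′} {Q : State → Set ℓ} → Run p s w (λ s′ → Run p′ s′ w′ Q) → Run (p ⨾ p′) s (w + w′) Q
  seq-run (run e b (run e′ b′ h)) = run (seq e e′) (bound-+ b b′) h

  skip-run : ∀ {ℓ s} {Q : State → Set ℓ} → Q s → Run skip s 1 Q
  skip-run h = run skip (≤stepFactor*1 1 tt) h

  block-executes : ∀ as {m b o} → block as , ⟨ m , b , o ⟩ ⇓[ block-cost as ] ⟨ run-block xs m as , b , o ⟩
  block-executes []                  = skip
  block-executes ((a [ i ]≔ e) ∷ as) = seq assign (block-executes as)

  block-run : ∀ {ℓ} as {s} {Q : State → Set ℓ} {h : T (block-cost as ≤ᵇ 1000)} →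
    Q ⟨ run-block xs (memory s) as , query s , output s ⟩ → Run (block as) s 1 Q
  block-run as {h = h} = run (block-executes as) (≤stepFactor*1 _ h)

  bound-test : ∀ {c k w} → T (suc c ≤ᵇ 1000) → k ≤ stepFactor * w → suc (c + k) ≤ stepFactor * suc w
  bound-test {c} {k} {w} h b =
    subst (suc c + k ≤_) (sym (*-suc stepFactor w)) (+-mono-≤ (≤stepFactor (suc c) h) b)

  if-run : ∀ {ℓ e p p′ s w} {Q : State → Set ℓ} {c : T (suc (cost e) ≤ᵇ 1000)} →
    (eval xs (memory s) e ≢ 0 → Run p s w Q) → (eval xs (memory s) e ≡ 0 → Run p′ s w Q) →
    Run (ifnz e then p else p′) s (suc w) Q
  if-run {e = e} {s = s} {c = c} f g with eval xs (memory s) e in eq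
  ... | suc _ with f (λ ())
  ...   | run e b h = run (if-nz (λ z → 1+n≢0 (trans (sym eq) z)) e) (bound-test c b) h
  if-run {e = e} {s = s} {c = c} f g | zero with g refl
  ...   | run e b h = run (if-z eq e) (bound-test c b) h

  -- There is no invariant rule for loops. Each loop is verified by recursion on the data it
  -- consumes, one unfolding per recursive call, and the weights add up along the recursion.
  while-step : ∀ {ℓ e p s w w′} {Q : State → Set ℓ} {c : T (suc (cost e) ≤ᵇ 1000)} → eval xs (memory s) e ≢ 0 →
    Run p s w (λ s′ → Run (whilenz e loop p) s′ w′ Q) → Run (whilenz e loop p) s (suc (w + w′)) Q
  while-step {e = e} {p} {w = w} {w′} {c = c} nz (run {steps = k} x b (run {steps = k′} x′ b′ h)) =
    run (while-nz nz x x′) bounded h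
    where
    bounded : suc (cost e + k + k′) ≤ stepFactor * suc (w + w′)
    bounded = subst (λ u → suc u ≤ stepFactor * suc (w + w′)) (sym (+-assoc (cost e) k k′))
      (bound-test {cost e} c (bound-+ b b′))

  while-exit : ∀ {ℓ e p s} {Q : State → Set ℓ} {c : T (suc (cost e) ≤ᵇ 1000)} → eval xs (memory s) e ≡ 0 →
    Q s → Run (whilenz e loop p) s 1 Q
  while-exit {c = c} z h = run (while-z z) (≤stepFactor*1 _ c) h

-- F, X, Y and Z hold lists of entries: F is 1 at an entry and 0 at the end of a list;
-- they are filled up to TOP.  KIND holds the degrees of the nodes, TAB the leaf labels
-- followed by the tables of reachable states, and STK the starts of the latter.
F X Y Z TOP KIND N CNT IX OUT OC POS A P SC NS BETA X0 Y0 Z0 ACC RP DEG : ℕ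
F = 0
X = 1
Y = 2
Z = 3
TOP = 4
KIND = 5
N = 6
CNT = 7
IX = 8
OUT = 9
OC = 10
POS = 11
A = 12
P = 13
SC = 14
NS = 15
BETA = 16
X0 = 17
Y0 = 18
Z0 = 19
ACC = 20
RP = 21
DEG = 22

TAB BASE STK SP B1 B2 PC RES PA PB QB ROW COL VX VY VB LY COLS DS OK HA : ℕ
TAB = 23
BASE = 24
STK = 25
SP = 26
B1 = 27
B2 = 28
PC = 29
RES = 30
PA = 31
PB = 32
QB = 33
ROW = 34
COL = 35
VX = 36
VY = 37
VB = 38
LY = 39
COLS = 40
DS = 41
OK = 42
HA = 43

-- A tuple of numbers: `x` is the state of a node, `y` and `z` are the states of its children. At a
-- leaf `y` is the leaf label, and absent components are 0.
record Entry : Set where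
  constructor ent
  field
    x y z : ℕ

open Entry public

data Slot : Set where
  full : Entry → Slot
  end  : Slot

slots : List Entry → List Slot
slots l = map full l ++ end ∷ []

flat : List (List Entry) → List Slot
flat = concatMap slots

At : Memory → ℕ → Slot → Set
At m p (full (ent x y z)) = m F p ≡ 1 × m X p ≡ x × m Y p ≡ y × m Z p ≡ z
At m p end                = m F p ≡ 0

Stored : Memory → ℕ → Slot → Set
Stored m p c = p < m TOP 0 × At m p c

data Seg (m : Memory) (p : ℕ) : List Slot → Set where
  []  : Seg m p []
  _∷_ : ∀ {c cs} → Stored m p c → Seg m (suc p) cs → Seg m p (c ∷ cs)

Seg-++⁻ : ∀ {m} cs {p ds} → Seg m p (cs ++ ds) → Seg m p cs × Seg m (length cs + p) ds
Seg-++⁻ []       h       = [] , h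
Seg-++⁻ {m} (c ∷ cs) {p} {ds} (h ∷ t) with Seg-++⁻ cs t
... | t₁ , t₂ = (h ∷ t₁) , subst (λ k → Seg m k ds) (+-suc (length cs) p) t₂

Seg-++⁺ : ∀ {m} cs {p ds} → Seg m p cs → Seg m (length cs + p) ds → Seg m p (cs ++ ds)
Seg-++⁺ []       _        h = h
Seg-++⁺ {m} (c ∷ cs) {p} {ds} (h ∷ t) h′ =
  h ∷ Seg-++⁺ cs t (subst (λ k → Seg m k ds) (sym (+-suc (length cs) p)) h′)

infix 4 _⊑_ _≋_

-- The pool of lists only grows: cells below `TOP` are never overwritten, so a list found in memory
-- once stays valid through all later phases. The four arrays of the pool are those with numbers up
-- to 3.
record _⊑_ (m m′ : Memory) : Set where
  field
    top≤ : m TOP 0 ≤ m′ TOP 0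
    keep : ∀ a k → a ≤ 3 → k < m TOP 0 → m′ a k ≡ m a k

open _⊑_

_≋_ : Memory → Memory → Set
m ≋ m′ = ∀ a k → a ≤ 4 → m′ a k ≡ m a k

pool-refl : ∀ {m m′ : Memory} → (∀ k → m′ F k ≡ m F k) → (∀ k → m′ X k ≡ m X k) →
  (∀ k → m′ Y k ≡ m Y k) → (∀ k → m′ Z k ≡ m Z k) → (∀ k → m′ TOP k ≡ m TOP k) → m ≋ m′
pool-refl f x y z t 0 k _ = f k
pool-refl f x y z t 1 k _ = x k
pool-refl f x y z t 2 k _ = y k
pool-refl f x y z t 3 k _ = z k
pool-refl f x y z t 4 k _ = t k
pool-refl f x y z t (suc (suc (suc (suc (suc a))))) k (s≤s (s≤s (s≤s (s≤s ()))))

pool : Memory → ℕ → ℕ × ℕ × ℕ × ℕ × ℕ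
pool m k = m F k , m X k , m Y k , m Z k , m TOP k

-- The five arrays are packed into one tuple so that a single `refl` covers straight-line code that
-- writes to none of them.
untouched : ∀ {m m′ : Memory} → (∀ k → pool m′ k ≡ pool m k) → m ≋ m′
untouched h = pool-refl (λ k → cong proj₁ (h k)) (λ k → cong (proj₁ ∘ proj₂) (h k))
  (λ k → cong (proj₁ ∘ proj₂ ∘ proj₂) (h k)) (λ k → cong (proj₁ ∘ proj₂ ∘ proj₂ ∘ proj₂) (h k))
  (λ k → cong (proj₂ ∘ proj₂ ∘ proj₂ ∘ proj₂) (h k))

Seg-≋ : ∀ {m m′ cs p} → m ≋ m′ → Seg m p cs → Seg m′ p cs

≋⇒⊑ : ∀ {m m′} → m ≋ m′ → m ⊑ m′
≋⇒⊑ h = record { top≤ = ≤-reflexive (sym (h TOP 0 ≤-refl)) ; keep = λ a k a≤3 _ → h a k (m≤n⇒m≤1+n a≤3) }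

≋-trans : ∀ {m m′ m″} → m ≋ m′ → m′ ≋ m″ → m ≋ m″
≋-trans h h′ a k a≤4 = trans (h′ a k a≤4) (h a k a≤4)

⊑-trans : ∀ {m m′ m″} → m ⊑ m′ → m′ ⊑ m″ → m ⊑ m″
⊑-trans h h′ = record
  { top≤ = ≤-trans (top≤ h) (top≤ h′)
  ; keep = λ a k a≤3 k< → trans (keep h′ a k a≤3 (≤-trans k< (top≤ h))) (keep h a k a≤3 k<) }

Stored-⊑ : ∀ {m m′ p} → m ⊑ m′ → ∀ c → Stored m p c → Stored m′ p c
Stored-⊑ h (full e) (p< , f , x , y , z) = ≤-trans p< (top≤ h) ,
  trans (keep h F _ z≤n p<) f , trans (keep h X _ (s≤s z≤n) p<) x ,
  trans (keep h Y _ (s≤s (s≤s z≤n)) p<) y , trans (keep h Z _ ≤-refl p<) z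
Stored-⊑ h end (p< , f) = ≤-trans p< (top≤ h) , trans (keep h F _ z≤n p<) f

Seg-⊑ : ∀ {m m′ cs p} → m ⊑ m′ → Seg m p cs → Seg m′ p cs
Seg-⊑ h []      = []
Seg-⊑ h (s ∷ t) = Stored-⊑ h _ s ∷ Seg-⊑ h t

Seg-at : ∀ {m cs p p′} → p ≡ p′ → Seg m p cs → Seg m p′ cs
Seg-at refl h = h

Seg-≋ h = Seg-⊑ (≋⇒⊑ h)

record Appends (m m′ : Memory) (cs : List Slot) : Set where
  constructor appends
  field
    extends : m ⊑ m′
    segment : Seg m′ (m TOP 0) cs
    top     : m′ TOP 0 ≡ length cs + m TOP 0

open Appends

≋⇒Appends : ∀ {m m′} → m ≋ m′ → Appends m m′ []
≋⇒Appends h = appends (≋⇒⊑ h) [] (h TOP 0 ≤-refl)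

Appends-trans : ∀ {m m′ m″ cs ds} → Appends m m′ cs → Appends m′ m″ ds → Appends m m″ (cs ++ ds)
Appends-trans {m} {m′} {m″} {cs} {ds} h h′ = appends
  (⊑-trans (extends h) (extends h′))
  (Seg-++⁺ cs (Seg-⊑ (extends h′) (segment h)) (Seg-at (top h) (segment h′)))
  (begin
    m″ TOP 0                          ≡⟨ top h′ ⟩
    length ds + m′ TOP 0              ≡⟨ cong (length ds +_) (top h) ⟩
    length ds + (length cs + m TOP 0) ≡⟨ sym (+-assoc (length ds) (length cs) _) ⟩
    length ds + length cs + m TOP 0   ≡⟨ cong (_+ m TOP 0) (+-comm (length ds) (length cs)) ⟩
    length cs + length ds + m TOP 0   ≡⟨ cong (_+ m TOP 0) (sym (length-++ cs)) ⟩
    length (cs ++ ds) + m TOP 0       ∎)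
  where open ≡-Reasoning

Appends-after : ∀ {m m′ m″ cs} → m ≋ m′ → Appends m′ m″ cs → Appends m m″ cs
Appends-after h h′ = Appends-trans (≋⇒Appends h) h′

Appends-before : ∀ {m m′ m″ cs} → Appends m m′ cs → m′ ≋ m″ → Appends m m″ cs
Appends-before {m} {m″ = m″} {cs} h h′ = subst (Appends m m″) (++-identityʳ cs) (Appends-trans h (≋⇒Appends h′))

Appends-push : ∀ {m m′ : Memory} {x y z vx vy vz} →
  (∀ k → m′ F k ≡ (if m TOP 0 ≡ᵇ k then 1 else m F k)) →
  (∀ k → m′ X k ≡ (if m TOP 0 ≡ᵇ k then vx else m X k)) → vx ≡ x →
  (∀ k → m′ Y k ≡ (if m TOP 0 ≡ᵇ k then vy else m Y k)) → vy ≡ y →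
  (∀ k → m′ Z k ≡ (if m TOP 0 ≡ᵇ k then vz else m Z k)) → vz ≡ z →
  m′ TOP 0 ≡ suc (m TOP 0) → Appends m m′ (full (ent x y z) ∷ [])
Appends-push {m} {m′} f x refl y refl z refl t = appends
  (record { top≤ = ≤-trans (n≤1+n _) (≤-reflexive (sym t)) ; keep = kept })
  ((≤-reflexive (sym t) , trans (f _) (if-≡ (m TOP 0)) , trans (x _) (if-≡ (m TOP 0))
   , trans (y _) (if-≡ (m TOP 0)) , trans (z _) (if-≡ (m TOP 0))) ∷ [])
  t
  where
  kept : ∀ a k → a ≤ 3 → k < m TOP 0 → m′ a k ≡ m a k
  kept 0 k _ k< = trans (f k) (if-≢ (≢-sym (<⇒≢ k<)))
  kept 1 k _ k< = trans (x k) (if-≢ (≢-sym (<⇒≢ k<)))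
  kept 2 k _ k< = trans (y k) (if-≢ (≢-sym (<⇒≢ k<)))
  kept 3 k _ k< = trans (z k) (if-≢ (≢-sym (<⇒≢ k<)))
  kept (suc (suc (suc (suc a)))) k (s≤s (s≤s (s≤s ()))) k<

Appends-end : ∀ {m m′ : Memory} →
  (∀ k → m′ F k ≡ (if m TOP 0 ≡ᵇ k then 0 else m F k)) →
  (∀ k → m′ X k ≡ m X k) → (∀ k → m′ Y k ≡ m Y k) → (∀ k → m′ Z k ≡ m Z k) →
  m′ TOP 0 ≡ suc (m TOP 0) → Appends m m′ (end ∷ [])
Appends-end {m} {m′} f x y z t = appends
  (record { top≤ = ≤-trans (n≤1+n _) (≤-reflexive (sym t)) ; keep = kept })
  ((≤-reflexive (sym t) , trans (f _) (if-≡ (m TOP 0))) ∷ []) t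
  where
  kept : ∀ a k → a ≤ 3 → k < m TOP 0 → m′ a k ≡ m a k
  kept 0 k _ k< = trans (f k) (if-≢ (≢-sym (<⇒≢ k<)))
  kept 1 k _ k< = x k
  kept 2 k _ k< = y k
  kept 3 k _ k< = z k
  kept (suc (suc (suc (suc a)))) k (s≤s (s≤s (s≤s ()))) k<

push : Expr → Expr → Expr → List Assignment
push ex ey ez =
  F [ var TOP ]≔ const 1 ∷ X [ var TOP ]≔ ex ∷ Y [ var TOP ]≔ ey ∷ Z [ var TOP ]≔ ez ∷
  TOP ≔ const 1 ⊞ var TOP ∷ []

push-end : List Assignment
push-end = F [ var TOP ]≔ const 0 ∷ TOP ≔ const 1 ⊞ var TOP ∷ []

increment decrement : ℕ → Assignment
increment a = a ≔ const 1 ⊞ var a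
decrement a = a ≔ var a ⊟ const 1

-- Products of entry lists

_⊕ₑ_ : Entry → Entry → Entry
ent x y z ⊕ₑ ent x′ y′ z′ = ent (x + x′) (y + y′) (z + z′)

crossₑ : List Entry → List Entry → List Entry
crossₑ l l′ = concatMap (λ e → map (e ⊕ₑ_) l′) l

module _ {q : ℕ} where
  -- `PA` and `QB` walk through the lists of the two factors, node by node. `PB` rescans the second
  -- list once for each entry of the first; afterwards `QB` still stands at its start and
  -- `skip-list` carries it to the end. All sums are appended at the top of the pool, in the same
  -- order of nodes, so the result is again a list per node.
  cross-row cross-rows cross-node cross-nodes : Prog q
  cross-row = whilenz cell F (var PB) loop
    block (push (cell X (var PA) ⊞ cell X (var PB)) (cell Y (var PA) ⊞ cell Y (var PB))
                (cell Z (var PA) ⊞ cell Z (var PB)) ++ increment PB ∷ [])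
  cross-rows = whilenz cell F (var PA) loop
    (block (PB ≔ var QB ∷ []) ⨾ (cross-row ⨾ block (increment PA ∷ [])))
  skip-list : Prog q
  skip-list = whilenz cell F (var QB) loop block (increment QB ∷ [])
  cross-node = cross-rows ⨾ (skip-list ⨾
    block (push-end ++ increment PA ∷ increment QB ∷ decrement CNT ∷ []))
  cross-nodes = whilenz var CNT loop cross-node
  cross : Prog q
  cross = block (CNT ≔ var N ∷ []) ⨾ cross-nodes

≡1⇒≢0 : ∀ {k} → k ≡ 1 → k ≢ 0
≡1⇒≢0 refl ()

module CrossRuns {q : ℕ} (oracle : Fin q → Bits → Bool) (xs : List ℕ) where
  open Logic oracle xs

  frame-≋ : ∀ {p s s′} → Frame p s s′ →
    modifies p 0 ∨ (modifies p 1 ∨ (modifies p 2 ∨ (modifies p 3 ∨ modifies p 4))) ≡ false →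
    memory s ≋ memory s′
  frame-≋ {p} fr h with modifies p 0 in e₀ | modifies p 1 in e₁ | modifies p 2 in e₂ | modifies p 3 in e₃ | modifies p 4 in e₄
  frame-≋ {p} fr h | false | false | false | false | false =
    pool-refl (same-memory fr 0 e₀) (same-memory fr 1 e₁) (same-memory fr 2 e₂)
              (same-memory fr 3 e₃) (same-memory fr 4 e₄)

  cross-row-run : ∀ l s e rest → Stored (memory s) (memory s PA 0) (full e) →
    Seg (memory s) (memory s PB 0) (map full l ++ end ∷ rest) →
    Run cross-row s (1 + length l * 2) λ s′ →
      Appends (memory s) (memory s′) (map full (map (e ⊕ₑ_) l))
  cross-row-run [] s e rest sa ((_ , F≡0) ∷ _) =
    while-exit F≡0 (≋⇒Appends (λ _ _ _ → refl))
  cross-row-run (e′ ∷ l) s e rest sa@(_ , fa , xa , ya , za) ((_ , fb , xb , yb , zb) ∷ sg) =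
    while-step (≡1⇒≢0 fb) (block-run _ (map-run (λ _ → Appends-trans pushed)
      (cross-row-run l _ e rest (Stored-⊑ (extends pushed) (full e) sa) (Seg-⊑ (extends pushed) sg))))
    where
    m₁ : Memory
    m₁ = run-block xs (memory s)
      (push (cell X (var PA) ⊞ cell X (var PB)) (cell Y (var PA) ⊞ cell Y (var PB))
                (cell Z (var PA) ⊞ cell Z (var PB)) ++ increment PB ∷ [])
    pushed : Appends (memory s) m₁ (full (e ⊕ₑ e′) ∷ [])
    pushed = Appends-push (λ _ → refl) (λ _ → refl) (cong₂ _+_ xa xb) (λ _ → refl) (cong₂ _+_ ya yb)
                          (λ _ → refl) (cong₂ _+_ za zb) refl

  cross-rows-run : ∀ l l′ s rest rest′ → Seg (memory s) (memory s PA 0) (map full l ++ end ∷ rest) →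
    Seg (memory s) (memory s QB 0) (map full l′ ++ end ∷ rest′) →
    Run cross-rows s (1 + length l * (4 + length l′ * 2)) λ s′ →
      Appends (memory s) (memory s′) (map full (crossₑ l l′)) × memory s′ PA 0 ≡ length l + memory s PA 0
  cross-rows-run [] l′ s rest rest′ ((_ , F≡0) ∷ _) sb =
    while-exit F≡0 (≋⇒Appends (λ _ _ _ → refl) , refl)
  cross-rows-run (e ∷ l) l′ s rest rest′ (sa ∷ sg) sb =
    weaken {w = suc (1 + ((1 + length l′ * 2) + 1) + (1 + length l * (4 + length l′ * 2)))}
      (linear (# 1 :+ (# 1 :+ ((# 1 :+ v₀) :+ # 1)) :+ (# 1 :+ v₁))
         (# 1 :+ (# 4 :+ v₀ :+ v₁)) (length l′ * 2 ∷ length l * (4 + length l′ * 2) ∷ []))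
    (while-step (≡1⇒≢0 (proj₁ (proj₂ sa))) (seq-run (block-run _ (seq-run
      (map-run next (framed (cross-row-run l′ _ e rest′ sa (Seg-≋ start sb))))))))
    where
    m₁ : Memory
    m₁ = run-block xs (memory s) (PB ≔ var QB ∷ [])
    start : memory s ≋ m₁
    start = untouched (λ _ → refl)
    next : ∀ s₂ → Appends m₁ (memory s₂) (map full (map (e ⊕ₑ_) l′)) × Frame cross-row ⟨ m₁ , query s , output
        s ⟩ s₂ →
      Run (block (increment PA ∷ [])) s₂ 1 λ s₃ → Run cross-rows s₃ (1 + length l * (4 + length l′ * 2)) λ s′ →
        Appends (memory s) (memory s′) (map full (crossₑ (e ∷ l) l′)) × memory s′ PA 0 ≡ length (e ∷ l) +
            memory s PA 0
    next s₂ (ap , fr) = block-run _ (map-run finish (cross-rows-run l l′ _ rest rest′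
      (Seg-at (cong suc (sym (same-memory fr PA refl 0))) (Seg-⊑ (extends done) sg))
      (Seg-at (sym (same-memory fr QB refl 0)) (Seg-⊑ (extends done) sb))))
      where
      m₃ : Memory
      m₃ = run-block xs (memory s₂) (increment PA ∷ [])
      done : Appends (memory s) m₃ (map full (map (e ⊕ₑ_) l′))
      done = Appends-before (Appends-after start ap) (untouched (λ _ → refl))
      finish : ∀ s₄ → Appends m₃ (memory s₄) (map full (crossₑ l l′)) × memory s₄ PA 0 ≡ length l + suc
          (memory s₂ PA 0) →
        Appends (memory s) (memory s₄) (map full (crossₑ (e ∷ l) l′)) × memory s₄ PA 0 ≡ suc
            (length l + memory s PA 0)
      finish s₄ (ap′ , pa) =
        subst (Appends (memory s) (memory s₄)) (sym (map-++ full (map (e ⊕ₑ_) l′) (crossₑ l l′)))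
            (Appends-trans done ap′)
        , trans pa (trans (cong (λ u → length l + suc u) (same-memory fr PA refl 0)) (+-suc (length l) _))

  skip-list-run : ∀ l s rest → Seg (memory s) (memory s QB 0) (map full l ++ end ∷ rest) →
    Run skip-list s (1 + length l * 2) λ s′ → memory s′ QB 0 ≡ length l + memory s QB 0
  skip-list-run [] s rest ((_ , F≡0) ∷ _) = while-exit F≡0 refl
  skip-list-run (e ∷ l) s rest (sa ∷ sg) = while-step (≡1⇒≢0 (proj₁ (proj₂ sa)))
    (block-run _ (map-run (λ _ h → trans h (+-suc (length l) _))
        (skip-list-run l _ rest (Seg-≋ (untouched (λ _ → refl)) sg))))

  cross-node-run : ∀ l l′ s rest rest′ → Seg (memory s) (memory s PA 0) (slots l ++ rest) →
    Seg (memory s) (memory s QB 0) (slots l′ ++ rest′) →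
    Run cross-node s (3 + length l * (4 + length l′ * 2) + length l′ * 2) λ s′ →
      Appends (memory s) (memory s′) (slots (crossₑ l l′)) ×
      memory s′ PA 0 ≡ length (slots l) + memory s PA 0 ×
      memory s′ QB 0 ≡ length (slots l′) + memory s QB 0 ×
      memory s′ CNT 0 ≡ memory s CNT 0 ∸ 1
  cross-node-run l l′ s rest rest′ sa sb =
    weaken (linear (# 1 :+ v₀ :+ (# 1 :+ v₁ :+ # 1)) (# 3 :+ v₀ :+ v₁)
             (length l * (4 + length l′ * 2) ∷ length l′ * 2 ∷ []))
    (seq-run (map-run next (framed (cross-rows-run l l′ s rest rest′ (assoc l sa) sb′))))
    where
    assoc : ∀ l {rest m p} → Seg m p (slots l ++ rest) → Seg m p (map full l ++ end ∷ rest)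
    assoc l {rest} = subst (Seg _ _) (++-assoc (map full l) (end ∷ []) rest)
    sb′ : Seg (memory s) (memory s QB 0) (map full l′ ++ end ∷ rest′)
    sb′ = assoc l′ sb
    Goal : State → Set
    Goal s′ = Appends (memory s) (memory s′) (slots (crossₑ l l′)) ×
      memory s′ PA 0 ≡ length (slots l) + memory s PA 0 ×
      memory s′ QB 0 ≡ length (slots l′) + memory s QB 0 ×
      memory s′ CNT 0 ≡ memory s CNT 0 ∸ 1
    length-slots : ∀ l k → suc (length l + k) ≡ length (slots l) + k
    length-slots l k = cong (_+ k) (sym (trans (length-++ (map full l))
      (trans (cong (_+ 1) (length-map full l)) (+-comm (length l) 1))))
    next : ∀ s₂ → (Appends (memory s) (memory s₂) (map full (crossₑ l l′)) × memory s₂ PA 0 ≡ length l +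
        memory s PA 0) ×
       Frame cross-rows s s₂ → Run _ s₂ (1 + length l′ * 2 + 1) Goal
    next s₂ ((ap , pa) , fr) = seq-run (map-run finish (framed (skip-list-run l′ s₂ rest′
        (Seg-at (sym (same-memory fr QB refl 0)) (Seg-⊑ (extends ap) sb′)))))
      where
      finish : ∀ s₃ → (memory s₃ QB 0 ≡ length l′ + memory s₂ QB 0) × Frame skip-list s₂ s₃ →
        Run (block (push-end ++ increment PA ∷ increment QB ∷ decrement CNT ∷ [])) s₃ 1 Goal
      finish s₃ (qb , fr₃) = block-run _
        ( Appends-trans (Appends-before ap (frame-≋ fr₃ refl))
            (Appends-end (λ _ → refl) (λ _ → refl) (λ _ → refl) (λ _ → refl) refl)
        , trans (cong suc (trans (same-memory fr₃ PA refl 0) pa)) (length-slots l _)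
        , trans (cong suc (trans qb (cong (length l′ +_) (same-memory fr QB refl 0)))) (length-slots l′ _)
        , cong (_∸ 1) (trans (same-memory fr₃ CNT refl 0) (same-memory fr CNT refl 0)))

  -- Per node: 2 units for each sum, 4 for each entry of the first list, 2 for each entry of the
  -- second one when it is skipped, and 4 for control.
  cross-weight : ℕ → ℕ → ℕ
  cross-weight a b = 4 + a * (4 + b * 2) + b * 2

  cross-nodes-run : ∀ (ls ls′ : List (List Entry)) a b s rest rest′ → length ls ≡ length ls′ →
    All (λ l → length l ≤ a) ls → All (λ l → length l ≤ b) ls′ →
    memory s CNT 0 ≡ length ls →
    Seg (memory s) (memory s PA 0) (flat ls ++ rest) → Seg (memory s) (memory s QB 0) (flat ls′ ++ rest′) →
    Run cross-nodes s (1 + length ls * cross-weight a b) λ s′ →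
      Appends (memory s) (memory s′) (flat (zipWith crossₑ ls ls′)) ×
      memory s′ QB 0 ≡ length (flat ls′) + memory s QB 0
  cross-nodes-run [] [] a b s rest rest′ _ _ _ c sa sb = while-exit c (≋⇒Appends (λ _ _ _ → refl) , refl)
  cross-nodes-run (l ∷ ls) (l′ ∷ ls′) a b s rest rest′ e (l≤ ∷ ls≤) (l′≤ ∷ ls′≤) c sa sb =
    weaken (≤-reflexive (cong suc (+-suc (3 + a * (4 + b * 2) + b * 2) (length ls * cross-weight a b))))
    (while-step (λ z → 1+n≢0 (trans (sym c) z))
      (weaken bounded (map-run next (cross-node-run l l′ s (flat ls ++ rest) (flat ls′ ++ rest′)
        (subst (Seg _ _) (++-assoc (slots l) (flat ls) rest) sa)
        (subst (Seg _ _) (++-assoc (slots l′) (flat ls′) rest′) sb)))))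
    where
    bounded : 3 + length l * (4 + length l′ * 2) + length l′ * 2 ≤ 3 + a * (4 + b * 2) + b * 2
    bounded = +-mono-≤ (+-monoʳ-≤ 3 (*-mono-≤ l≤ (+-monoʳ-≤ 4 (*-monoˡ-≤ 2 l′≤)))) (*-monoˡ-≤ 2 l′≤)
    next : ∀ s₂ → _ → Run cross-nodes s₂ (1 + length ls * cross-weight a b) λ s′ →
      Appends (memory s) (memory s′) (flat (zipWith crossₑ (l ∷ ls) (l′ ∷ ls′))) ×
      memory s′ QB 0 ≡ length (flat (l′ ∷ ls′)) + memory s QB 0
    next s₂ (ap , pa , qb , cnt) = map-run (λ _ (ap′ , qb′) → Appends-trans ap ap′ ,
        trans qb′ (trans (cong (length (flat ls′) +_) qb) (trans (sym (+-assoc (length (flat ls′)) _ _))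
          (cong (_+ _) (trans (+-comm (length (flat ls′)) _) (sym (length-++ (slots l′))))))))
      (cross-nodes-run ls ls′ a b s₂ rest rest′ (suc-injective e) ls≤ ls′≤ (trans cnt (cong (_∸ 1) c))
        (Seg-at (sym pa) (Seg-⊑ (extends ap)
            (proj₂ (Seg-++⁻ (slots l) (subst (Seg _ _) (++-assoc (slots l) (flat ls) rest) sa)))))
        (Seg-at (sym qb) (Seg-⊑ (extends ap)
            (proj₂ (Seg-++⁻ (slots l′) (subst (Seg _ _) (++-assoc (slots l′) (flat ls′) rest′) sb))))))

  cross-run : ∀ (ls ls′ : List (List Entry)) a b s rest rest′ → length ls ≡ length ls′ →
    All (λ l → length l ≤ a) ls → All (λ l → length l ≤ b) ls′ →
    memory s N 0 ≡ length ls →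
    Seg (memory s) (memory s PA 0) (flat ls ++ rest) → Seg (memory s) (memory s QB 0) (flat ls′ ++ rest′) →
    Run cross s (2 + length ls * cross-weight a b) λ s′ →
      Appends (memory s) (memory s′) (flat (zipWith crossₑ ls ls′)) ×
      memory s′ QB 0 ≡ length (flat ls′) + memory s QB 0
  cross-run ls ls′ a b s rest rest′ e h h′ c sa sb = seq-run (block-run _ (map-run
    (λ _ (ap , qb) → Appends-after (untouched (λ _ → refl)) ap , qb)
    (cross-nodes-run ls ls′ a b _ rest rest′ e h h′ c (Seg-≋ (untouched (λ _ → refl)) sa)
        (Seg-≋ (untouched (λ _ → refl)) sb))))

-- Evaluation of entry lists along a decomposition

Iff : Set → Set → Set
Iff U V = (U → V) × (V → U)

Step : List Entry → (G G′ : ℕ → Set) → ℕ → Set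
Step l G G′ k = ∃[ e ] e ∈ l × x e ≡ k × G (y e) × G′ (z e)

Step-map : ∀ l {G G′ H H′ k} → (∀ e → e ∈ l → G (y e) → H (y e)) → (∀ e → e ∈ l → G′ (z e) → H′ (z e)) →
  Step l G G′ k → Step l H H′ k
Step-map l f f′ (e , e∈ , ex , g , g′) = e , e∈ , ex , f e e∈ g , f′ e e∈ g′

-- Absent children are subject to the condition `W` on leaf labels. Their component is 0, and 0 will
-- be an admissible label, so nodes of all degrees share one form of step and one scanning loop.
Reachable : ∀ {ω} → (ℕ → Set) → (D : Decomp ω) → (Node D → List Entry) → ℕ → Set
Reachable W (intro v a)      f = Step (f root) W W
Reachable W (t₁ ⊕ t₂)        f = Step (f root) (Reachable W t₁ (f ∘ left)) (Reachable W t₂ (f ∘ right))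
Reachable W (recolor t a b)  f = Step (f root) (Reachable W t (f ∘ inRecolor)) W
Reachable W (addEdges t a b) f = Step (f root) (Reachable W t (f ∘ inAddEdges)) W

-- b bounds leaf labels, s bounds states.
record EntryBelow (b s degree : ℕ) (e : Entry) : Set where
  field
    x< : x e < s
    y< : y e < (if degree ≡ᵇ 0 then b else s)
    z< : z e < (if degree <ᵇ 2 then b else s)

open EntryBelow

Bounded : ∀ {ω} → ℕ → ℕ → (D : Decomp ω) → (Node D → List Entry) → Set
Bounded b s D f = ∀ t e → e ∈ f t → EntryBelow b s (δ t) e

data Numbers (m : Memory) (a p : ℕ) : List ℕ → Set where
  []  : Numbers m a p []
  _∷_ : ∀ {k ks} → m a p ≡ k → Numbers m a (suc p) ks → Numbers m a p (k ∷ ks)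

Numbers-≗ : ∀ {m m′ a p ks} → (∀ k → m′ a k ≡ m a k) → Numbers m a p ks → Numbers m′ a p ks
Numbers-≗ h []      = []
Numbers-≗ h (e ∷ t) = trans (h _) e ∷ Numbers-≗ h t

Numbers-at : ∀ {m a p p′ ks} → p ≡ p′ → Numbers m a p ks → Numbers m a p′ ks
Numbers-at refl h = h

StackAt : Memory → List ℕ → Set
StackAt m []       = ⊤
StackAt m (b ∷ bs) = m STK (length bs) ≡ b × StackAt m bs

StackAt-≗ : ∀ {m m′} bs → (∀ k → k < length bs → m′ STK k ≡ m STK k) → StackAt m bs → StackAt m′ bs
StackAt-≗ []       h _       = tt
StackAt-≗ (b ∷ bs) h (e , t) = trans (h _ ≤-refl) e , StackAt-≗ bs (λ k k< → h k (m≤n⇒m≤1+n k<)) t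

map-nodes-⊕ : ∀ {ω} {B : Set} (t₁ t₂ : Decomp ω) (f : Node (t₁ ⊕ t₂) → B) rest →
  map f (nodes (t₁ ⊕ t₂)) ++ rest ≡ map (f ∘ left) (nodes t₁) ++ (map (f ∘ right) (nodes t₂) ++ (f root ∷ rest))
map-nodes-⊕ t₁ t₂ f rest = begin
  map f (map left (nodes t₁) ++ map right (nodes t₂) ++ root ∷ []) ++ rest
    ≡⟨ cong (_++ rest) (trans (map-++ f (map left (nodes t₁)) _)
         (cong₂ _++_ (sym (map-∘ (nodes t₁))) (trans (map-++ f (map right (nodes t₂)) _)
           (cong (_++ f root ∷ []) (sym (map-∘ (nodes t₂))))))) ⟩
  (map (f ∘ left) (nodes t₁) ++ (map (f ∘ right) (nodes t₂) ++ f root ∷ [])) ++ rest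
    ≡⟨ ++-assoc (map (f ∘ left) (nodes t₁)) _ rest ⟩
  map (f ∘ left) (nodes t₁) ++ ((map (f ∘ right) (nodes t₂) ++ f root ∷ []) ++ rest)
    ≡⟨ cong (map (f ∘ left) (nodes t₁) ++_) (++-assoc (map (f ∘ right) (nodes t₂)) _ rest) ⟩
  map (f ∘ left) (nodes t₁) ++ (map (f ∘ right) (nodes t₂) ++ (f root ∷ rest)) ∎
  where open ≡-Reasoning

map-nodes-un : ∀ {ω} {B : Set} {D : Decomp ω} {t : Decomp ω} (g : Node t → Node D) (f : Node D → B) r rest →
  map f (map g (nodes t) ++ r ∷ []) ++ rest ≡ map (f ∘ g) (nodes t) ++ (f r ∷ rest)
map-nodes-un {t = t} g f r rest = begin
  map f (map g (nodes t) ++ r ∷ []) ++ rest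
    ≡⟨ cong (_++ rest) (trans (map-++ f (map g (nodes t)) _) (cong (_++ f r ∷ []) (sym (map-∘ (nodes t))))) ⟩
  (map (f ∘ g) (nodes t) ++ f r ∷ []) ++ rest
    ≡⟨ ++-assoc (map (f ∘ g) (nodes t)) _ rest ⟩
  map (f ∘ g) (nodes t) ++ (f r ∷ rest) ∎
  where open ≡-Reasoning

-- Truncated subtraction expresses the conjunction of two nonzero tests as an arithmetic term, which
-- keeps the body of the scanning loop straight-line.
conjunction : ℕ → ℕ → ℕ
conjunction a b = 1 ∸ ((1 ∸ a) + (1 ∸ b))

conjunction-≢0 : ∀ a b → Iff (conjunction a b ≢ 0) (a ≢ 0 × b ≢ 0)
conjunction-≢0 zero    b       = (λ h → ⊥-elim (h (0∸n≡0 (1 ∸ b)))) , λ (h , _) → ⊥-elim (h refl)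
conjunction-≢0 (suc a) zero    = (λ h → ⊥-elim (h (cong (1 ∸_) (cong (_+ 1) (0∸n≡0 a))))) , λ (_ , h) → ⊥-elim
    (h refl)
conjunction-≢0 (suc a) (suc b) = (λ _ → (λ ()) , λ ()) ,
  λ _ h → 1+n≢0 (trans (sym (cong (1 ∸_) (cong₂ _+_ (0∸n≡0 a) (0∸n≡0 b)))) h)

-- Marks the state `x` in the table starting at `BASE` if `y` is marked in the table at `B1` and `z`
-- in the one at `B2`. Labels and absent components are looked up in the table at 0, which holds the
-- admissible labels. The mark is added, not assigned, so that a failing entry does not erase an
-- earlier success for the same state.
scan-body : List Assignment
scan-body =
  TAB [ var BASE ⊞ cell X (var PC) ]≔
    cell TAB (var BASE ⊞ cell X (var PC)) ⊞
    (const 1 ⊟ ((const 1 ⊟ cell TAB (var B1 ⊞ cell Y (var PC))) ⊞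
                (const 1 ⊟ cell TAB (var B2 ⊞ cell Z (var PC))))) ∷
  increment PC ∷ []
-- The table of the node is complete and its start is pushed. Advancing `BASE` by the scale reserves
-- a range of cells that have never been written, at constant cost and without clearing anything.
scan-end : List Assignment
scan-end = STK [ var SP ]≔ var BASE ∷ increment SP ∷ BASE ≔ var BASE ⊞ var SC ∷
           increment PC ∷ increment IX ∷ decrement CNT ∷ []

module _ {q : ℕ} where
  scan find-children find eval-node eval-nodes evaluate : Prog q
  scan = whilenz cell F (var PC) loop block scan-body
  find-children =
    ifnz var DEG
    then (ifnz var DEG ⊟ const 1
          then block (decrement SP ∷ B2 ≔ cell STK (var SP) ∷ decrement SP ∷ B1 ≔ cell STK (var SP) ∷ [])
          else block (decrement SP ∷ B1 ≔ cell STK (var SP) ∷ B2 ≔ const 0 ∷ []))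
    else block (B1 ≔ const 0 ∷ B2 ≔ const 0 ∷ [])
  find = block (DEG ≔ cell KIND (var IX) ∷ []) ⨾ find-children
  eval-node = find ⨾ (scan ⨾ block scan-end)
  eval-nodes = whilenz var CNT loop eval-node
  evaluate =
    block (CNT ≔ var N ∷ IX ≔ const 0 ∷ SP ≔ const 0 ∷ []) ⨾
    -- Only the table of the root is left on the stack; its first cell belongs to the state 0.
    (eval-nodes ⨾ block (RES ≔ cell TAB (cell STK (const 0)) ∷ []))

Nonzero : Memory → ℕ → ℕ → Set
Nonzero m b k = m TAB (b + k) ≢ 0

eval-weight : List (List Entry) → ℕ
eval-weight []       = 0
eval-weight (l ∷ ls) = 7 + length l * 2 + eval-weight ls

eval-weight-++ : ∀ ls {ls′} → eval-weight (ls ++ ls′) ≡ eval-weight ls + eval-weight ls′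
eval-weight-++ []       = refl
eval-weight-++ (l ∷ ls) = trans (cong (7 + length l * 2 +_) (eval-weight-++ ls))
    (sym (+-assoc (7 + length l * 2) _ _))

un-weight : ∀ {ω} {D : Decomp ω} (t : Decomp ω) (g : Node t → Node D) (f : Node D → List Entry) r w →
  eval-weight (map f (map g (nodes t) ++ r ∷ [])) + w ≡ eval-weight (map (f ∘ g) (nodes t)) +
      (7 + length (f r) * 2 + w)
un-weight t g f r w = begin
  eval-weight (map f (map g (nodes t) ++ r ∷ [])) + w
    ≡⟨ cong (λ u → eval-weight u + w) (trans (sym (++-identityʳ _)) (map-nodes-un g f r [])) ⟩
  eval-weight (map (f ∘ g) (nodes t) ++ (f r ∷ [])) + w
    ≡⟨ cong (_+ w) (trans (eval-weight-++ (map (f ∘ g) (nodes t)))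
        (cong (eval-weight (map (f ∘ g) (nodes t)) +_) (+-identityʳ _))) ⟩
  (eval-weight (map (f ∘ g) (nodes t)) + (7 + length (f r) * 2)) + w
    ≡⟨ +-assoc (eval-weight (map (f ∘ g) (nodes t))) _ w ⟩
  eval-weight (map (f ∘ g) (nodes t)) + (7 + length (f r) * 2 + w) ∎
  where open ≡-Reasoning

module EvalRuns {q : ℕ} (oracle : Fin q → Bits → Bool) (xs : List ℕ) where
  open Logic oracle xs
  open CrossRuns oracle xs

  -- The cells consulted lie below `BASE` and the cells written do not, so the tests for later
  -- entries give the same results as in the initial memory. This makes the recursion over the list
  -- go through with the condition fixed at the start.
  scan-run : ∀ l s rest → Seg (memory s) (memory s PC 0) (map full l ++ end ∷ rest) →
    (∀ e → e ∈ l → memory s B1 0 + y e < memory s BASE 0 × memory s B2 0 + z e < memory s BASE 0) →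
    Run scan s (1 + length l * 2) λ s′ →
      (∀ k → k < memory s BASE 0 → memory s′ TAB k ≡ memory s TAB k) ×
      (∀ k → Iff (Nonzero (memory s′) (memory s BASE 0) k)
                 (Nonzero (memory s) (memory s BASE 0) k ⊎
                  Step l (Nonzero (memory s) (memory s B1 0)) (Nonzero (memory s) (memory s B2 0)) k)) ×
      memory s′ PC 0 ≡ length l + memory s PC 0
  scan-run [] s rest ((_ , F≡0) ∷ _) _ =
    while-exit F≡0 ((λ _ _ → refl) , (λ k → inj₁ , λ { (inj₁ h) → h }) , refl)
  scan-run (e ∷ l) s rest ((_ , fe , xe , ye , ze) ∷ sg) below = while-step (≡1⇒≢0 fe)
    (block-run _ (map-run combine (scan-run l _ rest (Seg-≋ (untouched (λ _ → refl)) sg)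
        (λ e′ e′∈ → below e′ (there e′∈)))))
    where
    m m₁ : Memory
    m = memory s
    m₁ = run-block xs m scan-body
    base b₁ b₂ : ℕ
    base = m BASE 0
    b₁ = m B1 0
    b₂ = m B2 0
    added : ℕ
    added = conjunction (m TAB (b₁ + m Y (m PC 0))) (m TAB (b₂ + m Z (m PC 0)))
    added-iff : Iff (added ≢ 0) (m TAB (b₁ + m Y (m PC 0)) ≢ 0 × m TAB (b₂ + m Z (m PC 0)) ≢ 0)
    added-iff = conjunction-≢0 (m TAB (b₁ + m Y (m PC 0))) (m TAB (b₂ + m Z (m PC 0)))
    kept : ∀ k → k < base → m₁ TAB k ≡ m TAB k
    kept k k< = if-≢ λ h → <-irrefl (sym h) (≤-trans k< (m≤m+n base (m X (m PC 0))))
    G₁ G₂ : ℕ → Set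
    G₁ = Nonzero m b₁
    G₂ = Nonzero m b₂
    Head : ℕ → Set
    Head k = x e ≡ k × G₁ (y e) × G₂ (z e)
    added-≢0 : Iff (added ≢ 0) (G₁ (y e) × G₂ (z e))
    added-≢0 = (λ h → subst G₁ ye (proj₁ (proj₁ added-iff h)) , subst G₂ ze (proj₂ (proj₁ added-iff h)))
             , (λ (g , g′) → proj₂ added-iff (subst G₁ (sym ye) g , subst G₂ (sym ze) g′))
    head : ∀ k → Iff (Nonzero m₁ base k) (Nonzero m base k ⊎ Head k)
    head k with (base + m X (m PC 0)) ≟ (base + k)
    ... | no ne = (λ h → inj₁ (λ z → h (trans (if-≢ ne) z)))
                , λ { (inj₁ h) z → h (trans (sym (if-≢ ne)) z)
                    ; (inj₂ (ex , _)) → ⊥-elim (ne (cong (base +_) (trans xe ex))) }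
    ... | yes eq rewrite sym eq | if-≡ (base + m X (m PC 0)) {m TAB (base + m X (m PC 0)) + added}
        {m TAB (base + m X (m PC 0))} =
      to , from
      where
      old = m TAB (base + m X (m PC 0))
      x≡k : x e ≡ k
      x≡k = trans (sym xe) (+-cancelˡ-≡ base _ _ eq)
      to : old + added ≢ 0 → old ≢ 0 ⊎ Head k
      to h with old ≟ 0
      ... | no ne  = inj₁ ne
      ... | yes o  = inj₂ (x≡k , proj₁ added-≢0 (λ a → h (cong₂ _+_ o a)))
      from : old ≢ 0 ⊎ Head k → old + added ≢ 0
      from (inj₁ h) z = h (m+n≡0⇒m≡0 old z)
      from (inj₂ (_ , g)) z = proj₂ added-≢0 g (m+n≡0⇒n≡0 old z)
    combine : ∀ s′ → _ → _
    combine s′ (same , nz , pc) =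
      (λ k k< → trans (same k k<) (kept k k<)) , (λ k → to k , from k) , trans pc (+-suc (length l) _)
      where
      S : ℕ → Set
      S = Step (e ∷ l) G₁ G₂
      to : ∀ k → Nonzero (memory s′) base k → Nonzero m base k ⊎ S k
      to k h with proj₁ (nz k) h
      ... | inj₂ (e′ , e′∈ , ex , g , g′) = inj₂ (e′ , there e′∈ , ex ,
             (λ z → g (trans (kept _ (proj₁ (below e′ (there e′∈)))) z)) , λ z → g′
                 (trans (kept _ (proj₂ (below e′ (there e′∈)))) z))
      ... | inj₁ h₁ with proj₁ (head k) h₁
      ...   | inj₁ h₀ = inj₁ h₀
      ...   | inj₂ (ex , g , g′) = inj₂ (e , here refl , ex , g , g′)
      from : ∀ k → Nonzero m base k ⊎ S k → Nonzero (memory s′) base k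
      from k (inj₁ h) = proj₂ (nz k) (inj₁ (proj₂ (head k) (inj₁ h)))
      from k (inj₂ (e′ , here refl , ex , g , g′)) = proj₂ (nz k) (inj₁ (proj₂ (head k) (inj₂ (ex , g , g′))))
      from k (inj₂ (e′ , there e′∈ , ex , g , g′)) = proj₂ (nz k) (inj₂ (e′ , e′∈ , ex ,
             (λ z → g (trans (sym (kept _ (proj₁ (below e′ (there e′∈))))) z)) ,
             λ z → g′ (trans (sym (kept _ (proj₂ (below e′ (there e′∈))))) z)))

  record Below (m m′ : Memory) : Set where
    field
      base≤      : m BASE 0 ≤ m′ BASE 0
      same-table : ∀ k → k < m BASE 0 → m′ TAB k ≡ m TAB k

  open Below

  module _ (W : ℕ → Set) (b s : ℕ) (b≤s : b ≤ s) (0<b : 0 < b) (rest : List Slot) (stop : ℕ) where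

    -- The situation between two nodes in postorder. `bs` lists, top first, the tables of finished
    -- subtrees whose parents are still to come; `ls` and `ks` belong to the remaining nodes. Cells
    -- from `BASE` on are still 0. The equation `cursor` records the position reached, so that a
    -- following evaluation can continue where this one ends.
    record Evaluating (m : Memory) (bs : List ℕ) (ls : List (List Entry)) (ks : List ℕ) : Set where
      field
        scale  : m SC 0 ≡ s
        base≥  : b ≤ m BASE 0
        labels : ∀ k → k < b → Iff (m TAB k ≢ 0) (W k)
        fresh  : ∀ k → m BASE 0 ≤ k → m TAB k ≡ 0
        sp     : m SP 0 ≡ length bs
        stack  : StackAt m bs
        lists  : Seg m (m PC 0) (flat ls ++ rest)
        cursor : m PC 0 + length (flat ls ++ rest) ≡ stop
        kinds  : Numbers m KIND (m IX 0) ks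
        count  : m CNT 0 ≡ length ks

    open Evaluating

    Table : Memory → ℕ → (ℕ → Set) → Set
    Table m c G = c + s ≤ m BASE 0 × (∀ k → k < s → Iff (Nonzero m c k) (G k))

    Table-Below : ∀ {m m′ c G} → Below m m′ → Table m c G → Table m′ c G
    Table-Below h (c≤ , t) = ≤-trans c≤ (base≤ h) , λ k k< →
      (λ nz → proj₁ (t k k<) λ z → nz (trans (same k k<) z)) ,
      (λ g z → proj₂ (t k k<) g (trans (sym (same k k<)) z))
      where
      same : ∀ k → k < s → _
      same k k< = same-table h _ (<-≤-trans (+-monoʳ-< _ k<) c≤)

    scan-end-run : ∀ st bs l ls k ks (G G′ : ℕ → Set) → Evaluating (memory st) bs (l ∷ ls) (k ∷ ks) →
      (∀ e → e ∈ l → x e < s ×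
         (memory st B1 0 + y e < memory st BASE 0 × Iff (Nonzero (memory st) (memory st B1 0) (y e)) (G (y e))) ×
         (memory st B2 0 + z e < memory st BASE 0 × Iff (Nonzero (memory st) (memory st B2 0) (z e)) (G′ (z e)))) →
      Run (scan ⨾ block scan-end) st (2 + length l * 2) λ st′ →
        Evaluating (memory st′) (memory st BASE 0 ∷ bs) ls ks ×
        Table (memory st′) (memory st BASE 0) (Step l G G′) × Below (memory st) (memory st′)
    scan-end-run st bs l ls k ks G G′ ev ok = weaken (≤-reflexive (cong suc (+-comm (length l * 2) 1)))
      (seq-run (map-run next (framed (scan-run l st (flat ls ++ rest) sg
          (λ e e∈ → proj₁ (proj₁ (proj₂ (ok e e∈))) , proj₁ (proj₂ (proj₂ (ok e e∈))))))))
      where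
      m : Memory
      m = memory st
      sg₀ : Seg m (m PC 0) (slots l ++ (flat ls ++ rest))
      sg₀ = subst (Seg _ _) (++-assoc (slots l) (flat ls) rest) (lists ev)
      sg : Seg m (m PC 0) (map full l ++ end ∷ (flat ls ++ rest))
      sg = subst (Seg _ _) (++-assoc (map full l) (end ∷ []) (flat ls ++ rest)) sg₀
      next : ∀ s₂ → _ → Run (block scan-end) s₂ 1 _
      next s₂ ((same , nz , pc) , fr) = block-run _ (ev′ , (c≤ , table) , below)
        where
        m₂ m₃ : Memory
        m₂ = memory s₂
        m₃ = run-block xs m₂ scan-end
        eqBASE : m₂ BASE 0 ≡ m BASE 0
        eqBASE = same-memory fr BASE refl 0
        eqSC : m₂ SC 0 ≡ s
        eqSC = trans (same-memory fr SC refl 0) (scale ev)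
        eqSP : m₂ SP 0 ≡ length bs
        eqSP = trans (same-memory fr SP refl 0) (sp ev)
        base′ : m₃ BASE 0 ≡ m BASE 0 + s
        base′ = cong₂ _+_ eqBASE eqSC
        c≤ : m BASE 0 + s ≤ m₃ BASE 0
        c≤ = ≤-reflexive (sym base′)
        below : Below m m₃
        below = record { base≤ = ≤-trans (m≤m+n (m BASE 0) s) c≤ ; same-table = same }
        table : ∀ k → k < s → Iff (Nonzero m₃ (m BASE 0) k) (Step l G G′ k)
        table k k< = to , from
          where
          to : Nonzero m₂ (m BASE 0) k → Step l G G′ k
          to h with proj₁ (nz k) h
          ... | inj₁ h₀ = ⊥-elim (h₀ (fresh ev _ (m≤m+n (m BASE 0) k)))
          ... | inj₂ st = Step-map l (λ e e∈ → proj₁ (proj₂ (proj₁ (proj₂ (ok e e∈)))))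
              (λ e e∈ → proj₁ (proj₂ (proj₂ (proj₂ (ok e e∈))))) st
          from : Step l G G′ k → Nonzero m₂ (m BASE 0) k
          from st = proj₂ (nz k) (inj₂ (Step-map l (λ e e∈ → proj₂ (proj₂ (proj₁ (proj₂ (ok e e∈)))))
              (λ e e∈ → proj₂ (proj₂ (proj₂ (proj₂ (ok e e∈))))) st))
        -- All states of the node are below `s`, hence nothing was written beyond the range reserved
        -- for its table.
        fresh₂ : ∀ k → s ≤ k → m₂ TAB (m BASE 0 + k) ≡ 0
        fresh₂ k s≤k with m₂ TAB (m BASE 0 + k) ≟ 0
        ... | yes e = e
        ... | no ne with proj₁ (nz k) ne
        ...   | inj₁ h = ⊥-elim (h (fresh ev _ (m≤m+n (m BASE 0) k)))
        ...   | inj₂ (e , e∈ , refl , _) = ⊥-elim (<⇒≱ (proj₁ (ok e e∈)) s≤k)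
        ev′ : Evaluating m₃ (m BASE 0 ∷ bs) ls ks
        ev′ = record
          { scale  = eqSC
          ; base≥  = ≤-trans (base≥ ev) (base≤ below)
          ; labels = λ k k< → (λ h → proj₁ (labels ev k k<) λ z → h (trans (same k (≤-trans k< (base≥ ev))) z)) ,
                              (λ w z → proj₂ (labels ev k k<) w (trans (sym (same k (≤-trans k< (base≥ ev)))) z))
          ; fresh  = λ k le → let le′ = ≤-trans c≤ le in
              subst (λ u → m₂ TAB u ≡ 0) (m+[n∸m]≡n (≤-trans (m≤m+n (m BASE 0) s) le′))
                (fresh₂ (k ∸ m BASE 0) (subst (_≤ k ∸ m BASE 0) (m+n∸m≡n (m BASE 0) s) (∸-monoˡ-≤ (m BASE 0) le′)))
          ; sp     = cong suc eqSP
          ; stack  = trans (cong (λ u → if m₂ SP 0 ≡ᵇ u then m₂ BASE 0 else m₂ STK u) (sym eqSP))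
                           (trans (if-≡ (m₂ SP 0)) eqBASE)
                   , StackAt-≗ bs (λ k k< → trans (if-≢ (λ h → <-irrefl (trans (sym h) eqSP) k<))
                       (same-memory fr STK refl k)) (stack ev)
          ; lists  = Seg-at (trans (cong (_+ m PC 0)
              (trans (length-++ (map full l)) (trans (+-comm _ 1) (cong suc (length-map full l)))))
              (sym (cong suc pc)))
                       (proj₂ (Seg-++⁻ (slots l) (Seg-≋ (≋-trans (frame-≋ fr refl) (untouched (λ _ → refl))) sg₀)))
          ; cursor = trans (cong₂ (λ u v → u + v) (cong suc pc) refl) (trans advance (cursor ev))
          ; kinds  = tail (kinds ev)
          ; count  = cong (_∸ 1) (trans (same-memory fr CNT refl 0) (count ev))
          }
          where
          X′ = length (flat ls ++ rest)
          advance : suc (length l + m PC 0) + X′ ≡ m PC 0 + length ((slots l ++ flat ls) ++ rest)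
          advance = begin
            suc (length l + m PC 0) + X′       ≡⟨ cong (λ u → suc u + X′) (+-comm (length l) _) ⟩
            suc (m PC 0 + length l) + X′       ≡⟨ cong (_+ X′) (sym (+-suc (m PC 0) (length l))) ⟩
            m PC 0 + suc (length l) + X′       ≡⟨ +-assoc (m PC 0) (suc (length l)) X′ ⟩
            m PC 0 + (suc (length l) + X′)     ≡⟨ cong (λ u → m PC 0 + (u + X′))
                (sym (trans (length-++ (map full l)) (trans (+-comm _ 1) (cong suc (length-map full l))))) ⟩
            m PC 0 + (length (slots l) + X′)   ≡⟨ cong (m PC 0 +_)
                (trans (sym (length-++ (slots l))) (cong length (sym (++-assoc (slots l) (flat ls) rest)))) ⟩
            m PC 0 + length ((slots l ++ flat ls) ++ rest) ∎
            where open ≡-Reasoning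
          tail : Numbers m KIND (m IX 0) (k ∷ ks) → Numbers m₃ KIND (m₃ IX 0) ks
          tail (_ ∷ t) = Numbers-at (cong suc (sym (same-memory fr IX refl 0)))
              (Numbers-≗ (same-memory fr KIND refl) t)

    record Found (m m′ : Memory) (c c′ : ℕ) : Set where
      field
        b1 : m′ B1 0 ≡ c
        b2 : m′ B2 0 ≡ c′

    find-leaf : ∀ st → memory st KIND (memory st IX 0) ≡ 0 →
      Run find st 4 λ st′ → memory st′ SP 0 ≡ memory st SP 0 × Found (memory st) (memory st′) 0 0
    find-leaf st k = seq-run (block-run _ (if-run (λ h → ⊥-elim (h k))
      (λ _ → weaken (s≤s z≤n) (block-run _ (refl , record { b1 = refl ; b2 = refl })))))

    find-un : ∀ st n → memory st KIND (memory st IX 0) ≡ 1 → memory st SP 0 ≡ suc n →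
      Run find st 4 λ st′ → memory st′ SP 0 ≡ n × Found (memory st) (memory st′) (memory st STK n) 0
    find-un st n k e = seq-run (block-run _ (if-run
      (λ _ → if-run (λ h → ⊥-elim (h (cong (_∸ 1) k)))
        (λ _ → block-run _ (cong (_∸ 1) e , record { b1 = cong (λ u → memory st STK (u ∸ 1)) e ; b2 = refl })))
      (λ h → ⊥-elim (0≢1+n (trans (sym h) k)))))

    find-bin : ∀ st n → memory st KIND (memory st IX 0) ≡ 2 → memory st SP 0 ≡ suc (suc n) →
      Run find st 4 λ st′ → memory st′ SP 0 ≡ n × Found (memory st) (memory st′) (memory st STK n)
          (memory st STK (suc n))
    find-bin st n k e = seq-run (block-run _ (if-run
      (λ _ → if-run (λ _ → block-run _ (cong (λ u → u ∸ 1 ∸ 1) e , record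
                 { b1 = cong (λ u → memory st STK (u ∸ 1 ∸ 1)) e ; b2 = cong (λ u → memory st STK (u ∸ 1)) e }))
        (λ h → ⊥-elim (0≢1+n (trans (sym h) (cong (_∸ 1) k)))))
      (λ h → ⊥-elim (0≢1+n (trans (sym h) k)))))

    popped : ∀ {st st′} bs₀ {bs ls ks} → Frame (find {q}) st st′ → StackAt (memory st) bs → memory st′ SP 0 ≡
        length bs →
      Evaluating (memory st) bs₀ ls ks → Evaluating (memory st′) bs ls ks
    popped {st} {st′} bs₀ {bs} fr stk e ev = record
      { scale  = trans (same-memory fr SC refl 0) (scale ev)
      ; base≥  = subst (b ≤_) (sym (same-memory fr BASE refl 0)) (base≥ ev)
      ; labels = λ k k< → (λ h → proj₁ (labels ev k k<) λ z → h (trans (same-memory fr TAB refl k) z)) ,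
                          (λ w z → proj₂ (labels ev k k<) w (trans (sym (same-memory fr TAB refl k)) z))
      ; fresh  = λ k le → trans (same-memory fr TAB refl k)
          (fresh ev k (subst (_≤ k) (same-memory fr BASE refl 0) le))
      ; sp     = e
      ; stack  = StackAt-≗ bs (λ k _ → same-memory fr STK refl k) stk
      ; lists  = Seg-at (sym (same-memory fr PC refl 0)) (Seg-≋ (frame-≋ fr refl) (lists ev))
      ; cursor = trans (cong (_+ _) (same-memory fr PC refl 0)) (cursor ev)
      ; kinds  = Numbers-at (sym (same-memory fr IX refl 0)) (Numbers-≗ (same-memory fr KIND refl) (kinds ev))
      ; count  = trans (same-memory fr CNT refl 0) (count ev)
      }

    Below-find : ∀ {st st′} → Frame (find {q}) st st′ → Below (memory st) (memory st′)
    Below-find fr = record { base≤ = ≤-reflexive (sym (same-memory fr BASE refl 0)) ; same-table = λ k _ →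
        same-memory fr TAB refl k }

    Below-trans : ∀ {m m′ m″} → Below m m′ → Below m′ m″ → Below m m″
    Below-trans h h′ = record
      { base≤ = ≤-trans (base≤ h) (base≤ h′)
      ; same-table = λ k k< → trans (same-table h′ k (≤-trans k< (base≤ h))) (same-table h k k<) }

    Lookup : Memory → ℕ → ℕ → (ℕ → Set) → Set
    Lookup m c lim G = ∀ k → k < lim → c + k < m BASE 0 × Iff (Nonzero m c k) (G k)

    label-lookup : ∀ m {bs ls ks} → Evaluating m bs ls ks → Lookup m 0 b W
    label-lookup m ev k k< = ≤-trans k< (base≥ ev) , labels ev k k<

    table-lookup : ∀ m {c G} → Table m c G → Lookup m c s G
    table-lookup m (c≤ , t) k k< = <-≤-trans (+-monoʳ-< _ k<) c≤ , t k k<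

    node-run : ∀ st bs₀ bs l ls k ks c c′ lim lim′ (G G′ : ℕ → Set) w (Q : State → Set) →
      Evaluating (memory st) bs₀ (l ∷ ls) (k ∷ ks) → StackAt (memory st) bs →
      Run find st 4 (λ st′ → memory st′ SP 0 ≡ length bs × Found (memory st) (memory st′) c c′) →
      (∀ st′ → Below (memory st) (memory st′) → Evaluating (memory st′) bs (l ∷ ls) (k ∷ ks) →
         Lookup (memory st′) c lim G × Lookup (memory st′) c′ lim′ G′) →
      (∀ e → e ∈ l → x e < s × y e < lim × z e < lim′) →
      (∀ st′ d → Evaluating (memory st′) (d ∷ bs) ls ks → Table (memory st′) d (Step l G G′) →
         Below (memory st) (memory st′) → Run eval-nodes st′ w Q) →
      Run eval-nodes st (7 + length l * 2 + w) Q
    node-run st bs₀ bs l ls k ks c c′ lim lim′ G G′ w Q ev stk found look ok cont =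
      while-step (λ z → 1+n≢0 (trans (sym (count ev)) z)) (seq-run (map-run next (framed found)))
      where
      next : ∀ s₂ → _ × Frame (find {q}) st s₂ → Run (scan ⨾ block scan-end) s₂ (2 + length l * 2) λ s₃ → Run
          eval-nodes s₃ w Q
      next s₂ ((sp′ , fd) , fr) with popped bs₀ fr stk sp′ ev
      ... | ev₂ with look s₂ (Below-find fr) ev₂
      ...   | lk , lk′ = map-run (λ s₃ (ev₃ , t , bl) → cont s₃ _ ev₃ t (Below-trans (Below-find fr) bl))
        (scan-end-run s₂ bs l ls k ks G G′ ev₂ λ e e∈ → proj₁ (ok e e∈) ,
          subst (λ u → u + y e < memory s₂ BASE 0 × Iff (Nonzero (memory s₂) u (y e)) (G (y e)))
              (sym (Found.b1 fd)) (lk (y e) (proj₁ (proj₂ (ok e e∈)))) ,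
          subst (λ u → u + z e < memory s₂ BASE 0 × Iff (Nonzero (memory s₂) u (z e)) (G′ (z e)))
              (sym (Found.b2 fd)) (lk′ (z e) (proj₂ (proj₂ (ok e e∈)))))

    kind-head : ∀ {m bs ls k ks} → Evaluating m bs ls (k ∷ ks) → m KIND (m IX 0) ≡ k
    kind-head ev with kinds ev
    ... | e ∷ _ = e

    un-run : ∀ st bs l ls ks c w (Q : State → Set) (G : ℕ → Set) → Evaluating (memory st) (c ∷ bs) (l ∷ ls) (1 ∷ ks) →
      (∀ e → e ∈ l → EntryBelow b s 1 e) → Table (memory st) c G →
      (∀ st′ d → Evaluating (memory st′) (d ∷ bs) ls ks → Table (memory st′) d (Step l G W) →
         Below (memory st) (memory st′) → Run eval-nodes st′ w Q) →
      Run eval-nodes st (7 + length l * 2 + w) Q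
    un-run st bs l ls ks c w Q G ev ok t cont =
      node-run st (c ∷ bs) bs l ls 1 ks c 0 s b G W w Q ev (proj₂ (stack ev))
        (subst (λ u → Run find st 4 λ st′ → memory st′ SP 0 ≡ length bs × Found (memory st) (memory st′) u 0)
            (proj₁ (stack ev))
          (find-un st (length bs) (kind-head ev) (sp ev)))
        (λ st′ bl ev′ → table-lookup (memory st′) (Table-Below bl t) , label-lookup (memory st′) ev′)
        (λ e e∈ → x< (ok e e∈) , y< (ok e e∈) , z< (ok e e∈)) cont

    -- The loop runs over a flat list in postorder while the proof is by induction on the tree. The
    -- two are reconciled by a continuation: it stands for the remaining iterations and receives the
    -- state in which the table of the subtree lies on top of the stack.
    tree-run : ∀ {ω} (D : Decomp ω) f → Bounded b s D f → ∀ st bs ls ks w (Q : State → Set) →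
      Evaluating (memory st) bs (map f (nodes D) ++ ls) (map δ (nodes D) ++ ks) →
      (∀ st′ c → Evaluating (memory st′) (c ∷ bs) ls ks → Table (memory st′) c (Reachable W D f) →
         Below (memory st) (memory st′) → Run eval-nodes st′ w Q) →
      Run eval-nodes st (eval-weight (map f (nodes D)) + w) Q
    tree-run (intro v a) f bd st bs ls ks w Q ev cont =
      subst (λ u → Run eval-nodes st (u + w) Q) (sym (+-identityʳ _))
      (node-run st bs bs (f root) ls 0 ks 0 0 b b W W w Q ev (stack ev)
        (map-run (λ _ (e , fd) → trans e (sp ev) , fd) (find-leaf st (kind-head ev)))
        (λ st′ _ ev′ → label-lookup (memory st′) ev′ , label-lookup (memory st′) ev′)
        (λ e e∈ → x< (bd root e e∈) , y< (bd root e e∈) , z< (bd root e e∈)) cont)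
    tree-run (t₁ ⊕ t₂) f bd st bs ls ks w Q ev cont =
      subst (λ u → Run eval-nodes st u Q) (sym weight)
      (tree-run t₁ (f ∘ left) (bd ∘ left) st bs _ _ _ Q
        (subst₂ (Evaluating (memory st) bs) (map-nodes-⊕ t₁ t₂ f ls) (map-nodes-⊕ t₁ t₂ δ ks) ev)
        λ s₁ c₁ ev₁ T₁ bl₁ → tree-run t₂ (f ∘ right) (bd ∘ right) s₁ (c₁ ∷ bs) _ _ _ Q ev₁
        λ s₂ c₂ ev₂ T₂ bl₂ →
          node-run s₂ (c₂ ∷ c₁ ∷ bs) bs (f root) ls 2 ks c₁ c₂ s s _ _ w Q ev₂ (proj₂ (proj₂ (stack ev₂)))
            (subst₂ (λ u v → Run find s₂ 4 λ st′ → memory st′ SP 0 ≡ length bs × Found (memory s₂) (memory st′) u v)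
              (proj₁ (proj₂ (stack ev₂))) (proj₁ (stack ev₂))
              (find-bin s₂ (length bs) (kind-head ev₂) (sp ev₂)))
            (λ st′ bl _ → table-lookup (memory st′) (Table-Below (Below-trans bl₂ bl) T₁) , table-lookup
                (memory st′) (Table-Below bl T₂))
            (λ e e∈ → x< (bd root e e∈) , y< (bd root e e∈) , z< (bd root e e∈))
            λ s₃ c₃ ev₃ T₃ bl₃ → cont s₃ c₃ ev₃ T₃ (Below-trans bl₁ (Below-trans bl₂ bl₃)))
      where
      e₁ = eval-weight (map (f ∘ left) (nodes t₁))
      e₂ = eval-weight (map (f ∘ right) (nodes t₂))
      e₃ = 7 + length (f root) * 2
      weight : eval-weight (map f (nodes (t₁ ⊕ t₂))) + w ≡ e₁ + (e₂ + (e₃ + w))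
      weight = begin
        eval-weight (map f (nodes (t₁ ⊕ t₂))) + w
          ≡⟨ cong (λ u → eval-weight u + w) (trans (sym (++-identityʳ _)) (map-nodes-⊕ t₁ t₂ f [])) ⟩
        eval-weight (map (f ∘ left) (nodes t₁) ++ (map (f ∘ right) (nodes t₂) ++ (f root ∷ []))) + w
          ≡⟨ cong (_+ w) (trans (eval-weight-++ (map (f ∘ left) (nodes t₁)))
               (cong (e₁ +_) (trans (eval-weight-++ (map (f ∘ right) (nodes t₂))) (cong (e₂ +_) (+-identityʳ e₃))))) ⟩
        (e₁ + (e₂ + e₃)) + w   ≡⟨ +-assoc e₁ (e₂ + e₃) w ⟩
        e₁ + ((e₂ + e₃) + w)   ≡⟨ cong (e₁ +_) (+-assoc e₂ e₃ w) ⟩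
        e₁ + (e₂ + (e₃ + w))   ∎
        where open ≡-Reasoning
    tree-run (recolor t a a′) f bd st bs ls ks w Q ev cont =
      subst (λ u → Run eval-nodes st u Q) (sym (un-weight t inRecolor f root w))
      (tree-run t (f ∘ inRecolor) (bd ∘ inRecolor) st bs _ _ _ Q
        (subst₂ (Evaluating (memory st) bs) (map-nodes-un inRecolor f root ls) (map-nodes-un inRecolor δ root ks) ev)
        λ s₁ c ev₁ T₁ bl₁ → un-run s₁ bs (f root) ls ks c w Q _ ev₁ (bd root) T₁
          λ s₂ d ev₂ T₂ bl₂ → cont s₂ d ev₂ T₂ (Below-trans bl₁ bl₂))
    tree-run (addEdges t a a′) f bd st bs ls ks w Q ev cont =
      subst (λ u → Run eval-nodes st u Q) (sym (un-weight t inAddEdges f root w))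
      (tree-run t (f ∘ inAddEdges) (bd ∘ inAddEdges) st bs _ _ _ Q
        (subst₂ (Evaluating (memory st) bs) (map-nodes-un inAddEdges f root ls)
            (map-nodes-un inAddEdges δ root ks) ev)
        λ s₁ c ev₁ T₁ bl₁ → un-run s₁ bs (f root) ls ks c w Q _ ev₁ (bd root) T₁
          λ s₂ d ev₂ T₂ bl₂ → cont s₂ d ev₂ T₂ (Below-trans bl₁ bl₂))

    record Ready (m : Memory) : Set where
      field
        base≥  : b ≤ m BASE 0
        labels : ∀ k → k < b → Iff (m TAB k ≢ 0) (W k)
        fresh  : ∀ k → m BASE 0 ≤ k → m TAB k ≡ 0

    evaluate-run : ∀ {ω} (D : Decomp ω) f → Bounded b s D f → ∀ st → Ready (memory st) → memory st SC 0 ≡ s →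
      memory st N 0 ≡ length (nodes D) → Numbers (memory st) KIND 0 (map δ (nodes D)) →
      Seg (memory st) (memory st PC 0) (flat (map f (nodes D)) ++ rest) →
      memory st PC 0 + length (flat (map f (nodes D)) ++ rest) ≡ stop →
      Run evaluate st (3 + eval-weight (map f (nodes D))) λ st′ →
        Iff (memory st′ RES 0 ≢ 0) (Reachable W D f 0) × Ready (memory st′) × Seg (memory st′)
            (memory st′ PC 0) rest ×
        memory st′ PC 0 + length rest ≡ stop
    evaluate-run D f bd st rd sc n kd sg cu =
      weaken (linear (# 1 :+ (v₀ :+ # 1 :+ # 1)) (# 3 :+ v₀) (eval-weight (map f (nodes D)) ∷ []))
      (seq-run (block-run _ (seq-run (
        (tree-run D f bd _ [] [] [] 1 _ start λ s₁ c ev T bl → while-exit (count ev) (block-run _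
          ( subst (λ u → Iff (memory s₁ TAB u ≢ 0) (Reachable W D f 0))
              (trans (+-identityʳ c) (sym (proj₁ (stack ev)))) (proj₂ T 0 (≤-trans 0<b b≤s))
          , record { base≥ = base≥ ev ; labels = labels ev ; fresh = fresh ev }
          , Seg-≋ (untouched (λ _ → refl)) (lists ev) , cursor ev)))))))
      where
      start : Evaluating (run-block xs (memory st) (CNT ≔ var N ∷ IX ≔ const 0 ∷ SP ≔ const 0 ∷ [])) []
        (map f (nodes D) ++ []) (map δ (nodes D) ++ [])
      start = record
        { scale = sc ; base≥ = Ready.base≥ rd ; labels = Ready.labels rd ; fresh = Ready.fresh rd
        ; sp = refl ; stack = tt
        ; lists = Seg-≋ (untouched (λ _ → refl))
            (subst (λ u → Seg (memory st) (memory st PC 0) (flat u ++ rest))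
            (sym (++-identityʳ (map f (nodes D)))) sg)
        ; cursor = trans (cong (λ u → memory st PC 0 + length (flat u ++ rest)) (++-identityʳ (map f (nodes D)))) cu
        ; kinds = Numbers-≗ (λ _ → refl) (subst (Numbers (memory st) KIND 0)
            (sym (++-identityʳ (map δ (nodes D)))) kd)
        ; count = trans n (trans (sym (length-map δ (nodes D)))
            (cong length (sym (++-identityʳ (map δ (nodes D)))))) }

-- Simulation of the cores

Numbers-++⁺ : ∀ {m a p} ks {ls} → Numbers m a p ks → Numbers m a (length ks + p) ls → Numbers m a p (ks ++ ls)
Numbers-++⁺ []       []      h′ = h′
Numbers-++⁺ {p = p} (k ∷ ks) (e ∷ h) h′ = e ∷ Numbers-++⁺ ks h (Numbers-at (sym (+-suc (length ks) p)) h′)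

Numbers-++⁻ : ∀ {m a p} ks {ls} → Numbers m a p (ks ++ ls) → Numbers m a p ks × Numbers m a (length ks + p) ls
Numbers-++⁻ []       h = [] , h
Numbers-++⁻ {p = p} (k ∷ ks) (e ∷ h) with Numbers-++⁻ ks h
... | h₁ , h₂ = e ∷ h₁ , Numbers-at (+-suc (length ks) p) h₂

Numbers-below : ∀ {m m′ a p ks} → (∀ k → k < p + length ks → m′ a k ≡ m a k) → Numbers m a p ks → Numbers m′ a p ks
Numbers-below h []      = []
Numbers-below {p = p} {ks = k ∷ ks} h (e ∷ t) =
  trans (h p (m<m+n p (s≤s z≤n))) e ∷ Numbers-below (λ j j< → h j (subst (j <_) (sym (+-suc p (length ks))) j<)) t

-- The input of a core is that of the machine simulating it without its first entry d.
translate : (ℕ → ℕ) → Expr → Expr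
translate φ (const k)  = const k
translate φ (inp e)    = inp (const 1 ⊞ translate φ e)
translate φ (cell a e) = cell (φ a) (translate φ e)
translate φ (e ⊞ f)    = translate φ e ⊞ translate φ f
translate φ (e ⊟ f)    = translate φ e ⊟ translate φ f

-- Output is collected in `OUT` for the parser instead of being printed. `feed` can become `skip`: a
-- core has no oracles, so its query buffer is never read, and the buffer of the simulating machine
-- stays empty.
simulate : ∀ {q} → (ℕ → ℕ) → Prog 0 → Prog q
simulate φ skip                    = skip
simulate φ (assign a i e)          = assign (φ a) (translate φ i) (translate φ e)
simulate φ (emit e)                =
  assign OUT (var OC) (translate φ e) ⨾ assign OC (const 0) (const 1 ⊞ var OC)
simulate φ (feed e)                = skip
simulate φ (ask a i ())
simulate φ (p ⨾ p′)                = simulate φ p ⨾ simulate φ p′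
simulate φ (ifnz e then p else p′) = ifnz translate φ e then simulate φ p else simulate φ p′
simulate φ (whilenz e loop p)      = whilenz translate φ e loop simulate φ p

modifies-simulate : ∀ {q} φ p a → (OUT ≡ᵇ a) ≡ false → (OC ≡ᵇ a) ≡ false → (∀ b → (φ b ≡ᵇ a) ≡ false) →
  modifies (simulate {q} φ p) a ≡ false
modifies-simulate φ skip                    a o c h = refl
modifies-simulate φ (assign b _ _)          a o c h = h b
modifies-simulate φ (emit e)                a o c h = cong₂ _∨_ o c
modifies-simulate φ (feed e)                a o c h = refl
modifies-simulate φ (ask b i ())            a o c h
modifies-simulate φ (p ⨾ p′)                a o c h =
  cong₂ _∨_ (modifies-simulate φ p a o c h) (modifies-simulate φ p′ a o c h)
modifies-simulate φ (ifnz _ then p else p′) a o c h =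
  cong₂ _∨_ (modifies-simulate φ p a o c h) (modifies-simulate φ p′ a o c h)
modifies-simulate φ (whilenz _ loop p)      a o c h = modifies-simulate φ p a o c h

silent-simulate : ∀ {q} φ p → queries (simulate {q} φ p) ≡ false × emits (simulate {q} φ p) ≡ false
silent-simulate φ skip                    = refl , refl
silent-simulate φ (assign b _ _)          = refl , refl
silent-simulate φ (emit e)                = refl , refl
silent-simulate φ (feed e)                = refl , refl
silent-simulate φ (ask b i ())
silent-simulate φ (p ⨾ p′)                = let (a , b) = silent-simulate φ p ; (a′ , b′) = silent-simulate φ p′
                                            in cong₂ _∨_ a a′ , cong₂ _∨_ b b′
silent-simulate φ (ifnz _ then p else p′) = let (a , b) = silent-simulate φ p ; (a′ , b′) = silent-simulate φ p′
                                            in cong₂ _∨_ a a′ , cong₂ _∨_ b b′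
silent-simulate φ (whilenz _ loop p)      = silent-simulate φ p

-- The factor 3 is caused by `inp`, whose address is increased by 1 at the cost of two more units;
-- the other constructors pass the factor on.
cost-translate : ∀ φ e → cost (translate φ e) ≤ 3 * cost e
cost-translate φ (const k)  = s≤s z≤n
cost-translate φ (inp e)    = ≤-trans (+-monoʳ-≤ 3 (cost-translate φ e))
  (linear (# 3 :+ 3 :* v₀) (3 :* (# 1 :+ v₀)) (cost e ∷ []))
cost-translate φ (cell a e) = ≤-trans (+-monoʳ-≤ 1 (cost-translate φ e))
  (linear (# 1 :+ 3 :* v₀) (3 :* (# 1 :+ v₀)) (cost e ∷ []))
cost-translate φ (e ⊞ f)    = ≤-trans (s≤s (+-mono-≤ (cost-translate φ e) (cost-translate φ f)))
  (linear (# 1 :+ (3 :* v₀ :+ 3 :* v₁)) (3 :* (# 1 :+ (v₀ :+ v₁))) (cost e ∷ cost f ∷ []))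
cost-translate φ (e ⊟ f)    = ≤-trans (s≤s (+-mono-≤ (cost-translate φ e) (cost-translate φ f)))
  (linear (# 1 :+ (3 :* v₀ :+ 3 :* v₁)) (3 :* (# 1 :+ (v₀ :+ v₁))) (cost e ∷ cost f ∷ []))

≡ᵇ-refl : ∀ k → (k ≡ᵇ k) ≡ true
≡ᵇ-refl zero    = refl
≡ᵇ-refl (suc k) = ≡ᵇ-refl k

≢⇒≡ᵇ : ∀ {a b} → a ≢ b → (a ≡ᵇ b) ≡ false
≢⇒≡ᵇ {a} {b} a≢b with a ≡ᵇ b | ≡ᵇ⇒≡ a b
... | false | _ = refl
... | true  | h = ⊥-elim (a≢b (h tt))

module SimulationRuns {q : ℕ} (oracle : Fin q → Bits → Bool) (d : ℕ) (ys : List ℕ)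
  (φ : ℕ → ℕ) (φ-injective : ∀ {a b} → φ a ≡ φ b → a ≡ b)
  (φ-OUT : ∀ a → (φ a ≡ᵇ OUT) ≡ false) (φ-OC : ∀ a → (φ a ≡ᵇ OC) ≡ false)
  (OUT-φ : ∀ a → (OUT ≡ᵇ φ a) ≡ false) (OC-φ : ∀ a → (OC ≡ᵇ φ a) ≡ false) where
  open Logic oracle (d ∷ ys)
  module Source = Semantics noOracle ys

  record Simulates (s s̃ : State) : Set where
    field
      arrays : ∀ a k → memory s̃ (φ a) k ≡ memory s a k
      number : memory s̃ OC 0 ≡ length (output s)
      stored : Numbers (memory s̃) OUT 0 (output s)

  open Simulates

  eval-translate : ∀ (m m̃ : Memory) → (∀ a k → m̃ (φ a) k ≡ m a k) → ∀ e → eval (d ∷ ys) m̃ (translate φ e) ≡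
      eval ys m e
  eval-translate m m̃ h (const k)  = refl
  eval-translate m m̃ h (inp e)    = cong (nth ys) (eval-translate m m̃ h e)
  eval-translate m m̃ h (cell a e) = trans (cong (m̃ (φ a)) (eval-translate m m̃ h e)) (h a _)
  eval-translate m m̃ h (e ⊞ f)    = cong₂ _+_ (eval-translate m m̃ h e) (eval-translate m m̃ h f)
  eval-translate m m̃ h (e ⊟ f)    = cong₂ _∸_ (eval-translate m m̃ h e) (eval-translate m m̃ h f)

  ≡ᵇ-φ : ∀ a b → (φ a ≡ᵇ φ b) ≡ (a ≡ᵇ b)
  ≡ᵇ-φ a b with a ≟ b
  ... | yes refl = trans (≡ᵇ-refl (φ a)) (sym (≡ᵇ-refl a))
  ... | no a≢b   = trans (≢⇒≡ᵇ (λ e → a≢b (φ-injective e))) (sym (≢⇒≡ᵇ a≢b))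

  small : ∀ {k w} → k ≤ 10 * w → k ≤ stepFactor * w
  small {w = w} h = ≤-trans h (*-monoˡ-≤ w (≤stepFactor 10 tt))

  small-cost : ∀ e → suc (cost (translate φ e)) ≤ stepFactor * suc (cost e)
  small-cost e = small (≤-trans (s≤s (cost-translate φ e))
    (linear (# 1 :+ 3 :* v₀) (10 :* (# 1 :+ v₀)) (cost e ∷ [])))

  simulate-run : ∀ {p s s′ k s̃} → p Source., s ⇓[ k ] s′ → Simulates s s̃ → Run (simulate φ p) s̃ k (Simulates s′)
  simulate-run Source.skip h = run skip (small {1} {1} (s≤s z≤n)) h
  simulate-run {s̃ = s̃} (Source.assign {m = m} {a = a} {addr = i} {e = e}) h = run assign
    (small (≤-trans (s≤s (+-mono-≤ (cost-translate φ i) (cost-translate φ e)))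
      (linear (# 1 :+ (3 :* v₀ :+ 3 :* v₁)) (10 :* (# 1 :+ (v₀ :+ v₁))) (cost i ∷ cost e ∷ []))))
    (record
      { arrays = write-arrays
      ; number = trans (write-array (memory s̃) {φ a} {eval (d ∷ ys) (memory s̃) (translate φ i)}
          {eval (d ∷ ys) (memory s̃) (translate φ e)} OC (φ-OC a) 0) (number h)
      ; stored = Numbers-≗ (write-array (memory s̃) {φ a} {eval (d ∷ ys) (memory s̃) (translate φ i)}
          {eval (d ∷ ys) (memory s̃) (translate φ e)} OUT (φ-OUT a)) (stored h) })
    where
    write-arrays : ∀ b k → write (memory s̃) (φ a) (eval (d ∷ ys) (memory s̃) (translate φ i))
        (eval (d ∷ ys) (memory s̃) (translate φ e)) (φ b) k
       ≡ write m a (eval ys m i) (eval ys m e) b k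
    write-arrays b k rewrite ≡ᵇ-φ a b | eval-translate m (memory s̃) (arrays h) i | eval-translate m
        (memory s̃) (arrays h) e | arrays h b k = refl
  simulate-run {s̃ = s̃} (Source.emit {m = m} {o = o} {e = e}) h = run (seq assign assign)
    (small (≤-trans (+-monoˡ-≤ 6 (+-monoʳ-≤ 3 (cost-translate φ e)))
      (linear (# 3 :+ 3 :* v₀ :+ # 6) (10 :* (# 1 :+ v₀)) (cost e ∷ []))))
    (record
      { arrays = λ a k → trans (write-array m̃ {OC} {0} {suc (memory s̃ OC 0)} (φ a) (OC-φ a) k)
          (trans (write-array (memory s̃) {OUT} {memory s̃ OC 0} {v} (φ a) (OUT-φ a) k) (arrays h a k))
      ; number = trans (cong suc (number h)) (sym (trans (length-++ o) (+-comm (length o) 1)))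
      ; stored = Numbers-++⁺ o
          (Numbers-below (λ k k< → if-≢ (λ c → <-irrefl (sym (trans (sym (number h)) c)) k<)) (stored h))
          (trans (cong (λ u → m̃ OUT u) (trans (+-identityʳ (length o)) (sym (number h))))
             (trans (if-≡ (memory s̃ OC 0)) (eval-translate m (memory s̃) (arrays h) e)) ∷ []) })
    where
    v = eval (d ∷ ys) (memory s̃) (translate φ e)
    m̃ : Memory
    m̃ = write (memory s̃) OUT (memory s̃ OC 0) v
  simulate-run {s̃ = s̃} (Source.feed {e = e}) h = run skip (small {1} {suc (cost e)} (s≤s z≤n))
    (record { arrays = arrays h ; number = number h ; stored = stored h })
  simulate-run (Source.ask {i = ()}) h
  simulate-run (Source.seq e e′) h = seq-run (map-run (λ _ h′ → simulate-run e′ h′) (simulate-run e h))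
  simulate-run {s̃ = s̃} (Source.if-nz {e = e} nz x) h with simulate-run x h
  ... | run x̃ b h′ = run (if-nz (λ z → nz (trans (sym (eval-translate _ (memory s̃) (arrays h) e)) z)) x̃)
    (bound-+ (small-cost e) b) h′
  simulate-run {s̃ = s̃} (Source.if-z {e = e} z x) h with simulate-run x h
  ... | run x̃ b h′ = run (if-z (trans (eval-translate _ (memory s̃) (arrays h) e) z) x̃)
    (bound-+ (small-cost e) b) h′
  simulate-run {s̃ = s̃} (Source.while-nz {e = e} nz x y) h with simulate-run x h
  ... | run x̃ b h′ with simulate-run y h′
  ...   | run ỹ b′ h″ = run (while-nz (λ z → nz (trans (sym (eval-translate _ (memory s̃) (arrays h) e)) z)) x̃ ỹ)
    (bound-+ (bound-+ (small-cost e) b) b′) h″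
  simulate-run {s̃ = s̃} (Source.while-z {e = e} z) h =
    run (while-z (trans (eval-translate _ (memory s̃) (arrays h) e) z)) (small-cost e) h

-- core-index i a = 2^i (2a + 1) - 1, hence different cores use different arrays.
core-index : ℕ → ℕ → ℕ
core-index zero    a = a + a
core-index (suc i) a = suc (core-index i a + core-index i a)

-- The offset 64 exceeds the numbers of all arrays of the main program, so comparisons with them
-- evaluate to `false` for every core and every array.
core-array : ℕ → ℕ → ℕ
core-array i a = 64 + core-index i a

double≢suc-double : ∀ a b → a + a ≢ suc (b + b)
double≢suc-double zero    b       ()
double≢suc-double (suc a) zero    e = 1+n≢0 (trans (sym (+-suc a a)) (suc-injective e))
double≢suc-double (suc a) (suc b) e = double≢suc-double a b (suc-injective (suc-injective
  (trans (cong suc (sym (+-suc a a))) (trans e (cong (λ (u : ℕ) → suc (suc u)) (+-suc b b))))))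

double-injective : ∀ a b → a + a ≡ b + b → a ≡ b
double-injective zero    zero    _ = refl
double-injective (suc a) (suc b) e = cong suc (double-injective a b (suc-injective (suc-injective
  (trans (cong suc (sym (+-suc a a))) (trans e (cong suc (+-suc b b)))))))

core-index-injective : ∀ i {a b} → core-index i a ≡ core-index i b → a ≡ b
core-index-injective zero    e = double-injective _ _ e
core-index-injective (suc i) e = core-index-injective i (double-injective _ _ (suc-injective e))

-- Index 0 yields even numbers and a positive index odd ones; two positive indices are compared
-- after halving.
core-index-disjoint : ∀ i j {a b} → i < j → core-index i a ≢ core-index j b
core-index-disjoint zero    (suc j) {a} {b} _ e = double≢suc-double a (core-index j b) e
core-index-disjoint (suc i) (suc j) (s≤s i<j) e =
  core-index-disjoint i j i<j (double-injective _ _ (suc-injective e))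

-- Parsing the output of a core

-- The binary number with digits `w`, lowest first, below a leading 1. The leading 1 distinguishes
-- strings that differ by trailing zeros, and it makes every code positive, which keeps the state 0
-- free for the additional root.
code : Bits → ℕ
code []      = 1
code (b ∷ w) = bit b + (code w + code w)

label : ℕ → Bool → ℕ
label lab β = if β then lab else 0

module _ (sc lab : ℕ) (ρ : Bits → Bool) where
  toEntry : ∀ {κ} → Vec Bits (suc κ) → Entry
  toEntry (w ∷ [])           = ent (sc * code w) (label lab (ρ w)) 0
  toEntry (w ∷ w₁ ∷ [])      = ent (sc * code w) (sc * code w₁) 0
  toEntry (w ∷ w₁ ∷ w₂ ∷ ws) = ent (sc * code w) (sc * code w₁) (sc * code w₂)

-- A cell of P indexed by a bit b holds b times the current power.
read-bit read-end : List Assignment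
read-bit = A ≔ var A ⊞ cell P (cell OUT (var POS)) ∷ P [ const 1 ]≔ cell P (const 1) ⊞ cell P (const 1) ∷
    increment POS ∷ []
-- The power reached is the leading 1 of the code. `NS` starts at the old scale and sums all numbers
-- read; so it finally exceeds each of them by at least the old scale, and no maximum has to be
-- computed.
read-end = A ≔ var A ⊞ cell P (const 1) ∷ NS ≔ var NS ⊞ var A ∷ increment POS ∷ []

module _ {q : ℕ} (i : Fin q) where
  read-bits read-string : Prog q
  read-bits = whilenz const 2 ⊟ cell OUT (var POS) loop (feed (cell OUT (var POS)) ⨾ block read-bit)
  read-string = block (A ≔ const 0 ∷ P [ const 0 ]≔ const 0 ∷ P [ const 1 ]≔ var SC ∷ []) ⨾
    -- The oracle is asked for every string, also where no membership bit is wanted, since asking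
    -- empties the query buffer. The bits have been fed while reading, so this only costs a
    -- constant.
    (read-bits ⨾ (block read-end ⨾ ask BETA (const 0) i))

  module _ (lab : ℕ) where
    read-tuple read-tuples read-node read-nodes : Prog q
    read-tuple = read-string ⨾ (block (X0 ≔ var A ∷ Y0 ≔ const 0 ∷ Z0 ≔ const 0 ∷ []) ⨾
      ((ifnz var DEG
        then (read-string ⨾ (block (Y0 ≔ var A ∷ []) ⨾
               (ifnz var DEG ⊟ const 1 then (read-string ⨾ block (Z0 ≔ var A ∷ [])) else skip)))
        else (ifnz var BETA then block (Y0 ≔ const lab ∷ []) else skip)) ⨾
       block (push (var X0) (var Y0) (var Z0))))
    read-tuples = whilenz const 3 ⊟ cell OUT (var POS) loop read-tuple
    read-node = block (RP ≔ var TOP ∷ DEG ≔ cell KIND (var IX) ∷ []) ⨾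
      (read-tuples ⨾ block (push-end ++ increment POS ∷ increment IX ∷ decrement CNT ∷ []))
    read-nodes = whilenz var CNT loop read-node

  read-accept : Prog q
  read-accept = whilenz const 3 ⊟ cell OUT (var POS) loop (read-string ⨾ block (ACC [ var A ]≔ const 1 ∷ []))

  filter-root : Prog q
  filter-root = whilenz cell F (var PA) loop
    ((ifnz cell ACC (cell X (var PA)) then block (Y0 ≔ cell X (var PA) ∷ push (const 0) (var Y0) (const 0))
        else skip) ⨾
     block (increment PA ∷ []))

  parse : ℕ → Prog q
  parse lab =
    block (POS ≔ const 0 ∷ NS ≔ var SC ∷ IX ≔ const 0 ∷ CNT ≔ var N ⊟ const 1 ∷ []) ⨾
    (read-nodes lab ⨾ (read-accept ⨾ (block (PA ≔ var RP ∷ []) ⨾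
    (filter-root ⨾ block (push-end ++ SC ≔ var NS ∷ [])))))

-- The entries of the additional root are read off the tuples of the root and not off the accepted
-- strings: their number is then bounded by `Size`, which does not count accepted strings. A state
-- with several tuples merely gives repeated entries.
root-entries : (ℕ → Bool) → List Entry → List Entry
root-entries p []      = []
root-entries p (e ∷ l) = if p (x e) then ent 0 (x e) 0 ∷ root-entries p l else root-entries p l

length-root-entries : ∀ p l → length (root-entries p l) ≤ length l
length-root-entries p []      = z≤n
length-root-entries p (e ∷ l) with p (x e)
... | true  = s≤s (length-root-entries p l)
... | false = m≤n⇒m≤1+n (length-root-entries p l)

1≤code : ∀ w → 1 ≤ code w
1≤code []      = ≤-refl
1≤code (b ∷ w) = ≤-trans (1≤code w) (≤-trans (m≤m+n (code w) (code w)) (m≤n+m _ (bit b)))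

toEntry-x : ∀ sc lab ρ {κ} (v : Vec Bits (suc κ)) → sc ≤ x (toEntry sc lab ρ v)
toEntry-x sc lab ρ (w ∷ [])           = ≤-trans (≤-reflexive (sym (*-identityʳ sc))) (*-monoʳ-≤ sc (1≤code w))
toEntry-x sc lab ρ (w ∷ w₁ ∷ [])      = ≤-trans (≤-reflexive (sym (*-identityʳ sc))) (*-monoʳ-≤ sc (1≤code w))
toEntry-x sc lab ρ (w ∷ w₁ ∷ w₂ ∷ ws) = ≤-trans (≤-reflexive (sym (*-identityʳ sc))) (*-monoʳ-≤ sc (1≤code w))

nonzero-bit : ∀ b → nonzero (bit b) ≡ b
nonzero-bit false = refl
nonzero-bit true  = refl

label-true : ∀ {lab v} {b : Bool} → v ≡ bit b → v ≢ 0 → lab ≡ label lab b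
label-true {b = true}  _ _ = refl
label-true {b = false} e h = ⊥-elim (h e)

label-false : ∀ {lab v} {b : Bool} → v ≡ bit b → v ≡ 0 → 0 ≡ label lab b
label-false {b = true}  e h = ⊥-elim (0≢1+n (trans (sym h) e))
label-false {b = false} _ _ = refl

module ParseRuns {q : ℕ} (oracle : Fin q → Bits → Bool) (xs : List ℕ) (i : Fin q) where
  open Logic oracle xs
  open CrossRuns oracle xs

  feed-run : ∀ {ℓ} e {s} {Q : State → Set ℓ} {h : T (suc (cost e) ≤ᵇ 1000)} →
    Q ⟨ memory s , query s ++ nonzero (eval xs (memory s) e) ∷ [] , output s ⟩ → Run (feed e) s 1 Q
  feed-run e {h = h} = run feed (≤stepFactor*1 _ h)

  ask-run : ∀ {ℓ} a j {s} {Q : State → Set ℓ} → Q ⟨ write (memory s) a 0 (bit (oracle j (query s))) , [] ,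
      output s ⟩ → Run (ask a (const 0) j) s 1 Q
  ask-run a j = run ask (≤stepFactor*1 2 tt)

  -- Adding the current power to `A` gives the invariant: that power is the leading 1 of the code,
  -- which the loop itself does not yet add.
  read-bits-run : ∀ w rest s → Numbers (memory s) OUT (memory s POS 0) (map bit w ++ 2 ∷ rest) → memory s P 0 ≡ 0 →
    Run (read-bits i) s (1 + length w * 3) λ s′ →
      memory s′ A 0 + memory s′ P 1 ≡ memory s A 0 + memory s P 1 * code w ×
      query s′ ≡ query s ++ w × memory s′ POS 0 ≡ length w + memory s POS 0
  read-bits-run [] rest s (e ∷ _) p0 = while-exit (cong (2 ∸_) e)
    (cong (memory s A 0 +_) (sym (*-identityʳ _)) , sym (++-identityʳ _) , refl)
  read-bits-run (b ∷ w) rest s (e ∷ t) p0 = while-step (λ z → bit-≢0 b (trans (sym (cong (2 ∸_) e)) z))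
    (seq-run (feed-run (cell OUT (var POS)) (block-run _ (map-run
      (λ s′ (a , qu , po) → trans a (arith b e) ,
         trans qu (trans (cong (λ u → (query s ++ u ∷ []) ++ w) (trans (cong nonzero e) (nonzero-bit b)))
             (++-assoc (query s) (b ∷ []) w)) ,
         trans po (+-suc (length w) _))
      (read-bits-run w rest _ (Numbers-≗ (λ _ → refl) t) p0)))))
    where
    m = memory s
    bit-≢0 : ∀ b → 2 ∸ bit b ≢ 0
    bit-≢0 false ()
    bit-≢0 true  ()
    p = m P 1
    arith : ∀ b → m OUT (m POS 0) ≡ bit b →
      m A 0 + m P (m OUT (m POS 0)) + (p + p) * code w ≡ m A 0 + p * (bit b + (code w + code w))
    doubled : (p + p) * code w ≡ p * (code w + code w)
    doubled = trans (*-distribʳ-+ (code w) p p) (sym (*-distribˡ-+ p (code w) (code w)))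
    arith false e = cong₂ _+_ (trans (cong (m A 0 +_) (trans (cong (m P) e) p0)) (+-identityʳ _)) doubled
    arith true  e = trans (+-assoc (m A 0) _ _) (cong (m A 0 +_)
      (trans (cong₂ _+_ (cong (m P) e) doubled) (sym (*-suc p _))))

  record AfterString (s s′ : State) (w : Bits) : Set where
    field
      a     : memory s′ A 0 ≡ memory s SC 0 * code w
      ns    : memory s′ NS 0 ≡ memory s NS 0 + memory s SC 0 * code w
      beta  : memory s′ BETA 0 ≡ bit (oracle i w)
      quiet : query s′ ≡ []
      pos   : memory s′ POS 0 ≡ length (encodeBits w) + memory s POS 0

  length-encodeBits : ∀ w → length (encodeBits w) ≡ suc (length w)
  length-encodeBits w = trans (length-++ (map bit w)) (trans (+-comm _ 1) (cong suc (length-map bit w)))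

  read-string-run : ∀ w rest s → query s ≡ [] → Numbers (memory s) OUT (memory s POS 0) (encodeBits w ++ rest) →
    Run (read-string i) s (4 * length (encodeBits w)) λ s′ → AfterString s s′ w × Frame (read-string i) s s′
  read-string-run w rest s qu out = framed (weaken
    (≤-trans (linear (# 1 :+ (# 1 :+ v₀ :+ # 2)) (# 4 :+ v₀) (length w * 3 ∷ []))
      (≤-trans (linear (# 4 :+ v₀) (# 4 :+ (v₀ :+ v₁)) (length w * 3 ∷ length w ∷ []))
        (≤-reflexive (trans (cong (4 +_) (trans (+-comm (length w * 3) (length w)) (sym (*-suc (length w) 3))))
          (trans (cong (4 +_) (*-comm (length w) 4))
              (trans (sym (*-suc 4 (length w))) (cong (4 *_) (sym (length-encodeBits w)))))))))
    (seq-run (block-run _ (seq-run (map-run next (framed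
      (read-bits-run w rest _ (Numbers-≗ (λ _ → refl)
          (subst (Numbers _ _ _) (++-assoc (map bit w) (2 ∷ []) rest) out)) refl)))))))
    where
    m : Memory
    m = memory s
    next : ∀ s₂ → _ → Run (block read-end ⨾ ask BETA (const 0) i) s₂ 2 (λ s′ → AfterString s s′ w)
    next s₂ ((ap , q₂ , po) , fr) = seq-run (block-run _ (ask-run BETA i (record
      { a = ap ; ns = cong₂ _+_ (same-memory fr NS refl 0) ap
      ; beta = cong (bit ∘ oracle i) (trans q₂ (cong (_++ w) qu)) ; quiet = refl
      ; pos = trans (cong suc po) (cong (_+ m POS 0) (sym (length-encodeBits w))) })))

  record Reading (sc : ℕ) (s : State) (syms : List ℕ) : Set where
    field
      scale   : memory s SC 0 ≡ sc
      ns≥     : sc ≤ memory s NS 0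
      quiet   : query s ≡ []
      symbols : Numbers (memory s) OUT (memory s POS 0) syms

  open Reading

  reading-same : ∀ {sc s s′ syms} → memory s′ SC 0 ≡ memory s SC 0 → memory s′ NS 0 ≡ memory s NS 0 →
    memory s′ POS 0 ≡ memory s POS 0 → query s′ ≡ query s → (∀ k → memory s′ OUT k ≡ memory s OUT k) →
    Reading sc s syms → Reading sc s′ syms
  reading-same h₁ h₂ h₃ h₄ h₅ rd = record
    { scale = trans h₁ (scale rd) ; ns≥ = subst (_ ≤_) (sym h₂) (ns≥ rd) ; quiet = trans h₄ (quiet rd)
    ; symbols = Numbers-at (sym h₃) (Numbers-≗ h₅ (symbols rd)) }

  -- For each string read, the future scale leaves room for its number plus anything below the
  -- present scale. This is exactly the bound in `Span`, and it survives further reading because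
  -- `NS` only grows.
  record Progress (sc : ℕ) (m m′ : Memory) (ws : List Bits) : Set where
    field
      ns≤    : m NS 0 ≤ m′ NS 0
      covers : ∀ w → w ∈ ws → sc * code w + sc ≤ m′ NS 0

  open Progress

  progress-refl : ∀ {sc m m′} → m′ NS 0 ≡ m NS 0 → Progress sc m m′ []
  progress-refl e = record { ns≤ = ≤-reflexive (sym e) ; covers = λ _ () }

  progress-trans : ∀ {sc m m′ m″ ws ws′} → Progress sc m m′ ws → Progress sc m′ m″ ws′ → Progress sc m m″ (ws ++ ws′)
  progress-trans {ws = ws} h h′ = record
    { ns≤ = ≤-trans (ns≤ h) (ns≤ h′)
    ; covers = λ w w∈ → case w (∈-++⁻ ws w∈) }
    where
    case : ∀ w → w ∈ ws ⊎ w ∈ _ → _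
    case w (inj₁ w∈) = ≤-trans (covers h w w∈) (ns≤ h′)
    case w (inj₂ w∈) = covers h′ w w∈

  string-run : ∀ sc w rest s → Reading sc s (encodeBits w ++ rest) →
    Run (read-string i) s (4 * length (encodeBits w)) λ s′ → Reading sc s′ rest × Progress sc (memory s)
        (memory s′) (w ∷ []) ×
      memory s′ A 0 ≡ sc * code w × memory s′ BETA 0 ≡ bit (oracle i w) × Frame (read-string i) s s′
  string-run sc w rest s rd = map-run
    (λ s′ (as , fr) → let open AfterString as
                          ns′ = trans ns (cong (λ u → memory s NS 0 + u * code w) (scale rd)) in
      record { scale = trans (same-memory fr SC refl 0) (scale rd)
             ; ns≥ = ≤-trans (ns≥ rd) (≤-trans (m≤m+n _ _) (≤-reflexive (sym ns′)))
             ; quiet = AfterString.quiet as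
             ; symbols = Numbers-at (sym pos) (Numbers-≗ (same-memory fr OUT refl)
                 (proj₂ (Numbers-++⁻ (encodeBits w) (symbols rd)))) } ,
      record { ns≤ = ≤-trans (m≤m+n _ _) (≤-reflexive (sym ns′))
             ; covers = λ { _ (here refl) → ≤-trans (+-monoʳ-≤ (sc * code w) (ns≥ rd))
                 (≤-reflexive (trans (+-comm (sc * code w) _) (sym ns′))) } } ,
      trans a (cong (_* code w) (scale rd)) , beta , fr)
    (read-string-run w rest s (quiet rd) (symbols rd))

  encodeTuple : ∀ {k} → Vec Bits k → List ℕ
  encodeTuple v = concatMap encodeBits (Vec.toList v)

  1≤length-encodeBits : ∀ w → 1 ≤ length (encodeBits w)
  1≤length-encodeBits w = subst (1 ≤_) (sym (length-encodeBits w)) (s≤s z≤n)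

  record Loaded (sc : ℕ) (s s′ : State) (rest : List ℕ) (ws : List Bits) (e : Entry) : Set where
    field
      reading  : Reading sc s′ rest
      progress : Progress sc (memory s) (memory s′) ws
      pool≋    : memory s ≋ memory s′
      x-loaded : memory s′ X0 0 ≡ x e
      y-loaded : memory s′ Y0 0 ≡ y e
      z-loaded : memory s′ Z0 0 ≡ z e

  open Loaded

  TupleRead : ℕ → State → List ℕ → List Bits → Entry → State → Set
  TupleRead sc s rest ws e s′ =
    Reading sc s′ rest × Progress sc (memory s) (memory s′) ws × Appends (memory s) (memory s′) (full e ∷ [])

  pushed-run : ∀ {sc s s′ rest ws e} → Loaded sc s s′ rest ws e →
    Run (block (push (var X0) (var Y0) (var Z0))) s′ 1 (TupleRead sc s rest ws e)
  pushed-run {s = s} {s′} ld = block-run _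
    ( reading-same refl refl refl refl (λ _ → refl) (reading ld)
    , record { ns≤ = ns≤ (progress ld) ; covers = covers (progress ld) }
    , Appends-after (pool≋ ld) (Appends-push (λ _ → refl) (λ _ → refl) (x-loaded ld) (λ _ → refl) (y-loaded ld)
        (λ _ → refl) (z-loaded ld) refl))

  head-run : ∀ sc lab w syms ws e rest s k → Reading sc s (encodeBits w ++ syms) →
    (∀ s₁ → Loaded sc s s₁ syms (w ∷ []) (ent (sc * code w) 0 0) → memory s₁ DEG 0 ≡ memory s DEG 0 →
       memory s₁ BETA 0 ≡ bit (oracle i w) →
       Run (ifnz var DEG
        then (read-string i ⨾ (block (Y0 ≔ var A ∷ []) ⨾
               (ifnz var DEG ⊟ const 1 then (read-string i ⨾ block (Z0 ≔ var A ∷ [])) else skip)))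
        else (ifnz var BETA then block (Y0 ≔ const lab ∷ []) else skip)) s₁ k (λ s₂ → Loaded sc s s₂ rest ws e)) →
    Run (read-tuple i lab) s (4 * length (encodeBits w) + (2 + k)) (TupleRead sc s rest ws e)
  head-run sc lab w syms ws e rest s k rd cont = weaken
      (+-monoʳ-≤ (4 * length (encodeBits w)) (≤-reflexive (cong suc (+-comm k 1))))
    (seq-run (map-run (λ s₁ (rd₁ , pr , a , β , fr) → seq-run
        (block-run _ (seq-run (map-run (λ _ ld → pushed-run ld) (cont _ (record
      { reading = reading-same refl refl refl refl (λ _ → refl) rd₁
      ; progress = record { ns≤ = ns≤ pr ; covers = covers pr }
      ; pool≋ = ≋-trans (frame-≋ fr refl) (untouched (λ _ → refl))
      ; x-loaded = a ; y-loaded = refl ; z-loaded = refl }) (same-memory fr DEG refl 0) β)))))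
      (string-run sc w syms s rd)))

  second-run : ∀ sc w rest s s₁ ws e → Loaded sc s s₁ (encodeBits w ++ rest) ws e →
    Run (read-string i) s₁ (4 * length (encodeBits w)) λ s₂ →
      Loaded sc s s₂ rest (ws ++ w ∷ []) e × memory s₂ A 0 ≡ sc * code w × Frame (read-string i) s₁ s₂
  second-run sc w rest s s₁ ws e ld = map-run (λ s₂ (rd , pr , a , _ , fr) → record
      { reading = rd ; progress = progress-trans (progress ld) pr ; pool≋ = ≋-trans (pool≋ ld) (frame-≋ fr refl)
      ; x-loaded = trans (same-memory fr X0 refl 0) (x-loaded ld) ; y-loaded = trans
          (same-memory fr Y0 refl 0) (y-loaded ld)
      ; z-loaded = trans (same-memory fr Z0 refl 0) (z-loaded ld) } , a , fr)
    (string-run sc w rest s₁ (reading ld))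

  -- An encoded string contains at least its end mark, so the constant overhead of a tuple can be
  -- charged to the first string; in this way the time is linear in the symbols read, without an
  -- additive term.
  tuple-run : ∀ sc lab κ (v : Vec Bits (suc κ)) rest s → κ ≤ 2 → memory s DEG 0 ≡ κ → Reading sc s
      (encodeTuple v ++ rest) →
    Run (read-tuple i lab) s (12 * length (encodeTuple v))
        (TupleRead sc s rest (Vec.toList v) (toEntry sc lab (oracle i) v))
  tuple-run sc lab zero (w ∷ []) rest s _ deg rd = weaken weight
    (head-run sc lab w rest (w ∷ []) (toEntry sc lab (oracle i) (w ∷ [])) rest s 5
      (subst (Reading sc s) (cong (_++ rest) (++-identityʳ (encodeBits w))) rd) branch)
    where
    L = length (encodeBits w)
    weight : 4 * L + 7 ≤ 12 * length (encodeBits w ++ [])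
    weight = ≤-trans (≤-trans (+-monoʳ-≤ (4 * L) (*-monoʳ-≤ 7 (1≤length-encodeBits w)))
      (linear (4 :* v₀ :+ 7 :* v₀) (12 :* v₀) (L ∷ [])))
          (≤-reflexive (cong (λ u → 12 * length u) (sym (++-identityʳ (encodeBits w)))))
    e₀ e₁ : Entry
    e₀ = ent (sc * code w) 0 0
    e₁ = toEntry sc lab (oracle i) (w ∷ [])
    relabel : ∀ {s₁ s₂} → Loaded sc s s₁ rest (w ∷ []) e₀ → Reading sc s₂ rest → memory s₁ ≋ memory s₂ →
      memory s₂ NS 0 ≡ memory s₁ NS 0 → memory s₂ X0 0 ≡ memory s₁ X0 0 → memory s₂ Z0 0 ≡ memory s₁ Z0 0 →
      memory s₂ Y0 0 ≡ y e₁ → Loaded sc s s₂ rest (w ∷ []) e₁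
    relabel ld rd₂ po n x₂ z₂ y₂ = record
      { reading = rd₂ ; progress = progress-trans (progress ld) (progress-refl n) ; pool≋ = ≋-trans (pool≋ ld) po
      ; x-loaded = trans x₂ (x-loaded ld) ; y-loaded = y₂ ; z-loaded = trans z₂ (z-loaded ld) }
    branch : ∀ s₁ → _ → _ → _ → Run _ s₁ 5 (λ s₂ → Loaded sc s s₂ rest (w ∷ []) e₁)
    branch s₁ ld dg β = if-run (λ h → ⊥-elim (h (trans dg deg))) λ _ →
      if-run (λ h → weaken {w = 1} (s≤s z≤n)
          (block-run _ (relabel {s₁} ld (reading-same refl refl refl refl (λ _ → refl) (reading ld))
          (untouched (λ _ → refl)) refl refl refl (label-true β h))))
             (λ h → weaken {w = 1} (s≤s z≤n) (skip-run
                 (relabel {s₁} {s₁} ld (reading ld) (untouched (λ _ → refl)) refl refl refl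
                (trans (y-loaded ld) (label-false β h)))))
  tuple-run sc lab (suc zero) (w ∷ w₁ ∷ []) rest s _ deg rd = weaken weight
    (head-run sc lab w (encodeBits w₁ ++ rest) (w ∷ w₁ ∷ []) e₁ rest s (suc (4 * L₁ + (1 + 2)))
      (subst (Reading sc s) (trans (++-assoc (encodeBits w) _ rest)
          (cong (λ u → encodeBits w ++ (u ++ rest)) (++-identityʳ (encodeBits w₁)))) rd)
      branch)
    where
    L = length (encodeBits w)
    L₁ = length (encodeBits w₁)
    e₁ : Entry
    e₁ = toEntry sc lab (oracle i) (w ∷ w₁ ∷ [])
    weight : 4 * L + (2 + suc (4 * L₁ + 3)) ≤ 12 * length (encodeTuple (w ∷ w₁ ∷ []))
    weight = ≤-trans (≤-trans (linear (4 :* v₀ :+ (# 2 :+ (# 1 :+ (4 :* v₁ :+ # 3))))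
        (4 :* (v₀ :+ v₁) :+ 6 :* # 1) (L ∷ L₁ ∷ []))
        (≤-trans (+-monoʳ-≤ (4 * (L + L₁)) (*-monoʳ-≤ 6 (1≤length-encodeBits w)))
            (linear (4 :* (v₀ :+ v₁) :+ 6 :* v₀) (12 :* (v₀ :+ v₁)) (L ∷ L₁ ∷ []))))
      (≤-reflexive (cong (12 *_) (sym (trans (length-++ (encodeBits w))
          (cong (λ u → L + length u) (++-identityʳ (encodeBits w₁)))))))
    branch : ∀ s₁ → _ → _ → _ → Run _ s₁ (suc (4 * L₁ + 3)) (λ s₂ → Loaded sc s s₂ rest (w ∷ w₁ ∷ []) e₁)
    branch s₁ ld dg β = if-run (λ _ → seq-run (map-run (λ s₂ (ld₂ , a , fr) → seq-run (block-run _ (if-run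
        (λ h → ⊥-elim (h (cong (_∸ 1) (trans (same-memory fr DEG refl 0) (trans dg deg)))))
        (λ _ → skip-run (record
          { reading = reading-same refl refl refl refl (λ _ → refl) (reading ld₂)
          ; progress = record { ns≤ = ns≤ (progress ld₂) ; covers = covers (progress ld₂) }
          ; pool≋ = ≋-trans (pool≋ ld₂) (untouched (λ _ → refl))
          ; x-loaded = x-loaded ld₂ ; y-loaded = a ; z-loaded = z-loaded ld₂ })))))
        (second-run sc w₁ rest s s₁ (w ∷ []) _ ld)))
      (λ h → ⊥-elim (0≢1+n (trans (sym h) (trans dg deg))))
  tuple-run sc lab (suc (suc zero)) (w ∷ w₁ ∷ w₂ ∷ []) rest s _ deg rd = weaken weight
    (head-run sc lab w (encodeBits w₁ ++ (encodeBits w₂ ++ rest)) (w ∷ w₁ ∷ w₂ ∷ []) e₁ rest s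
        (suc (4 * L₁ + (1 + suc (4 * L₂ + 1))))
      (subst (Reading sc s) (trans (++-assoc (encodeBits w) _ rest)
          (cong (encodeBits w ++_) (trans (++-assoc (encodeBits w₁) _ rest)
        (cong (λ u → encodeBits w₁ ++ (u ++ rest)) (++-identityʳ (encodeBits w₂)))))) rd)
      branch)
    where
    L = length (encodeBits w)
    L₁ = length (encodeBits w₁)
    L₂ = length (encodeBits w₂)
    e₁ : Entry
    e₁ = toEntry sc lab (oracle i) (w ∷ w₁ ∷ w₂ ∷ [])
    weight : 4 * L + (2 + suc (4 * L₁ + (1 + suc (4 * L₂ + 1)))) ≤ 12 * length (encodeTuple (w ∷ w₁ ∷ w₂ ∷ []))
    weight = ≤-trans (≤-trans (linear (4 :* v₀ :+ (# 2 :+ (# 1 :+ (4 :* v₁ :+ (# 1 :+ (# 1 :+ (4 :* v₂ :+ # 1)))))))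
          (4 :* (v₀ :+ (v₁ :+ v₂)) :+ 6 :* # 1) (L ∷ L₁ ∷ L₂ ∷ []))
        (≤-trans (+-monoʳ-≤ (4 * (L + (L₁ + L₂))) (*-monoʳ-≤ 6 (1≤length-encodeBits w)))
          (linear (4 :* (v₀ :+ (v₁ :+ v₂)) :+ 6 :* v₀) (12 :* (v₀ :+ (v₁ :+ v₂))) (L ∷ L₁ ∷ L₂ ∷ []))))
      (≤-reflexive (cong (12 *_) (sym (trans (length-++ (encodeBits w))
          (cong (L +_) (trans (length-++ (encodeBits w₁))
         (cong (λ u → L₁ + length u) (++-identityʳ (encodeBits w₂)))))))))
    branch : ∀ s₁ → _ → _ → _ → Run _ s₁ (suc (4 * L₁ + (1 + suc (4 * L₂ + 1))))
        (λ s₂ → Loaded sc s s₂ rest (w ∷ w₁ ∷ w₂ ∷ []) e₁)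
    branch s₁ ld dg β = if-run (λ _ → seq-run (map-run (λ s₂ (ld₂ , a , fr) → seq-run (block-run _ (if-run
        (λ _ → seq-run (map-run (λ s₃ (ld₃ , a₃ , fr₃) → block-run _ (record
            { reading = reading-same refl refl refl refl (λ _ → refl) (reading ld₃)
            ; progress = record { ns≤ = ns≤ (progress ld₃) ; covers = covers (progress ld₃) }
            ; pool≋ = ≋-trans (pool≋ ld₃) (untouched (λ _ → refl))
            ; x-loaded = x-loaded ld₃ ; y-loaded = y-loaded ld₃ ; z-loaded = a₃ }))
          (second-run sc w₂ rest s _ (w ∷ w₁ ∷ []) (ent (sc * code w) (sc * code w₁) 0) (record
            { reading = reading-same refl refl refl refl (λ _ → refl) (reading ld₂)
            ; progress = record { ns≤ = ns≤ (progress ld₂) ; covers = covers (progress ld₂) }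
            ; pool≋ = ≋-trans (pool≋ ld₂) (untouched (λ _ → refl))
            ; x-loaded = x-loaded ld₂ ; y-loaded = a ; z-loaded = z-loaded ld₂ }))))
        (λ h → ⊥-elim (0≢1+n (trans (sym h) (cong (_∸ 1) (trans (same-memory fr DEG refl 0) (trans dg deg)))))))))
        (second-run sc w₁ (encodeBits w₂ ++ rest) s s₁ (w ∷ []) _ ld)))
      (λ h → ⊥-elim (0≢1+n (trans (sym h) (trans dg deg))))
  tuple-run sc lab (suc (suc (suc κ))) v rest s (s≤s (s≤s ())) deg rd

  starts-below-3 : ∀ w rest s sc → Reading sc s (encodeBits w ++ rest) → 3 ∸ memory s OUT (memory s POS 0) ≢ 0
  starts-below-3 []          rest s sc rd with symbols rd
  ... | e ∷ _ = λ z → 1+n≢0 (trans (sym (cong (3 ∸_) e)) z)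
  starts-below-3 (false ∷ w) rest s sc rd with symbols rd
  ... | e ∷ _ = λ z → 1+n≢0 (trans (sym (cong (3 ∸_) e)) z)
  starts-below-3 (true ∷ w)  rest s sc rd with symbols rd
  ... | e ∷ _ = λ z → 1+n≢0 (trans (sym (cong (3 ∸_) e)) z)

  at-3 : ∀ {sc s rest} → Reading sc s (3 ∷ rest) → 3 ∸ memory s OUT (memory s POS 0) ≡ 0
  at-3 rd with symbols rd
  ... | e ∷ _ = cong (3 ∸_) e

  strings : ∀ {k} → List (Vec Bits k) → List Bits
  strings = concatMap Vec.toList

  encodeTuples-∷ : ∀ {k} (v : Vec Bits k) vs rest →
    encodeTuples (v ∷ vs) ++ rest ≡ encodeTuple v ++ (encodeTuples vs ++ rest)
  encodeTuples-∷ v vs rest = trans (cong (_++ rest) (++-assoc (encodeTuple v) _ (3 ∷ [])))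
      (++-assoc (encodeTuple v) _ rest)

  TuplesRead : ℕ → State → List ℕ → List Bits → List Entry → State → Set
  TuplesRead sc s rest ws es s′ =
    Reading sc s′ rest × Progress sc (memory s) (memory s′) ws × Appends (memory s) (memory s′) (map full es)

  1≤length-encodeTuple : ∀ {κ} (v : Vec Bits (suc κ)) → 1 ≤ length (encodeTuple v)
  1≤length-encodeTuple (w ∷ v) = ≤-trans (1≤length-encodeBits w)
    (≤-trans (m≤m+n _ _) (≤-reflexive (sym (length-++ (encodeBits w)))))

  tuples-run : ∀ sc lab κ (vs : List (Vec Bits (suc κ))) rest s → κ ≤ 2 → memory s DEG 0 ≡ κ →
    Reading sc s (encodeTuples vs ++ rest) →
    Run (read-tuples i lab) s (13 * length (encodeTuples vs))
      (TuplesRead sc s (3 ∷ rest) (strings vs) (map (toEntry sc lab (oracle i)) vs))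
  tuples-run sc lab κ [] rest s _ deg rd = weaken {w = 1} (s≤s z≤n) (while-exit (at-3 rd)
    (rd , progress-refl refl , ≋⇒Appends (λ _ _ _ → refl)))
  tuples-run sc lab κ (v@(w ∷ v′) ∷ vs) rest s κ≤2 deg rd = weaken weight
    (while-step (starts-below-3 w _ s sc
        (subst (Reading sc s) (trans (encodeTuples-∷ v vs rest) (++-assoc (encodeBits w) _ _)) rd))
      (map-run (λ s₁ ((rd₁ , pr , ap) , fr) → map-run
          (λ s₂ (rd₂ , pr₂ , ap₂) → rd₂ , progress-trans pr pr₂ , Appends-trans ap ap₂)
          (tuples-run sc lab κ vs rest s₁ κ≤2 (trans (same-memory fr DEG refl 0) deg) rd₁))
        (framed (tuple-run sc lab κ v (encodeTuples vs ++ rest) s κ≤2 deg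
            (subst (Reading sc s) (encodeTuples-∷ v vs rest) rd)))))
    where
    weight : suc (12 * length (encodeTuple v) + 13 * length (encodeTuples vs)) ≤ 13 * length (encodeTuples (v ∷ vs))
    weight = ≤-trans (+-monoˡ-≤ (12 * length (encodeTuple v) + 13 * length (encodeTuples vs))
        (1≤length-encodeTuple v))
      (≤-trans (linear (v₀ :+ (12 :* v₀ :+ 13 :* v₁)) (13 :* (v₀ :+ v₁))
          (length (encodeTuple v) ∷ length (encodeTuples vs) ∷ []))
        (≤-reflexive (cong (13 *_) (sym (trans (cong length (++-assoc (encodeTuple v) _ (3 ∷ [])))
            (length-++ (encodeTuple v)))))))

  -- A node reduced to its degree and its tuples. The parser follows the list of nodes in postorder
  -- and does not need the tree.
  Item : Set
  Item = ∃[ κ ] List (Vec Bits (suc κ))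

  item-symbols : Item → List ℕ
  item-symbols (κ , vs) = encodeTuples vs

  item-entries : ℕ → ℕ → Item → List Entry
  item-entries sc lab (κ , vs) = map (toEntry sc lab (oracle i)) vs

  item-strings : Item → List Bits
  item-strings (κ , vs) = strings vs

  -- RP points to the entries of the last node, if there is one.
  LastStored : Memory → Memory → List (List Entry) → Set
  LastStored m m′ []            = m′ RP 0 ≡ m RP 0
  LastStored m m′ (l ∷ [])      = Seg m′ (m′ RP 0) (slots l)
  LastStored m m′ (l ∷ l′ ∷ ls) = LastStored m m′ (l′ ∷ ls)

  nodes-run : ∀ sc lab (its : List Item) rest s → All (λ it → proj₁ it ≤ 2) its →
    Reading sc s (concatMap item-symbols its ++ rest) → Numbers (memory s) KIND (memory s IX 0) (map proj₁ its) →
    memory s CNT 0 ≡ length its →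
    Run (read-nodes i lab) s (1 + 17 * length (concatMap item-symbols its)) λ s′ →
      Reading sc s′ rest × Progress sc (memory s) (memory s′) (concatMap item-strings its) ×
      Appends (memory s) (memory s′) (flat (map (item-entries sc lab) its)) ×
      LastStored (memory s) (memory s′) (map (item-entries sc lab) its)
  nodes-run sc lab [] rest s _ rd ks cnt = while-exit cnt
      (rd , progress-refl refl , ≋⇒Appends (λ _ _ _ → refl) , refl)
  nodes-run sc lab ((κ , vs) ∷ its) rest s (κ≤2 ∷ all≤) rd (k ∷ ks) cnt = weaken weight
    (while-step (λ z → 1+n≢0 (trans (sym cnt) z)) (seq-run (block-run _ (seq-run (map-run next (framed
      (tuples-run sc lab κ vs (concatMap item-symbols its ++ rest) _ κ≤2 k (record
        { scale = scale rd ; ns≥ = ns≥ rd ; quiet = quiet rd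
        ; symbols = Numbers-≗ (λ _ → refl) (subst (Numbers _ _ _) (++-assoc (encodeTuples vs) _ rest)
            (symbols rd)) })))))))
    )
    where
    es : List Entry
    es = map (toEntry sc lab (oracle i)) vs
    m₁ : Memory
    m₁ = run-block xs (memory s) (RP ≔ var TOP ∷ DEG ≔ cell KIND (var IX) ∷ [])
    start : memory s ≋ m₁
    start = untouched (λ _ → refl)
    S₁ = length (encodeTuples vs)
    S₂ = length (concatMap item-symbols its)
    weight : suc ((1 + (13 * S₁ + 1)) + (1 + 17 * S₂)) ≤ 1 + 17 * length
        (encodeTuples vs ++ concatMap item-symbols its)
    weight = ≤-trans (linear (# 1 :+ ((# 1 :+ (13 :* v₀ :+ # 1)) :+ (# 1 :+ 17 :* v₁)))
        (# 1 :+ 3 :* # 1 :+ 13 :* v₀ :+ 17 :* v₁) (S₁ ∷ S₂ ∷ []))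
      (≤-trans (+-monoˡ-≤ (17 * S₂) (+-monoˡ-≤ (13 * S₁) (+-monoʳ-≤ 1 (*-monoʳ-≤ 3 1≤S₁))))
        (≤-trans (linear (# 1 :+ 3 :* v₀ :+ 13 :* v₀ :+ 17 :* v₁) (# 1 :+ 17 :* (v₀ :+ v₁)) (S₁ ∷ S₂ ∷ []))
          (≤-reflexive (cong (λ u → 1 + 17 * u) (sym (length-++ (encodeTuples vs)))))))
      where
      1≤S₁ : 1 ≤ S₁
      1≤S₁ = ≤-trans (m≤n+m 1 _) (≤-reflexive
          (sym (length-++ (concatMap (λ w → concatMap encodeBits (Vec.toList w)) vs))))
    next : ∀ s₂ → TuplesRead sc ⟨ m₁ , query s , output s ⟩ (3 ∷ (concatMap item-symbols its ++ rest))
        (strings vs) es s₂ × Frame (read-tuples i lab) ⟨ m₁ , query s , output s ⟩ s₂ → Run _ s₂ 1 _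
    next s₂ ((rd₂ , pr₂ , ap₂) , fr) = block-run _ (map-run (λ s₄ (rd₄ , pr₄ , ap₄ , last) →
        rd₄ , progress-trans pr₃ pr₄ , Appends-trans ap₃ ap₄ , stored its s₄ (extends ap₄) last)
      (nodes-run sc lab its rest _ all≤ rd₃
         (Numbers-at (cong suc (sym (same-memory fr IX refl 0))) (Numbers-≗ (same-memory fr KIND refl) ks))
         (trans (cong (_∸ 1) (same-memory fr CNT refl 0)) (cong (_∸ 1) cnt))))
      where
      m₃ : Memory
      m₃ = run-block xs (memory s₂) (push-end ++ increment POS ∷ increment IX ∷ decrement CNT ∷ [])
      tail : Numbers (memory s₂) OUT (memory s₂ POS 0) (3 ∷ (concatMap item-symbols its ++ rest)) →
        Numbers m₃ OUT (suc (memory s₂ POS 0)) (concatMap item-symbols its ++ rest)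
      tail (_ ∷ t) = Numbers-≗ (λ _ → refl) t
      rd₃ : Reading sc ⟨ m₃ , query s₂ , output s₂ ⟩ (concatMap item-symbols its ++ rest)
      rd₃ = record { scale = scale rd₂ ; ns≥ = ns≥ rd₂ ; quiet = quiet rd₂ ; symbols = tail (symbols rd₂) }
      pr₃ : Progress sc (memory s) m₃ (strings vs)
      pr₃ = record { ns≤ = ns≤ pr₂ ; covers = covers pr₂ }
      ap₃ : Appends (memory s) m₃ (slots es)
      ap₃ = Appends-trans (Appends-after start ap₂)
          (Appends-end (λ _ → refl) (λ _ → refl) (λ _ → refl) (λ _ → refl) refl)
      rp₃ : m₃ RP 0 ≡ memory s TOP 0
      rp₃ = same-memory fr RP refl 0
      stored : ∀ its s₄ → m₃ ⊑ memory s₄ → LastStored m₃ (memory s₄) (map (item-entries sc lab) its) →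
        LastStored (memory s) (memory s₄) (es ∷ map (item-entries sc lab) its)
      stored []          s₄ ex e = Seg-at (trans (sym rp₃) (sym e)) (Seg-⊑ ex (segment ap₃))
      stored (it ∷ [])   s₄ ex h = h
      stored (it ∷ it′ ∷ its) s₄ ex h = last-start (map (item-entries sc lab) its) h
        where
        last-start : ∀ {m m′ m″ l} ls → LastStored m m″ (l ∷ ls) → LastStored m′ m″ (l ∷ ls)
        last-start []       h = h
        last-start (l′ ∷ ls) h = last-start ls h

  accept-run : ∀ sc (ws : List Bits) rest s → Reading sc s (concatMap encodeBits ws ++ 3 ∷ rest) →
    Run (read-accept i) s (1 + 7 * length (concatMap encodeBits ws)) λ s′ →
      Progress sc (memory s) (memory s′) ws ×
      (∀ k → Iff (memory s′ ACC k ≢ 0) (memory s ACC k ≢ 0 ⊎ ∃[ w ] w ∈ ws × sc * code w ≡ k)) × query s′ ≡ []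
  accept-run sc [] rest s rd = while-exit (at-3 rd)
    (progress-refl refl , (λ k → inj₁ , λ { (inj₁ h) → h ; (inj₂ (_ , () , _)) }) , quiet rd)
  accept-run sc (w ∷ ws) rest s rd = weaken weight
    (while-step (starts-below-3 w _ s sc rd′) (seq-run (map-run (λ s₁ (rd₁ , pr₁ , a , _ , fr) → block-run _ (map-run
        (λ s₂ (pr₂ , acc₂ , qu) →
           progress-trans (record { ns≤ = ns≤ pr₁ ; covers = covers pr₁ }) pr₂ ,
           combine s₁ (memory s₂) fr a acc₂ , qu)
        (accept-run sc ws rest _ (reading-same refl refl refl refl (λ _ → refl) rd₁))))
      (string-run sc w _ s rd′))))
    where
    rd′ : Reading sc s (encodeBits w ++ (concatMap encodeBits ws ++ 3 ∷ rest))
    rd′ = subst (Reading sc s) (++-assoc (encodeBits w) _ (3 ∷ rest)) rd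
    weight : suc ((4 * length (encodeBits w) + 1) + (1 + 7 * length (concatMap encodeBits ws))) ≤ 1 + 7 *
        length (encodeBits w ++ concatMap encodeBits ws)
    weight = ≤-trans (linear (# 1 :+ ((4 :* v₀ :+ # 1) :+ (# 1 :+ 7 :* v₁)))
        (# 1 :+ 2 :* # 1 :+ (4 :* v₀ :+ 7 :* v₁)) (length (encodeBits w) ∷ length (concatMap encodeBits ws) ∷ []))
      (≤-trans (+-monoˡ-≤ (4 * length (encodeBits w) + 7 * length (concatMap encodeBits ws))
          (+-monoʳ-≤ 1 (*-monoʳ-≤ 2 (1≤length-encodeBits w))))
        (≤-trans (linear (# 1 :+ 2 :* v₀ :+ (4 :* v₀ :+ 7 :* v₁)) (# 1 :+ 7 :* (v₀ :+ v₁))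
            (length (encodeBits w) ∷ length (concatMap encodeBits ws) ∷ []))
          (≤-reflexive (cong (λ u → 1 + 7 * u) (sym (length-++ (encodeBits w)))))))
    combine : ∀ s₁ m₂ → Frame (read-string i) s s₁ → memory s₁ A 0 ≡ sc * code w →
      (∀ k → Iff (m₂ ACC k ≢ 0) ((if memory s₁ A 0 ≡ᵇ k then 1 else memory s₁ ACC k) ≢ 0 ⊎ ∃[ w ] w ∈ ws × sc
          * code w ≡ k)) →
      ∀ k → Iff (m₂ ACC k ≢ 0) (memory s ACC k ≢ 0 ⊎ ∃[ w′ ] w′ ∈ w ∷ ws × sc * code w′ ≡ k)
    combine s₁ m₂ fr a h k with memory s₁ A 0 ≟ k
    ... | yes refl = (λ _ → inj₂ (w , here refl , sym a)) ,
          (λ _ → proj₂ (h k) (inj₁ λ z → 1+n≢0 (trans (sym (if-≡ k)) z)))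
    ... | no ne = to , from
      where
      to : m₂ ACC k ≢ 0 → _
      to nz with proj₁ (h k) nz
      ... | inj₁ h₁ = inj₁ λ z → h₁ (trans (if-≢ ne) (trans (same-memory fr ACC refl k) z))
      ... | inj₂ (w′ , w′∈ , e) = inj₂ (w′ , there w′∈ , e)
      from : memory s ACC k ≢ 0 ⊎ ∃[ w′ ] w′ ∈ w ∷ ws × sc * code w′ ≡ k → m₂ ACC k ≢ 0
      from (inj₁ h₁) = proj₂ (h k) (inj₁ λ z → h₁ (trans (sym (trans (if-≢ ne) (same-memory fr ACC refl k))) z))
      from (inj₂ (w′ , here refl , e)) = ⊥-elim (ne (trans a e))
      from (inj₂ (w′ , there w′∈ , e)) = proj₂ (h k) (inj₂ (w′ , w′∈ , e))

  -- `ACC` is trusted from `sc` on only; below it contains marks of earlier cores. All states of the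
  -- present core lie above, because codes are positive.
  filter-run : ∀ sc p l s rest → (∀ k → sc ≤ k → Iff (memory s ACC k ≢ 0) (p k ≡ true)) → (∀ e → e ∈ l → sc ≤ x e) →
    Seg (memory s) (memory s PA 0) (map full l ++ end ∷ rest) →
    Run (filter-root i) s (1 + length l * 4) λ s′ → Appends (memory s) (memory s′) (map full (root-entries p l))
  filter-run sc p [] s rest acc big ((_ , F≡0) ∷ _) = while-exit F≡0 (≋⇒Appends (λ _ _ _ → refl))
  filter-run sc p (e ∷ l) s rest acc big ((_ , fe , xe , _) ∷ sg) =
    while-step (≡1⇒≢0 fe) (seq-run {w = 2} (if-run
      (λ h → block-run _ (finish _ (pushed (subst (λ u → p u ≡ true) xe (proj₁ (acc _ big-x) h))) (λ _ → refl) refl))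
      (λ h → skip-run (finish s (skipped (λ t → proj₂ (acc _ big-x) (subst (λ u → p u ≡ true) (sym xe) t) h))
          (λ _ → refl) refl))))
    where
    big-x : sc ≤ memory s X (memory s PA 0)
    big-x = subst (sc ≤_) (sym xe) (big e (here refl))
    head-entries : List Entry
    head-entries = if p (x e) then ent 0 (x e) 0 ∷ [] else []
    skipped : ¬ (p (x e) ≡ true) → Appends (memory s) (memory s) (map full head-entries)
    skipped ne with p (x e)
    ... | true  = ⊥-elim (ne refl)
    ... | false = ≋⇒Appends (λ _ _ _ → refl)
    pushed : p (x e) ≡ true → Appends (memory s)
      (run-block xs (memory s) (Y0 ≔ cell X (var PA) ∷ push (const 0) (var Y0) (const 0))) (map full head-entries)
    pushed pe rewrite pe = Appends-push (λ _ → refl) (λ _ → refl) refl (λ _ → refl) xe (λ _ → refl) refl refl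
    split : ∀ m′ → Appends (memory s) m′ (map full head-entries ++ map full (root-entries p l)) →
      Appends (memory s) m′ (map full (root-entries p (e ∷ l)))
    split m′ ap with p (x e)
    ... | true  = ap
    ... | false = ap
    finish : ∀ s₁ → Appends (memory s) (memory s₁) (map full head-entries) →
        (∀ k → memory s₁ ACC k ≡ memory s ACC k) →
      memory s₁ PA 0 ≡ memory s PA 0 → Run (block (increment PA ∷ [])) s₁ 1 λ s₂ → Run (filter-root i) s₂
          (1 + length l * 4)
        λ s′ → Appends (memory s) (memory s′) (map full (root-entries p (e ∷ l)))
    finish s₁ ap ac pa = block-run _ (map-run
      (λ s′ ap′ → split (memory s′) (Appends-trans (Appends-before ap (untouched (λ _ → refl))) ap′))
      (filter-run sc p l _ rest
        (λ k le → (λ h → proj₁ (acc k le) λ z → h (trans (ac k) z)) ,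
            (λ t z → proj₂ (acc k le) t (trans (sym (ac k)) z)))
        (λ e′ e′∈ → big e′ (there e′∈))
        (Seg-at (cong suc (sym pa)) (Seg-≋ (untouched (λ _ → refl)) (Seg-⊑ (extends ap) sg)))))

  LastStored-last : ∀ {m m′} ls l → LastStored m m′ (ls ++ l ∷ []) → Seg m′ (m′ RP 0) (slots l)
  LastStored-last []            l h = h
  LastStored-last (l₁ ∷ [])     l h = h
  LastStored-last (l₁ ∷ l₂ ∷ ls) l h = LastStored-last (l₂ ∷ ls) l h

  item-length : ∀ sc lab it → length (item-entries sc lab it) ≤ length (item-symbols it)
  item-length sc lab (κ , vs) = ≤-trans (≤-reflexive (length-map _ vs)) (count vs)
    where
    count : ∀ {κ} (vs : List (Vec Bits (suc κ))) → length vs ≤ length (encodeTuples vs)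
    count []       = z≤n
    count (v ∷ vs) = ≤-trans (+-mono-≤ (1≤length-encodeTuple v) (count vs))
      (≤-reflexive (sym (trans (cong length (++-assoc (encodeTuple v) _ (3 ∷ []))) (length-++ (encodeTuple v)))))

  -- `ACC` is shared by all cores and never cleared. A core marks only numbers that stay below its
  -- new scale, and the next core looks only at numbers from that scale on; the hypothesis and the
  -- conclusion about `ACC` hand this on. `N` counts the additional root, which has no tuples in the
  -- output and is built by filtering.
  parse-run : ∀ sc lab p its it ws s →
    let all-items = its ++ it ∷ []
        symbols = concatMap item-symbols all-items ++ (concatMap encodeBits ws ++ 3 ∷ []) in
    All (λ it → proj₁ it ≤ 2) all-items →
    query s ≡ [] → memory s SC 0 ≡ sc → Numbers (memory s) OUT 0 symbols →
    Numbers (memory s) KIND 0 (map proj₁ all-items) → memory s N 0 ≡ suc (length all-items) →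
    (∀ k → sc ≤ k → memory s ACC k ≡ 0) →
    (∀ k → Iff (p k ≡ true) (∃[ w ] w ∈ ws × sc * code w ≡ k)) → 0 < sc →
    Run (parse i lab) s (30 * length symbols) λ s′ →
      query s′ ≡ [] × sc ≤ memory s′ SC 0 ×
      (∀ w → w ∈ concatMap item-strings all-items ++ ws → sc * code w + sc ≤ memory s′ SC 0) ×
      (∀ k → memory s′ SC 0 ≤ k → memory s′ ACC k ≡ 0) ×
      Appends (memory s) (memory s′)
        (flat (map (item-entries sc lab) all-items ++ root-entries p (item-entries sc lab it) ∷ []))
  parse-run sc lab p its it ws s all≤ qu scl out kinds n acc spec 0<sc = weaken weight
    (seq-run (block-run _ (seq-run (map-run after-nodes (framed (nodes-run sc lab all-items _ _ all≤
      (record { scale = scl ; ns≥ = ≤-reflexive (sym scl) ; quiet = qu ; symbols = Numbers-≗ (λ _ → refl) out })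
      (Numbers-≗ (λ _ → refl) kinds) (cong (_∸ 1) n)))))))
    where
    all-items = its ++ it ∷ []
    es : List Entry
    es = item-entries sc lab it
    m m₁ : Memory
    m = memory s
    m₁ = run-block xs m (POS ≔ const 0 ∷ NS ≔ var SC ∷ IX ≔ const 0 ∷ CNT ≔ var N ⊟ const 1 ∷ [])
    s₁ : State
    s₁ = ⟨ m₁ , query s , output s ⟩
    S₁ = length (concatMap item-symbols all-items)
    S₂ = length (concatMap encodeBits ws)
    es≤S₁ : length es ≤ S₁
    es≤S₁ = ≤-trans (item-length sc lab it)
        (≤-trans (≤-trans (≤-reflexive (cong length (sym (++-identityʳ (item-symbols it)))))
        (m≤n+m _ (length (concatMap item-symbols its))))
      (≤-reflexive (sym (trans (cong length (concatMap-++ item-symbols its (it ∷ [])))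
          (length-++ (concatMap item-symbols its))))))
    weight : 1 + ((1 + 17 * S₁) + ((1 + 7 * S₂) + (1 + ((1 + length es * 4) + 1)))) ≤ 30 * length
        (concatMap item-symbols all-items ++ (concatMap encodeBits ws ++ 3 ∷ []))
    weight = ≤-trans (+-monoʳ-≤ (1 + (1 + 17 * S₁))
        (+-monoʳ-≤ (1 + 7 * S₂) (+-monoʳ-≤ 1
        (+-monoˡ-≤ 1 (+-monoʳ-≤ 1 (≤-trans (*-monoˡ-≤ 4 es≤S₁) (≤-reflexive (*-comm S₁ 4))))))))
      (≤-trans (linear (# 1 :+ (# 1 :+ 17 :* v₀) :+ ((# 1 :+ 7 :* v₁) :+ (# 1 :+ ((# 1 :+ 4 :* v₀) :+ # 1))))
          (30 :* (v₀ :+ (v₁ :+ # 1))) (S₁ ∷ S₂ ∷ []))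
        (≤-reflexive (cong (30 *_) (sym (trans (length-++ (concatMap item-symbols all-items))
            (cong (S₁ +_) (length-++ (concatMap encodeBits ws))))))))
    Goal : State → Set
    Goal s′ =
      query s′ ≡ [] × sc ≤ memory s′ SC 0 ×
      (∀ w → w ∈ concatMap item-strings all-items ++ ws → sc * code w + sc ≤ memory s′ SC 0) ×
      (∀ k → memory s′ SC 0 ≤ k → memory s′ ACC k ≡ 0) ×
      Appends m (memory s′) (flat (map (item-entries sc lab) all-items ++ root-entries p es ∷ []))
    after-nodes : ∀ s₂ → _ × Frame (read-nodes i lab) s₁ s₂ → Run _ s₂ _ Goal
    after-nodes s₂ ((rd₂ , pr₂ , ap₂ , last) , fr₂) = seq-run
        (map-run after-accept (framed (accept-run sc ws [] s₂ rd₂)))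
      where
      stored : Seg (memory s₂) (memory s₂ RP 0) (slots es)
      stored = LastStored-last (map (item-entries sc lab) its) es
          (subst (LastStored _ _) (map-++ (item-entries sc lab) its (it ∷ [])) last)
      after-accept : ∀ s₃ → _ × Frame (read-accept i) s₂ s₃ → Run _ s₃ _ Goal
      after-accept s₃ ((pr₃ , acc₃ , qu₃) , fr₃) = seq-run (block-run _ (seq-run (map-run after-filter (framed
          (filter-run sc p es ⟨ m₃ , query s₃ , output s₃ ⟩ [] accepted (λ e e∈ → big it e e∈)
            (Seg-at (sym (same-memory fr₃ RP refl 0)) (Seg-≋ moved stored)))))))
        where
        m₃ : Memory
        m₃ = run-block xs (memory s₃) (PA ≔ var RP ∷ [])
        moved : memory s₂ ≋ m₃
        moved = ≋-trans (frame-≋ fr₃ refl) (untouched (λ _ → refl))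
        old-acc : ∀ k → sc ≤ k → memory s₂ ACC k ≡ 0
        old-acc k le = trans (same-memory fr₂ ACC refl k) (acc k le)
        accepted : ∀ k → sc ≤ k → Iff (memory s₃ ACC k ≢ 0) (p k ≡ true)
        accepted k le = (λ h → to (proj₁ (acc₃ k) h)) , λ t → proj₂ (acc₃ k) (inj₂ (proj₁ (spec k) t))
          where
          to : memory s₂ ACC k ≢ 0 ⊎ _ → p k ≡ true
          to (inj₁ h) = ⊥-elim (h (old-acc k le))
          to (inj₂ h) = proj₂ (spec k) h
        big : ∀ it e → e ∈ item-entries sc lab it → sc ≤ x e
        big (κ , v ∷ vs) e (here refl) = toEntry-x sc lab (oracle i) v
        big (κ , v ∷ vs) e (there e∈)  = big (κ , vs) e e∈
        pr : Progress sc m₁ (memory s₃) (concatMap item-strings all-items ++ ws)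
        pr = progress-trans pr₂ pr₃
        after-filter : ∀ s₄ → _ × Frame (filter-root i) ⟨ m₃ , query s₃ , output s₃ ⟩ s₄ → Run _ s₄ 1 Goal
        after-filter s₄ (ap₄ , fr₄) = block-run _
          ( trans (same-query fr₄ refl) qu₃
          , ≤-trans (≤-reflexive (sym scl)) (≤-trans (ns≤ pr) (≤-reflexive (sym ns₄)))
          , (λ w w∈ → ≤-trans (covers pr w w∈) (≤-reflexive (sym ns₄)))
          , (λ k le → trans (same-memory fr₄ ACC refl k) (cleared k (≤-trans (≤-reflexive (sym ns₄)) le)))
          , subst (Appends m _) (trans (cong (flat (map (item-entries sc lab) all-items) ++_) (sym (++-identityʳ _)))
              (sym (concatMap-++ slots (map (item-entries sc lab) all-items) _)))
              (Appends-trans (Appends-before (Appends-after (untouched (λ _ → refl)) ap₂) moved)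
                (Appends-trans ap₄ (Appends-end (λ _ → refl) (λ _ → refl) (λ _ → refl) (λ _ → refl) refl))))
          where
          ns₄ : memory s₄ NS 0 ≡ memory s₃ NS 0
          ns₄ = same-memory fr₄ NS refl 0
          cleared : ∀ k → memory s₃ NS 0 ≤ k → memory s₃ ACC k ≡ 0
          cleared k le with memory s₃ ACC k ≟ 0
          ... | yes z = z
          ... | no nz with proj₁ (acc₃ k) nz
          ...   | inj₁ h = ⊥-elim (h (old-acc k (≤-trans (≤-trans (≤-reflexive (sym scl)) (ns≤ pr)) le)))
          ...   | inj₂ (w , w∈ , refl) = ⊥-elim (<⇒≱ (m<m+n (sc * code w) 0<sc) (≤-trans (covers pr₃ w w∈) le))

-- Node degrees and leaf labels

-- Relates the degrees of the nodes in postorder to their input symbols without reference to the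
-- tree, in the form on which the reading loop recurses.
data Coded : List ℕ → List ℕ → Set where
  []        : Coded [] []
  leaf      : ∀ {ks ys} v a → Coded ks ys → Coded (0 ∷ ks) (0 ∷ v ∷ a ∷ ys)
  join      : ∀ {ks ys} → Coded ks ys → Coded (2 ∷ ks) (1 ∷ ys)
  recolour  : ∀ {ks ys} a b → Coded ks ys → Coded (1 ∷ ks) (2 ∷ a ∷ b ∷ ys)
  add-edges : ∀ {ks ys} a b → Coded ks ys → Coded (1 ∷ ks) (3 ∷ a ∷ b ∷ ys)

coded-nodes : ∀ {ω} (D : Decomp ω) {ks ys} → Coded ks ys → Coded (map δ (nodes D) ++ ks) (encodeNodes D ++ ys)
coded-nodes (intro v a) h = leaf v (toℕ a) h
coded-nodes (t₁ ⊕ t₂) {ks} {ys} h = subst₂ Coded (sym (map-nodes-⊕ t₁ t₂ δ ks))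
  (sym (trans (++-assoc (encodeNodes t₁) _ ys) (cong (encodeNodes t₁ ++_) (++-assoc (encodeNodes t₂) _ ys))))
  (coded-nodes t₁ (coded-nodes t₂ (join h)))
coded-nodes (recolor t a b) {ks} {ys} h = subst₂ Coded (sym (map-nodes-un inRecolor δ root ks))
  (sym (++-assoc (encodeNodes t) _ ys)) (coded-nodes t (recolour (toℕ a) (toℕ b) h))
coded-nodes (addEdges t a b) {ks} {ys} h = subst₂ Coded (sym (map-nodes-un inAddEdges δ root ks))
  (sym (++-assoc (encodeNodes t) _ ys)) (coded-nodes t (add-edges (toℕ a) (toℕ b) h))

Input : List ℕ → ℕ → List ℕ → Set
Input xs p ys = Numbers (λ _ → nth xs) 0 p ys

nth-++ : ∀ ws {ys} k → nth (ws ++ ys) (length ws + k) ≡ nth ys k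
nth-++ []       k = refl
nth-++ (w ∷ ws) k = nth-++ ws k

input-suffix : ∀ ws ys → Input (ws ++ ys) (length ws) ys
input-suffix ws []       = []
input-suffix ws (y ∷ ys) =
  trans (cong (nth (ws ++ y ∷ ys)) (sym (+-identityʳ (length ws)))) (nth-++ ws 0) ∷
  subst₂ (λ u v → Input u v ys) (++-assoc ws (y ∷ []) ys) (trans (length-++ ws) (+-comm (length ws) 1))
    (input-suffix (ws ++ y ∷ []) ys)

col-entries : (vx vy vb sc n : ℕ) → List Entry
col-entries vx vy vb sc zero    = []
col-entries vx vy vb sc (suc n) = ent (vx + vb) vy vb ∷ col-entries vx vy (vb + sc) sc n

grid : (vx vy ly sc c n : ℕ) → List Entry
grid vx vy ly sc c zero    = []
grid vx vy ly sc c (suc n) = col-entries vx vy 0 sc c ++ grid (vx + sc) (vy + ly) ly sc c n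

-- With zero offsets a grid consists of the entries (i + j) · sc, i · ly, j · sc and is generated by
-- additions alone. A leaf is the case of one column, two rows and `ly` equal to the label bit: not
-- selected with count 0, or selected with count 1. A single column gives the identity at a unary
-- node, and the full square the addition at a join.
counter-entries : (d sc lab degree : ℕ) → List Entry
counter-entries d sc lab 0             = grid 0 0 lab sc 1 2
counter-entries d sc lab 1             = grid 0 0 sc sc 1 (suc d)
counter-entries d sc lab (suc (suc _)) = grid 0 0 sc sc (suc d) (suc d)

module _ {q : ℕ} where
  read-kind read-kinds kinds-init : Prog q
  read-kind =
    (ifnz inp (var POS)
     then (ifnz inp (var POS) ⊟ const 1
           then block (KIND [ var IX ]≔ const 1 ∷ POS ≔ const 3 ⊞ var POS ∷ [])
           else block (KIND [ var IX ]≔ const 2 ∷ POS ≔ const 1 ⊞ var POS ∷ []))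
     else block (KIND [ var IX ]≔ const 0 ∷ POS ≔ const 3 ⊞ var POS ∷ []))
    ⨾ block (increment IX ∷ decrement CNT ∷ [])
  read-kinds = whilenz var CNT loop read-kind
  kinds-init =
    -- The input starts with `d`, the width and the number of nodes. The additional root is not
    -- encoded there and is appended as one more node of degree 1.
    block (POS ≔ const 3 ∷ IX ≔ const 0 ∷ CNT ≔ inp (const 2) ∷ []) ⨾
    (read-kinds ⨾ block (KIND [ var IX ]≔ const 1 ∷ N ≔ const 1 ⊞ inp (const 2) ∷ []))

  mark-labels : List ℕ → Prog q
  mark-labels []       = skip
  mark-labels (c ∷ cs) = block (TAB [ const c ]≔ const 1 ∷ []) ⨾ mark-labels cs

  cols rows multiply : Prog q
  cols = whilenz var COL loop
    block (push (var VX ⊞ var VB) (var VY) (var VB) ++ VB ≔ var VB ⊞ var SC ∷ decrement COL ∷ [])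
  rows = whilenz var ROW loop (block (COL ≔ var COLS ∷ VB ≔ const 0 ∷ []) ⨾
    (cols ⨾ block (VX ≔ var VX ⊞ var SC ∷ VY ≔ var VY ⊞ var LY ∷ decrement ROW ∷ [])))
  multiply = whilenz var CNT loop block (DS ≔ var DS ⊞ var SC ∷ decrement CNT ∷ [])

  module _ (lab : ℕ) where
    choose-grid count-node count-nodes counter : Prog q
    choose-grid =
      ifnz cell KIND (var IX)
      then (ifnz cell KIND (var IX) ⊟ const 1
            then block (ROW ≔ const 1 ⊞ inp (const 0) ∷ LY ≔ var SC ∷ COLS ≔ const 1 ⊞ inp (const 0) ∷ VX ≔
                const 0 ∷ VY ≔ const 0 ∷ [])
            else block (ROW ≔ const 1 ⊞ inp (const 0) ∷ LY ≔ var SC ∷ COLS ≔ const 1 ∷ VX ≔ const 0 ∷ VY ≔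
                const 0 ∷ []))
      else block (ROW ≔ const 2 ∷ LY ≔ const lab ∷ COLS ≔ const 1 ∷ VX ≔ const 0 ∷ VY ≔ const 0 ∷ [])
    count-node = choose-grid ⨾ (rows ⨾ block (push-end ++ increment IX ∷ decrement CNT ∷ []))
    count-nodes = whilenz var CNT loop count-node
    counter =
      block (DS ≔ const 0 ∷ CNT ≔ inp (const 0) ∷ []) ⨾ (multiply ⨾
      (block (IX ≔ const 0 ∷ CNT ≔ var N ⊟ const 1 ∷ []) ⨾ (count-nodes ⨾
       -- The additional root asks for the count `d`. Joins produce counts up to 2d, for which the
       -- new scale leaves room.
       (block (push (const 0) (var DS) (const 0)) ⨾ block (push-end ++ SC ≔ (var DS ⊞ var DS) ⊞ var SC ∷ [])))))

module CounterRuns {q : ℕ} (oracle : Fin q → Bits → Bool) (xs : List ℕ) where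
  open Logic oracle xs
  open CrossRuns oracle xs

  read-kinds-run : ∀ ks ys s → Coded ks ys → Input xs (memory s POS 0) ys → memory s CNT 0 ≡ length ks →
    Run read-kinds s (1 + length ks * 5) λ s′ →
      Numbers (memory s′) KIND (memory s IX 0) ks × (∀ k → k < memory s IX 0 → memory s′ KIND k ≡ memory s KIND k) ×
      memory s′ IX 0 ≡ length ks + memory s IX 0
  read-kinds-run [] ys s _ _ cnt = while-exit cnt ([] , (λ _ _ → refl) , refl)
  read-kinds-run (k₀ ∷ ks) ys₀ s coded input cnt =
    while-step (λ z → 1+n≢0 (trans (sym cnt) z)) (seq-run {w = 3} (head coded input))
    where
    m : Memory
    m = memory s
    Goal : State → Set
    Goal s′ = Numbers (memory s′) KIND (m IX 0) (k₀ ∷ ks) × (∀ k → k < m IX 0 → memory s′ KIND k ≡ m KIND k) ×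
      memory s′ IX 0 ≡ suc (length ks) + m IX 0
    finish : ∀ s₁ ys → Coded ks ys → Input xs (memory s₁ POS 0) ys →
      (∀ k → memory s₁ KIND k ≡ (if m IX 0 ≡ᵇ k then k₀ else m KIND k)) → memory s₁ IX 0 ≡ m IX 0 →
      memory s₁ CNT 0 ≡ m CNT 0 → Run (block (increment IX ∷ decrement CNT ∷ [])) s₁ 1 λ s₂ → Run read-kinds
          s₂ (1 + length ks * 5) Goal
    finish s₁ ys c inp′ kd ix cn = block-run _ (map-run
      (λ s′ (nums , same , ix′) →
        (trans (same (m IX 0) (s≤s (≤-reflexive (sym ix)))) (trans (kd (m IX 0)) (if-≡ (m IX 0))) ∷ Numbers-at
            (cong suc ix) nums) ,
        (λ k k< → trans (same k (m≤n⇒m≤1+n (≤-trans k< (≤-reflexive (sym ix)))))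
            (trans (kd k) (if-≢ (≢-sym (<⇒≢ k<))))) ,
        trans ix′ (trans (+-suc (length ks) _) (cong (λ u → suc (length ks + u)) ix)))
      (read-kinds-run ks ys _ c inp′ (trans (cong (_∸ 1) cn) (cong (_∸ 1) cnt))))
    head : Coded (k₀ ∷ ks) ys₀ → Input xs (m POS 0) ys₀ →
      Run _ s 3 λ s₁ → Run (block (increment IX ∷ decrement CNT ∷ [])) s₁ 1 λ s₂ → Run read-kinds s₂
          (1 + length ks * 5) Goal
    head (leaf v a c) (e ∷ _ ∷ _ ∷ t) = if-run (λ h → ⊥-elim (h e))
      (λ _ → weaken {w = 1} (s≤s z≤n) (block-run _ (finish _ _ c t (λ _ → refl) refl refl)))
    head (join c) (e ∷ t) = if-run (λ _ → if-run (λ h → ⊥-elim (h (cong (_∸ 1) e)))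
        (λ _ → block-run _ (finish _ _ c t (λ _ → refl) refl refl)))
      (λ h → ⊥-elim (0≢1+n (trans (sym h) e)))
    head (recolour a b c) (e ∷ _ ∷ _ ∷ t) = if-run
        (λ _ → if-run (λ _ → block-run _ (finish _ _ c t (λ _ → refl) refl refl))
        (λ h → ⊥-elim (0≢1+n (trans (sym h) (cong (_∸ 1) e)))))
      (λ h → ⊥-elim (0≢1+n (trans (sym h) e)))
    head (add-edges a b c) (e ∷ _ ∷ _ ∷ t) = if-run
        (λ _ → if-run (λ _ → block-run _ (finish _ _ c t (λ _ → refl) refl refl))
        (λ h → ⊥-elim (0≢1+n (trans (sym h) (cong (_∸ 1) e)))))
      (λ h → ⊥-elim (0≢1+n (trans (sym h) e)))

  kinds-init-run : ∀ ks ys s → Coded ks ys → Input xs 3 ys → nth xs 2 ≡ length ks →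
    Run kinds-init s (3 + length ks * 5) λ s′ →
      Numbers (memory s′) KIND 0 (ks ++ 1 ∷ []) × memory s′ N 0 ≡ suc (length ks)
  kinds-init-run ks ys s c inp′ n = weaken (≤-reflexive (cong (2 +_) (+-comm (length ks * 5) 1)))
    (seq-run (block-run _ (seq-run (map-run (λ s₂ (nums , _ , ix) → block-run _
      ( Numbers-++⁺ ks (Numbers-below (λ k k< → if-≢
          (λ e → <-irrefl (sym (trans (sym (trans ix (+-identityʳ _))) e)) k<)) nums)
          (trans (cong (λ u → if memory s₂ IX 0 ≡ᵇ u then 1 else memory s₂ KIND u) (sym ix))
              (if-≡ (memory s₂ IX 0)) ∷ [])
      , cong suc n))
      (read-kinds-run ks ys _ c inp′ n)))))

  mark-labels-run : ∀ cs s → Run (mark-labels cs) s (1 + length cs) λ s′ →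
    ∀ k → Iff (memory s′ TAB k ≢ 0) (memory s TAB k ≢ 0 ⊎ k ∈ cs)
  mark-labels-run [] s = skip-run (λ k → inj₁ , λ { (inj₁ h) → h ; (inj₂ ()) })
  mark-labels-run (c ∷ cs) s = seq-run
      (block-run _ (map-run (λ s′ h k → combine (memory s′) h k) (mark-labels-run cs _)))
    where
    combine : ∀ m′ → (∀ k → Iff (m′ TAB k ≢ 0) ((if c ≡ᵇ k then 1 else memory s TAB k) ≢ 0 ⊎ k ∈ cs)) →
      ∀ k → Iff (m′ TAB k ≢ 0) (memory s TAB k ≢ 0 ⊎ k ∈ c ∷ cs)
    combine m′ h k with c ≟ k
    ... | yes refl = (λ _ → inj₂ (here refl)) , λ _ → proj₂ (h k) (inj₁ λ z → 1+n≢0 (trans (sym (if-≡ k)) z))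
    ... | no ne = (λ nz → to (proj₁ (h k) nz)) , from
      where
      to : _ ⊎ k ∈ cs → _
      to (inj₁ h₁) = inj₁ λ z → h₁ (trans (if-≢ ne) z)
      to (inj₂ k∈) = inj₂ (there k∈)
      from : memory s TAB k ≢ 0 ⊎ k ∈ c ∷ cs → m′ TAB k ≢ 0
      from (inj₁ h₁) = proj₂ (h k) (inj₁ λ z → h₁ (trans (sym (if-≢ ne)) z))
      from (inj₂ (here refl)) = ⊥-elim (ne refl)
      from (inj₂ (there k∈)) = proj₂ (h k) (inj₂ k∈)

  cols-run : ∀ n s → memory s COL 0 ≡ n → Run cols s (1 + n * 2) λ s′ →
    Appends (memory s) (memory s′) (map full
        (col-entries (memory s VX 0) (memory s VY 0) (memory s VB 0) (memory s SC 0) n))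
  cols-run zero    s e = while-exit e (≋⇒Appends (λ _ _ _ → refl))
  cols-run (suc n) s e = while-step (λ z → 1+n≢0 (trans (sym e) z)) (block-run _ (map-run
    (λ _ → Appends-trans (Appends-push (λ _ → refl) (λ _ → refl) refl (λ _ → refl) refl (λ _ → refl) refl refl))
    (cols-run n _ (cong (_∸ 1) e))))

  rows-run : ∀ n s → memory s ROW 0 ≡ n → Run rows s (1 + n * (4 + memory s COLS 0 * 2)) λ s′ →
    Appends (memory s) (memory s′)
      (map full (grid (memory s VX 0) (memory s VY 0) (memory s LY 0) (memory s SC 0) (memory s COLS 0) n))
  rows-run zero    s e = while-exit e (≋⇒Appends (λ _ _ _ → refl))
  rows-run (suc n) s e = weaken
    (linear (# 1 :+ ((# 1 :+ ((# 1 :+ v₀) :+ # 1)) :+ (# 1 :+ v₁))) (# 1 :+ (# 4 :+ v₀ :+ v₁))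
       (memory s COLS 0 * 2 ∷ n * (4 + memory s COLS 0 * 2) ∷ []))
    (while-step (λ z → 1+n≢0 (trans (sym e) z))
        (seq-run (block-run _ (seq-run (map-run next (framed (cols-run (memory s COLS 0) _ refl)))))))
    where
    m m₁ : Memory
    m = memory s
    m₁ = run-block xs m (COL ≔ var COLS ∷ VB ≔ const 0 ∷ [])
    row : List Entry
    row = col-entries (m VX 0) (m VY 0) 0 (m SC 0) (m COLS 0)
    next : ∀ s₂ → Appends m₁ (memory s₂) (map full row) × Frame cols ⟨ m₁ , query s , output s ⟩ s₂ → Run _ s₂ 1 _
    next s₂ (ap , fr) = block-run _ (subst (λ u → Run rows s₃ (1 + n * (4 + u * 2)) _) cs (map-run
      (λ s′ ap′ → subst (Appends m (memory s′)) (sym (map-++ full row _))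
        (Appends-trans (Appends-before (Appends-after (untouched (λ _ → refl)) ap) (untouched (λ _ → refl)))
          (subst (Appends m₃ (memory s′)) (cong (map full) same-grid) ap′)))
      (rows-run n s₃ (trans (cong (_∸ 1) (same-memory fr ROW refl 0)) (cong (_∸ 1) e)))))
      where
      m₃ : Memory
      m₃ = run-block xs (memory s₂) (VX ≔ var VX ⊞ var SC ∷ VY ≔ var VY ⊞ var LY ∷ decrement ROW ∷ [])
      s₃ : State
      s₃ = ⟨ m₃ , query s₂ , output s₂ ⟩
      cs : m₃ COLS 0 ≡ m COLS 0
      cs = same-memory fr COLS refl 0
      same-grid : grid (m₃ VX 0) (m₃ VY 0) (m₃ LY 0) (m₃ SC 0) (m₃ COLS 0) n ≡
        grid (m VX 0 + m SC 0) (m VY 0 + m LY 0) (m LY 0) (m SC 0) (m COLS 0) n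
      same-grid rewrite same-memory fr VX refl 0 | same-memory fr VY refl 0 | same-memory fr LY refl 0
                      | same-memory fr SC refl 0 | same-memory fr COLS refl 0 = refl

  module _ (lab : ℕ) where
    entries : Memory → ℕ → List Entry
    entries m = counter-entries (nth xs 0) (m SC 0) lab

    node-weight : ℕ
    node-weight = 6 + (2 + nth xs 0) * (4 + (1 + nth xs 0) * 2)

    count-node-run : ∀ s k ks → k ≤ 2 → Numbers (memory s) KIND (memory s IX 0) (k ∷ ks) →
      Run (count-node lab) s (5 + (2 + nth xs 0) * (4 + (1 + nth xs 0) * 2)) λ s′ →
        Appends (memory s) (memory s′) (slots (entries (memory s) k)) × Numbers (memory s′) KIND (memory s′ IX 0) ks ×
        memory s′ CNT 0 ≡ memory s CNT 0 ∸ 1 × memory s′ SC 0 ≡ memory s SC 0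
    count-node-run s k ks k≤2 (kind ∷ t) = choose k k≤2 kind
      where
      d = nth xs 0
      R = (2 + d) * (4 + (1 + d) * 2)
      Goal : List Entry → State → Set
      Goal l s′ = Appends (memory s) (memory s′) (slots l) × Numbers (memory s′) KIND (memory s′ IX 0) ks ×
        memory s′ CNT 0 ≡ memory s CNT 0 ∸ 1 × memory s′ SC 0 ≡ memory s SC 0
      finish : ∀ s₁ l n → n ≤ 2 + d → memory s₁ COLS 0 ≤ 1 + d → memory s₁ ROW 0 ≡ n →
        grid (memory s₁ VX 0) (memory s₁ VY 0) (memory s₁ LY 0) (memory s₁ SC 0) (memory s₁ COLS 0) n ≡ l →
        memory s ≋ memory s₁ → (∀ a k → (a ≡ KIND ⊎ a ≡ IX) ⊎ (a ≡ CNT ⊎ a ≡ SC) → memory s₁ a k ≡ memory s a k) →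
        Run (rows ⨾ block (push-end ++ increment IX ∷ decrement CNT ∷ [])) s₁ (2 + R) (Goal l)
      finish s₁ l n n≤ c≤ e refl po same = weaken bounded (seq-run (map-run (λ s₂ (ap , fr) → block-run _
        ( Appends-trans (Appends-after po ap) (Appends-end (λ _ → refl) (λ _ → refl) (λ _ → refl) (λ _ → refl) refl)
        , Numbers-at (cong suc (sym (trans (same-memory fr IX refl 0) (same IX 0 (inj₁ (inj₂ refl))))))
            (Numbers-≗ (λ k → trans (same-memory fr KIND refl k) (same KIND k (inj₁ (inj₁ refl)))) t)
        , cong (_∸ 1) (trans (same-memory fr CNT refl 0) (same CNT 0 (inj₂ (inj₁ refl))))
        , trans (same-memory fr SC refl 0) (same SC 0 (inj₂ (inj₂ refl)))))
        (framed (rows-run n s₁ e))))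
        where
        bounded : 1 + n * (4 + memory s₁ COLS 0 * 2) + 1 ≤ 2 + R
        bounded = ≤-trans (≤-reflexive (+-comm (1 + n * (4 + memory s₁ COLS 0 * 2)) 1))
          (+-monoʳ-≤ 2 (*-mono-≤ n≤ (+-monoʳ-≤ 4 (*-monoˡ-≤ 2 c≤))))
      kept : ∀ {m m₁ : Memory} → (∀ k → m₁ KIND k ≡ m KIND k) → (∀ k → m₁ IX k ≡ m IX k) →
          (∀ k → m₁ CNT k ≡ m CNT k) →
        (∀ k → m₁ SC k ≡ m SC k) → ∀ a k → (a ≡ KIND ⊎ a ≡ IX) ⊎ (a ≡ CNT ⊎ a ≡ SC) → m₁ a k ≡ m a k
      kept h₁ h₂ h₃ h₄ a k (inj₁ (inj₁ refl)) = h₁ k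
      kept h₁ h₂ h₃ h₄ a k (inj₁ (inj₂ refl)) = h₂ k
      kept h₁ h₂ h₃ h₄ a k (inj₂ (inj₁ refl)) = h₃ k
      kept h₁ h₂ h₃ h₄ a k (inj₂ (inj₂ refl)) = h₄ k
      choose : ∀ k → k ≤ 2 → memory s KIND (memory s IX 0) ≡ k → Run (count-node lab) s (5 + R)
          (Goal (entries (memory s) k))
      choose zero _ e = seq-run {w = 3} (if-run (λ h → ⊥-elim (h e)) (λ _ → weaken {w = 1} (s≤s z≤n) (block-run _
        (finish _ _ 2 (m≤m+n 2 d) (s≤s z≤n) refl refl (untouched (λ _ → refl))
            (kept (λ _ → refl) (λ _ → refl) (λ _ → refl) (λ _ → refl))))))
      choose (suc zero) _ e = seq-run {w = 3}
          (if-run (λ _ → if-run (λ h → ⊥-elim (h (cong (_∸ 1) e))) (λ _ → block-run _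
          (finish _ _ (suc d) (n≤1+n _) (s≤s z≤n) refl refl (untouched (λ _ → refl))
              (kept (λ _ → refl) (λ _ → refl) (λ _ → refl) (λ _ → refl)))))
        (λ h → ⊥-elim (0≢1+n (trans (sym h) e))))
      choose (suc (suc zero)) _ e = seq-run {w = 3} (if-run (λ _ → if-run (λ _ → block-run _
          (finish _ _ (suc d) (n≤1+n _) ≤-refl refl refl (untouched (λ _ → refl))
              (kept (λ _ → refl) (λ _ → refl) (λ _ → refl) (λ _ → refl))))
          (λ h → ⊥-elim (0≢1+n (trans (sym h) (cong (_∸ 1) e)))))
        (λ h → ⊥-elim (0≢1+n (trans (sym h) e))))
      choose (suc (suc (suc k))) (s≤s (s≤s ())) e

    count-nodes-run : ∀ ks s → All (_≤ 2) ks → Numbers (memory s) KIND (memory s IX 0) ks → memory s CNT 0 ≡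
        length ks →
      Run (count-nodes lab) s (1 + length ks * node-weight) λ s′ →
        Appends (memory s) (memory s′) (flat (map (entries (memory s)) ks)) × memory s′ SC 0 ≡ memory s SC 0
    count-nodes-run [] s _ _ cnt = while-exit cnt (≋⇒Appends (λ _ _ _ → refl) , refl)
    count-nodes-run (k ∷ ks) s (k≤2 ∷ all≤) nums cnt = weaken
      (≤-reflexive (cong suc (+-suc (5 + (2 + nth xs 0) * (4 + (1 + nth xs 0) * 2)) (length ks * node-weight))))
      (while-step (λ z → 1+n≢0 (trans (sym cnt) z)) (map-run (λ s₁ (ap , nums₁ , cnt₁ , sc₁) → map-run
        (λ s₂ (ap₂ , sc₂) → Appends-trans ap
            (subst (Appends _ _) (cong (λ u → flat (map (counter-entries (nth xs 0) u lab) ks)) sc₁) ap₂) ,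
            trans sc₂ sc₁)
        (count-nodes-run ks s₁ all≤ nums₁ (trans cnt₁ (cong (_∸ 1) cnt))))
        (count-node-run s k ks k≤2 nums)))

    multiply-run : ∀ n s → memory s CNT 0 ≡ n → Run multiply s (1 + n * 2) λ s′ → memory s′ DS 0 ≡ memory s DS
        0 + n * memory s SC 0
    multiply-run zero    s e = while-exit e (sym (+-identityʳ _))
    multiply-run (suc n) s e = while-step (λ z → 1+n≢0 (trans (sym e) z)) (block-run _ (map-run
      (λ _ h → trans h (+-assoc (memory s DS 0) (memory s SC 0) _)) (multiply-run n _ (cong (_∸ 1) e))))

    counter-run : ∀ ks s → All (_≤ 2) ks → Numbers (memory s) KIND 0 ks → memory s N 0 ≡ suc (length ks) →
      Run (counter lab) s (6 + nth xs 0 * 2 + length ks * node-weight) λ s′ →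
        Appends (memory s) (memory s′) (flat
            (map (entries (memory s)) ks ++ (ent 0 (nth xs 0 * memory s SC 0) 0 ∷ []) ∷ [])) ×
        memory s′ SC 0 ≡ nth xs 0 * memory s SC 0 + nth xs 0 * memory s SC 0 + memory s SC 0
    counter-run ks s all≤ nums n = weaken weight
      (seq-run (block-run _ (seq-run (map-run after-multiply (framed (multiply-run d _ refl))))))
      where
      d = nth xs 0
      m m₁ : Memory
      m = memory s
      m₁ = run-block xs m (DS ≔ const 0 ∷ CNT ≔ inp (const 0) ∷ [])
      s₁ : State
      s₁ = ⟨ m₁ , query s , output s ⟩
      l = map (entries m) ks
      weight : 1 + ((1 + d * 2) + (1 + ((1 + length ks * node-weight) + (1 + 1)))) ≤ 6 + d * 2 + length ks *
          node-weight
      weight = linear (# 1 :+ ((# 1 :+ v₀) :+ (# 1 :+ ((# 1 :+ v₁) :+ # 2)))) (# 6 :+ v₀ :+ v₁)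
          (d * 2 ∷ length ks * node-weight ∷ [])
      Goal : State → Set
      Goal s′ = Appends m (memory s′) (flat (l ++ (ent 0 (d * m SC 0) 0 ∷ []) ∷ [])) × memory s′ SC 0 ≡ d * m
          SC 0 + d * m SC 0 + m SC 0
      after-multiply : ∀ s₂ → _ × Frame multiply s₁ s₂ → Run _ s₂ _ Goal
      after-multiply s₂ (ds , fr) = seq-run (block-run _ (seq-run (map-run after-nodes (framed
          (count-nodes-run ks s₃ all≤ (Numbers-≗ (same-memory fr KIND refl) nums)
            (cong (_∸ 1) (trans (same-memory fr N refl 0) n)))))))
        where
        m₃ : Memory
        m₃ = run-block xs (memory s₂) (IX ≔ const 0 ∷ CNT ≔ var N ⊟ const 1 ∷ [])
        s₃ : State
        s₃ = ⟨ m₃ , query s₂ , output s₂ ⟩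
        start : m ≋ m₃
        start = ≋-trans (≋-trans (untouched (λ _ → refl)) (frame-≋ fr refl)) (untouched (λ _ → refl))
        after-nodes : ∀ s₄ → _ × Frame (count-nodes lab) s₃ s₄ → Run _ s₄ _ Goal
        after-nodes s₄ ((ap , sc) , fr₄) = seq-run (block-run _ (block-run _
          ( subst (Appends m _) (sym (concatMap-++ slots l _))
              (Appends-trans (subst (Appends m _) (cong (λ u → flat (map (counter-entries d u lab) ks))
                  (same-memory fr SC refl 0)) (Appends-after start ap))
                (Appends-trans {m′ = m₅} (Appends-push (λ _ → refl) (λ _ → refl) refl (λ _ → refl) ds₄
                    (λ _ → refl) refl refl)
                  (Appends-end (λ _ → refl) (λ _ → refl) (λ _ → refl) (λ _ → refl) refl)))
          , cong₂ _+_ (cong₂ _+_ ds₄ ds₄) (trans sc (same-memory fr SC refl 0)))))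
          where
          m₅ : Memory
          m₅ = run-block xs (memory s₄) (push (const 0) (var DS) (const 0))
          ds₄ : memory s₄ DS 0 ≡ d * m SC 0
          ds₄ = trans (same-memory fr₄ DS refl 0) ds

-- Runs with labelled leaves

Lists : ∀ {ω} → Decomp ω → Set
Lists D = Node D → List Entry

Labels : ∀ {ω} → Decomp ω → Set
Labels D = BuiltVertex D → ℕ

-- In contrast to `Reachable`, the labels at the leaves are kept as a function. Splitting a run of a
-- product into runs of its factors also splits these labels, and this is how the membership bits
-- and the selections are recovered.
Reach : ∀ {ω} (D : Decomp ω) → Lists D → ℕ → Labels D → Set
Reach (intro v a)      f k λs = ent k (λs tt) 0 ∈ f root
Reach (t₁ ⊕ t₂)        f k λs = ∃[ i ] ∃[ j ] ent k i j ∈ f root ×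
  Reach t₁ (f ∘ left) i (λs ∘ inj₁) × Reach t₂ (f ∘ right) j (λs ∘ inj₂)
Reach (recolor t a b)  f k λs = ∃[ i ] ent k i 0 ∈ f root × Reach t (f ∘ inRecolor) i λs
Reach (addEdges t a b) f k λs = ∃[ i ] ent k i 0 ∈ f root × Reach t (f ∘ inAddEdges) i λs

Padded : ∀ {ω} (D : Decomp ω) → Lists D → Set
Padded D f = ∀ t e → e ∈ f t → δ t ≤ 1 → z e ≡ 0

module _ (W : ℕ → Set) (W0 : W 0) where
  Reachable⇒Reach : ∀ {ω} (D : Decomp ω) f {k} → Padded D f → Reachable W D f k → ∃[ λs ] Reach D f k λs ×
      (∀ v → W (λs v))
  Reachable⇒Reach (intro v a) f pd (ent k i j , e∈ , refl , w , _) with pd root _ e∈ z≤n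
  ... | refl = (λ _ → i) , e∈ , λ _ → w
  Reachable⇒Reach (t₁ ⊕ t₂) f pd (ent k i j , e∈ , refl , h₁ , h₂)
    with Reachable⇒Reach t₁ (f ∘ left) (pd ∘ left) h₁ | Reachable⇒Reach t₂ (f ∘ right) (pd ∘ right) h₂
  ... | λ₁ , r₁ , w₁ | λ₂ , r₂ , w₂ = [ λ₁ , λ₂ ]′ , (i , j , e∈ , r₁ , r₂) , λ { (inj₁ v) → w₁ v ; (inj₂ v) → w₂ v }
  Reachable⇒Reach (recolor t a b) f pd (ent k i j , e∈ , refl , h , _)
    with pd root _ e∈ ≤-refl | Reachable⇒Reach t (f ∘ inRecolor) (pd ∘ inRecolor) h
  ... | refl | λ₁ , r₁ , w₁ = λ₁ , (i , e∈ , r₁) , w₁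
  Reachable⇒Reach (addEdges t a b) f pd (ent k i j , e∈ , refl , h , _)
    with pd root _ e∈ ≤-refl | Reachable⇒Reach t (f ∘ inAddEdges) (pd ∘ inAddEdges) h
  ... | refl | λ₁ , r₁ , w₁ = λ₁ , (i , e∈ , r₁) , w₁

  Reach⇒Reachable : ∀ {ω} (D : Decomp ω) f {k} λs → Reach D f k λs → (∀ v → W (λs v)) → Reachable W D f k
  Reach⇒Reachable (intro v a)      f λs e∈ w = _ , e∈ , refl , w tt , W0
  Reach⇒Reachable (t₁ ⊕ t₂)        f λs (i , j , e∈ , r₁ , r₂) w = _ , e∈ , refl ,
    Reach⇒Reachable t₁ (f ∘ left) _ r₁ (w ∘ inj₁) , Reach⇒Reachable t₂ (f ∘ right) _ r₂ (w ∘ inj₂)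
  Reach⇒Reachable (recolor t a b)  f λs (i , e∈ , r) w = _ , e∈ , refl , Reach⇒Reachable t (f ∘ inRecolor) _ r w , W0
  Reach⇒Reachable (addEdges t a b) f λs (i , e∈ , r) w = _ , e∈ , refl , Reach⇒Reachable t (f ∘ inAddEdges) _ r w , W0

-- Products of lists and the unique decomposition of their runs

infixl 7 _⊗_

_⊗_ : ∀ {ω} {D : Decomp ω} → Lists D → Lists D → Lists D
(f ⊗ g) t = crossₑ (f t) (g t)

∈-crossₑ⁺ : ∀ {l l′ e e′} → e ∈ l → e′ ∈ l′ → e ⊕ₑ e′ ∈ crossₑ l l′
∈-crossₑ⁺ {e ∷ l} {l′} (here refl) e′∈ = ∈-++⁺ˡ (∈-map⁺ (e ⊕ₑ_) e′∈)
∈-crossₑ⁺ {e ∷ l} {l′} (there e∈)  e′∈ = ∈-++⁺ʳ (map (e ⊕ₑ_) l′) (∈-crossₑ⁺ e∈ e′∈)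

∈-crossₑ⁻ : ∀ l {l′ u} → u ∈ crossₑ l l′ → ∃[ e ] ∃[ e′ ] e ∈ l × e′ ∈ l′ × u ≡ e ⊕ₑ e′
∈-crossₑ⁻ (e ∷ l) {l′} u∈ with ∈-++⁻ (map (e ⊕ₑ_) l′) u∈
... | inj₁ h with ∈-map⁻ (e ⊕ₑ_) h
...   | e′ , e′∈ , refl = e , e′ , here refl , e′∈ , refl
∈-crossₑ⁻ (e ∷ l) {l′} u∈ | inj₂ h with ∈-crossₑ⁻ l h
...   | e₁ , e′ , e₁∈ , e′∈ , eq = e₁ , e′ , there e₁∈ , e′∈ , eq

⊗-Reach : ∀ {ω} (D : Decomp ω) (f g : Lists D) {i j} λs μs → Reach D f i λs → Reach D g j μs →
  Reach D (f ⊗ g) (i + j) (λ v → λs v + μs v)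
⊗-Reach (intro v a)      f g λs μs e∈ e′∈ = ∈-crossₑ⁺ e∈ e′∈
⊗-Reach (t₁ ⊕ t₂)        f g λs μs (i , j , e∈ , r₁ , r₂) (i′ , j′ , e′∈ , r₁′ , r₂′) =
  i + i′ , j + j′ , ∈-crossₑ⁺ e∈ e′∈ , ⊗-Reach t₁ (f ∘ left) (g ∘ left) _ _ r₁ r₁′ , ⊗-Reach t₂ (f ∘ right)
      (g ∘ right) _ _ r₂ r₂′
⊗-Reach (recolor t a b)  f g λs μs (i , e∈ , r) (i′ , e′∈ , r′) =
  i + i′ , ∈-crossₑ⁺ e∈ e′∈ , ⊗-Reach t (f ∘ inRecolor) (g ∘ inRecolor) _ _ r r′
⊗-Reach (addEdges t a b) f g λs μs (i , e∈ , r) (i′ , e′∈ , r′) =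
  i + i′ , ∈-crossₑ⁺ e∈ e′∈ , ⊗-Reach t (f ∘ inAddEdges) (g ∘ inAddEdges) _ _ r r′

Reach-entry : ∀ {ω} (D : Decomp ω) f {k} λs → Reach D f k λs → ∃[ e ] e ∈ f root × x e ≡ k
Reach-entry (intro v a)      f λs e∈ = _ , e∈ , refl
Reach-entry (t₁ ⊕ t₂)        f λs (i , j , e∈ , _) = _ , e∈ , refl
Reach-entry (recolor t a b)  f λs (i , e∈ , _) = _ , e∈ , refl
Reach-entry (addEdges t a b) f λs (i , e∈ , _) = _ , e∈ , refl

Within : (l s degree : ℕ) → Entry → Set
Within l s 0             e = x e < s × y e ≤ l × z e ≡ 0
Within l s 1             e = x e < s × y e < s × z e ≡ 0
Within l s (suc (suc _)) e = x e < s × y e < s × z e < s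

-- Adding a number below s to such a multiple of s is injective and stays below s′.
Span : (s s′ k : ℕ) → Set
Span s s′ k = s ∣ k × k + s ≤ s′

Spanning : (l s s′ degree : ℕ) → Entry → Set
Spanning l s s′ 0             e = Span s s′ (x e) × y e ≤ l × z e ≡ 0
Spanning l s s′ 1             e = Span s s′ (x e) × Span s s′ (y e) × z e ≡ 0
Spanning l s s′ (suc (suc _)) e = Span s s′ (x e) × Span s s′ (y e) × Span s s′ (z e)

Everywhere : ∀ {ω} (D : Decomp ω) → (ℕ → Entry → Set) → Lists D → Set
Everywhere D Q f = ∀ t e → e ∈ f t → Q (δ t) e

span-+ : ∀ {s s′ i j} → i < s → Span s s′ j → i + j < s′
span-+ {s} {s′} {i} {j} i< (_ , le) = <-≤-trans (+-monoˡ-< j i<) (≤-trans (≤-reflexive (+-comm s j)) le)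

span-< : ∀ {s s′ j} → 0 < s → Span s s′ j → j < s′
span-< {s} {s′} {j} 0<s (_ , le) = <-≤-trans (m<m+n j 0<s) le

-- The first summand is the remainder of the sum modulo `s`.
span-unique : ∀ {s i i′ j j′} → i < s → i′ < s → s ∣ j → s ∣ j′ → i + j ≡ i′ + j′ → i ≡ i′ × j ≡ j′
span-unique {s@(suc _)} {i} {i′} i< i′< (divides c refl) (divides c′ refl) e = i≡ , +-cancelˡ-≡ i′ _ _
    (trans (cong (_+ c * s) (sym i≡)) e)
  where
  i≡ : i ≡ i′
  i≡ = trans (sym (trans ([m+kn]%n≡m%n i c s) (m<n⇒m%n≡m i<)))
       (trans (cong (_% s) e) (trans ([m+kn]%n≡m%n i′ c′ s) (m<n⇒m%n≡m i′<)))

⊗-Within : ∀ {ω} (D : Decomp ω) {f g l l′ s s′} → Everywhere D (Within l s) f → Everywhere D (Spanning l′ s s′) g →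
  Everywhere D (Within (l + l′) s′) (f ⊗ g)
⊗-Within D {f} {g} hf hg t u u∈ with ∈-crossₑ⁻ (f t) u∈
... | e , e′ , e∈ , e′∈ , refl with δ t | hf t e e∈ | hg t e′ e′∈
...   | 0             | a , b , c | a′ , b′ , c′ = span-+ a a′ , +-mono-≤ b b′ , cong₂ _+_ c c′
...   | 1             | a , b , c | a′ , b′ , c′ = span-+ a a′ , span-+ b b′ , cong₂ _+_ c c′
...   | suc (suc _)   | a , b , c | a′ , b′ , c′ = span-+ a a′ , span-+ b b′ , span-+ c c′

Spanning⇒Within : ∀ {ω} (D : Decomp ω) {g l s s′} → 0 < s → Everywhere D (Spanning l s s′) g → Everywhere D
    (Within l s′) g
Spanning⇒Within D 0<s hg t e e∈ with δ t | hg t e e∈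
... | 0             | a , b , c = span-< 0<s a , b , c
... | 1             | a , b , c = span-< 0<s a , span-< 0<s b , c
... | suc (suc _)   | a , b , c = span-< 0<s a , span-< 0<s b , span-< 0<s c

within-x : ∀ {l s} n {e} → Within l s n e → x e < s
within-x 0             h = proj₁ h
within-x 1             h = proj₁ h
within-x (suc (suc n)) h = proj₁ h

spanning-x : ∀ {l s s′} n {e} → Spanning l s s′ n e → s ∣ x e
spanning-x 0             h = proj₁ (proj₁ h)
spanning-x 1             h = proj₁ (proj₁ h)
spanning-x (suc (suc n)) h = proj₁ (proj₁ h)

Reach-< : ∀ {ω} (D : Decomp ω) f {k l s} λs → Everywhere D (Within l s) f → Reach D f k λs → k < s
Reach-< D f λs h r with Reach-entry D f λs r
... | e , e∈ , refl = within-x (δ {D = D} root) (h root e e∈)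

Reach-∣ : ∀ {ω} (D : Decomp ω) f {k l s s′} λs → Everywhere D (Spanning l s s′) f → Reach D f k λs → s ∣ k
Reach-∣ D f λs h r with Reach-entry D f λs r
... | e , e∈ , refl = spanning-x (δ {D = D} root) (h root e e∈)

Splits : ∀ {ω} (D : Decomp ω) → Lists D → Lists D → ℕ → Labels D → Set
Splits D f g k λs = ∃[ i ] ∃[ j ] ∃[ μs ] ∃[ νs ] Reach D f i μs × Reach D g j νs × k ≡ i + j ×
    (∀ v → λs v ≡ μs v + νs v)

unary-split : ∀ {ω} {D : Decomp ω} {t : Decomp ω} (g : Node t → Node D) (f₁ f₂ : Lists D) {l l′ s s′ k λs} r →
  δ r ≡ 1 → Everywhere t (Within l s) (f₁ ∘ g) → Everywhere t (Spanning l′ s s′) (f₂ ∘ g) →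
  (∀ e → e ∈ f₁ r → Within l s 1 e) → (∀ e → e ∈ f₂ r → Spanning l′ s s′ 1 e) →
  ∀ {i} → ent k i 0 ∈ crossₑ (f₁ r) (f₂ r) → Splits t (f₁ ∘ g) (f₂ ∘ g) i λs →
  ∃[ a ] ∃[ b ] ∃[ μs ] ∃[ νs ] (∃[ i ] ent a i 0 ∈ f₁ r × Reach t (f₁ ∘ g) i μs) ×
    (∃[ j ] ent b j 0 ∈ f₂ r × Reach t (f₂ ∘ g) j νs) × k ≡ a + b × (∀ v → λs v ≡ μs v + νs v)
unary-split {t = t} g f₁ f₂ r _ h₁ h₂ hr₁ hr₂ u∈ (i₁ , i₂ , μs , νs , R₁ , R₂ , i≡ , eq)
  with ∈-crossₑ⁻ (f₁ r) u∈
... | ent a p q , ent b p′ q′ , e∈ , e′∈ , eq′ with hr₁ _ e∈ | hr₂ _ e′∈ | cong x eq′ | cong y eq′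
...   | _ , p< , refl | _ , (p′∣ , _) , refl | refl | refl
  with span-unique p< (Reach-< t _ μs h₁ R₁) p′∣ (Reach-∣ t _ νs h₂ R₂) i≡
... | refl , refl = a , b , μs , νs , (i₁ , e∈ , R₁) , (i₂ , e′∈ , R₂) , refl , eq

-- The state of a child is a sum in two ways: by the two entries combined at the parent and by the
-- decomposition of the run below. `span-unique` identifies the summands, so the runs below fit
-- under the separate entries. Labels are only split as sums here; that they consist of single bits
-- is left to the factors.
⊗-split : ∀ {ω} (D : Decomp ω) (f g : Lists D) {l l′ s s′ k} λs → Everywhere D (Within l s) f → Everywhere D
    (Spanning l′ s s′) g →
  Reach D (f ⊗ g) k λs → Splits D f g k λs
⊗-split (intro v a) f g λs hf hg u∈ with ∈-crossₑ⁻ (f root) u∈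
... | ent i m p , ent j n q , e∈ , e′∈ , eq with hf root _ e∈ | hg root _ e′∈
...   | _ , _ , refl | _ , _ , refl with refl ← cong x eq = i , j , (λ _ → m) , (λ _ → n) , e∈ , e′∈ , refl ,
    λ _ → cong y eq
⊗-split (t₁ ⊕ t₂) f g λs hf hg (i , j , u∈ , r₁ , r₂)
  with ∈-crossₑ⁻ (f root) u∈ | ⊗-split t₁ (f ∘ left) (g ∘ left) _ (hf ∘ left) (hg ∘ left) r₁
     | ⊗-split t₂ (f ∘ right) (g ∘ right) _ (hf ∘ right) (hg ∘ right) r₂
... | ent a p q , ent b p′ q′ , e∈ , e′∈ , refl | i₁ , i₂ , μ₁ , ν₁ , R₁ , R₁′ , e₁ , eq₁ | j₁ , j₂ , μ₂ , ν₂
    , R₂ , R₂′ , e₂ , eq₂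
  with hf root _ e∈ | hg root _ e′∈
...   | _ , p< , q< | _ , (p′∣ , _) , (q′∣ , _)
  with span-unique p< (Reach-< t₁ _ _ (hf ∘ left) R₁) p′∣ (Reach-∣ t₁ _ _ (hg ∘ left) R₁′) e₁
     | span-unique q< (Reach-< t₂ _ _ (hf ∘ right) R₂) q′∣ (Reach-∣ t₂ _ _ (hg ∘ right) R₂′) e₂
... | refl , refl | refl , refl = a , b , [ μ₁ , μ₂ ]′ , [ ν₁ , ν₂ ]′ , (i₁ , j₁ , e∈ , R₁ , R₂) ,
    (i₂ , j₂ , e′∈ , R₁′ , R₂′) , refl ,
      λ { (inj₁ v) → eq₁ v ; (inj₂ v) → eq₂ v }
⊗-split (recolor t a b) f g λs hf hg (i , u∈ , r) =
  unary-split inRecolor f g root refl (hf ∘ inRecolor) (hg ∘ inRecolor) (hf root) (hg root) u∈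
    (⊗-split t (f ∘ inRecolor) (g ∘ inRecolor) λs (hf ∘ inRecolor) (hg ∘ inRecolor) r)
⊗-split (addEdges t a b) f g λs hf hg (i , u∈ , r) =
  unary-split inAddEdges f g root refl (hf ∘ inAddEdges) (hg ∘ inAddEdges) (hf root) (hg root) u∈
    (⊗-split t (f ∘ inAddEdges) (g ∘ inAddEdges) λs (hf ∘ inAddEdges) (hg ∘ inAddEdges) r)

-- Families of factors

encode : ℕ → List Bool → ℕ
encode k []      = 0
encode k (b ∷ l) = label (2 ^ k) b + encode (suc k) l

at : {V : Set} → List (V → Bool) → V → List Bool
at bs v = map (λ b → b v) bs

Property : ∀ {ω} → Decomp ω → Set₁
Property D = (BuiltVertex D → Bool) → Set

-- The common interface of cores and counters. States occupy the interval of scales from `s` to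
-- `s′`, the labels use only the bit `k`, and the runs ending in the state 0 are described by a
-- property of the bit function on the leaves, which is all that later arguments need.
record Factor {ω} (D : Decomp ω) (k s s′ : ℕ) (g : Lists D) (Q : Property D) : Set where
  field
    s≤s′     : s ≤ s′
    spanning : Everywhere D (Spanning (2 ^ k) s s′) g
    sound    : ∀ λs → Reach D g 0 λs → ∃[ b ] (∀ v → λs v ≡ label (2 ^ k) (b v)) × Q b
    complete : ∀ b → Q b → ∃[ λs ] Reach D g 0 λs × (∀ v → λs v ≡ label (2 ^ k) (b v))

open Factor

data Factors {ω} (D : Decomp ω) : ℕ → ℕ → ℕ → List (Lists D) → List (Property D) → Set₁ where
  []  : ∀ {k s} → Factors D k s s [] []
  _∷_ : ∀ {k s s′ s″ g Q gs Qs} → Factor D k s s′ g Q → Factors D (suc k) s′ s″ gs Qs →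
        Factors D k s s″ (g ∷ gs) (Q ∷ Qs)

factors-≤ : ∀ {ω} {D : Decomp ω} {k s s′ gs Qs} → Factors D k s s′ gs Qs → s ≤ s′
factors-≤ []       = ≤-refl
factors-≤ (h ∷ hs) = ≤-trans (s≤s′ h) (factors-≤ hs)

factors-++ : ∀ {ω} {D : Decomp ω} {k s s′ s″ gs Qs gs′ Qs′} → Factors D k s s′ gs Qs →
  Factors D (length gs + k) s′ s″ gs′ Qs′ → Factors D k s s″ (gs ++ gs′) (Qs ++ Qs′)
factors-++ [] hs′ = hs′
factors-++ {D = D} {k} {s′ = s′} {s″} {g ∷ gs} {gs′ = gs′} {Qs′} (h ∷ hs) hs′ =
  h ∷ factors-++ hs (subst (λ u → Factors D u s′ s″ gs′ Qs′) (sym (+-suc (length gs) k)) hs′)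

-- Nested to the left, since splitting off a factor requires the accumulated states to be below the
-- scale at which that factor begins.
product⊗ : ∀ {ω} {D : Decomp ω} → Lists D → List (Lists D) → Lists D
product⊗ f []       = f
product⊗ f (g ∷ gs) = product⊗ (f ⊗ g) gs

_satisfy_ : {V : Set} → List (V → Bool) → List ((V → Bool) → Set) → Set₁
bs satisfy Qs = Pointwise (λ Q b → Q b) Qs bs

module _ {ω} (D : Decomp ω) where
  -- A further factor adds at most 2^k to labels below 2^k, which doubles the bound. Labels of the
  -- whole product thus fit into a table with one bit per factor.
  product-within : ∀ {k s s′ gs Qs l} f → l < 2 ^ k → Everywhere D (Within l s) f → Factors D k s s′ gs Qs →
    ∃[ l′ ] l′ < 2 ^ (length gs + k) × Everywhere D (Within l′ s′) (product⊗ f gs)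
  product-within f l< hf [] = _ , l< , hf
  product-within {k} {gs = g ∷ gs} {l = l} f l< hf (h ∷ hs)
    with product-within (f ⊗ g) (≤-trans (+-monoˡ-≤ (2 ^ k) l<) (≤-reflexive (cong (2 ^ k +_) (sym (+-identityʳ _)))))
           (⊗-Within D hf (spanning h)) hs
  ... | l′ , l′< , hp = l′ , subst (λ u → l′ < 2 ^ u) (+-suc (length gs) k) l′< , hp

  product-sound : ∀ {k s s′ gs Qs l} f Λ → Everywhere D (Within l s) f → Factors D k s s′ gs Qs →
    Reach D (product⊗ f gs) 0 Λ →
    ∃[ λ₀ ] ∃[ bs ] Reach D f 0 λ₀ × bs satisfy Qs × (∀ v → Λ v ≡ λ₀ v + encode k (at bs v))
  product-sound f Λ hf [] r = Λ , [] , r , [] , λ v → sym (+-identityʳ _)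
  product-sound {k} f Λ hf (_∷_ {g = g} h hs) r with product-sound (f ⊗ g) Λ (⊗-Within D hf (spanning h)) hs r
  ... | λ₀ , bs , r₀ , sat , eq with ⊗-split D f g λ₀ hf (spanning h) r₀
  -- The state 0 is a sum only of zeros, so a successful run of the product restricts to successful
  -- runs of the factors.
  ...   | zero , zero , μs , νs , r₁ , r₂ , _ , eq′ with sound h νs r₂
  ...     | b , νb , q = μs , b ∷ bs , r₁ , q ∷ sat , λ v → begin
    Λ v                                                          ≡⟨ eq v ⟩
    λ₀ v + encode (suc k) (at bs v)                      ≡⟨ cong (_+ _) (trans (eq′ v) (cong (μs v +_) (νb v))) ⟩
    μs v + label (2 ^ k) (b v) + encode (suc k) (at bs v) ≡⟨ +-assoc (μs v) _ _ ⟩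
    μs v + encode k (at (b ∷ bs) v)                      ∎
    where open ≡-Reasoning

  product-complete : ∀ {k s s′ gs Qs} f λ₀ bs → Reach D f 0 λ₀ → Factors D k s s′ gs Qs → bs satisfy Qs →
    ∃[ Λ ] Reach D (product⊗ f gs) 0 Λ × (∀ v → Λ v ≡ λ₀ v + encode k (at bs v))
  product-complete f λ₀ [] r [] [] = λ₀ , r , λ v → sym (+-identityʳ _)
  product-complete {k} f λ₀ (b ∷ bs) r (_∷_ {g = g} h hs) (q ∷ sat) with complete h b q
  ... | νs , r′ , eq with product-complete (f ⊗ g) (λ v → λ₀ v + νs v) bs (⊗-Reach D f g λ₀ νs r r′) hs sat
  ...   | Λ , R , eq′ = Λ , R , λ v → trans (eq′ v)
      (trans (cong (λ u → λ₀ v + u + encode (suc k) (at bs v)) (eq v)) (+-assoc (λ₀ v) _ _))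

  within-padded : ∀ {l s f} → Everywhere D (Within l s) f → Padded D f
  within-padded h t e e∈ δ≤ with δ t | h t e e∈
  ... | 0           | _ , _ , c = c
  ... | 1           | _ , _ , c = c
  within-padded h t e e∈ (s≤s ()) | suc (suc _) | _

  within-bounded : ∀ {l s b f} → l < b → Everywhere D (Within l s) f → Bounded b s D f
  within-bounded l<b h t e e∈ with δ t | h t e e∈
  ... | 0               | p , q , c = record
      { x< = p ; y< = ≤-<-trans q l<b ; z< = subst (_< _) (sym c) (≤-<-trans z≤n l<b) }
  ... | 1               | p , q , c = record { x< = p ; y< = q ; z< = subst (_< _) (sym c) (≤-<-trans z≤n l<b) }
  ... | suc (suc n) | p , q , c = record { x< = p ; y< = q ; z< = c }

-- The factor of a core

withRoot : ∀ {ω} {t : Decomp ω} {a b} → List Entry → Lists t → Lists (recolor t a b)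
withRoot l f root          = l
withRoot l f (inRecolor t) = f t

code≢0 : ∀ w → code w ≢ 0
code≢0 w e = <⇒≢ (1≤code w) (sym e)

code-injective : ∀ {w w′} → code w ≡ code w′ → w ≡ w′
code-injective {[]}        {[]}         e = refl
code-injective {[]}        {true ∷ w′}  e = ⊥-elim (code≢0 w′ (m+n≡0⇒m≡0 (code w′) (sym (suc-injective e))))
code-injective {[]}        {false ∷ w′} e = ⊥-elim (double≢suc-double (code w′) 0 (sym e))
code-injective {true ∷ w}  {[]}         e = ⊥-elim (code≢0 w (m+n≡0⇒m≡0 (code w) (suc-injective e)))
code-injective {false ∷ w} {[]}         e = ⊥-elim (double≢suc-double (code w) 0 e)
code-injective {false ∷ w} {false ∷ w′} e = cong (false ∷_) (code-injective (double-injective _ _ e))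
code-injective {true ∷ w}  {true ∷ w′}  e = cong (true ∷_) (code-injective (double-injective _ _ (suc-injective e)))
code-injective {false ∷ w} {true ∷ w′}  e = ⊥-elim (double≢suc-double (code w) (code w′) e)
code-injective {true ∷ w}  {false ∷ w′} e = ⊥-elim (double≢suc-double (code w′) (code w) (sym e))

scaled-injective : ∀ sc {w w′} → 0 < sc → sc * code w ≡ sc * code w′ → w ≡ w′
scaled-injective (suc sc) _ e = code-injective (*-cancelˡ-≡ _ _ (suc sc) e)

Tuples : ∀ {ω} → Decomp ω → Set
Tuples D = (t : Node D) → List (Vec Bits (suc (δ t)))

Consistent : ∀ {ω} (D : Decomp ω) → Tuples D → (Node D → Bits) → Set
Consistent D pr α = ∀ t → (α t ∷ Vec.map α (children t)) ∈ pr t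

entriesOf : ℕ → ℕ → (Bits → Bool) → ∀ {ω} {D : Decomp ω} → Tuples D → Lists D
entriesOf sc lab ρ pr t = map (toEntry sc lab ρ) (pr t)

module _ (sc lab : ℕ) (ρ : Bits → Bool) (0<sc : 0 < sc) where

  -- The state of a child occurs both in the tuple chosen at its parent and as the result of the run
  -- below. Scaled codes are injective, so the two strings agree and the tuples chosen at all nodes
  -- form one map `α`.
  core-sound : ∀ {ω} (D : Decomp ω) (pr : Tuples D) {k} λs → Reach D (entriesOf sc lab ρ pr) k λs →
    ∃[ α ] Consistent D pr α × k ≡ sc * code (α root) × (∀ v → λs v ≡ label lab (ρ (α (leafNode D v))))
  core-sound (intro v a) pr λs e∈ with ∈-map⁻ (toEntry sc lab ρ) e∈
  ... | w ∷ [] , w∈ , eq = (λ _ → w) , (λ { root → w∈ }) , cong x eq , λ _ → cong y eq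
  core-sound (t₁ ⊕ t₂) pr λs (i , j , e∈ , r₁ , r₂) with ∈-map⁻ (toEntry sc lab ρ) e∈
    | core-sound t₁ (pr ∘ left) _ r₁ | core-sound t₂ (pr ∘ right) _ r₂
  ... | w ∷ w₁ ∷ w₂ ∷ [] , w∈ , eq | α₁ , c₁ , k₁ , l₁ | α₂ , c₂ , k₂ , l₂ = α , consistent , cong x eq , λ
      { (inj₁ v) → l₁ v ; (inj₂ v) → l₂ v }
    where
    α : Node (t₁ ⊕ t₂) → Bits
    α root      = w
    α (left t)  = α₁ t
    α (right t) = α₂ t
    consistent : Consistent (t₁ ⊕ t₂) pr α
    consistent root = subst₂ (λ u u′ → (w ∷ u ∷ u′ ∷ []) ∈ pr root)
      (scaled-injective sc 0<sc (trans (sym (cong y eq)) k₁))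
          (scaled-injective sc 0<sc (trans (sym (cong z eq)) k₂)) w∈
    consistent (left t)  = subst (λ u → (α₁ t ∷ u) ∈ pr (left t)) (vec-map-∘ α left (children t)) (c₁ t)
    consistent (right t) = subst (λ u → (α₂ t ∷ u) ∈ pr (right t)) (vec-map-∘ α right (children t)) (c₂ t)
  core-sound (recolor t a b) pr λs (i , e∈ , r) with ∈-map⁻ (toEntry sc lab ρ) e∈ | core-sound t (pr ∘ inRecolor) _ r
  ... | w ∷ w₁ ∷ [] , w∈ , eq | α₁ , c₁ , k₁ , l₁ = α , consistent , cong x eq , l₁
    where
    α : Node (recolor t a b) → Bits
    α root          = w
    α (inRecolor t) = α₁ t
    consistent : Consistent (recolor t a b) pr α
    consistent root = subst (λ u → (w ∷ u ∷ []) ∈ pr root) (scaled-injective sc 0<sc (trans (sym (cong y eq)) k₁)) w∈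
    consistent (inRecolor t)  = subst (λ u → (α₁ t ∷ u) ∈ pr (inRecolor t))
        (vec-map-∘ α inRecolor (children t)) (c₁ t)
  core-sound (addEdges t a b) pr λs (i , e∈ , r) with ∈-map⁻ (toEntry sc lab ρ) e∈ | core-sound t
      (pr ∘ inAddEdges) _ r
  ... | w ∷ w₁ ∷ [] , w∈ , eq | α₁ , c₁ , k₁ , l₁ = α , consistent , cong x eq , l₁
    where
    α : Node (addEdges t a b) → Bits
    α root           = w
    α (inAddEdges t) = α₁ t
    consistent : Consistent (addEdges t a b) pr α
    consistent root = subst (λ u → (w ∷ u ∷ []) ∈ pr root) (scaled-injective sc 0<sc (trans (sym (cong y eq)) k₁)) w∈
    consistent (inAddEdges t)  = subst (λ u → (α₁ t ∷ u) ∈ pr (inAddEdges t))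
        (vec-map-∘ α inAddEdges (children t)) (c₁ t)

  core-complete : ∀ {ω} (D : Decomp ω) (pr : Tuples D) α → Consistent D pr α →
    Reach D (entriesOf sc lab ρ pr) (sc * code (α root)) (λ v → label lab (ρ (α (leafNode D v))))
  core-complete (intro v a) pr α c = ∈-map⁺ (toEntry sc lab ρ) (c root)
  core-complete (t₁ ⊕ t₂) pr α c = _ , _ , ∈-map⁺ (toEntry sc lab ρ) (c root) ,
    core-complete t₁ (pr ∘ left) (α ∘ left)
        (λ t → subst (λ u → (α (left t) ∷ u) ∈ pr (left t)) (sym (vec-map-∘ α left (children t))) (c (left t))) ,
    core-complete t₂ (pr ∘ right) (α ∘ right)
        (λ t → subst (λ u → (α (right t) ∷ u) ∈ pr (right t)) (sym (vec-map-∘ α right (children t))) (c (right t)))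
  core-complete (recolor t a b) pr α c = _ , ∈-map⁺ (toEntry sc lab ρ) (c root) ,
    core-complete t (pr ∘ inRecolor) (α ∘ inRecolor)
        (λ t → subst (λ u → (α (inRecolor t) ∷ u) ∈ pr (inRecolor t))
        (sym (vec-map-∘ α inRecolor (children t))) (c (inRecolor t)))
  core-complete (addEdges t a b) pr α c = _ , ∈-map⁺ (toEntry sc lab ρ) (c root) ,
    core-complete t (pr ∘ inAddEdges) (α ∘ inAddEdges)
        (λ t → subst (λ u → (α (inAddEdges t) ∷ u) ∈ pr (inAddEdges t))
        (sym (vec-map-∘ α inAddEdges (children t))) (c (inAddEdges t)))

∈-root-entries⁺ : ∀ p {l e} → e ∈ l → p (x e) ≡ true → ent 0 (x e) 0 ∈ root-entries p l
∈-root-entries⁺ p {e ∷ l} (here refl) h rewrite h = here refl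
∈-root-entries⁺ p {e₁ ∷ l} (there e∈) h with p (x e₁)
... | true  = there (∈-root-entries⁺ p e∈ h)
... | false = ∈-root-entries⁺ p e∈ h

∈-root-entries⁻ : ∀ p l {u} → u ∈ root-entries p l → ∃[ e ] e ∈ l × p (x e) ≡ true × u ≡ ent 0 (x e) 0
∈-root-entries⁻ p (e ∷ l) u∈ with p (x e) in eq
∈-root-entries⁻ p (e ∷ l) (here refl) | true = e , here refl , eq , refl
∈-root-entries⁻ p (e ∷ l) (there u∈) | true with ∈-root-entries⁻ p l u∈
... | e′ , e′∈ , h = e′ , there e′∈ , h
∈-root-entries⁻ p (e ∷ l) u∈ | false with ∈-root-entries⁻ p l u∈
... | e′ , e′∈ , h = e′ , there e′∈ , h

label≤ : ∀ k b → label k b ≤ k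
label≤ k false = z≤n
label≤ k true  = ≤-refl

span-0 : ∀ {s s′} → s ≤ s′ → Span s s′ 0
span-0 {s} le = divides 0 refl , le

span-code : ∀ {s s′} w → s * code w + s ≤ s′ → Span s s′ (s * code w)
span-code {s} w le = divides (code w) (*-comm s (code w)) , le

CoreProperty : ∀ {ω} → Core → (Bits → Bool) → (D : Decomp ω) → (BuiltVertex D → Bool) → Set
CoreProperty C ρ D b = ∃[ α ] IsWitness C D α × (∀ v → ρ (α (leafNode D v)) ≡ b v)

-- The entry at the additional root belongs to an accepted string, and the run below determines the
-- string at the root of `D`; injectivity of the scaled code identifies them, which makes `α` a
-- witness. The hypothesis on the tuples is what parsing ensures for the new scale.
core-factor : ∀ {ω} (C : Core) (ρ : Bits → Bool) (D : Decomp ω) a a′ k s s′ p → 0 < s → s ≤ s′ →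
  (∀ t v → v ∈ Process C D t → ∀ w → w ∈ Vec.toList v → s * code w + s ≤ s′) →
  (∀ j → Iff (p j ≡ true) (∃[ w ] w ∈ Accept C D × s * code w ≡ j)) →
  Factor (recolor D a a′) k s s′
    (withRoot (root-entries p (entriesOf s (2 ^ k) ρ (Process C D) root)) (entriesOf s (2 ^ k) ρ (Process C D)))
    (CoreProperty C ρ D)
core-factor C ρ D a a′ k s s′ p 0<s s≤s′ covered accepted = record
  { s≤s′ = s≤s′ ; spanning = spans ; sound = snd ; complete = cmp }
  where
  pr = Process C D
  f = entriesOf s (2 ^ k) ρ pr
  g : Lists (recolor D a a′)
  g = withRoot (root-entries p (f root)) f
  spans-entry : ∀ {κ} (v : Vec Bits (suc κ)) → (∀ w → w ∈ Vec.toList v → s * code w + s ≤ s′) →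
    Spanning (2 ^ k) s s′ κ (toEntry s (2 ^ k) ρ v)
  spans-entry (w ∷ []) h = span-code w (h w (here refl)) , label≤ (2 ^ k) (ρ w) , refl
  spans-entry (w ∷ w₁ ∷ []) h = span-code w (h w (here refl)) , span-code w₁ (h w₁ (there (here refl))) , refl
  spans-entry (w ∷ w₁ ∷ w₂ ∷ ws) h = span-code w (h w (here refl)) , span-code w₁ (h w₁ (there (here refl))) ,
    span-code w₂ (h w₂ (there (there (here refl))))
  spans-x : ∀ n {e} → Spanning (2 ^ k) s s′ n e → Span s s′ (x e)
  spans-x 0             h = proj₁ h
  spans-x 1             h = proj₁ h
  spans-x (suc (suc _)) h = proj₁ h
  spans-f : ∀ t e → e ∈ f t → Spanning (2 ^ k) s s′ (δ t) e
  spans-f t e e∈ with ∈-map⁻ (toEntry s (2 ^ k) ρ) e∈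
  ... | v , v∈ , refl = spans-entry v (covered t v v∈)
  spans : Everywhere (recolor D a a′) (Spanning (2 ^ k) s s′) g
  spans root e e∈ with ∈-root-entries⁻ p (f root) e∈
  ... | e′ , e′∈ , _ , refl = span-0 s≤s′ , spans-x (δ {D = D} root) (spans-f root e′ e′∈) , refl
  spans (inRecolor t) e e∈ = spans-f t e e∈
  snd : ∀ λs → Reach (recolor D a a′) g 0 λs → ∃[ b ] (∀ v → λs v ≡ label (2 ^ k) (b v)) × CoreProperty C ρ D b
  snd λs (i , e∈ , r) with ∈-root-entries⁻ p (f root) e∈ | core-sound s (2 ^ k) ρ 0<s D pr λs r
  ... | e′ , _ , pe , eq | α , c , k≡ , l with proj₁ (accepted _) pe
  ...   | w , w∈ , w≡ = (λ v → ρ (α (leafNode D v))) , l , α ,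
      (w , (c , sym (scaled-injective s 0<s (trans w≡ (trans (sym (cong y eq)) k≡)))) , w∈) , λ _ → refl
  cmp : ∀ b → CoreProperty C ρ D b → ∃[ λs ] Reach (recolor D a a′) g 0 λs × (∀ v → λs v ≡ label (2 ^ k) (b v))
  cmp b (α , (w , (c , refl) , w∈) , eq) with core-complete s (2 ^ k) ρ 0<s D pr α c
  ... | r with Reach-entry D f _ r
  ...   | e , e∈ , x≡ = _ , (_ , subst (λ u → ent 0 u 0 ∈ root-entries p (f root)) x≡
      (∈-root-entries⁺ p e∈ (proj₂ (accepted _) (α root , w∈ , sym x≡))) , r) , λ v → cong (label (2 ^ k)) (eq v)

-- The factor counting selected vertices

∈-col⁻ : ∀ vx vy vb sc n {e} → e ∈ col-entries vx vy vb sc n →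
  ∃[ j ] j < n × e ≡ ent (vx + (vb + j * sc)) vy (vb + j * sc)
∈-col⁻ vx vy vb sc (suc n) (here refl) = 0 , s≤s z≤n , cong₂ (λ u v → ent (vx + u) vy v)
    (sym (+-identityʳ vb)) (sym (+-identityʳ vb))
∈-col⁻ vx vy vb sc (suc n) (there e∈) with ∈-col⁻ vx vy (vb + sc) sc n e∈
... | j , j< , refl = suc j , s≤s j< , cong₂ (λ u v → ent (vx + u) vy v) (+-assoc vb sc (j * sc))
    (+-assoc vb sc (j * sc))

∈-col⁺ : ∀ vx vy vb sc n j → j < n → ent (vx + (vb + j * sc)) vy (vb + j * sc) ∈ col-entries vx vy vb sc n
∈-col⁺ vx vy vb sc (suc n) zero    _ = here (cong₂ (λ u v → ent (vx + u) vy v) (+-identityʳ vb) (+-identityʳ vb))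
∈-col⁺ vx vy vb sc (suc n) (suc j) (s≤s j<) =
  there (subst (λ u → ent (vx + u) vy u ∈ col-entries vx vy (vb + sc) sc n) (+-assoc vb sc (j * sc))
      (∈-col⁺ vx vy (vb + sc) sc n j j<))

∈-grid⁻ : ∀ vx vy ly sc c n {e} → e ∈ grid vx vy ly sc c n →
  ∃[ i ] ∃[ j ] i < n × j < c × e ≡ ent ((vx + i * sc) + j * sc) (vy + i * ly) (j * sc)
∈-grid⁻ vx vy ly sc c (suc n) e∈ with ∈-++⁻ (col-entries vx vy 0 sc c) e∈
... | inj₁ h with ∈-col⁻ vx vy 0 sc c h
...   | j , j< , refl = 0 , j , s≤s z≤n , j< , cong₂ (λ u v → ent (u + j * sc) v (j * sc))
    (sym (+-identityʳ vx)) (sym (+-identityʳ vy))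
∈-grid⁻ vx vy ly sc c (suc n) e∈ | inj₂ h with ∈-grid⁻ (vx + sc) (vy + ly) ly sc c n h
...   | i , j , i< , j< , refl = suc i , j , s≤s i< , j< ,
        cong₂ (λ u v → ent (u + j * sc) v (j * sc)) (+-assoc vx sc (i * sc)) (+-assoc vy ly (i * ly))

∈-grid⁺ : ∀ vx vy ly sc c n i j → i < n → j < c → ent ((vx + i * sc) + j * sc) (vy + i * ly) (j * sc) ∈ grid
    vx vy ly sc c n
∈-grid⁺ vx vy ly sc c (suc n) zero j _ j< = ∈-++⁺ˡ
  (subst₂ (λ u v → ent (u + j * sc) v (j * sc) ∈ col-entries vx vy 0 sc c) (sym (+-identityʳ vx))
      (sym (+-identityʳ vy)) (∈-col⁺ vx vy 0 sc c j j<))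
∈-grid⁺ vx vy ly sc c (suc n) (suc i) j (s≤s i<) j< = ∈-++⁺ʳ (col-entries vx vy 0 sc c)
  (subst₂ (λ u v → ent (u + j * sc) v (j * sc) ∈ grid (vx + sc) (vy + ly) ly sc c n) (+-assoc vx sc (i * sc))
      (+-assoc vy ly (i * ly))
     (∈-grid⁺ (vx + sc) (vy + ly) ly sc c n i j i< j<))

count : ∀ {ω} (D : Decomp ω) → (BuiltVertex D → Bool) → ℕ
count (intro v a)      b = bit (b tt)
count (t₁ ⊕ t₂)        b = count t₁ (b ∘ inj₁) + count t₂ (b ∘ inj₂)
count (recolor t a a′)  b = count t b
count (addEdges t a a′) b = count t b

-- As many of the `d` vertices as possible are taken from the left subtree and the remaining ones
-- from the right.
choose : ∀ {ω} (D : Decomp ω) b d → d ≤ count D b →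
  ∃[ b′ ] (∀ v → b′ v ≡ true → b v ≡ true) × count D b′ ≡ d
choose (intro v a) b zero    _ = (λ _ → false) , (λ _ ()) , refl
choose (intro v a) b (suc d) h with b tt in eq
choose (intro v a) b (suc zero)    h | true = b , (λ _ e → e) , cong bit eq
choose (intro v a) b (suc (suc d)) (s≤s ()) | true
choose (t₁ ⊕ t₂) b d h
  with choose t₁ (b ∘ inj₁) (d ⊓ count t₁ (b ∘ inj₁)) (m⊓n≤n d _)
     | choose t₂ (b ∘ inj₂) (d ∸ count t₁ (b ∘ inj₁))
         (≤-trans (∸-monoˡ-≤ (count t₁ (b ∘ inj₁)) h) (≤-reflexive (m+n∸m≡n (count t₁ (b ∘ inj₁)) _)))
... | b₁ , s₁ , c₁ | b₂ , s₂ , c₂ = [ b₁ , b₂ ]′ , (λ { (inj₁ v) → s₁ v ; (inj₂ v) → s₂ v }) ,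
  trans (cong₂ _+_ c₁ c₂) (m⊓n+m∸n≡m d _)
  where
  m⊓n+m∸n≡m : ∀ m n → m ⊓ n + (m ∸ n) ≡ m
  m⊓n+m∸n≡m zero    n       = 0∸n≡0 n
  m⊓n+m∸n≡m (suc m) zero    = refl
  m⊓n+m∸n≡m (suc m) (suc n) = cong suc (m⊓n+m∸n≡m m n)
choose (recolor t a a′)  b d h = choose t b d h
choose (addEdges t a a′) b d h = choose t b d h

count-mono : ∀ {ω} (D : Decomp ω) b b′ → (∀ v → b v ≡ true → b′ v ≡ true) → count D b ≤ count D b′
count-mono (intro v a) b b′ h with b tt in e
... | false = z≤n
... | true  = ≤-reflexive (sym (cong bit (h tt e)))
count-mono (t₁ ⊕ t₂) b b′ h = +-mono-≤ (count-mono t₁ _ _ (h ∘ inj₁)) (count-mono t₂ _ _ (h ∘ inj₂))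
count-mono (recolor t a a′)  b b′ h = count-mono t b b′ h
count-mono (addEdges t a a′) b b′ h = count-mono t b b′ h

module _ (d sc lab : ℕ) where
  counters : ∀ {ω} (D : Decomp ω) → Lists D
  counters D t = counter-entries d sc lab (δ t)

  unary-form : ∀ {k i} → ent k i 0 ∈ counter-entries d sc lab 1 → k ≡ i
  unary-form e∈ with ∈-grid⁻ 0 0 sc sc 1 (suc d) e∈
  ... | i , zero , _ , _ , refl = +-identityʳ (i * sc)
  ... | i , suc j , _ , s≤s () , _

  counter-sound : ∀ {ω} (D : Decomp ω) {k} λs → Reach D (counters D) k λs →
    ∃[ b ] (∀ v → λs v ≡ label lab (b v)) × k ≡ count D b * sc
  counter-sound (intro v a) λs e∈ with ∈-grid⁻ 0 0 lab sc 1 2 e∈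
  ... | zero , zero , _ , _ , eq = (λ _ → false) , (λ _ → cong y eq) , cong x eq
  ... | suc zero , zero , _ , _ , eq = (λ _ → true) , (λ _ → trans (cong y eq) (+-identityʳ lab)) , trans
      (cong x eq) (+-identityʳ _)
  ... | suc (suc i) , _ , s≤s (s≤s ()) , _ , _
  ... | _ , suc j , _ , s≤s () , _
  counter-sound (t₁ ⊕ t₂) λs (i , j , e∈ , r₁ , r₂)
    with counter-sound t₁ _ r₁ | counter-sound t₂ _ r₂ | ∈-grid⁻ 0 0 sc sc (suc d) (suc d) e∈
  ... | b₁ , l₁ , k₁ | b₂ , l₂ , k₂ | i′ , j′ , _ , _ , eq = [ b₁ , b₂ ]′ ,
      (λ { (inj₁ v) → l₁ v ; (inj₂ v) → l₂ v }) ,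
    trans (cong x eq) (trans (cong₂ _+_ (trans (sym (cong y eq)) k₁) (trans (sym (cong z eq)) k₂))
        (sym (*-distribʳ-+ sc (count t₁ b₁) (count t₂ b₂))))
  counter-sound (recolor t a a′) λs (i , e∈ , r) with counter-sound t λs r
  ... | b , l , k≡ = b , l , trans (unary-form e∈) k≡
  counter-sound (addEdges t a a′) λs (i , e∈ , r) with counter-sound t λs r
  ... | b , l , k≡ = b , l , trans (unary-form e∈) k≡

  unary-entry : ∀ n → n ≤ d → ent (n * sc) (n * sc) 0 ∈ counter-entries d sc lab 1
  unary-entry n n≤ = subst (λ u → ent u (n * sc) 0 ∈ grid 0 0 sc sc 1 (suc d)) (+-identityʳ (n * sc))
      (∈-grid⁺ 0 0 sc sc 1 (suc d) n 0 (s≤s n≤) (s≤s z≤n))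

  -- The count of a subtree is at most that of the whole tree, so each entry required along the run
  -- belongs to a grid of side d + 1.
  counter-complete : ∀ {ω} (D : Decomp ω) b → count D b ≤ d → Reach D (counters D) (count D b * sc)
      (λ v → label lab (b v))
  counter-complete (intro v a) b _ with b tt
  ... | false = here refl
  ... | true  = there (here refl)
  counter-complete (t₁ ⊕ t₂) b h = _ , _ ,
    subst (λ u → ent u (count t₁ (b ∘ inj₁) * sc) (count t₂ (b ∘ inj₂) * sc) ∈ grid 0 0 sc sc (suc d) (suc d))
      (sym (*-distribʳ-+ sc (count t₁ (b ∘ inj₁)) (count t₂ (b ∘ inj₂))))
      (∈-grid⁺ 0 0 sc sc (suc d) (suc d) (count t₁ (b ∘ inj₁)) (count t₂ (b ∘ inj₂)) (s≤s h₁) (s≤s h₂)) ,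
    counter-complete t₁ (b ∘ inj₁) h₁ , counter-complete t₂ (b ∘ inj₂) h₂
    where
    h₁ = ≤-trans (m≤m+n (count t₁ (b ∘ inj₁)) _) h
    h₂ = ≤-trans (m≤n+m (count t₂ (b ∘ inj₂)) _) h
  counter-complete (recolor t a a′)  b h = _ , unary-entry _ h , counter-complete t b h
  counter-complete (addEdges t a a′) b h = _ , unary-entry _ h , counter-complete t b h

CountProperty : ∀ {ω} → ℕ → (D : Decomp ω) → (BuiltVertex D → Bool) → Set
CountProperty d D b = count D b ≡ d

-- A join emits sums up to 2d, hence the growth of the scale by twice `d * s`. Sums above `d` are
-- dead ends, since no entry of a parent has such a component. The condition `0 < d` is what makes
-- room for the count 1 of a selected leaf.
counter-factor : ∀ {ω} d (D : Decomp ω) a a′ k s → 0 < s → 0 < d →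
  Factor (recolor D a a′) k s (d * s + d * s + s)
    (withRoot (ent 0 (d * s) 0 ∷ []) (counters d s (2 ^ k) D)) (CountProperty d D)
counter-factor d D a a′ k s 0<s 0<d = record
  { s≤s′ = m≤n+m s _ ; spanning = spans ; sound = snd ; complete = cmp }
  where
  lab = 2 ^ k
  s′ = d * s + d * s + s
  span-multiple : ∀ i → i ≤ d + d → Span s s′ (i * s)
  span-multiple i i≤ = divides i refl , +-monoˡ-≤ s (≤-trans (*-monoˡ-≤ s i≤) (≤-reflexive (*-distribʳ-+ s d d)))
  span-sum : ∀ i j → i + j ≤ d + d → Span s s′ (i * s + j * s)
  span-sum i j h = subst (Span s s′) (*-distribʳ-+ s i j) (span-multiple (i + j) h)
  spans-κ : ∀ κ e → e ∈ counter-entries d s lab κ → Spanning lab s s′ κ e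
  spans-κ 0 e e∈ with ∈-grid⁻ 0 0 lab s 1 2 e∈
  ... | i , zero , s≤s i≤1 , _ , refl = span-sum i 0
      (≤-trans (≤-reflexive (+-identityʳ i)) (≤-trans i≤1 (≤-trans 0<d (m≤m+n d d)))) ,
        ≤-trans (*-monoˡ-≤ lab i≤1) (≤-reflexive (+-identityʳ lab)) , refl
  ... | i , suc j , _ , s≤s () , _
  spans-κ 1 e e∈ with ∈-grid⁻ 0 0 s s 1 (suc d) e∈
  ... | i , zero , s≤s i≤ , _ , refl = span-sum i 0 (+-mono-≤ i≤ z≤n) , span-multiple i
      (≤-trans i≤ (m≤m+n d d)) , refl
  ... | i , suc j , _ , s≤s () , _
  spans-κ (suc (suc κ)) e e∈ with ∈-grid⁻ 0 0 s s (suc d) (suc d) e∈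
  ... | i , j , s≤s i≤ , s≤s j≤ , refl = span-sum i j (+-mono-≤ i≤ j≤) , span-multiple i
      (≤-trans i≤ (m≤m+n d d)) , span-multiple j (≤-trans j≤ (m≤m+n d d))
  g : Lists (recolor D a a′)
  g = withRoot (ent 0 (d * s) 0 ∷ []) (counters d s lab D)
  spans : Everywhere (recolor D a a′) (Spanning lab s s′) g
  spans root e (here refl) = span-multiple 0 z≤n , span-multiple d (m≤m+n d d) , refl
  spans (inRecolor t) e e∈ = spans-κ (δ t) e e∈
  snd : ∀ λs → Reach (recolor D a a′) g 0 λs → ∃[ b ] (∀ v → λs v ≡ label lab (b v)) × CountProperty d D b
  snd λs (i , here refl , r) with counter-sound d s lab D λs r
  ... | b , l , k≡ = b , l , sym (cancel s 0<s k≡)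
    where
    cancel : ∀ s {m n} → 0 < s → m * s ≡ n * s → m ≡ n
    cancel (suc s) _ e = *-cancelʳ-≡ _ _ (suc s) e
  cmp : ∀ b → CountProperty d D b → ∃[ λs ] Reach (recolor D a a′) g 0 λs × (∀ v → λs v ≡ label lab (b v))
  cmp b refl = _ , (_ , here refl , counter-complete d s lab D b ≤-refl) , λ _ → refl

-- Hamming distances

vertices : ∀ {ω} (D : Decomp ω) → List (BuiltVertex D)
vertices (intro v a)      = tt ∷ []
vertices (t₁ ⊕ t₂)        = map inj₁ (vertices t₁) ++ map inj₂ (vertices t₂)
vertices (recolor t a b)  = vertices t
vertices (addEdges t a b) = vertices t

∈-vertices : ∀ {ω} (D : Decomp ω) v → v ∈ vertices D
∈-vertices (intro v a)      tt       = here refl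
∈-vertices (t₁ ⊕ t₂)        (inj₁ v) = ∈-++⁺ˡ (∈-map⁺ inj₁ (∈-vertices t₁ v))
∈-vertices (t₁ ⊕ t₂)        (inj₂ v) = ∈-++⁺ʳ (map inj₁ (vertices t₁)) (∈-map⁺ inj₂ (∈-vertices t₂ v))
∈-vertices (recolor t a b)  v        = ∈-vertices t v
∈-vertices (addEdges t a b) v        = ∈-vertices t v

vertices-unique : ∀ {ω} (D : Decomp ω) → Unique (vertices D)
vertices-unique (intro v a)      = [] ∷ []
vertices-unique (t₁ ⊕ t₂)        = Unique.++⁺ (Unique.map⁺ inj₁-injective (vertices-unique t₁))
  (Unique.map⁺ inj₂-injective (vertices-unique t₂)) disjoint
  where
  disjoint : ∀ {v} → v ∈ map inj₁ (vertices t₁) × v ∈ map inj₂ (vertices t₂) → ⊥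
  disjoint (p , q) with ∈-map⁻ inj₁ p | ∈-map⁻ inj₂ q
  ... | _ , _ , refl | _ , _ , ()
vertices-unique (recolor t a b)  = vertices-unique t
vertices-unique (addEdges t a b) = vertices-unique t

count≡sum : ∀ {ω} (D : Decomp ω) b → count D b ≡ sum (map (bit ∘ b) (vertices D))
count≡sum (intro v a)      b = sym (+-identityʳ _)
count≡sum (t₁ ⊕ t₂)        b = sym (begin
  sum (map (bit ∘ b) (map inj₁ (vertices t₁) ++ map inj₂ (vertices t₂)))
    ≡⟨ cong sum (map-++ (bit ∘ b) (map inj₁ (vertices t₁)) _) ⟩
  sum (map (bit ∘ b) (map inj₁ (vertices t₁)) ++ map (bit ∘ b) (map inj₂ (vertices t₂)))
    ≡⟨ sum-++ (map (bit ∘ b) (map inj₁ (vertices t₁))) _ ⟩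
  sum (map (bit ∘ b) (map inj₁ (vertices t₁))) + sum (map (bit ∘ b) (map inj₂ (vertices t₂)))
    ≡⟨ cong₂ (λ u v → sum u + sum v) (sym (map-∘ (vertices t₁))) (sym (map-∘ (vertices t₂))) ⟩
  sum (map (bit ∘ b ∘ inj₁) (vertices t₁)) + sum (map (bit ∘ b ∘ inj₂) (vertices t₂))
    ≡⟨ cong₂ _+_ (sym (count≡sum t₁ (b ∘ inj₁))) (sym (count≡sum t₂ (b ∘ inj₂))) ⟩
  count t₁ (b ∘ inj₁) + count t₂ (b ∘ inj₂) ∎)
  where open ≡-Reasoning
count≡sum (recolor t a a′)  b = count≡sum t b
count≡sum (addEdges t a a′) b = count≡sum t b

-- The leaves in tree order and the images of the vertices of the graph are two lists without
-- repetition and with the same elements, hence permutations of each other, and sums do not depend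
-- on the order.
count-iso : ∀ {ω n} (D : Decomp ω) (iso : Fin n ↔ BuiltVertex D) b → count D b ≡ sum
    (tabulate (λ i → bit (b (Inverse.to iso i))))
count-iso {n = n} D iso b = begin
  count D b                                     ≡⟨ count≡sum D b ⟩
  sum (map (bit ∘ b) (vertices D))              ≡⟨ sum-↭ (map⁺ (bit ∘ b) same) ⟩
  sum (map (bit ∘ b) (map to (allFin n)))       ≡⟨ cong sum (sym (map-∘ (allFin n))) ⟩
  sum (map (bit ∘ b ∘ to) (allFin n))           ≡⟨ cong sum (map-tabulate id (bit ∘ b ∘ to)) ⟩
  sum (tabulate (bit ∘ b ∘ to))                 ∎
  where
  open ≡-Reasoning
  open Inverse iso
  same : vertices D ↭ map to (allFin n)
  same = ∼bag⇒↭ (unique∧set⇒bag (vertices-unique D)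
      (Unique.map⁺ (λ {i} {j} e → trans (sym (strictlyInverseʳ i)) (trans (cong from e) (strictlyInverseʳ j)))
      (Unique.allFin⁺ n))
    (λ {v} → mk⇔ (λ _ → subst (_∈ map to (allFin n)) (strictlyInverseˡ v) (∈-map⁺ to (∈-allFin (from v))))
        (λ _ → ∈-vertices D v)))

HamDist-sum : ∀ {n} (S S′ : Subset n) → HamDist S S′ ≡ sum (tabulate (λ i → bit (Vec.lookup S i xor Vec.lookup S′ i)))
HamDist-sum []          []           = refl
HamDist-sum (false ∷ S) (false ∷ S′) = HamDist-sum S S′
HamDist-sum (false ∷ S) (true ∷ S′)  = cong suc (HamDist-sum S S′)
HamDist-sum (true ∷ S)  (false ∷ S′) = cong suc (HamDist-sum S S′)
HamDist-sum (true ∷ S)  (true ∷ S′)  = HamDist-sum S S′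

HamDist-count : ∀ {ω n} (D : Decomp ω) (iso : Fin n ↔ BuiltVertex D) (S S′ : Subset n) (b b′ : BuiltVertex D → Bool) →
  (∀ i → Vec.lookup S i ≡ b (Inverse.to iso i)) → (∀ i → Vec.lookup S′ i ≡ b′ (Inverse.to iso i)) →
  HamDist S S′ ≡ count D (λ v → b v xor b′ v)
HamDist-count D iso S S′ b b′ h h′ = trans (HamDist-sum S S′)
  (trans (cong sum (tabulate-cong (λ i → cong₂ (λ u v → bit (u xor v)) (h i) (h′ i)))) (sym (count-iso D iso _)))

≤-foldr-⊓⁺ : ∀ {d} {A : Set} (f : A → ℕ) l → Iff ([ d ] ≤⁺ foldr _⊓⁺_ ⊤⁺ (map (λ a → [ f a ]) l))
    (∀ a → a ∈ l → d ≤ f a)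
≤-foldr-⊓⁺ f []      = (λ _ _ ()) , λ _ → [ _ ] ≤⊤⁺
≤-foldr-⊓⁺ {d} f (a ∷ l) with foldr _⊓⁺_ ⊤⁺ (map (λ a → [ f a ]) l) | ≤-foldr-⊓⁺ {d} f l
... | ⊤⁺    | to , from = (λ { [ h ] _ (here refl) → h ; [ h ] b (there b∈) → to ([ _ ] ≤⊤⁺) b b∈ }) , λ h → [
    h a (here refl) ]
... | [ m ] | to , from = (λ { [ h ] _ (here refl) → ≤-trans h (m⊓n≤m _ m) ; [ h ] b (there b∈) → to [ ≤-trans
    h (m⊓n≤n _ m) ] b b∈ }) ,
  λ h → [ ⊓-glb (h a (here refl)) (unlift (from (λ b b∈ → h b (there b∈)))) ]
  where
  unlift : ∀ {k l : ℕ} → [ k ] ≤⁺ [ l ] → k ≤ l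
  unlift [ h ] = h

DivMin-≥ : ∀ {d r n} (S : Fin r → Subset n) → Iff ([ d ] ≤⁺ DivMin S)
    (∀ i j → toℕ i < toℕ j → d ≤ HamDist (S i) (S j))
DivMin-≥ {d} {r} S with ≤-foldr-⊓⁺ {d} (λ ij → HamDist (S (proj₁ ij)) (S (proj₂ ij))) (indexPairs r)
... | to , from = (λ h i j i<j → to h (i , j)
    (∈-filter⁺ (λ ij → proj₁ ij <ᶠ? proj₂ ij) (∈-cartesianProduct⁺ (∈-allFin i) (∈-allFin j)) i<j)) ,
  λ h → from (λ { (i , j) ij∈ → h i j (proj₂
      (∈-filter⁻ (λ ij → proj₁ ij <ᶠ? proj₂ ij) {xs = cartesianProduct (allFin r) (allFin r)} ij∈)) })

-- The question transferred to bit functions on the leaves. The graph itself then enters only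
-- through the bijection between its vertices and the leaves.
Diverse : ∀ {ω r} (d : ℕ) → (Fin r → Core) → (Fin r → Bits → Bool) → Decomp ω → Set
Diverse {r = r} d C ρ D = Σ (Fin r → BuiltVertex D → Bool) λ b → (∀ i → CoreProperty (C i) (ρ i) D (b i)) ×
  (∀ (i j : Fin r) → toℕ i < toℕ j → d ≤ count D (λ v → b i v xor b j v))

module _ {ℓ r} (P : Fin r → VertexProblem ℓ) (C : Fin r → Core) (ρ : Fin r → Bits → Bool)
  (solves : ∀ i → Solves (C i) (ρ i) (P i)) (d : ℕ) (G : Graph) {ω} (D : Decomp ω) (isD : D IsDecompositionOf G) where

  iso : Fin (order G) ↔ BuiltVertex D
  iso = _IsDecompositionOf_.iso isD

  diverse⇒solution : Diverse d C ρ D → ∃[ S ] DivMinProblem d P G S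
  diverse⇒solution (b , core , far) = S , (λ i → Equivalence.from (solves i G D isD (S i)) (witness i)) ,
    proj₂ (DivMin-≥ S) (λ i j i<j → subst (d ≤_)
        (sym (HamDist-count D iso (S i) (S j) (b i) (b j) (values i) (values j))) (far i j i<j))
    where
    S : Fin r → Subset (order G)
    S i = Vec.tabulate (λ v → b i (Inverse.to iso v))
    values : ∀ i v → Vec.lookup (S i) v ≡ b i (Inverse.to iso v)
    values i v = lookup∘tabulate (λ v → b i (Inverse.to iso v)) v
    witness : ∀ i → ∃[ α ] IsWitness (C i) D α × (∀ v → v ∈ˢ S i ⇔ ρ i (α (Leaf isD v)) ≡ true)
    witness i with core i
    ... | α , wit , eq = α , wit , λ v → mk⇔
      (λ v∈ → trans (eq (Inverse.to iso v)) (trans (sym (values i v)) ([]=⇒lookup v∈)))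
      (λ h → lookup⇒[]= v (S i) (trans (values i v) (trans (sym (eq (Inverse.to iso v))) h)))

  solution⇒diverse : ∃[ S ] DivMinProblem d P G S → Diverse d C ρ D
  solution⇒diverse (S , sol , div) = b , (λ i → α i , proj₁ (proj₂ (witness i)) , λ _ → refl) ,
    λ i j i<j → subst (d ≤_) (HamDist-count D iso (S i) (S j) (b i) (b j) (values i) (values j))
        (proj₁ (DivMin-≥ S) div i j i<j)
    where
    witness : ∀ i → ∃[ α ] IsWitness (C i) D α × (∀ v → v ∈ˢ S i ⇔ ρ i (α (Leaf isD v)) ≡ true)
    witness i = Equivalence.to (solves i G D isD (S i)) (sol i)
    α : ∀ i → Node D → Bits
    α i = proj₁ (witness i)
    b : Fin r → BuiltVertex D → Bool
    b i v = ρ i (α i (leafNode D v))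
    values : ∀ i v → Vec.lookup (S i) v ≡ b i (Inverse.to iso v)
    values i v with Vec.lookup (S i) v in e | b i (Inverse.to iso v) in e′
    ... | true  | true  = refl
    ... | false | false = refl
    ... | true  | false = trans (sym (Equivalence.to (proj₂ (proj₂ (witness i)) v) (lookup⇒[]= v (S i) e))) e′
    ... | false | true  = trans (sym e) ([]=⇒lookup (Equivalence.from (proj₂ (proj₂ (witness i)) v) e′))

-- Labels of compatible selections

pairs : ℕ → List (ℕ × ℕ)
pairs zero    = []
pairs (suc r) = map (λ j → 0 , suc j) (upTo r) ++ map (λ ij → suc (proj₁ ij) , suc (proj₂ ij)) (pairs r)

∈-pairs⁺ : ∀ {i j} r → i < j → j < r → (i , j) ∈ pairs r
∈-pairs⁺ {zero}  {suc j} (suc r) _         (s≤s j<) = ∈-++⁺ˡ (∈-map⁺ (λ j → 0 , suc j) (∈-upTo⁺ j<))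
∈-pairs⁺ {suc i} {suc j} (suc r) (s≤s i<j) (s≤s j<) =
  ∈-++⁺ʳ (map (λ j → 0 , suc j) (upTo r)) (∈-map⁺ (λ ij → suc (proj₁ ij) , suc (proj₂ ij)) (∈-pairs⁺ r i<j j<))

∈-pairs⁻ : ∀ {i j} r → (i , j) ∈ pairs r → i < j × j < r
∈-pairs⁻ (suc r) ij∈ with ∈-++⁻ (map (λ j → 0 , suc j) (upTo r)) ij∈
... | inj₁ h with ∈-map⁻ (λ j → 0 , suc j) h
...   | j , j∈ , refl = s≤s z≤n , s≤s (∈-upTo⁻ j∈)
∈-pairs⁻ (suc r) ij∈ | inj₂ h with ∈-map⁻ (λ ij → suc (proj₁ ij) , suc (proj₂ ij)) h
...   | (i , j) , ij∈′ , refl = let (a , b) = ∈-pairs⁻ r ij∈′ in s≤s a , s≤s b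

-- A pair contributes the factor (d + 1)², so it is twice the number of pairs that has to be
-- compared with the exponent r².
length-pairs : ∀ r → 2 * length (pairs r) ≤ r * r
length-pairs zero    = z≤n
length-pairs (suc r) = subst (λ u → 2 * u ≤ suc r * suc r) (sym len)
  (≤-trans (≤-reflexive (*-distribˡ-+ 2 r (length (pairs r))))
    (≤-trans (+-monoʳ-≤ (2 * r) (length-pairs r))
      (≤-trans (n≤1+n _) (≤-reflexive square))))
  where
  len : length (pairs (suc r)) ≡ r + length (pairs r)
  len = trans (length-++ (map (λ j → 0 , suc j) (upTo r)))
    (cong₂ _+_ (trans (length-map _ (upTo r)) (length-upTo r)) (length-map _ (pairs r)))
  square : suc (2 * r + r * r) ≡ suc r * suc r
  square = cong suc (begin
    (r + (r + 0)) + r * r ≡⟨ cong (λ u → (r + u) + r * r) (+-identityʳ r) ⟩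
    (r + r) + r * r       ≡⟨ +-assoc r r (r * r) ⟩
    r + (r + r * r)       ≡⟨ cong (r +_) (sym (*-suc r r)) ⟩
    r + r * suc r         ∎)
    where open ≡-Reasoning

bitAt : List Bool → ℕ → Bool
bitAt []      _       = false
bitAt (b ∷ l) zero    = b
bitAt (b ∷ l) (suc k) = bitAt l k

-- The bits of a label are those of the r cores followed by those of the pairs.
compatibleFrom : ℕ → List (ℕ × ℕ) → List Bool → Bool
compatibleFrom k []             l = true
compatibleFrom k ((i , j) ∷ ps) l = (if bitAt l k then bitAt l i xor bitAt l j else true) ∧ compatibleFrom
    (suc k) ps l

bitLists : ℕ → List (List Bool)
bitLists zero    = [] ∷ []
bitLists (suc n) = map (false ∷_) (bitLists n) ++ map (true ∷_) (bitLists n)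

∈-bitLists : ∀ l → l ∈ bitLists (length l)
∈-bitLists []          = here refl
∈-bitLists (false ∷ l) = ∈-++⁺ˡ (∈-map⁺ (false ∷_) (∈-bitLists l))
∈-bitLists (true ∷ l)  = ∈-++⁺ʳ (map (false ∷_) (bitLists (length l))) (∈-map⁺ (true ∷_) (∈-bitLists l))

bitLists-length : ∀ n {l} → l ∈ bitLists n → length l ≡ n
bitLists-length zero    (here refl) = refl
bitLists-length (suc n) l∈ with ∈-++⁻ (map (false ∷_) (bitLists n)) l∈
... | inj₁ h with ∈-map⁻ (false ∷_) h
...   | l′ , l′∈ , refl = cong suc (bitLists-length n l′∈)
bitLists-length (suc n) l∈ | inj₂ h with ∈-map⁻ (true ∷_) h
...   | l′ , l′∈ , refl = cong suc (bitLists-length n l′∈)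

select : {A : Set} → (A → Bool) → List A → List A
select p []      = []
select p (a ∷ l) = if p a then a ∷ select p l else select p l

∈-select⁺ : ∀ {A : Set} (p : A → Bool) {a l} → a ∈ l → p a ≡ true → a ∈ select p l
∈-select⁺ p {a} {_ ∷ l} (here refl) h rewrite h = here refl
∈-select⁺ p {a} {a₁ ∷ l} (there a∈) h with p a₁
... | true  = there (∈-select⁺ p a∈ h)
... | false = ∈-select⁺ p a∈ h

∈-select⁻ : ∀ {A : Set} (p : A → Bool) {a} l → a ∈ select p l → a ∈ l × p a ≡ true
∈-select⁻ p (a₁ ∷ l) a∈ with p a₁ in e
∈-select⁻ p (a₁ ∷ l) (here refl) | true = here refl , e
∈-select⁻ p (a₁ ∷ l) (there a∈) | true = let (h , h′) = ∈-select⁻ p l a∈ in there h , h′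
∈-select⁻ p (a₁ ∷ l) a∈ | false = let (h , h′) = ∈-select⁻ p l a∈ in there h , h′

labelWidth : ℕ → ℕ
labelWidth r = length (pairs r) + r

compatible : ℕ → List Bool → Bool
compatible r l = compatibleFrom r (pairs r) l

labels : ℕ → List ℕ
labels r = map (encode 0) (select (compatible r) (bitLists (labelWidth r)))

value : List Bool → ℕ
value []      = 0
value (b ∷ l) = bit b + (value l + value l)

encode≡value : ∀ k l → encode k l ≡ 2 ^ k * value l
encode≡value k []      = sym (*-zeroʳ (2 ^ k))
encode≡value k (b ∷ l) = trans (cong₂ _+_ (head b) tail) (sym (*-distribˡ-+ (2 ^ k) (bit b) (value l + value l)))
  where
  head : ∀ b → label (2 ^ k) b ≡ 2 ^ k * bit b
  head false = sym (*-zeroʳ (2 ^ k))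
  head true  = sym (*-identityʳ (2 ^ k))
  tail : encode (suc k) l ≡ 2 ^ k * (value l + value l)
  tail = trans (encode≡value (suc k) l) (trans (cong (λ u → (2 ^ k + u) * value l) (+-identityʳ (2 ^ k)))
    (trans (*-distribʳ-+ (value l) (2 ^ k) (2 ^ k)) (sym (*-distribˡ-+ (2 ^ k) (value l) (value l)))))

value-injective : ∀ l l′ → length l ≡ length l′ → value l ≡ value l′ → l ≡ l′
value-injective []          []           _ _ = refl
value-injective (false ∷ l) (false ∷ l′) e h = cong (false ∷_)
    (value-injective l l′ (suc-injective e) (double-injective _ _ h))
value-injective (true ∷ l)  (true ∷ l′)  e h = cong (true ∷_)
    (value-injective l l′ (suc-injective e) (double-injective _ _ (suc-injective h)))
value-injective (false ∷ l) (true ∷ l′)  e h = ⊥-elim (double≢suc-double (value l) (value l′) h)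
value-injective (true ∷ l)  (false ∷ l′) e h = ⊥-elim (double≢suc-double (value l′) (value l) (sym h))

-- Among lists of the full length the number determines the bits. Hence one table access decides the
-- compatibility of all bits at a leaf.
∈-labels : ∀ r l → length l ≡ labelWidth r → Iff (encode 0 l ∈ labels r) (compatible r l ≡ true)
∈-labels r l len = to , λ h → ∈-map⁺ (encode 0)
    (∈-select⁺ (compatible r) (subst (λ u → l ∈ bitLists u) len (∈-bitLists l)) h)
  where
  to : encode 0 l ∈ labels r → compatible r l ≡ true
  to h with ∈-map⁻ (encode 0) h
  ... | l′ , l′∈ , e with ∈-select⁻ (compatible r) (bitLists (labelWidth r)) l′∈
  ...   | l′∈′ , c = subst (λ u → compatible r u ≡ true) (value-injective l′ l
            (trans (bitLists-length (labelWidth r) l′∈′) (sym len))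
            (trans (sym (trans (encode≡value 0 l′) (+-identityʳ _)))
                (trans (sym e) (trans (encode≡value 0 l) (+-identityʳ _))))) c

value-< : ∀ l → value l < 2 ^ length l
value-< []          = s≤s z≤n
value-< (b ∷ l) = ≤-trans (≤-trans (s≤s (+-monoˡ-≤ (value l + value l) (bit≤1 b)))
    (≤-reflexive (cong suc (sym (+-suc (value l) (value l))))))
  (≤-trans (+-mono-≤ (value-< l) (value-< l)) (≤-reflexive (cong (2 ^ length l +_) (sym (+-identityʳ _)))))
  where
  bit≤1 : ∀ b → bit b ≤ 1
  bit≤1 false = z≤n
  bit≤1 true  = s≤s z≤n

labels-< : ∀ r {k} → k ∈ labels r → k < 2 ^ labelWidth r
labels-< r k∈ with ∈-map⁻ (encode 0) k∈
... | l , l∈ , refl = subst₂ _<_ (sym (trans (encode≡value 0 l) (+-identityʳ _)))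
  (cong (2 ^_) (bitLists-length (labelWidth r)
      (proj₁ (∈-select⁻ (compatible r) (bitLists (labelWidth r)) l∈)))) (value-< l)

compatible-zeros : ∀ k ps l → (∀ m → k ≤ m → bitAt l m ≡ false) → compatibleFrom k ps l ≡ true
compatible-zeros k []             l h = refl
compatible-zeros k ((i , j) ∷ ps) l h rewrite h k ≤-refl = compatible-zeros (suc k) ps l
    (λ m le → h m (≤-trans (n≤1+n k) le))

-- Once the bit is placed, the recursion continues with an index just outside the remaining list, so
-- that all later bits are false.
single : ℕ → ℕ → Bool → List Bool
single zero    n       c = []
single (suc n) zero    c = c ∷ single n n c
single (suc n) (suc i) c = false ∷ single n i c

length-single : ∀ n i c → length (single n i c) ≡ n
length-single zero    i       c = refl
length-single (suc n) zero    c = cong suc (length-single n n c)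
length-single (suc n) (suc i) c = cong suc (length-single n i c)

bitAt-single : ∀ n i c m → m ≢ i → bitAt (single n i c) m ≡ false
bitAt-single zero    i       c m       _  = refl
bitAt-single (suc n) zero    c zero    ne = ⊥-elim (ne refl)
bitAt-single (suc n) zero    c (suc m) _  = beyond n n c m ≤-refl
  where
  beyond : ∀ n i c m → n ≤ i → bitAt (single n i c) m ≡ false
  beyond zero    i       c m       _ = refl
  beyond (suc n) (suc i) c zero    _ = refl
  beyond (suc n) (suc i) c (suc m) (s≤s h) = beyond n i c m h
bitAt-single (suc n) (suc i) c zero    _  = refl
bitAt-single (suc n) (suc i) c (suc m) ne = bitAt-single n i c m (λ e → ne (cong suc e))

encode-beyond : ∀ k n i c → n ≤ i → encode k (single n i c) ≡ 0
encode-beyond k zero    i       c _       = refl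
encode-beyond k (suc n) (suc i) c (s≤s h) = encode-beyond (suc k) n i c h

encode-single : ∀ k n i c → i < n → encode k (single n i c) ≡ label (2 ^ (i + k)) c
encode-single k (suc n) zero    c _       = trans
    (cong (label (2 ^ k) c +_) (encode-beyond (suc k) n n c ≤-refl)) (+-identityʳ _)
encode-single k (suc n) (suc i) c (s≤s h) = trans (encode-single (suc k) n i c h)
    (cong (λ u → label (2 ^ u) c) (+-suc i k))

-- A label in which no pair is selected satisfies all conditions. Therefore the same label table
-- serves when a core is evaluated alone: it admits both values of the bit of that core.
single-label : ∀ r i c → i < r → label (2 ^ i) c ∈ labels r
single-label r i c i<r = subst (_∈ labels r)
  (trans (encode-single 0 (labelWidth r) i c (≤-trans i<r (m≤n+m r _)))
      (cong (λ u → label (2 ^ u) c) (+-identityʳ i)))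
  (proj₂ (∈-labels r (single (labelWidth r) i c) (length-single _ i c))
    (compatible-zeros r (pairs r) _ (λ m le → bitAt-single (labelWidth r) i c m (λ e → <⇒≱ i<r (subst (r ≤_) e le)))))

funAt : {V : Set} → List (V → Bool) → ℕ → V → Bool
funAt []       _       = λ _ → false
funAt (b ∷ bs) zero    = b
funAt (b ∷ bs) (suc k) = funAt bs k

bitAt-at : ∀ {V : Set} (bs : List (V → Bool)) k v → bitAt (at bs v) k ≡ funAt bs k v
bitAt-at []       k       v = refl
bitAt-at (b ∷ bs) zero    v = refl
bitAt-at (b ∷ bs) (suc k) v = bitAt-at bs k v

funAt-++ : ∀ {V : Set} (bs : List (V → Bool)) {cs} k → funAt (bs ++ cs) (length bs + k) ≡ funAt cs k
funAt-++ []       k = refl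
funAt-++ (b ∷ bs) k = funAt-++ bs k

funAt-++ˡ : ∀ {V : Set} (bs : List (V → Bool)) {cs} k → k < length bs → funAt (bs ++ cs) k ≡ funAt bs k
funAt-++ˡ (b ∷ bs) zero    _       = refl
funAt-++ˡ (b ∷ bs) (suc k) (s≤s h) = funAt-++ˡ bs k h

funAt-tabulate : ∀ {V : Set} {r} (b : Fin r → V → Bool) i → funAt (tabulate b) (toℕ i) ≡ b i
funAt-tabulate b zero    = refl
funAt-tabulate b (suc i) = funAt-tabulate (b ∘ suc) i

position : ∀ {A : Set} {a : A} {l} → a ∈ l → ℕ
position (here _)  = 0
position (there h) = suc (position h)

position-< : ∀ {A : Set} {a : A} {l} (h : a ∈ l) → position h < length l
position-< (here _)  = s≤s z≤n
position-< (there h) = s≤s (position-< h)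

compatible⇒xor : ∀ k ps l {i j} → compatibleFrom k ps l ≡ true → (h : (i , j) ∈ ps) →
  bitAt l (position h + k) ≡ true → bitAt l i xor bitAt l j ≡ true
compatible⇒xor k ((i , j) ∷ ps) l c (here refl) e rewrite e with bitAt l i xor bitAt l j
... | true = refl
compatible⇒xor k (_ ∷ ps) l c (there h) e = compatible⇒xor (suc k) ps l (∧-right c) h
  (subst (λ u → bitAt l u ≡ true) (sym (+-suc (position h) k)) e)
  where
  ∧-right : ∀ {a b} → a ∧ b ≡ true → b ≡ true
  ∧-right {true} e = e

xor⇒compatible : ∀ k ps l → (∀ {i j} (h : (i , j) ∈ ps) → bitAt l (position h + k) ≡ true → bitAt l i xor
    bitAt l j ≡ true) →
  compatibleFrom k ps l ≡ true
xor⇒compatible k [] l h = refl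
xor⇒compatible k ((i , j) ∷ ps) l h = cong₂ _∧_ head
  (xor⇒compatible (suc k) ps l λ m e → h (there m) (subst (λ u → bitAt l u ≡ true) (+-suc (position m) k) e))
  where
  head : (if bitAt l k then bitAt l i xor bitAt l j else true) ≡ true
  head with bitAt l k in e
  ... | false = refl
  ... | true  = h (here refl) e

satisfy-tabulate : ∀ {V : Set} {r} (b : Fin r → V → Bool) (Q : Fin r → (V → Bool) → Set) → (∀ i → Q i (b i)) →
  tabulate b satisfy tabulate Q
satisfy-tabulate {r = zero}  b Q h = []
satisfy-tabulate {r = suc r} b Q h = h zero ∷ satisfy-tabulate (b ∘ suc) (Q ∘ suc) (h ∘ suc)

satisfy-++ : ∀ {V : Set} {bs cs : List (V → Bool)} {Qs Rs} → bs satisfy Qs → cs satisfy Rs → (bs ++ cs)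
    satisfy (Qs ++ Rs)
satisfy-++ []      h′ = h′
satisfy-++ (q ∷ h) h′ = q ∷ satisfy-++ h h′

satisfy-core : ∀ {V : Set} {r} (Q : Fin r → (V → Bool) → Set) {Rs bs} → bs satisfy (tabulate Q ++ Rs) → ∀ i →
    Q i (funAt bs (toℕ i))
satisfy-core {r = suc r} Q (q ∷ h) zero    = q
satisfy-core {r = suc r} Q (q ∷ h) (suc i) = satisfy-core (Q ∘ suc) h i

satisfy-pair : ∀ {V : Set} {r} (Q : Fin r → (V → Bool) → Set) {R p bs} → bs satisfy (tabulate Q ++ replicate p R) →
  ∀ k → k < p → R (funAt bs (k + r))
satisfy-pair {r = suc r} Q {R} {p} {b ∷ bs} (q ∷ h) k k<p =
  subst (λ u → R (funAt (b ∷ bs) u)) (sym (+-suc k r)) (satisfy-pair (Q ∘ suc) h k k<p)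
satisfy-pair {r = zero} Q {p = suc p} (q ∷ h) zero    _       = q
satisfy-pair {r = zero} Q {p = suc p} (q ∷ h) (suc k) (s≤s h′) = satisfy-pair {r = zero} (λ ()) h k h′

satisfy-length : ∀ {V : Set} {bs : List (V → Bool)} {Qs} → bs satisfy Qs → length bs ≡ length Qs
satisfy-length []      = refl
satisfy-length (q ∷ h) = cong suc (satisfy-length h)

choose-pairs : ∀ {ω} d (D : Decomp ω) (f : ℕ → BuiltVertex D → Bool) ps →
  (∀ {i j} → (i , j) ∈ ps → d ≤ count D (λ v → f i v xor f j v)) →
  ∃[ cs ] cs satisfy replicate (length ps) (CountProperty d D) ×
    (∀ {i j} (h : (i , j) ∈ ps) v → funAt cs (position h) v ≡ true → f i v xor f j v ≡ true)
choose-pairs d D f [] far = [] , [] , λ ()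
choose-pairs d D f ((i , j) ∷ ps) far with choose D (λ v → f i v xor f j v) d (far (here refl)) | choose-pairs
    d D f ps (far ∘ there)
... | c , sub , eq | cs , sat , h = c ∷ cs , eq ∷ sat , λ { (here refl) v → sub v ; (there m) v → h m v }

at-length : ∀ {V : Set} (bs : List (V → Bool)) v → length (at bs v) ≡ length bs
at-length bs v = length-map (λ b → b v) bs

module _ {r ω} (d : ℕ) (C : Fin r → Core) (ρ : Fin r → Bits → Bool) (D : Decomp ω) where

  properties : List (Property D)
  properties = tabulate (λ i → CoreProperty (C i) (ρ i) D) ++ replicate (length (pairs r)) (CountProperty d D)

  Compatible : Set₁
  Compatible = ∃[ bs ] bs satisfy properties × (∀ v → encode 0 (at bs v) ∈ labels r)

  satisfying-length : ∀ {bs} → bs satisfy properties → length bs ≡ labelWidth r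
  satisfying-length sat = trans (satisfy-length sat) (trans (length-++ (tabulate (λ i → CoreProperty (C i) (ρ i) D)))
    (trans (cong₂ _+_ (length-tabulate (λ i → CoreProperty (C i) (ρ i) D))
        (length-replicate (length (pairs r)))) (+-comm r _)))

  compatible⇒diverse : Compatible → Diverse d C ρ D
  compatible⇒diverse (bs , sat , good) = (λ i → funAt bs (toℕ i)) , satisfy-core _ sat , far
    where
    -- The selection belonging to the pair has exactly `d` vertices, and compatibility of the labels
    -- makes the two sets differ at each of them.
    far : ∀ i j → toℕ i < toℕ j → d ≤ count D (λ v → funAt bs (toℕ i) v xor funAt bs (toℕ j) v)
    far i j i<j = subst (_≤ count D (λ v → funAt bs (toℕ i) v xor funAt bs (toℕ j) v))
      (satisfy-pair _ sat (position m) (position-< m)) (count-mono D _ _ different)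
      where
      m : (toℕ i , toℕ j) ∈ pairs r
      m = ∈-pairs⁺ r i<j (toℕ<n j)
      different : ∀ v → funAt bs (position m + r) v ≡ true → funAt bs (toℕ i) v xor funAt bs (toℕ j) v ≡ true
      different v e = trans (sym (cong₂ _xor_ (bitAt-at bs (toℕ i) v) (bitAt-at bs (toℕ j) v)))
        (compatible⇒xor r (pairs r) (at bs v)
          (proj₁ (∈-labels r (at bs v) (trans (at-length bs v) (satisfying-length sat))) (good v)) m
          (trans (bitAt-at bs (position m + r) v) e))

  diverse⇒compatible : Diverse d C ρ D → Compatible
  diverse⇒compatible (b , core , far) with choose-pairs d D (funAt (tabulate b)) (pairs r) far′
    where
    far′ : ∀ {i j} → (i , j) ∈ pairs r → d ≤ count D (λ v → funAt (tabulate b) i v xor funAt (tabulate b) j v)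
    far′ {i} {j} ij∈ with ∈-pairs⁻ r ij∈
    ... | i<j , j<r = subst₂ (λ f g → d ≤ count D (λ v → f v xor g v)) (at-index (<-trans i<j j<r)) (at-index j<r)
          (far (fromℕ< (<-trans i<j j<r)) (fromℕ< j<r)
              (subst₂ _<_ (sym (toℕ-fromℕ< (<-trans i<j j<r))) (sym (toℕ-fromℕ< j<r)) i<j))
      where
      at-index : ∀ {k} (k<r : k < r) → b (fromℕ< k<r) ≡ funAt (tabulate b) k
      at-index k<r = trans (sym (funAt-tabulate b (fromℕ< k<r))) (cong (funAt (tabulate b)) (toℕ-fromℕ< k<r))
  ... | cs , sat , sub = tabulate b ++ cs , sat′ , λ v → proj₂
      (∈-labels r _ (trans (at-length (tabulate b ++ cs) v) (satisfying-length sat′)))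
      (xor⇒compatible r (pairs r) (at (tabulate b ++ cs) v) λ {i} {j} h e → let (i<j , j<r) = ∈-pairs⁻ r h in
        trans (cong₂ _xor_ (core-bit v (<-trans i<j j<r)) (core-bit v j<r))
            (sub h v (trans (sym (pair-bit v (position h))) e)))
    where
    sat′ : (tabulate b ++ cs) satisfy properties
    sat′ = satisfy-++ (satisfy-tabulate b _ core) sat
    bs : List (BuiltVertex D → Bool)
    bs = tabulate b
    core-bit : ∀ v {i} → i < r → bitAt (at (bs ++ cs) v) i ≡ funAt bs i v
    core-bit v {i} i<r = trans (bitAt-at (bs ++ cs) i v)
        (cong (λ g → g v) (funAt-++ˡ bs i (subst (i <_) (sym (length-tabulate b)) i<r)))
    pair-bit : ∀ v k → bitAt (at (bs ++ cs) v) (k + r) ≡ funAt cs k v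
    pair-bit v k = trans (cong (bitAt (at (bs ++ cs) v)) (trans (+-comm k r) (cong (_+ k) (sym (length-tabulate b)))))
      (trans (bitAt-at (bs ++ cs) (length bs + k) v) (cong (λ g → g v) (funAt-++ bs k)))

-- The main program: one core

∈-concatMap : ∀ {A B : Set} (f : A → List B) {l a b} → a ∈ l → b ∈ f a → b ∈ concatMap f l
∈-concatMap f (here refl) b∈ = ∈-++⁺ˡ b∈
∈-concatMap f {a₁ ∷ l} (there a∈) b∈ = ∈-++⁺ʳ (f a₁) (∈-concatMap f a∈ b∈)

∈-nodes : ∀ {ω} {D : Decomp ω} (t : Node D) → t ∈ nodes D
∈-nodes {D = intro v a}      root = here refl
∈-nodes {D = t₁ ⊕ t₂}        root = ∈-++⁺ʳ (map left (nodes t₁)) (∈-++⁺ʳ (map right (nodes t₂)) (here refl))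
∈-nodes {D = recolor t a b}  root = ∈-++⁺ʳ (map inRecolor (nodes t)) (here refl)
∈-nodes {D = addEdges t a b} root = ∈-++⁺ʳ (map inAddEdges (nodes t)) (here refl)
∈-nodes (left t)            = ∈-++⁺ˡ (∈-map⁺ left (∈-nodes t))
∈-nodes {D = t₁ ⊕ t₂} (right t) = ∈-++⁺ʳ (map left (nodes t₁)) (∈-++⁺ˡ (∈-map⁺ right (∈-nodes t)))
∈-nodes (inRecolor t)       = ∈-++⁺ˡ (∈-map⁺ inRecolor (∈-nodes t))
∈-nodes (inAddEdges t)      = ∈-++⁺ˡ (∈-map⁺ inAddEdges (∈-nodes t))

innerNodes : ∀ {ω} (D : Decomp ω) → List (Node D)
innerNodes (intro v a)      = []
innerNodes (t₁ ⊕ t₂)        = map left (nodes t₁) ++ map right (nodes t₂)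
innerNodes (recolor t a b)  = map inRecolor (nodes t)
innerNodes (addEdges t a b) = map inAddEdges (nodes t)

nodes-root : ∀ {ω} (D : Decomp ω) → nodes D ≡ innerNodes D ++ root ∷ []
nodes-root (intro v a)      = refl
nodes-root (t₁ ⊕ t₂)        = sym (++-assoc (map left (nodes t₁)) _ _)
nodes-root (recolor t a b)  = refl
nodes-root (addEdges t a b) = refl

1≤∣V∣ : ∀ {ω} (D : Decomp ω) → 1 ≤ ∣V D ∣
1≤∣V∣ D = subst (1 ≤_) (sym (trans (cong length (nodes-root D))
    (trans (length-++ (innerNodes D)) (+-comm (length (innerNodes D)) 1)))) (s≤s z≤n)

δ≤2 : ∀ {ω} {D : Decomp ω} (t : Node D) → δ t ≤ 2
δ≤2 {D = intro v a}      root = z≤n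
δ≤2 {D = t₁ ⊕ t₂}        root = ≤-refl
δ≤2 {D = recolor t a b}  root = s≤s z≤n
δ≤2 {D = addEdges t a b} root = s≤s z≤n
δ≤2 (left t)       = δ≤2 t
δ≤2 (right t)      = δ≤2 t
δ≤2 (inRecolor t)  = δ≤2 t
δ≤2 (inAddEdges t) = δ≤2 t

All-map : ∀ {A B : Set} {Q : B → Set} (f : A → B) l → (∀ a → Q (f a)) → All Q (map f l)
All-map f []      h = []
All-map f (a ∷ l) h = h a ∷ All-map f l h

acceptedBy : ℕ → List Bits → ℕ → Bool
acceptedBy sc []       k = false
acceptedBy sc (w ∷ ws) k = (sc * code w ≡ᵇ k) ∨ acceptedBy sc ws k

acceptedBy-iff : ∀ sc ws k → Iff (acceptedBy sc ws k ≡ true) (∃[ w ] w ∈ ws × sc * code w ≡ k)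
acceptedBy-iff sc [] k = (λ ()) , λ { (_ , () , _) }
acceptedBy-iff sc (w ∷ ws) k with sc * code w ≟ k
... | yes refl rewrite ≡ᵇ-refl (sc * code w) = (λ _ → w , here refl , refl) , λ _ → refl
... | no ne rewrite ≢⇒≡ᵇ ne = (λ h → let (w′ , w′∈ , e) = proj₁ (acceptedBy-iff sc ws k) h in w′ , there w′∈ , e) ,
  λ { (_ , here refl , e) → ⊥-elim (ne e) ; (w′ , there w′∈ , e) → proj₂ (acceptedBy-iff sc ws k) (w′ , w′∈ , e) }

module _ {q : ℕ} (oracle : Fin q → Bits → Bool) (xs : List ℕ) where
  open Semantics oracle xs

  -- A step emits at most one number. The output of a core, and with it the work of parsing and
  -- evaluating that core, is therefore charged to its running time.
  output-length : ∀ {p s s′ k} → p , s ⇓[ k ] s′ → length (output s′) ≤ length (output s) + k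
  output-length (skip {s})   = m≤m+n _ 1
  output-length assign       = m≤m+n _ _
  output-length (emit {o = o}) = ≤-trans (≤-reflexive (length-++ o)) (+-monoʳ-≤ (length o) (s≤s z≤n))
  output-length feed         = m≤m+n _ _
  output-length ask          = m≤m+n _ _
  output-length (seq {s = s} {k = k} e e′) =
    ≤-trans (output-length e′) (≤-trans (+-monoˡ-≤ _ (output-length e))
        (≤-reflexive (+-assoc (length (output s)) k _)))
  output-length (if-nz {e = e} {s = s} {k = k} _ x) = ≤-trans (output-length x)
      (+-monoʳ-≤ (length (output s)) (m≤n+m k (suc (cost e))))
  output-length (if-z {e = e} {s = s} {k = k} _ x)  = ≤-trans (output-length x)
      (+-monoʳ-≤ (length (output s)) (m≤n+m k (suc (cost e))))
  output-length (while-nz {e = e} {s = s} {k = k} {l} _ x y) =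
    ≤-trans (output-length y) (≤-trans (+-monoˡ-≤ l (output-length x))
      (≤-trans (≤-reflexive (+-assoc (length (output s)) k l))
        (+-monoʳ-≤ (length (output s)) (≤-trans (m≤n+m (k + l) (suc (cost e)))
            (≤-reflexive (cong suc (sym (+-assoc (cost e) k l))))))))
  output-length (while-z _)  = m≤m+n _ _

size-bound : ∀ {ω} (C : Core) (D : Decomp ω) t → length (Process C D t) ≤ Size C D
size-bound C D t = go (nodes D) (∈-nodes t)
  where
  go : ∀ l → t ∈ l → length (Process C D t) ≤ foldr _⊔_ 0 (map (λ t → length (Process C D t)) l)
  go (_ ∷ l) (here refl) = m≤m⊔n _ _
  go (u ∷ l) (there t∈)  = ≤-trans (go l t∈) (m≤n⊔m (length (Process C D u)) _)

-- Counts the cells occupied in the pool, end marks included; the time of an evaluation is linear in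
-- it even if many lists are empty.
entry-count : List (List Entry) → ℕ
entry-count []       = 0
entry-count (l ∷ ls) = suc (length l) + entry-count ls

eval-weight≤ : ∀ ls → eval-weight ls ≤ 7 * entry-count ls
eval-weight≤ []       = z≤n
eval-weight≤ (l ∷ ls) = ≤-trans (+-mono-≤
    (≤-trans (≤-reflexive (cong (7 +_) (*-comm (length l) 2)))
    (linear (# 7 :+ 2 :* v₀) (7 :* (# 1 :+ v₀)) (length l ∷ []))) (eval-weight≤ ls))
  (≤-reflexive (sym (*-distribˡ-+ 7 (suc (length l)) (entry-count ls))))

stage : ∀ {q} → Core → Fin q → Prog q
stage C i = block (OC ≔ const 0 ∷ []) ⨾ (simulate (core-array (toℕ i)) (program C) ⨾ parse i (2 ^ toℕ i))

module Assembly (r : ℕ) (ρ : Fin r → Bits → Bool) (d : ℕ) {ω : ℕ} (D : Decomp ω) (a : Fin ω) (wf : WellFormed D) where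

  xs : List ℕ
  xs = d ∷ encodeDecomp D

  open Logic ρ xs
  open CrossRuns ρ xs
  open EvalRuns ρ xs
  open CounterRuns ρ xs

  -- Recolouring `a` to itself supplies the unary node above the root of `D` at which acceptance is
  -- tested; it leaves the leaves as they are.
  D⁺ : Decomp ω
  D⁺ = recolor D a a

  b₀ n : ℕ
  b₀ = 2 ^ labelWidth r
  n  = ∣V D ∣

  record Common (s : State) : Set where
    field
      kinds  : Numbers (memory s) KIND 0 (map δ (nodes D) ++ 1 ∷ [])
      number : memory s N 0 ≡ suc n
      table  : ∀ k → Iff (memory s TAB k ≢ 0) (k ∈ labels r)
      base   : memory s BASE 0 ≡ b₀
      quiet  : query s ≡ []
      silent : output s ≡ []

  open Common

  Common-frame : ∀ {p s s′} → Frame p s s′ →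
    modifies p KIND ∨ (modifies p N ∨ (modifies p TAB ∨ (modifies p BASE ∨ emits p))) ≡ false →
    query s′ ≡ [] → Common s → Common s′
  Common-frame {p} fr h qu cm
    with modifies p KIND in e₁ | modifies p N in e₂ | modifies p TAB in e₃ | modifies p BASE in e₄ | emits p in e₅
  Common-frame {p} fr h qu cm | false | false | false | false | false = record
    { kinds = Numbers-≗ (same-memory fr KIND e₁) (kinds cm)
    ; number = trans (same-memory fr N e₂ 0) (number cm)
    ; table = λ k → (λ nz → proj₁ (table cm k) λ z → nz (trans (same-memory fr TAB e₃ k) z)) ,
                    (λ k∈ z → proj₂ (table cm k) k∈ (trans (sym (same-memory fr TAB e₃ k)) z))
    ; base = trans (same-memory fr BASE e₄ 0) (base cm)
    ; quiet = qu ; silent = trans (same-output fr e₅) (silent cm) }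

  -- The arrays of cores not yet simulated are still 0, so each simulation begins in the initial
  -- memory that its core expects.
  Fresh : ℕ → Memory → Set
  Fresh k m = ∀ j → k ≤ j → ∀ b x → m (core-array j b) x ≡ 0

  record Staged (C : Core) (i : Fin r) (sc : ℕ) (s s′ : State) : Set where
    field
      common  : Common s′
      fresh   : Fresh (suc (toℕ i)) (memory s′)
      acc     : ∀ k → memory s′ SC 0 ≤ k → memory s′ ACC k ≡ 0
      lists   : Lists D⁺
      factor  : Factor D⁺ (toℕ i) sc (memory s′ SC 0) lists (CoreProperty C (ρ i) D)
      appended : Appends (memory s) (memory s′) (flat (map lists (nodes D⁺)))
      sized   : ∀ t → length (lists t) ≤ Size C D
      total   : entry-count (map lists (nodes D⁺)) ≤ 2 * τ C D

  simulate-≋ : ∀ i (C : Core) {s s′} → Frame (simulate {r} (core-array i) (program C)) s s′ → memory s ≋ memory s′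
  simulate-≋ i C fr = pool-refl (same F refl refl (λ _ → refl)) (same X refl refl (λ _ → refl))
      (same Y refl refl (λ _ → refl))
      (same Z refl refl (λ _ → refl)) (same TOP refl refl (λ _ → refl))
    where
    same : ∀ b → (OUT ≡ᵇ b) ≡ false → (OC ≡ᵇ b) ≡ false → (∀ b′ → (core-array i b′ ≡ᵇ b) ≡ false) → ∀ k → _
    same b h₁ h₂ h₃ = same-memory fr b (modifies-simulate (core-array i) (program C) b h₁ h₂ h₃)

  stage-run : ∀ (C : Core) i sc s → Common s → Fresh (toℕ i) (memory s) → memory s SC 0 ≡ sc → 0 < sc →
    (∀ k → sc ≤ k → memory s ACC k ≡ 0) → Run (stage C i) s (32 * τ C D) (Staged C i sc s)
  stage-run C i sc s cm fr₀ scl 0<sc acc₀ = weaken weight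
      (seq-run (block-run _ (seq-run (map-run after-simulation (framed
      (simulate-run execution′ (record { arrays = λ b k → fr₀ (toℕ i) ≤-refl b k ; number = refl ; stored = []
          })))))))
    where
    φ : ℕ → ℕ
    φ = core-array (toℕ i)
    open SimulationRuns ρ d (encodeDecomp D) φ (λ e → core-index-injective (toℕ i) (+-cancelˡ-≡ 64 _ _ e))
        (λ _ → refl) (λ _ → refl) (λ _ → refl) (λ _ → refl)
    pr : Tuples D
    pr = Process C D
    ws : List Bits
    ws = Accept C D
    lab : ℕ
    lab = 2 ^ toℕ i
    p : ℕ → Bool
    p = acceptedBy sc ws
    f : Lists D
    f = entriesOf sc lab (ρ i) pr
    g : Lists D⁺
    g = withRoot (root-entries p (f root)) f
    module Parsing = ParseRuns ρ xs i
    item : Node D → Parsing.Item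
    item t = δ t , pr t
    its : List Parsing.Item
    its = map item (innerNodes D)
    all-items : map item (nodes D) ≡ its ++ item root ∷ []
    all-items = trans (cong (map item) (nodes-root D)) (map-++ item (innerNodes D) _)
    ys symbols : List ℕ
    ys = encodeCoreData D pr ws
    symbols = concatMap Parsing.item-symbols (its ++ item root ∷ []) ++ (concatMap encodeBits ws ++ 3 ∷ [])
    ys≡ : ys ≡ symbols
    ys≡ = cong (_++ (concatMap encodeBits ws ++ 3 ∷ []))
        (trans (sym (concatMap-map Parsing.item-symbols item (nodes D)))
        (cong (concatMap Parsing.item-symbols) all-items))
    final-state : State
    final-state = proj₁ (Core.computes C D wf)
    execution′ = proj₁ (proj₂ (Core.computes C D wf))
    output≡ : output final-state ≡ ys
    output≡ = proj₂ (proj₂ (Core.computes C D wf))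
    S≤τ : length symbols ≤ τ C D
    S≤τ = ≤-trans (≤-reflexive (cong length (trans (sym ys≡) (sym output≡))))
        (output-length noOracle (encodeDecomp D) execution′)
    1≤S : 1 ≤ length symbols
    1≤S = ≤-trans (≤-trans (m≤n+m 1 _) (≤-reflexive (sym (length-++ (concatMap encodeBits ws)))))
        (≤-trans (m≤n+m _ _) (≤-reflexive (sym (length-++ (concatMap Parsing.item-symbols (its ++ item root ∷ []))))))
    -- One unit for resetting the output counter, one per simulated step and 30 per output symbol.
    -- The output is not empty and not longer than the running time, so all three are charged to
    -- `τ`.
    weight : 1 + (τ C D + 30 * length symbols) ≤ 32 * τ C D
    weight = ≤-trans (+-mono-≤ (≤-trans 1≤S S≤τ) (+-monoʳ-≤ (τ C D) (*-monoʳ-≤ 30 S≤τ)))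
      (linear (v₀ :+ (v₀ :+ 30 :* v₀)) (32 :* v₀) (τ C D ∷ []))
    m₁ : Memory
    m₁ = run-block xs (memory s) (OC ≔ const 0 ∷ [])
    s₁ : State
    s₁ = ⟨ m₁ , query s , output s ⟩
    after-simulation : ∀ s₂ → Simulates final-state s₂ × Frame (simulate φ (program C)) s₁ s₂ → Run
        (parse i lab) s₂ (30 * length symbols) (Staged C i sc s)
    after-simulation s₂ (sim , fr) = map-run finish (framed (Parsing.parse-run sc lab p its (item root) ws s₂
        (subst (All _) all-items (All-map item (nodes D) δ≤2)) qu₂ (trans (same SC refl refl (λ _ → refl) 0) scl)
        (subst (Numbers (memory s₂) OUT 0) (trans output≡ ys≡) (Simulates.stored sim))
        (Numbers-≗ (same KIND refl refl (λ _ → refl))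
            (subst (Numbers m₁ KIND 0) kinds≡ (Numbers-≗ (λ _ → refl)
            (proj₁ (Numbers-++⁻ (map δ (nodes D)) (kinds cm))))))
        (trans (same N refl refl (λ _ → refl) 0)
            (trans (number cm) (cong suc (trans (sym (length-map item (nodes D))) (cong length all-items)))))
        (λ k le → trans (same ACC refl refl (λ _ → refl) k) (acc₀ k le))
        (acceptedBy-iff sc ws) 0<sc))
      where
      same : ∀ b → (OUT ≡ᵇ b) ≡ false → (OC ≡ᵇ b) ≡ false → (∀ b′ → (φ b′ ≡ᵇ b) ≡ false) → ∀ k → memory s₂ b k
          ≡ m₁ b k
      same b h₁ h₂ h₃ = same-memory fr b (modifies-simulate φ (program C) b h₁ h₂ h₃)
      qu₂ : query s₂ ≡ []
      qu₂ = trans (same-query fr (proj₁ (silent-simulate φ (program C)))) (quiet cm)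
      kinds≡ : map δ (nodes D) ≡ map proj₁ (its ++ item root ∷ [])
      kinds≡ = trans (map-∘ (nodes D)) (cong (map proj₁) all-items)
      cm₂ : Common s₂
      cm₂ = record
        { kinds = Numbers-≗ (same KIND refl refl (λ _ → refl)) (Numbers-≗ {memory s} {m₁} (λ _ → refl) (kinds cm))
        ; number = trans (same N refl refl (λ _ → refl) 0) (number cm)
        ; table = λ k → (λ nz → proj₁ (table cm k) λ z → nz (trans (same TAB refl refl (λ _ → refl) k) z)) ,
                        (λ k∈ z → proj₂ (table cm k) k∈ (trans (sym (same TAB refl refl (λ _ → refl) k)) z))
        ; base = trans (same BASE refl refl (λ _ → refl) 0) (base cm)
        ; quiet = qu₂ ; silent = trans (same-output fr (proj₂ (silent-simulate φ (program C)))) (silent cm) }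
      finish : ∀ s′ → _ × Frame (parse i lab) s₂ s′ → Staged C i sc s s′
      finish s′ ((qu , sc≤ , covers , acc′ , ap) , fr′) = record
        { common = Common-frame fr′ refl qu cm₂
        ; fresh = λ j j> b k → trans (same-memory fr′ (core-array j b) refl k)
            (trans (same (core-array j b) refl refl (λ b′ → ≢⇒≡ᵇ (core-index-disjoint (toℕ i) j j>)) k)
                (fr₀ j (<⇒≤ j>) b k))
        ; acc = acc′
        ; lists = g
        ; factor = core-factor C (ρ i) D a a (toℕ i) sc (memory s′ SC 0) p 0<sc sc≤ covered (acceptedBy-iff sc ws)
        ; appended = Appends-after (≋-trans (untouched {memory s} {m₁} (λ _ → refl))
            (simulate-≋ (toℕ i) C fr)) (subst (Appends (memory s₂) (memory s′)) (cong flat lists≡) ap)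
        ; sized = sized
        ; total = ≤-trans total (*-monoʳ-≤ 2 S≤τ) }
        where
        covered : ∀ t v → v ∈ pr t → ∀ w → w ∈ Vec.toList v → sc * code w + sc ≤ memory s′ SC 0
        covered t v v∈ w w∈ = covers w (∈-++⁺ˡ
            (∈-concatMap Parsing.item-strings (subst (item t ∈_) all-items (∈-map⁺ item (∈-nodes t)))
            (∈-concatMap Vec.toList v∈ w∈)))
        lists≡ : map (Parsing.item-entries sc lab) (its ++ item root ∷ []) ++ root-entries p (f root) ∷ [] ≡
            map g (nodes D⁺)
        lists≡ = trans (cong (_++ root-entries p (f root) ∷ [])
            (trans (cong (map (Parsing.item-entries sc lab)) (sym all-items)) (sym (map-∘ (nodes D)))))
          (trans (sym (map-nodes-un inRecolor g root [])) (++-identityʳ _))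
        sized : ∀ t → length (g t) ≤ Size C D
        sized root = ≤-trans (length-root-entries p (f root))
            (≤-trans (≤-reflexive (length-map _ (pr root))) (size-bound C D root))
        sized (inRecolor t) = ≤-trans (≤-reflexive (length-map _ (pr t))) (size-bound C D t)
        per-item : ∀ t → suc (length (f t)) ≤ length (encodeTuples (pr t))
        per-item t = ≤-trans (s≤s (≤-reflexive (length-map _ (pr t)))) (tuples (pr t))
          where
          tuples : ∀ {κ} (vs : List (Vec Bits (suc κ))) → suc (length vs) ≤ length (encodeTuples vs)
          tuples []       = s≤s z≤n
          tuples (v ∷ vs) = ≤-trans (≤-reflexive (+-comm 1 (suc (length vs))))
              (≤-trans (≤-reflexive (+-comm (suc (length vs)) 1))
            (≤-trans (+-mono-≤ (Parsing.1≤length-encodeTuple v) (tuples vs))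
                (≤-reflexive (sym (trans (cong length (++-assoc (Parsing.encodeTuple v) _ (3 ∷ [])))
                (length-++ (Parsing.encodeTuple v)))))))
        entry-count-++ : ∀ ls {ls′} → entry-count (ls ++ ls′) ≡ entry-count ls + entry-count ls′
        entry-count-++ []       = refl
        entry-count-++ (l ∷ ls) = trans (cong (suc (length l) +_) (entry-count-++ ls))
            (sym (+-assoc (suc (length l)) _ _))
        per-items : ∀ ts → entry-count (map f ts) ≤ length (concatMap (λ t → encodeTuples (pr t)) ts)
        per-items []       = z≤n
        per-items (t ∷ ts) = ≤-trans (+-mono-≤ (per-item t) (per-items ts))
            (≤-reflexive (sym (length-++ (encodeTuples (pr t)))))
        nodes≤S : entry-count (map f (nodes D)) ≤ length symbols
        nodes≤S = ≤-trans (per-items (nodes D))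
            (≤-trans (m≤m+n _ _) (≤-reflexive (trans
            (sym (length-++ (concatMap (λ t → encodeTuples (pr t)) (nodes D)))) (cong length ys≡))))
        root≤S : suc (length (root-entries p (f root))) ≤ length symbols
        root≤S = ≤-trans (s≤s (length-root-entries p (f root)))
            (≤-trans (≤-trans (m≤n+m _ (entry-count (map f (innerNodes D))))
            (≤-trans (+-monoʳ-≤ (entry-count (map f (innerNodes D))) (m≤m+n _ 0))
          (≤-reflexive (trans (sym (entry-count-++ (map f (innerNodes D))))
              (cong entry-count (trans (sym (map-++ f (innerNodes D) _))
              (cong (map f) (sym (nodes-root D))))))))) nodes≤S)
        -- The list of the additional root is no longer than that of the root below it, hence the
        -- factor 2.
        total : entry-count (map g (nodes D⁺)) ≤ 2 * length symbols
        total = ≤-trans (≤-reflexive (trans (cong entry-count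
            (trans (sym (++-identityʳ _)) (map-nodes-un inRecolor g root [])))
            (entry-count-++ (map f (nodes D))))) (+-mono-≤ nodes≤S (+-monoˡ-≤ 0 root≤S))

-- The main program: all phases

module _ {q : ℕ} where
  stages : ∀ {m} → (Fin m → Core) → (Fin m → Fin q) → Prog q
  stages {zero}  C ι = skip
  stages {suc m} C ι = stage (C zero) (ι zero) ⨾ stages (C ∘ suc) (ι ∘ suc)

  repeat : ℕ → Prog q → Prog q
  repeat zero    p = skip
  repeat (suc m) p = p ⨾ repeat m p

  note-result check : Prog q
  note-result = ifnz var RES then skip else block (OK ≔ const 0 ∷ [])
  check = evaluate ⨾ note-result

  counters-from : ℕ → ℕ → Prog q
  counters-from k zero    = skip
  counters-from k (suc p) = counter (2 ^ k) ⨾ counters-from (suc k) p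

  -- The product starts at the position saved in `HA` and becomes the first factor of the next
  -- multiplication. `QB` has moved behind the second factor, which is where the following factor
  -- begins.
  cross-next : Prog q
  cross-next = block (HA ≔ var TOP ∷ []) ⨾ (cross ⨾ block (PA ≔ var HA ∷ []))

  modifies-repeat : ∀ m p b → modifies p b ≡ false → modifies (repeat m p) b ≡ false
  modifies-repeat zero    p b h = refl
  modifies-repeat (suc m) p b h = cong₂ _∨_ h (modifies-repeat m p b h)

  silent-repeat : ∀ m p → queries p ≡ false → emits p ≡ false → queries (repeat m p) ≡ false × emits
      (repeat m p) ≡ false
  silent-repeat zero    p h h′ = refl , refl
  silent-repeat (suc m) p h h′ = let (a , b) = silent-repeat m p h h′ in cong₂ _∨_ h a , cong₂ _∨_ h′ b

within-mono : ∀ {l s S} κ e → s ≤ S → Within l s κ e → Within l S κ e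
within-mono 0             e le (a , h) = ≤-trans a le , h
within-mono 1             e le (a , b , h) = ≤-trans a le , ≤-trans b le , h
within-mono (suc (suc _)) e le (a , b , c) = ≤-trans a le , ≤-trans b le , ≤-trans c le

2^-mono-< : ∀ {i j} → i < j → 2 ^ i < 2 ^ j
2^-mono-< = ^-monoʳ-< 2 ≤-refl

1≤product : ∀ {ks} → All (1 ≤_) ks → 1 ≤ product ks
1≤product []       = ≤-refl
1≤product (h ∷ hs) = *-mono-≤ h (1≤product hs)

Satisfiable : ∀ {V : Set} → List ((V → Bool) → Set) → Set₁
Satisfiable = All (λ Q → ∃[ b ] Q b)

module Phases (r : ℕ) (ρ : Fin r → Bits → Bool) (0<r : 0 < r) (d : ℕ) {ω : ℕ} (D : Decomp ω) (a : Fin ω)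
    (wf : WellFormed D) where

  open Assembly r ρ d D a wf
  open Logic ρ xs
  open CrossRuns ρ xs
  open EvalRuns ρ xs
  open CounterRuns ρ xs

  nds : List (Node D⁺)
  nds = nodes D⁺

  n⁺ : ℕ
  n⁺ = length nds

  n⁺≡ : n⁺ ≡ suc n
  n⁺≡ = trans (length-++ (map inRecolor (nodes D)))
      (trans (cong (_+ 1) (length-map inRecolor (nodes D))) (+-comm n 1))

  δ-nodes : map δ nds ≡ map δ (nodes D) ++ 1 ∷ []
  δ-nodes = trans (sym (++-identityʳ _)) (map-nodes-un {D = D⁺} inRecolor δ root [])

  slotsOf : Lists D⁺ → List Slot
  slotsOf g = flat (map g nds)

  poolOf : List (Lists D⁺) → List Slot
  poolOf = concatMap slotsOf

  entriesIn : List (Lists D⁺) → ℕ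
  entriesIn []       = 0
  entriesIn (g ∷ gs) = entry-count (map g nds) + entriesIn gs

  Sized : List (Lists D⁺) → List ℕ → Set
  Sized = Pointwise (λ g k → ∀ t → length (g t) ≤ k)

  W : ℕ → Set
  W k = k ∈ labels r

  W0 : W 0
  W0 = single-label r 0 false 0<r

  b₀>0 : 0 < b₀
  b₀>0 = m^n>0 2 (labelWidth r)

  record AllStaged {m} (C : Fin m → Core) (ι : Fin m → Fin r) (k sc : ℕ) (s s′ : State) : Set₁ where
    field
      common   : Common s′
      factorLists : List (Lists D⁺)
      factors  : Factors D⁺ k sc (memory s′ SC 0) factorLists (tabulate (λ j → CoreProperty (C j) (ρ (ι j)) D))
      appended : Appends (memory s) (memory s′) (poolOf factorLists)
      sized    : Sized factorLists (tabulate (λ j → Size (C j) D))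
      total    : entriesIn factorLists ≤ 2 * sum (tabulate (λ j → τ (C j) D))

  stages-run : ∀ {m} (C : Fin m → Core) (ι : Fin m → Fin r) k s sc → (∀ j → toℕ (ι j) ≡ toℕ j + k) →
    Common s → Fresh k (memory s) → memory s SC 0 ≡ sc → 0 < sc → (∀ j → sc ≤ j → memory s ACC j ≡ 0) →
    Run (stages C ι) s (1 + 32 * sum (tabulate (λ j → τ (C j) D))) (AllStaged C ι k sc s)
  stages-run {zero} C ι k s sc ι≡ cm fr scl 0<sc acc = skip-run (record
    { common = cm ; factorLists = [] ; factors = subst (λ u → Factors D⁺ k sc u [] []) (sym scl) []
    ; appended = ≋⇒Appends (λ _ _ _ → refl) ; sized = [] ; total = z≤n })
  stages-run {suc m} C ι k s sc ι≡ cm fr scl 0<sc acc = weaken weight (seq-run (map-run next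
      (stage-run (C zero) (ι zero) sc s cm (subst (λ u → Fresh u (memory s)) (sym (ι≡ zero)) fr) scl 0<sc acc)))
    where
    Στ = sum (tabulate (λ j → τ (C (suc j)) D))
    weight : 32 * τ (C zero) D + (1 + 32 * Στ) ≤ 1 + 32 * (τ (C zero) D + Στ)
    weight = linear (32 :* v₀ :+ (# 1 :+ 32 :* v₁)) (# 1 :+ 32 :* (v₀ :+ v₁)) (τ (C zero) D ∷ Στ ∷ [])
    next : ∀ s₁ → Staged (C zero) (ι zero) sc s s₁ → Run (stages (C ∘ suc) (ι ∘ suc)) s₁ (1 + 32 * Στ)
        (AllStaged C ι k sc s)
    next s₁ st = map-run (λ s₂ rest → record
        { common = AllStaged.common rest
        ; factorLists = st.lists ∷ AllStaged.factorLists rest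
        ; factors = subst (λ u → Factor D⁺ u sc (memory s₁ SC 0) st.lists
            (CoreProperty (C zero) (ρ (ι zero)) D)) (ι≡ zero) st.factor ∷ AllStaged.factors rest
        ; appended = Appends-trans st.appended (AllStaged.appended rest)
        ; sized = st.sized ∷ AllStaged.sized rest
        ; total = ≤-trans (+-mono-≤ st.total (AllStaged.total rest))
            (≤-reflexive (sym (*-distribˡ-+ 2 (τ (C zero) D) Στ))) })
      (stages-run (C ∘ suc) (ι ∘ suc) (suc k) s₁ (memory s₁ SC 0) (λ j → trans (ι≡ (suc j)) (sym (+-suc (toℕ j) k)))
        st.common (subst (λ u → Fresh (suc u) (memory s₁)) (ι≡ zero) st.fresh) refl
            (≤-trans 0<sc (Factor.s≤s′ st.factor)) st.acc)
      where module st = Staged st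

  module Checking (S : ℕ) (b₀≤S : b₀ ≤ S) (stop : ℕ) where

    record Checkable (m : Memory) (rest : List Slot) : Set where
      field
        ready  : Ready W b₀ S b₀≤S b₀>0 [] stop m
        scale  : m SC 0 ≡ S
        number : m N 0 ≡ n⁺
        kinds  : Numbers m KIND 0 (map δ nds)
        next   : Seg m (m PC 0) rest
        cursor : m PC 0 + length rest ≡ stop

    open Checkable

    Checkable-frame : ∀ {p s s′ rest} → Frame p s s′ → Checkable (memory s) rest →
      Ready W b₀ S b₀≤S b₀>0 [] stop (memory s′) → Seg (memory s′) (memory s′ PC 0) rest → memory s′ PC 0 +
          length rest ≡ stop →
      modifies p SC ∨ (modifies p N ∨ modifies p KIND) ≡ false → Checkable (memory s′) rest
    Checkable-frame {p} fr ck rd sg cu h with modifies p SC in e₁ | modifies p N in e₂ | modifies p KIND in e₃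
    ... | false | false | false = record
      { ready = rd ; scale = trans (same-memory fr SC e₁ 0) (scale ck) ; number = trans
          (same-memory fr N e₂ 0) (number ck)
      ; kinds = Numbers-≗ (same-memory fr KIND e₃) (kinds ck) ; next = sg ; cursor = cu }

    evaluate-product : ∀ g l s rest → Everywhere D⁺ (Within l S) g → l < b₀ → Checkable (memory s)
        (slotsOf g ++ rest) →
      Run evaluate s (3 + 7 * entry-count (map g nds)) λ s′ →
        Iff (memory s′ RES 0 ≢ 0) (Reachable W D⁺ g 0) × Checkable (memory s′) rest × Frame evaluate s s′
    evaluate-product g l s rest wi l< ck = weaken (+-monoʳ-≤ 3 (eval-weight≤ (map g nds)))
      (map-run (λ s′ ((res , rd , sg , cu) , fr) → res , record
          { ready = record { base≥ = Ready.base≥ rd ; labels = Ready.labels rd ; fresh = Ready.fresh rd }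
          ; scale = trans (same-memory fr SC refl 0) (scale ck)
          ; number = trans (same-memory fr N refl 0) (number ck) ; kinds = Numbers-≗
              (same-memory fr KIND refl) (kinds ck) ; next = sg ; cursor = cu } , fr)
        (framed (evaluate-run W b₀ S b₀≤S b₀>0 rest stop D⁺ g (within-bounded D⁺ l< wi) s
          (record { base≥ = Ready.base≥ (ready ck) ; labels = Ready.labels (ready ck) ; fresh = Ready.fresh
              (ready ck) })
          (scale ck) (number ck) (kinds ck) (next ck) (cursor ck))))

    -- The separate evaluations already use the final scale `S` for their tables. Tables wider than
    -- the states of a core cost nothing, since they are neither cleared nor traversed.
    factor-within : ∀ {k s s′ g Q} → 0 < s → s′ ≤ S → Factor D⁺ k s s′ g Q → Everywhere D⁺ (Within (2 ^ k) S) g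
    factor-within 0<s s′≤S fa t e e∈ = within-mono (δ t) e s′≤S (Spanning⇒Within D⁺ 0<s (Factor.spanning fa) t e e∈)

    factor-reachable : ∀ {k s s′ g Q} → 0 < s → s′ ≤ S → k < r → Factor D⁺ k s s′ g Q → Iff
        (Reachable W D⁺ g 0) (∃[ b ] Q b)
    factor-reachable {k} {g = g} 0<s s′≤S k<r fa =
      (λ h → let (λs , re , _) = Reachable⇒Reach W W0 D⁺ g (within-padded D⁺ (factor-within 0<s s′≤S fa)) h
                 (b , _ , qb) = Factor.sound fa λs re in b , qb) ,
      (λ (b , qb) → let (λs , re , eq) = Factor.complete fa b qb in
         Reach⇒Reachable W W0 D⁺ g λs re (λ v → subst W (sym (eq v)) (single-label r k (b v) k<r)))

    note-run : ∀ {U V : Set} s → Iff (memory s RES 0 ≢ 0) V → Iff (memory s OK 0 ≢ 0) U →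
      Run note-result s 2 λ s′ → Iff (memory s′ OK 0 ≢ 0) (U × V)
    note-run s res ok = if-run
      (λ h → skip-run ((λ o → proj₁ ok o , proj₁ res h) , λ (u , _) → proj₂ ok u))
      (λ h → block-run _ ((λ o → ⊥-elim (o refl)) , λ (_ , v) → ⊥-elim (proj₂ res v h)))

    -- The effect of `note-result` is handed out as a function of the state, because after the first
    -- evaluation the position of the second factor is saved before the result is noted.
    check-run : ∀ {k s s′ g Q} {U : Set} st rest → 0 < s → s′ ≤ S → k < r → Factor D⁺ k s s′ g Q →
      Checkable (memory st) (slotsOf g ++ rest) → Iff (memory st OK 0 ≢ 0) U →
      Run evaluate st (3 + 7 * entry-count (map g nds)) λ st₁ → Checkable (memory st₁) rest × Frame evaluate st st₁ ×
        (∀ st₂ → memory st₂ RES 0 ≡ memory st₁ RES 0 → memory st₂ OK 0 ≡ memory st₁ OK 0 →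
           Run note-result st₂ 2 λ st′ → Iff (memory st′ OK 0 ≢ 0) (U × (∃[ b ] Q b)))
    check-run st rest 0<s s′≤S k<r fa ck ok = map-run (λ st₁ (res , ck₁ , fr) → ck₁ , fr , λ st₂ e e′ → note-run st₂
        ((λ h → proj₁ (factor-reachable 0<s s′≤S k<r fa) (proj₁ res λ z → h (trans e z))) ,
         (λ q z → proj₂ res (proj₂ (factor-reachable 0<s s′≤S k<r fa) q) (trans (sym e) z)))
        ((λ h → proj₁ ok λ z → h (trans e′ (trans (same-memory fr OK refl 0) z))) ,
         (λ u z → proj₂ ok u (trans (sym (trans e′ (same-memory fr OK refl 0))) z))))
      (evaluate-product _ _ st rest (factor-within 0<s s′≤S fa)
          (2^-mono-< (≤-trans k<r (m≤n+m r (length (pairs r))))) ck)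

    checks-run : ∀ {k s s′ gs Qs} {U : Set} st rest → 0 < s → s′ ≤ S → k + length gs ≤ r → Factors D⁺ k s s′ gs Qs →
      Checkable (memory st) (poolOf gs ++ rest) → Iff (memory st OK 0 ≢ 0) U →
      Run (repeat (length gs) check) st (1 + 12 * entriesIn gs) λ st′ →
        Checkable (memory st′) rest × (memory st′ OK 0 ≢ 0 → U × Satisfiable Qs) ×
            (U × Satisfiable Qs → memory st′ OK 0 ≢ 0)
    checks-run st rest 0<s s′≤S k≤ [] ck ok = skip-run (ck , (λ h → proj₁ ok h , []) , λ (u , _) → proj₂ ok u)
    checks-run {k} {gs = g ∷ gs} st rest 0<s s′≤S k≤ (fa ∷ fas) ck ok = weaken weight (seq-run (seq-run (map-run
        (λ st₁ (ck₁ , _ , note) → map-run (λ st₂ (ok₂ , fr₂) → map-run (λ st₃ (ck₃ , to , from) → ck₃ ,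
              (λ h → let ((u , q) , qs) = to h in u , q ∷ qs) , λ { (u , q ∷ qs) → from ((u , q) , qs) })
            (checks-run st₂ rest (≤-trans 0<s (Factor.s≤s′ fa)) s′≤S
                (≤-trans (≤-reflexive (sym (+-suc k (length gs)))) k≤) fas
               (Checkable-frame fr₂ ck₁ (record { base≥ = subst (b₀ ≤_) (sym (same-memory fr₂ BASE refl 0))
                   (Ready.base≥ (ready ck₁))
                   ; labels = λ j j< → (λ h → proj₁ (Ready.labels (ready ck₁) j j<) λ z → h
                       (trans (same-memory fr₂ TAB refl j) z)) ,
                                       (λ w z → proj₂ (Ready.labels (ready ck₁) j j<) w
                                           (trans (sym (same-memory fr₂ TAB refl j)) z))
                   ; fresh = λ j le → trans (same-memory fr₂ TAB refl j)
                       (Ready.fresh (ready ck₁) j (subst (_≤ j) (same-memory fr₂ BASE refl 0) le)) })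
                 (Seg-at (sym (same-memory fr₂ PC refl 0)) (Seg-≋ (frame-≋ fr₂ refl) (next ck₁)))
                     (trans (cong (_+ _) (same-memory fr₂ PC refl 0)) (cursor ck₁)) refl) ok₂))
          (framed (note st₁ refl refl)))
        (check-run st (poolOf gs ++ rest) 0<s (≤-trans (factors-≤ fas) s′≤S)
            (≤-trans (≤-trans (s≤s (m≤m+n k _)) (≤-reflexive (sym (+-suc k (length gs))))) k≤) fa
           (record { ready = ready ck ; scale = scale ck ; number = number ck ; kinds = kinds ck
                   ; next = subst (Seg (memory st) (memory st PC 0)) (++-assoc (slotsOf g) (poolOf gs) rest) (next ck)
                   ; cursor = trans (cong (λ u → memory st PC 0 + length u)
                       (sym (++-assoc (slotsOf g) (poolOf gs) rest))) (cursor ck) }) ok))))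
      where
      E = entry-count (map g nds)
      1≤E : 1 ≤ E
      1≤E with nds | n⁺≡
      ... | t ∷ ts | _ = s≤s z≤n
      weight : ((3 + 7 * E) + 2) + (1 + 12 * entriesIn gs) ≤ 1 + 12 * (E + entriesIn gs)
      weight = ≤-trans (linear (((# 3 :+ 7 :* v₀) :+ # 2) :+ (# 1 :+ 12 :* v₁))
          (# 1 :+ (7 :* v₀ :+ 5 :* # 1) :+ 12 :* v₁) (E ∷ entriesIn gs ∷ []))
        (≤-trans (+-monoˡ-≤ (12 * entriesIn gs) (+-monoʳ-≤ 1 (+-monoʳ-≤ (7 * E) (*-monoʳ-≤ 5 1≤E))))
          (linear (# 1 :+ (7 :* v₀ :+ 5 :* v₀) :+ 12 :* v₁) (# 1 :+ 12 :* (v₀ :+ v₁)) (E ∷ entriesIn gs ∷ [])))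

  square : ℕ
  square = suc d * suc d

  length-col : ∀ vx vy vb sc c → length (col-entries vx vy vb sc c) ≡ c
  length-col vx vy vb sc zero    = refl
  length-col vx vy vb sc (suc c) = cong suc (length-col vx vy (vb + sc) sc c)

  length-grid : ∀ vx vy ly sc c m → length (grid vx vy ly sc c m) ≡ m * c
  length-grid vx vy ly sc c zero    = refl
  length-grid vx vy ly sc c (suc m) = trans (length-++ (col-entries vx vy 0 sc c))
    (cong₂ _+_ (length-col vx vy 0 sc c) (length-grid (vx + sc) (vy + ly) ly sc c m))

  -- The condition `0 < d` is due to the leaves: they have two entries, while (d + 1)² is 1 for d =
  -- 0.
  length-counter : 0 < d → ∀ sc lab κ → length (counter-entries d sc lab κ) ≤ square
  length-counter 0<d sc lab 0             = ≤-trans (*-mono-≤ {2} {suc d} {1} {1} (s≤s 0<d) ≤-refl)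
      (≤-trans (≤-reflexive (*-identityʳ (suc d))) (m≤m+n (suc d) (d * suc d)))
  length-counter 0<d sc lab 1             = ≤-trans
      (≤-reflexive (trans (length-grid 0 0 sc sc 1 (suc d)) (*-identityʳ (suc d)))) (m≤m+n (suc d) (d * suc d))
  length-counter 0<d sc lab (suc (suc κ)) = ≤-reflexive (length-grid 0 0 sc sc (suc d) (suc d))

  record Counted (k p sc : ℕ) (s s′ : State) : Set₁ where
    field
      factorLists : List (Lists D⁺)
      factors  : Factors D⁺ k sc (memory s′ SC 0) factorLists (replicate p (CountProperty d D))
      appended : Appends (memory s) (memory s′) (poolOf factorLists)
      sized    : Sized factorLists (replicate p square)

  counters-frame : ∀ k p b → (∀ lab → modifies (counter {r} lab) b ≡ false) → modifies (counters-from {r} k p)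
      b ≡ false
  counters-frame k zero    b h = refl
  counters-frame k (suc p) b h = cong₂ _∨_ (h (2 ^ k)) (counters-frame (suc k) p b h)

  counters-silent : ∀ k p → queries (counters-from {r} k p) ≡ false × emits (counters-from {r} k p) ≡ false
  counters-silent k zero    = refl , refl
  counters-silent k (suc p) = counters-silent (suc k) p

  counters-weight : ℕ
  counters-weight = 6 + d * 2 + n * (6 + (2 + d) * (4 + (1 + d) * 2))

  counters-run : 0 < d → ∀ k p s → 0 < memory s SC 0 → memory s N 0 ≡ n⁺ → Numbers (memory s) KIND 0 (map δ nds) →
    Run (counters-from k p) s (1 + p * counters-weight) (Counted k p (memory s SC 0) s)
  counters-run 0<d k zero    s 0<sc nn kd = skip-run (record
    { factorLists = [] ; factors = [] ; appended = ≋⇒Appends (λ _ _ _ → refl) ; sized = [] })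
  counters-run 0<d k (suc p) s 0<sc nn kd = weaken weight (seq-run (map-run next (framed
      (counter-run (2 ^ k) (map δ (nodes D)) s (All-map δ (nodes D) δ≤2)
        (proj₁ (Numbers-++⁻ (map δ (nodes D)) (subst (Numbers (memory s) KIND 0) δ-nodes kd)))
        (trans nn (trans n⁺≡ (cong suc (sym (length-map δ (nodes D))))))))))
    where
    sc = memory s SC 0
    lab = 2 ^ k
    g : Lists D⁺
    g = withRoot (ent 0 (d * sc) 0 ∷ []) (counters d sc lab D)
    lists≡ : map (counter-entries d sc lab) (map δ (nodes D)) ++ (ent 0 (d * sc) 0 ∷ []) ∷ [] ≡ map g nds
    lists≡ = trans (cong (_++ (ent 0 (d * sc) 0 ∷ []) ∷ []) (sym (map-∘ (nodes D))))
      (trans (sym (map-nodes-un {D = D⁺} inRecolor g root [])) (++-identityʳ _))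
    weight : (6 + d * 2 + length (map δ (nodes D)) * (6 + (2 + d) * (4 + (1 + d) * 2))) +
        (1 + p * counters-weight) ≤ 1 + (counters-weight + p * counters-weight)
    weight = ≤-reflexive (trans (+-suc _ (p * counters-weight))
        (cong (λ u → suc (6 + d * 2 + u * (6 + (2 + d) * (4 + (1 + d) * 2)) + p * counters-weight))
        (length-map δ (nodes D))))
    sized : ∀ t → length (g t) ≤ square
    sized root          = s≤s z≤n
    sized (inRecolor t) = length-counter 0<d sc lab (δ t)
    next : ∀ s₁ → _ × Frame (counter lab) s s₁ → Run (counters-from (suc k) p) s₁ (1 + p * counters-weight)
        (Counted k (suc p) sc s)
    next s₁ ((ap , sc₁) , fr) = map-run (λ s₂ rest → record
        { factorLists = g ∷ Counted.factorLists rest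
        ; factors = subst (λ u → Factor D⁺ k sc u g (CountProperty d D)) (sym sc₁)
            (counter-factor d D a a k sc 0<sc 0<d) ∷ Counted.factors rest
        ; appended = Appends-trans (subst (Appends (memory s) (memory s₁)) (cong flat lists≡) ap)
            (Counted.appended rest)
        ; sized = sized ∷ Counted.sized rest })
      (counters-run 0<d (suc k) p s₁ (≤-trans 0<sc (≤-trans (m≤n+m sc _) (≤-reflexive (sym sc₁))))
        (trans (same-memory fr N refl 0) nn) (Numbers-≗ (same-memory fr KIND refl) kd))

  zipWith-map : ∀ (f g : Lists D⁺) ts → zipWith crossₑ (map f ts) (map g ts) ≡ map (f ⊗ g) ts
  zipWith-map f g []       = refl
  zipWith-map f g (t ∷ ts) = cong (crossₑ (f t) (g t) ∷_) (zipWith-map f g ts)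

  length-crossₑ : ∀ l l′ → length (crossₑ l l′) ≡ length l * length l′
  length-crossₑ []      l′ = refl
  length-crossₑ (e ∷ l) l′ = trans (length-++ (map (e ⊕ₑ_) l′))
      (cong₂ _+_ (length-map (e ⊕ₑ_) l′) (length-crossₑ l l′))

  length-⊗ : ∀ {f g : Lists D⁺} {i j} → (∀ t → length (f t) ≤ i) → (∀ t → length (g t) ≤ j) → ∀ t → length
      ((f ⊗ g) t) ≤ i * j
  length-⊗ {f} {g} h h′ t = ≤-trans (≤-reflexive (length-crossₑ (f t) (g t))) (*-mono-≤ (h t) (h′ t))

  module Crossing (M : ℕ) where

    crossing-weight : ℕ
    crossing-weight = 17 * (n⁺ * M)

    -- Every intermediate product must be built, so each of them has to be within `M`. This follows
    -- from the bound on the last one, because all sizes still to come are at least 1; an empty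
    -- factor at the end could hide arbitrarily large products before it.
    crosses-run : ∀ gs zs f z s rest → Sized gs zs → (∀ t → length (f t) ≤ z) → 1 ≤ z → All (1 ≤_) zs → z *
        product zs ≤ M →
      memory s N 0 ≡ n⁺ → Seg (memory s) (memory s PA 0) (slotsOf f ++ rest) → Seg (memory s) (memory s QB 0)
          (poolOf gs) →
      Run (repeat (length gs) cross-next) s (1 + length gs * crossing-weight) λ s′ →
        (∃[ rest′ ] Seg (memory s′) (memory s′ PA 0) (slotsOf (product⊗ f gs) ++ rest′)) ×
        (∀ t → length (product⊗ f gs t) ≤ M)
    crosses-run [] zs f z s rest [] hf 1≤z _ le nn sa sb = skip-run
        ((rest , sa) , λ t → ≤-trans (hf t) (≤-trans (m≤m*product zs) le))
      where
      m≤m*product : ∀ zs → z ≤ z * 1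
      m≤m*product _ = ≤-reflexive (sym (*-identityʳ z))
    crosses-run (g ∷ gs) (z′ ∷ zs) f z s rest (hg ∷ hgs) hf 1≤z (1≤z′ ∷ 1≤zs) le nn sa sb = weaken weight
      (seq-run (seq-run (block-run _ (seq-run
          (map-run next (framed (cross-run (map f nds) (map g nds) z z′ _ rest (poolOf gs)
        (trans (length-map f nds) (sym (length-map g nds))) (All-map f nds hf) (All-map g nds hg)
        (trans nn (sym (length-map f nds))) (Seg-≋ (untouched (λ _ → refl)) sa)
            (Seg-≋ (untouched (λ _ → refl)) sb))))))))
      where
      zz′≤M : z * z′ ≤ M
      zz′≤M = ≤-trans (≤-trans (≤-reflexive (sym (*-identityʳ (z * z′))))
          (*-monoʳ-≤ (z * z′) (1≤product 1≤zs))) (≤-trans (≤-reflexive (*-assoc z z′ _)) le)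
      z≤M : z ≤ M
      z≤M = ≤-trans (≤-trans (≤-reflexive (sym (*-identityʳ z))) (*-monoʳ-≤ z 1≤z′)) zz′≤M
      z′≤M : z′ ≤ M
      z′≤M = ≤-trans (≤-trans (≤-reflexive (sym (*-identityˡ z′))) (*-monoˡ-≤ z′ 1≤z)) zz′≤M
      1≤M : 1 ≤ M
      1≤M = ≤-trans 1≤z z≤M
      1≤n⁺ : 1 ≤ n⁺
      1≤n⁺ = subst (1 ≤_) (sym n⁺≡) (s≤s z≤n)
      cw≤ : cross-weight z z′ ≤ 12 * M
      cw≤ = ≤-trans (+-mono-≤ (+-mono-≤ (*-monoʳ-≤ 4 1≤M)
          (≤-trans (≤-reflexive (trans (*-distribˡ-+ z 4 (z′ * 2))
          (cong₂ _+_ (*-comm z 4) (trans (sym (*-assoc z z′ 2)) (*-comm (z * z′) 2)))))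
          (+-mono-≤ (*-monoʳ-≤ 4 z≤M) (*-monoʳ-≤ 2 zz′≤M)))) (≤-trans (*-monoˡ-≤ 2 z′≤M) (≤-reflexive (*-comm M 2))))
        (linear ((4 :* v₀ :+ (4 :* v₀ :+ 2 :* v₀)) :+ 2 :* v₀) (12 :* v₀) (M ∷ []))
      weight : (1 + ((2 + length (map f nds) * cross-weight z z′) + 1)) + (1 + length gs * crossing-weight) ≤
          1 + (crossing-weight + length gs * crossing-weight)
      weight = ≤-trans (+-monoˡ-≤ (1 + length gs * crossing-weight)
          (+-monoʳ-≤ 1 (+-monoˡ-≤ 1 (+-monoʳ-≤ 2 (*-mono-≤ (≤-reflexive (length-map f nds)) cw≤)))))
        (≤-trans (≤-reflexive (cong (λ u → (1 + ((2 + u) + 1)) + (1 + length gs * crossing-weight))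
            (trans (sym (*-assoc n⁺ 12 M)) (trans (cong (_* M) (*-comm n⁺ 12)) (*-assoc 12 n⁺ M)))))
          (≤-trans (linear ((# 1 :+ ((# 2 :+ 12 :* v₀) :+ # 1)) :+ (# 1 :+ v₁))
              (# 1 :+ ((12 :* v₀ :+ 5 :* # 1) :+ v₁)) (n⁺ * M ∷ length gs * crossing-weight ∷ []))
            (≤-trans (+-monoʳ-≤ 1 (+-monoˡ-≤ (length gs * crossing-weight)
                (+-monoʳ-≤ (12 * (n⁺ * M)) (*-monoʳ-≤ 5 (*-mono-≤ 1≤n⁺ 1≤M)))))
              (linear (# 1 :+ ((12 :* v₀ :+ 5 :* v₀) :+ v₁)) (# 1 :+ (17 :* v₀ :+ v₁))
                  (n⁺ * M ∷ length gs * crossing-weight ∷ [])))))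
      m₁ : Memory
      m₁ = run-block xs (memory s) (HA ≔ var TOP ∷ [])
      next : ∀ s₂ → (Appends m₁ (memory s₂) (flat (zipWith crossₑ (map f nds) (map g nds))) × memory s₂ QB 0 ≡
          length (slotsOf g) + memory s QB 0) ×
        Frame cross ⟨ m₁ , query s , output s ⟩ s₂ → Run (block (PA ≔ var HA ∷ [])) s₂ 1 λ s₃ → Run
            (repeat (length gs) cross-next) s₃ (1 + length gs * crossing-weight) _
      next s₂ ((ap , qb) , fr) = block-run _
          (crosses-run gs zs (f ⊗ g) (z * z′) _ [] hgs (length-⊗ {f} {g} hf hg) (*-mono-≤ 1≤z 1≤z′) 1≤zs
        (≤-trans (≤-reflexive (*-assoc z z′ _)) le) (trans (same-memory fr N refl 0) nn)
        (Seg-at (sym (same-memory fr HA refl 0)) (Seg-≋ (untouched (λ _ → refl))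
          (subst (Seg (memory s₂) (memory s TOP 0))
              (trans (cong flat (zipWith-map f g nds)) (sym (++-identityʳ _))) (segment ap))))
        (Seg-at (sym qb) (Seg-≋ (untouched (λ _ → refl))
            (Seg-⊑ (extends ap) (Seg-≋ (untouched (λ _ → refl)) (proj₂ (Seg-++⁻ (slotsOf g) sb)))))))

module _ (r′ : ℕ) where
  private
    r p : ℕ
    r = suc r′
    p = length (pairs r)

  initialise combine : Prog r
  initialise = mark-labels (labels r) ⨾
    (kinds-init ⨾ block (SC ≔ const (2 ^ labelWidth r) ∷ BASE ≔ const (2 ^ labelWidth r) ∷ []))
  -- After the evaluation of the first factor, PC points to the lists of the second one.
  check-all : Prog r
  check-all = block (PC ≔ const 0 ∷ OK ≔ const 1 ∷ []) ⨾
    (evaluate ⨾ (block (QB ≔ var PC ∷ []) ⨾ (note-result ⨾ repeat r′ check)))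
  combine = counters-from r p ⨾ (block (PA ≔ const 0 ∷ []) ⨾ (repeat (r′ + p) cross-next ⨾
    (block (PC ≔ var PA ∷ []) ⨾ (evaluate ⨾ emit (const 1 ⊟ (const 1 ⊟ var RES))))))

  main : (Fin r → Core) → Prog r
  main C = initialise ⨾ (stages C id ⨾ (check-all ⨾
    (ifnz var OK then (ifnz inp (const 0) then combine else emit (const 1)) else emit (const 0))))

modifies-mark-labels : ∀ {q} cs b → (TAB ≡ᵇ b) ≡ false → modifies (mark-labels {q} cs) b ≡ false
modifies-mark-labels []       b h = refl
modifies-mark-labels (c ∷ cs) b h = cong₂ _∨_ (cong (_∨ false) h) (modifies-mark-labels cs b h)

silent-mark-labels : ∀ {q} cs → queries (mark-labels {q} cs) ≡ false × emits (mark-labels {q} cs) ≡ false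
silent-mark-labels []       = refl , refl
silent-mark-labels (c ∷ cs) = silent-mark-labels cs

flag : ℕ → Bool
flag zero    = false
flag (suc _) = true

flag-iff : ∀ k → Iff (flag k ≡ true) (k ≢ 0)
flag-iff zero    = (λ ()) , λ h → ⊥-elim (h refl)
flag-iff (suc k) = (λ _ ()) , λ _ → refl

-- Marks are added up during the scan, so the cell of the final state may exceed 1; the double
-- truncated subtraction cuts it down to a bit.
flag-bit : ∀ k → 1 ∸ (1 ∸ k) ≡ bit (flag k)
flag-bit zero    = refl
flag-bit (suc k) = cong (1 ∸_) (0∸n≡0 k)

-- The complete computation, its answer and its running time

module Final (r′ : ℕ) (C : Fin (suc r′) → Core) (ρ : Fin (suc r′) → Bits → Bool) (d : ℕ) {ω : ℕ}
    (D : Decomp ω) (a : Fin ω) (wf : WellFormed D) where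

  r p : ℕ
  r = suc r′
  p = length (pairs r)

  open Assembly r ρ d D a wf
  open Logic ρ xs
  open CrossRuns ρ xs
  open EvalRuns ρ xs
  open CounterRuns ρ xs
  open Phases r ρ (s≤s z≤n) d D a wf

  -- Here the first run is a value to which the second one may refer: its final state and
  -- postcondition can be named before the second run is constructed.
  seq-runs : ∀ {ℓ ℓ′ q q′ s w w′} {Q : State → Set ℓ} {Q′ : State → Set ℓ′} (h : Run q s w Q) → Run q′
      (final h) w′ Q′ → Run (q ⨾ q′) s (w + w′) Q′
  seq-runs h h′ = seq-run (run (execution h) (bound h) h′)

  emit-run : ∀ e {s} {h : T (suc (cost e) ≤ᵇ 1000)} {Q : State → Set} → Q ⟨ memory s , query s , output s ++
      eval xs (memory s) e ∷ [] ⟩ → Run (emit e) s 1 Q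
  emit-run e {h = h} q = run emit (≤stepFactor*1 _ h) q

  record Initialised (s : State) : Set where
    field
      common : Common s
      fresh  : Fresh 0 (memory s)
      scale  : memory s SC 0 ≡ b₀
      acc    : ∀ k → memory s ACC k ≡ 0
      top0   : memory s TOP 0 ≡ 0

  initialise-run : Run (initialise r′) initial (length (labels r) + (5 + n * 5)) Initialised
  initialise-run = weaken (≤-reflexive weight)
    (seq-run (map-run after-labels (framed (mark-labels-run (labels r) initial))))
    where
    weight : (1 + length (labels r)) + ((3 + length (map δ (nodes D)) * 5) + 1) ≡ length (labels r) + (5 + n * 5)
    weight = trans (cong (λ u → (1 + length (labels r)) + ((3 + u * 5) + 1)) (length-map δ (nodes D)))
      (trans (cong (λ u → suc (length (labels r) + u)) (+-comm (3 + n * 5) 1)) (sym (+-suc (length (labels r)) _)))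
    ml : Prog r
    ml = mark-labels (labels r)
    after-labels : ∀ s₁ → _ × Frame ml initial s₁ → Run _ s₁ _ Initialised
    after-labels s₁ (tab , fr₁) = seq-run
        (map-run after-kinds (framed (kinds-init-run (map δ (nodes D)) (encodeNodes D) s₁
        (subst₂ Coded (++-identityʳ _) (++-identityʳ _) (coded-nodes D []))
            (input-suffix (d ∷ ω ∷ n ∷ []) (encodeNodes D)) (sym (length-map δ (nodes D))))))
      where
      zero₁ : ∀ b → (TAB ≡ᵇ b) ≡ false → ∀ k → memory s₁ b k ≡ 0
      zero₁ b h k = same-memory fr₁ b (modifies-mark-labels (labels r) b h) k
      after-kinds : ∀ s₂ → _ × Frame kinds-init s₁ s₂ → Run _ s₂ 1 Initialised
      after-kinds s₂ ((kd , nn) , fr₂) = block-run _ (record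
        { common = record
            { kinds = Numbers-≗ (λ _ → refl) kd
            ; number = trans nn (cong suc (length-map δ (nodes D)))
            ; table = λ k → (λ nz → to (proj₁ (tab k) λ z → nz (trans (same-memory fr₂ TAB refl k) z))) ,
                            λ k∈ z → proj₂ (tab k) (inj₂ k∈) (trans (sym (same-memory fr₂ TAB refl k)) z)
            ; base = refl
            ; quiet = trans (same-query fr₂ refl) (same-query fr₁ (proj₁ (silent-mark-labels {r} (labels r))))
            ; silent = trans (same-output fr₂ refl) (same-output fr₁ (proj₂ (silent-mark-labels {r} (labels r)))) }
        ; fresh = λ j _ b k → trans (same-memory fr₂ (core-array j b) refl k) (zero₁ (core-array j b) refl k)
        ; scale = refl
        ; acc = λ k → trans (same-memory fr₂ ACC refl k) (zero₁ ACC refl k)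
        ; top0 = trans (same-memory fr₂ TOP refl 0) (zero₁ TOP refl 0) })
        where
        to : ∀ {k} → 0 ≢ 0 ⊎ k ∈ labels r → k ∈ labels r
        to (inj₁ h) = ⊥-elim (h refl)
        to (inj₂ h) = h

  -- Reachability in the product of all factors

  product-compatible : ∀ {s s′ g gs} {Q : Property D⁺} {Qs : List (Property D⁺)} → (Q ∷ Qs) ≡ properties d C ρ
      D → 0 < s →
    Factor D⁺ 0 s s′ g Q → ∀ {s″} → Factors D⁺ 1 s′ s″ gs Qs →
    Iff (Reachable W D⁺ (product⊗ g gs) 0) (Diverse d C ρ D)
  product-compatible {s} {s′} {g} {gs} {Q} {Qs} eqQ 0<s fa fas = to , from
    where
    inside-g : Everywhere D⁺ (Within 1 s′) g
    inside-g = Spanning⇒Within D⁺ 0<s (Factor.spanning fa)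
    padded : Padded D⁺ (product⊗ g gs)
    padded = within-padded D⁺ (proj₂ (proj₂ (product-within D⁺ {k = 1} g (s≤s (s≤s z≤n)) inside-g fas)))
    to : Reachable W D⁺ (product⊗ g gs) 0 → Diverse d C ρ D
    to h with Reachable⇒Reach W W0 D⁺ (product⊗ g gs) padded h
    ... | Λ , re , good with product-sound D⁺ g Λ inside-g fas re
    ...   | λ₀ , bs , r₀ , sat , eq with Factor.sound fa λ₀ r₀
    ...     | b , lb , q = compatible⇒diverse d C ρ D (b ∷ bs , subst ((b ∷ bs) satisfy_) eqQ (q ∷ sat) ,
                λ v → subst W (trans (eq v) (cong (_+ encode 1 (at bs v)) (lb v))) (good v))
    from : Diverse d C ρ D → Reachable W D⁺ (product⊗ g gs) 0
    from dv with diverse⇒compatible d C ρ D dv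
    ... | bs , sat , good = build bs (subst (bs satisfy_) (sym eqQ) sat) good
      where
      build : ∀ bs → bs satisfy (Q ∷ Qs) → (∀ v → encode 0 (at bs v) ∈ labels r) → Reachable W D⁺ (product⊗ g gs) 0
      build (b ∷ bs) (q ∷ sat) good with Factor.complete fa b q
      ... | λ₀ , r₀ , lb with product-complete D⁺ g λ₀ bs r₀ fas sat
      ...   | Λ , R , eq = Reach⇒Reachable W W0 D⁺ (product⊗ g gs) Λ R
                (λ v → subst W (sym (trans (eq v) (cong (_+ encode 1 (at bs v)) (lb v)))) (good v))

  Answer : State → Set
  Answer s = ∃[ answer ] output s ≡ bit answer ∷ [] × Iff (answer ≡ true) (Diverse d C ρ D)

  product-replicate : ∀ m k → product (replicate m k) ≡ k ^ m
  product-replicate zero    k = refl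
  product-replicate (suc m) k = cong (k *_) (product-replicate m k)

  sized-length : ∀ {gs zs} → Sized gs zs → length gs ≡ length zs
  sized-length []      = refl
  sized-length (_ ∷ h) = cong suc (sized-length h)

  sized-++ : ∀ {gs zs gs′ zs′} → Sized gs zs → Sized gs′ zs′ → Sized (gs ++ gs′) (zs ++ zs′)
  sized-++ []      h′ = h′
  sized-++ (h ∷ t) h′ = h ∷ sized-++ t h′

  module Checked (S : ℕ) (b₀≤S : b₀ ≤ S) (g : Lists D⁺) (gs : List (Lists D⁺)) (Qs : List (Property D⁺)) where

    stop : ℕ
    stop = length (poolOf (g ∷ gs))

    open Checking S b₀≤S stop
    open Checkable

    record Start (s : State) : Set where
      field
        common : Common s
        scale  : memory s SC 0 ≡ S
        lists  : Seg (memory s) 0 (poolOf (g ∷ gs))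
        top≡   : memory s TOP 0 ≡ stop

    -- The tables of the separate evaluations remain in memory. The final evaluation only requires
    -- that the cells from the present `BASE` on are 0 and that the labels at the bottom are intact.
    record CheckedAll (s : State) : Set₁ where
      field
        base≥  : b₀ ≤ memory s BASE 0
        table  : ∀ k → k < b₀ → Iff (memory s TAB k ≢ 0) (W k)
        zeros  : ∀ k → memory s BASE 0 ≤ k → memory s TAB k ≡ 0
        scale  : memory s SC 0 ≡ S
        number : memory s N 0 ≡ n⁺
        kinds  : Numbers (memory s) KIND 0 (map δ nds)
        first  : Seg (memory s) 0 (slotsOf g)
        others : Seg (memory s) (memory s QB 0) (poolOf gs)
        ends   : memory s TOP 0 ≡ length (poolOf gs) + memory s QB 0
        quiet  : query s ≡ []
        silent : output s ≡ []
        ok⇒    : memory s OK 0 ≢ 0 → Satisfiable Qs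
        ⇒ok    : Satisfiable Qs → memory s OK 0 ≢ 0

    check-all-run : ∀ {s₀ s₁ Q Rs} → Qs ≡ Q ∷ Rs → 0 < s₀ → Factor D⁺ 0 s₀ s₁ g Q → Factors D⁺ 1 s₁ S gs Rs →
        length gs ≡ r′ →
      ∀ st → Start st → Run (check-all r′) st (8 + 12 * entriesIn (g ∷ gs)) CheckedAll
    check-all-run {Rs = Rs} refl 0<s₀ fa fas len st ini = weaken weight
        (map-run (λ s′ (h , fr) → conclude s′ h fr) (framed
        (seq-run (block-run _ (seq-run (map-run after-first
            (check-run {U = ⊤} s₁′ (poolOf gs) 0<s₀ (factors-≤ fas) (s≤s z≤n) fa start ((λ _ → tt) , λ _ ()))))))))
      where
      m₁ : Memory
      m₁ = run-block xs (memory st) (PC ≔ const 0 ∷ OK ≔ const 1 ∷ [])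
      s₁′ : State
      s₁′ = ⟨ m₁ , query st , output st ⟩
      cm : Common st
      cm = Start.common ini
      E₀ = entry-count (map g nds)
      weight : 1 + ((3 + 7 * E₀) + (1 + (2 + (1 + 12 * entriesIn gs)))) ≤ 8 + 12 * (E₀ + entriesIn gs)
      weight = linear (# 1 :+ ((# 3 :+ 7 :* v₀) :+ (# 1 :+ (# 2 :+ (# 1 :+ 12 :* v₁)))))
          (# 8 :+ 12 :* (v₀ :+ v₁)) (E₀ ∷ entriesIn gs ∷ [])
      start : Checkable m₁ (poolOf (g ∷ gs))
      start = record
        { ready = record
          { base≥ = ≤-reflexive (sym (Common.base cm))
          ; labels = λ k _ → Common.table cm k
          ; fresh = λ k le → zero-above k (≤-trans (≤-reflexive (sym (Common.base cm))) le) }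
        ; scale = Start.scale ini
        ; number = trans (Common.number cm) (sym n⁺≡)
        ; kinds = subst (Numbers m₁ KIND 0) (sym δ-nodes) (Numbers-≗ {memory st} {m₁} (λ _ → refl) (Common.kinds cm))
        ; next = Seg-≋ {memory st} {m₁} (untouched (λ _ → refl)) (Start.lists ini)
        ; cursor = refl }
        where
        zero-above : ∀ k → b₀ ≤ k → memory st TAB k ≡ 0
        zero-above k le with memory st TAB k ≟ 0
        ... | yes z = z
        ... | no nz = ⊥-elim (<⇒≱ (labels-< r (proj₁ (Common.table cm k) nz)) le)
      Core′ : State → Set₁
      Core′ s′ = Checkable (memory s′) [] × Seg (memory s′) (memory s′ QB 0) (poolOf gs) ×
          (memory s′ QB 0 + length (poolOf gs) ≡ stop) ×
        (memory s′ OK 0 ≢ 0 → Satisfiable Qs) × (Satisfiable Qs → memory s′ OK 0 ≢ 0)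
      after-first : ∀ s₂ → _ → Run (block (QB ≔ var PC ∷ []) ⨾ (note-result ⨾ repeat r′ check)) s₂
          (1 + (2 + (1 + 12 * entriesIn gs))) Core′
      after-first s₂ (ck₂ , fr₂ , note) = seq-run
          (block-run _ (seq-run (map-run after-note (framed (note ⟨ m₃ , query s₂ , output s₂ ⟩ refl refl)))))
        where
        m₃ : Memory
        m₃ = run-block xs (memory s₂) (QB ≔ var PC ∷ [])
        after-note : ∀ s₄ → _ × Frame note-result ⟨ m₃ , query s₂ , output s₂ ⟩ s₄ → Run (repeat r′ check) s₄
            (1 + 12 * entriesIn gs) Core′
        after-note s₄ (ok , fr₄) = subst (λ u → Run (repeat u check) s₄ (1 + 12 * entriesIn gs) Core′) len
          (map-run (λ s₅ ((ck₅ , to , from) , fr₅) → ck₅ ,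
              Seg-at (sym (qb s₅ fr₅)) (Seg-≋ (frame-≋ {repeat (length gs) check} fr₅ pool-free)
                  (Seg-≋ moved (next ck₂))) ,
              trans (cong (_+ _) (qb s₅ fr₅)) (cursor ck₂) ,
              (λ h → let ((_ , q) , qs) = to h in q ∷ qs) , λ { (q ∷ qs) → from ((tt , q) , qs) })
            (framed (checks-run s₄ [] (≤-trans 0<s₀ (Factor.s≤s′ fa)) ≤-refl (s≤s (≤-reflexive len)) fas ck₄ ok)))
          where
          moved : memory s₂ ≋ memory s₄
          moved = ≋-trans (untouched {memory s₂} {m₃} (λ _ → refl)) (frame-≋ fr₄ refl)
          pool-free : modifies (repeat (length gs) check) 0 ∨
              (modifies (repeat (length gs) check) 1 ∨ (modifies (repeat (length gs) check) 2 ∨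
            (modifies (repeat (length gs) check) 3 ∨ modifies (repeat {r} (length gs) check) 4))) ≡ false
          pool-free = cong₂ _∨_ (modifies-repeat (length gs) check 0 refl)
              (cong₂ _∨_ (modifies-repeat (length gs) check 1 refl)
            (cong₂ _∨_ (modifies-repeat (length gs) check 2 refl)
                (cong₂ _∨_ (modifies-repeat (length gs) check 3 refl) (modifies-repeat (length gs) check 4 refl))))
          qb : ∀ s₅ → Frame (repeat (length gs) check) s₄ s₅ → memory s₅ QB 0 ≡ memory s₂ PC 0
          qb s₅ fr₅ = trans (same-memory fr₅ QB (modifies-repeat (length gs) check QB refl) 0)
              (same-memory fr₄ QB refl 0)
          ck₄ : Checkable (memory s₄) (poolOf gs ++ [])
          ck₄ = record
            { ready = record
              { base≥ = subst (b₀ ≤_) (sym (same-memory fr₄ BASE refl 0)) (Ready.base≥ (ready ck₂))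
              ; labels = λ j j< → (λ h → proj₁ (Ready.labels (ready ck₂) j j<) λ z → h
                  (trans (same-memory fr₄ TAB refl j) z)) ,
                                  (λ w z → proj₂ (Ready.labels (ready ck₂) j j<) w
                                      (trans (sym (same-memory fr₄ TAB refl j)) z))
              ; fresh = λ j le → trans (same-memory fr₄ TAB refl j)
                  (Ready.fresh (ready ck₂) j (subst (_≤ j) (same-memory fr₄ BASE refl 0) le)) }
            ; scale = trans (same-memory fr₄ SC refl 0) (scale ck₂)
            ; number = trans (same-memory fr₄ N refl 0) (number ck₂)
            ; kinds = Numbers-≗ (same-memory fr₄ KIND refl) (Numbers-≗ {memory s₂} {m₃} (λ _ → refl) (kinds ck₂))
            ; next = subst (Seg (memory s₄) (memory s₄ PC 0)) (sym (++-identityʳ (poolOf gs)))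
                (Seg-at (sym (same-memory fr₄ PC refl 0)) (Seg-≋ moved (next ck₂)))
            ; cursor = trans (cong₂ (λ u v → u + length v) (same-memory fr₄ PC refl 0)
                (++-identityʳ (poolOf gs))) (cursor ck₂) }
      conclude : ∀ s′ → Core′ s′ → Frame (check-all r′) st s′ → CheckedAll s′
      conclude s′ (ck , sg , en , to , from) fr = record
        { base≥ = Ready.base≥ (ready ck) ; table = Ready.labels (ready ck) ; zeros = Ready.fresh (ready ck)
        ; scale = scale ck ; number = number ck ; kinds = kinds ck
        ; first = proj₁ (Seg-++⁻ (slotsOf g)
            (Seg-≋ (frame-≋ fr (cong₂ _∨_ (free 0 refl)
            (cong₂ _∨_ (free 1 refl) (cong₂ _∨_ (free 2 refl) (cong₂ _∨_ (free 3 refl) (free 4 refl))))))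
            (Start.lists ini)))
        ; others = sg
        ; ends = trans (same-memory fr TOP (free 4 refl) 0)
            (trans (Start.top≡ ini) (trans (sym en) (+-comm (memory s′ QB 0) _)))
        ; quiet = trans (same-query fr (proj₁ (silent-repeat r′ check refl refl))) (Common.quiet cm)
        ; silent = trans (same-output fr (proj₂ (silent-repeat r′ check refl refl))) (Common.silent cm)
        ; ok⇒ = to ; ⇒ok = from }
        where
        free : ∀ b → modifies (check {r}) b ≡ false → modifies (repeat {r} r′ check) b ≡ false
        free b h = modifies-repeat r′ check b h

    entry-count≤ : ∀ (f : Lists D⁺) M ts → (∀ t → length (f t) ≤ M) → entry-count (map f ts) ≤ length ts * suc M
    entry-count≤ f M []       h = z≤n
    entry-count≤ f M (t ∷ ts) h = +-mono-≤ (s≤s (h t)) (entry-count≤ f M ts h)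

    combine-weight : ℕ → ℕ
    combine-weight M = (1 + p * counters-weight) +
        (1 + ((1 + (r′ + p) * (17 * (n⁺ * M))) + (1 + ((3 + 7 * (n⁺ * suc M)) + 1))))

    combine-run : ∀ {s₀ s₁ Q Rs z zs} → Qs ≡ Q ∷ Rs → Qs ≡ tabulate (λ i → CoreProperty (C i) (ρ i) D) → 0 < s₀ →
      Factor D⁺ 0 s₀ s₁ g Q → Factors D⁺ 1 s₁ S gs Rs → Sized (g ∷ gs) (z ∷ zs) → length gs ≡ r′ → 0 < d → All
          (1 ≤_) (z ∷ zs) →
      ∀ s → CheckedAll s → Run (combine r′) s (combine-weight (product (z ∷ zs) * square ^ p)) Answer
    combine-run {s₀} {s₁} {Q} {Rs} {z} {zs} eqQ eqC 0<s₀ fa fas (hg ∷ hgs) len 0<d (1≤z ∷ 1≤zs) s ck =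
      seq-run (map-run after-counters (framed
          (counters-run 0<d r p s (subst (0 <_) (sym (CheckedAll.scale ck)) 0<S) (CheckedAll.number ck)
          (CheckedAll.kinds ck))))
      where
      0<S : 0 < S
      0<S = ≤-trans b₀>0 b₀≤S
      M : ℕ
      M = product (z ∷ zs) * square ^ p
      after-counters : ∀ s₂ → Counted r p (memory s SC 0) s s₂ × Frame (counters-from r p) s s₂ → Run _ s₂ _ Answer
      after-counters s₂ (cn , fr₂) = seq-run (block-run _ (seq-run (map-run after-crosses (framed
          (subst (λ u → Run (repeat u cross-next) s₃ (1 + u * (17 * (n⁺ * M))) Crossed) count≡
            (crosses-run all-gs all-zs g z s₃ [] all-sized hg 1≤z all-1≤ (≤-reflexive product≡)
                (trans (free₂ N (λ _ → refl) 0) (CheckedAll.number ck))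
              (subst (Seg m₃ 0) (sym (++-identityʳ (slotsOf g)))
                  (Seg-≋ {memory s₂} {m₃} (untouched (λ _ → refl)) (Seg-⊑ (extends ap) (CheckedAll.first ck))))
              (Seg-at (sym (free₂ QB (λ _ → refl) 0)) (Seg-≋ {memory s₂} {m₃} (untouched (λ _ → refl)) pool₂))))))))
        where
        open Crossing M
        gs′ : List (Lists D⁺)
        gs′ = Counted.factorLists cn
        ap = Counted.appended cn
        all-gs : List (Lists D⁺)
        all-gs = gs ++ gs′
        all-zs : List ℕ
        all-zs = zs ++ replicate p square
        all-sized : Sized all-gs all-zs
        all-sized = sized-++ hgs (Counted.sized cn)
        product≡ : z * product all-zs ≡ M
        product≡ = trans (cong (z *_) (trans (product-++ zs (replicate p square))
            (cong (product zs *_) (product-replicate p square)))) (sym (*-assoc z (product zs) (square ^ p)))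
        all-1≤ : All (1 ≤_) all-zs
        all-1≤ = ++⁺ 1≤zs (replicate⁺ p (s≤s z≤n))
        length-gs′ : length gs′ ≡ p
        length-gs′ = trans (sized-length (Counted.sized cn)) (length-replicate p)
        count≡ : length all-gs ≡ r′ + p
        count≡ = trans (length-++ gs) (cong₂ _+_ len length-gs′)
        free₂ : ∀ b → (∀ lab → modifies (counter {r} lab) b ≡ false) → ∀ k → memory s₂ b k ≡ memory s b k
        free₂ b h = same-memory fr₂ b (counters-frame r p b h)
        pool₂ : Seg (memory s₂) (memory s QB 0) (poolOf all-gs)
        pool₂ = subst (Seg (memory s₂) (memory s QB 0)) (sym (concatMap-++ slotsOf gs gs′))
          (Seg-++⁺ (poolOf gs) (Seg-⊑ (extends ap) (CheckedAll.others ck)) (Seg-at (CheckedAll.ends ck) (segment ap)))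
        S′ : ℕ
        S′ = memory s₂ SC 0
        -- Scales and bits continue without a gap: the counters start at the scale left by the cores
        -- and at the bit `r`.
        all-fas : Factors D⁺ 1 s₁ S′ all-gs (Rs ++ replicate p (CountProperty d D))
        all-fas = factors-++ fas (subst₂ (λ u v → Factors D⁺ u v S′ gs′ (replicate p (CountProperty d D)))
          (trans (cong suc (sym len)) (+-comm 1 (length gs))) (CheckedAll.scale ck) (Counted.factors cn))
        S≤S′ : S ≤ S′
        S≤S′ = subst (_≤ S′) (CheckedAll.scale ck) (factors-≤ (Counted.factors cn))
        m₃ : Memory
        m₃ = run-block xs (memory s₂) (PA ≔ const 0 ∷ [])
        s₃ : State
        s₃ = ⟨ m₃ , query s₂ , output s₂ ⟩
        h : Lists D⁺
        h = product⊗ g all-gs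
        Crossed : State → Set
        Crossed s′ = (∃[ rest′ ] Seg (memory s′) (memory s′ PA 0) (slotsOf h ++ rest′)) × (∀ t → length (h t) ≤ M)
        all-properties : (Q ∷ (Rs ++ replicate p (CountProperty d D))) ≡ properties d C ρ D
        all-properties = cong (_++ replicate p (CountProperty d D)) (trans (sym eqQ) eqC)
        after-crosses : ∀ s₄ → Crossed s₄ × Frame (repeat (r′ + p) cross-next) s₃ s₄ → Run _ s₄
            (1 + ((3 + 7 * (n⁺ * suc M)) + 1)) Answer
        after-crosses s₄ (((rest′ , sg) , h≤) , fr₄) = seq-run
            (block-run _ (seq-run (weaken (+-monoʳ-≤ 3 (*-monoʳ-≤ 7 (entry-count≤ h M nds h≤)))
            (map-run after-evaluation (Last.evaluate-product h (proj₁ inside-h) s₅ rest′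
                (proj₂ (proj₂ inside-h)) label< checkable)))))
          where
          m₅ : Memory
          m₅ = run-block xs (memory s₄) (PC ≔ var PA ∷ [])
          s₅ : State
          s₅ = ⟨ m₅ , query s₄ , output s₄ ⟩
          module Last = Checking S′ (≤-trans b₀≤S S≤S′) (memory s₄ PA 0 + length (slotsOf h ++ rest′))
          free : ∀ b → (∀ lab → modifies (counter {r} lab) b ≡ false) → modifies (cross-next {r}) b ≡ false →
              (PA ≡ᵇ b) ≡ false → (PC ≡ᵇ b) ≡ false → ∀ k → m₅ b k ≡ memory s b k
          free b e e′ e″ e‴ k = trans (write-array (memory s₄) {PC} {0} {memory s₄ PA 0} b e‴ k)
              (trans (same-memory fr₄ b (modifies-repeat (r′ + p) cross-next b e′) k)
            (trans (write-array (memory s₂) {PA} {0} {0} b e″ k) (free₂ b e k)))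
          inside-h : ∃[ l ] l < 2 ^ (length all-gs + 1) × Everywhere D⁺ (Within l S′) h
          inside-h = product-within D⁺ {k = 1} g (s≤s (s≤s z≤n))
              (Spanning⇒Within D⁺ 0<s₀ (Factor.spanning fa)) all-fas
          -- The first core uses bit 0 and each of the `r′ + p` further factors one bit more,
          -- together the width of the label table.
          label< : proj₁ inside-h < b₀
          label< = subst (λ u → proj₁ inside-h < 2 ^ u)
              (trans (cong (_+ 1) count≡) (trans (+-comm (r′ + p) 1) (+-comm r p))) (proj₁ (proj₂ inside-h))
          checkable : Last.Checkable m₅ (slotsOf h ++ rest′)
          checkable = record
            { ready = record
              { base≥ = subst (b₀ ≤_) (sym (free BASE (λ _ → refl) refl refl refl 0)) (CheckedAll.base≥ ck)
              ; labels = λ j j< → (λ nz → proj₁ (CheckedAll.table ck j j<) λ z → nz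
                  (trans (free TAB (λ _ → refl) refl refl refl j) z)) ,
                                  (λ w z → proj₂ (CheckedAll.table ck j j<) w
                                      (trans (sym (free TAB (λ _ → refl) refl refl refl j)) z))
              ; fresh = λ j le → trans (free TAB (λ _ → refl) refl refl refl j)
                  (CheckedAll.zeros ck j (subst (_≤ j) (free BASE (λ _ → refl) refl refl refl 0) le)) }
            ; scale = same-memory fr₄ SC (modifies-repeat (r′ + p) cross-next SC refl) 0
            ; number = trans (free N (λ _ → refl) refl refl refl 0) (CheckedAll.number ck)
            ; kinds = Numbers-≗ {memory s} {m₅} (free KIND (λ _ → refl) refl refl refl) (CheckedAll.kinds ck)
            ; next = Seg-≋ {memory s₄} {m₅} (untouched (λ _ → refl)) sg
            ; cursor = refl }
          after-evaluation : ∀ s₆ → _ × _ × Frame evaluate s₅ s₆ → Run (emit (const 1 ⊟ (const 1 ⊟ var RES)))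
              s₆ 1 Answer
          after-evaluation s₆ (res , _ , fr₆) = emit-run (const 1 ⊟ (const 1 ⊟ var RES))
            ( flag (memory s₆ RES 0)
            , trans (cong (_++ _) silent₆) (cong (_∷ []) (flag-bit (memory s₆ RES 0)))
            , ((λ e → proj₁ correct (proj₁ res (proj₁ (flag-iff _) e))) , λ dv → proj₂ (flag-iff _)
                (proj₂ res (proj₂ correct dv))))
            where
            correct : Iff (Reachable W D⁺ h 0) (Diverse d C ρ D)
            correct = product-compatible all-properties 0<s₀ fa all-fas
            silent₆ : output s₆ ≡ []
            silent₆ = trans (same-output fr₆ refl)
                (trans (same-output fr₄ (proj₂ (silent-repeat (r′ + p) cross-next refl refl)))
              (trans (same-output fr₂ (proj₂ (counters-silent r p))) (CheckedAll.silent ck)))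

  core-properties : List (Property D⁺)
  core-properties = tabulate (λ i → CoreProperty (C i) (ρ i) D)

  sizes : List ℕ
  sizes = tabulate (λ i → Size (C i) D)

  product-power : ∀ m j k → (j * k) ^ m ≡ j ^ m * k ^ m
  product-power zero    j k = refl
  product-power (suc m) j k = begin
    j * k * (j * k) ^ m        ≡⟨ cong (j * k *_) (product-power m j k) ⟩
    j * k * (j ^ m * k ^ m)    ≡⟨ *-assoc j k _ ⟩
    j * (k * (j ^ m * k ^ m))  ≡⟨ cong (j *_)
        (trans (sym (*-assoc k (j ^ m) (k ^ m)))
        (trans (cong (_* k ^ m) (*-comm k (j ^ m))) (*-assoc (j ^ m) k (k ^ m)))) ⟩
    j * (j ^ m * (k * k ^ m))  ≡⟨ sym (*-assoc j (j ^ m) _) ⟩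
    j ^ suc m * k ^ suc m      ∎
    where open ≡-Reasoning

  -- In `K`, 24 per pair pays for building the counter, 34 for each of the `r′ + p` multiplications,
  -- and 36 for the last evaluation and all constants. The factor 4^p comes from (d + 1)² ≤ 4d². `L`
  -- is the number of admissible labels, and `T₂` bounds the cells filled by the cores.
  Στ budget K L T₂ : ℕ
  Στ = Σ[τ] C D
  budget = n * ∏[Size] C D * d ^ (r ^ 2)
  K  = (36 + (24 * p + 34 * (r′ + p))) * 4 ^ p
  L  = length (labels r)
  T₂ = 2 * Στ

  -- A witness uses a tuple at the root, so the set of tuples there is not empty.
  1≤size : ∀ i b → CoreProperty (C i) (ρ i) D b → 1 ≤ Size (C i) D
  1≤size i b (α , (_ , (c , _) , _) , _) = ≤-trans (nonempty (c root)) (size-bound (C i) D root)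
    where
    nonempty : ∀ {A : Set} {x : A} {l} → x ∈ l → 1 ≤ length l
    nonempty (here _)  = s≤s z≤n
    nonempty (there _) = s≤s z≤n

  satisfiable⇒sizes : Satisfiable core-properties → All (1 ≤_) sizes
  satisfiable⇒sizes sat = tabulate⁺ λ i → let (b , q) = tabulate⁻ {f = λ i → CoreProperty (C i) (ρ i) D} sat i in 1≤size i b q

  1≤n : 1 ≤ n
  1≤n = 1≤∣V∣ D

  counters-weight≤ : counters-weight ≤ 24 * (n * square)
  counters-weight≤ = ≤-trans (+-mono-≤ first second) (≤-reflexive (sym (*-distribʳ-+ (n * square) 6 18)))
    where
    suc≤ : suc d ≤ square
    suc≤ = m≤m+n (suc d) (d * suc d)
    1≤sq : 1 ≤ square
    1≤sq = ≤-trans (s≤s z≤n) suc≤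
    sq≤ : square ≤ n * square
    sq≤ = ≤-trans (≤-reflexive (sym (*-identityˡ square))) (*-monoˡ-≤ square 1≤n)
    first : 6 + d * 2 ≤ 6 * (n * square)
    first = ≤-trans (≤-trans (≤-reflexive (cong (6 +_) (*-comm d 2)))
        (linear (# 6 :+ 2 :* v₀) (6 :* (# 1 :+ v₀)) (d ∷ []))) (*-monoʳ-≤ 6 (≤-trans suc≤ sq≤))
    middle : (2 + d) * (4 + (1 + d) * 2) ≤ 12 * square
    middle = ≤-trans (*-mono-≤ {2 + d} {2 * suc d} {4 + (1 + d) * 2} {6 * suc d}
        (linear (# 2 :+ v₀) (2 :* (# 1 :+ v₀)) (d ∷ []))
        (≤-trans (≤-reflexive (cong (4 +_) (*-comm (1 + d) 2)))
            (linear (# 4 :+ 2 :* (# 1 :+ v₀)) (6 :* (# 1 :+ v₀)) (d ∷ []))))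
      (≤-reflexive (trans (*-assoc 2 (suc d) (6 * suc d))
          (trans (cong (2 *_) (trans (sym (*-assoc (suc d) 6 (suc d)))
          (trans (cong (_* suc d) (*-comm (suc d) 6)) (*-assoc 6 (suc d) (suc d))))) (sym (*-assoc 2 6 square)))))
    second : n * (6 + (2 + d) * (4 + (1 + d) * 2)) ≤ 18 * (n * square)
    second = ≤-trans (*-monoʳ-≤ n (≤-trans (+-mono-≤ (*-monoʳ-≤ 6 1≤sq) middle)
        (≤-reflexive (sym (*-distribʳ-+ square 6 12)))))
      (≤-reflexive (trans (sym (*-assoc n 18 square)) (trans (cong (_* square) (*-comm n 18)) (*-assoc 18 n square))))

  -- All sizes and the number of nodes are positive, hence `Q`, the number of nodes times the bound
  -- on the product lists, is at least 1 and dominates every summand, constants included. It remains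
  -- to replace the powers of (d + 1)² by powers of d, where `0 < d` enters.
  combine-weight≤ : 0 < d → All (1 ≤_) sizes → ∀ {S b₀≤S g gs Qs} →
    Checked.combine-weight S b₀≤S g gs Qs (product sizes * square ^ p) ≤ K * budget
  combine-weight≤ 0<d 1≤sizes = ≤-trans bounded
      (≤-trans (*-monoʳ-≤ (36 + (24 * p + 34 * (r′ + p))) Q≤)
      (≤-reflexive (sym (*-assoc (36 + (24 * p + 34 * (r′ + p))) (4 ^ p) budget))))
    where
    Π M Q : ℕ
    Π = product sizes
    M = Π * square ^ p
    Q = n * M
    1≤sq^ : ∀ m → 1 ≤ square ^ m
    1≤sq^ m = m^n>0 square m
    1≤M : 1 ≤ M
    1≤M = *-mono-≤ (1≤product 1≤sizes) (1≤sq^ p)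
    1≤Q : 1 ≤ Q
    1≤Q = *-mono-≤ 1≤n 1≤M
    -- The factor `m` in front covers the case without pairs, in which (d + 1)² is not bounded by
    -- its power 0 but no counter is built either.
    psq≤ : ∀ m → m * square ≤ m * (Π * square ^ m)
    psq≤ zero    = z≤n
    psq≤ (suc m) = *-monoʳ-≤ (suc m) (≤-trans
        (≤-reflexive (sym (trans (*-identityˡ (square * 1)) (*-identityʳ square))))
      (*-mono-≤ (1≤product 1≤sizes) (*-monoʳ-≤ square (1≤sq^ m))))
    counters≤ : p * counters-weight ≤ 24 * p * Q
    counters≤ = ≤-trans (*-monoʳ-≤ p counters-weight≤)
        (≤-trans (≤-reflexive (swap p n square)) (≤-trans (*-monoʳ-≤ 24 (*-monoʳ-≤ n (psq≤ p)))
        (≤-reflexive (trans (sym (swap p n M)) (trans (sym (*-assoc p 24 Q)) (cong (_* Q) (*-comm p 24)))))))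
      where
      swap : ∀ p n k → p * (24 * (n * k)) ≡ 24 * (n * (p * k))
      swap p n k = trans (sym (*-assoc p 24 (n * k)))
          (trans (cong (_* (n * k)) (*-comm p 24)) (trans (*-assoc 24 p (n * k))
        (cong (24 *_) (trans (sym (*-assoc p n k)) (trans (cong (_* k) (*-comm p n)) (*-assoc n p k))))))
    n⁺≤ : n⁺ ≤ 2 * n
    n⁺≤ = ≤-trans (≤-reflexive n⁺≡) (≤-trans (+-monoˡ-≤ n 1≤n) (≤-reflexive (cong (n +_) (sym (+-identityʳ n)))))
    crosses≤ : (r′ + p) * (17 * (n⁺ * M)) ≤ 34 * (r′ + p) * Q
    crosses≤ = ≤-trans (*-monoʳ-≤ (r′ + p) (*-monoʳ-≤ 17 (≤-trans (*-monoˡ-≤ M n⁺≤) (≤-reflexive (*-assoc 2 n M)))))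
      (≤-reflexive (trans (cong ((r′ + p) *_) (sym (*-assoc 17 2 Q)))
          (trans (sym (*-assoc (r′ + p) 34 Q)) (cong (_* Q) (*-comm (r′ + p) 34)))))
    last≤ : n⁺ * suc M ≤ 4 * Q
    last≤ = ≤-trans (*-mono-≤ n⁺≤ (≤-trans (+-monoˡ-≤ M 1≤M) (≤-reflexive (cong (M +_) (sym (+-identityʳ M))))))
      (≤-reflexive (trans (*-assoc 2 n (2 * M))
          (trans (cong (2 *_) (trans (sym (*-assoc n 2 M))
          (trans (cong (_* M) (*-comm n 2)) (*-assoc 2 n M)))) (sym (*-assoc 2 2 Q)))))
    bounded : (1 + p * counters-weight) +
        (1 + ((1 + (r′ + p) * (17 * (n⁺ * M))) + (1 + ((3 + 7 * (n⁺ * suc M)) + 1)))) ≤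
        (36 + (24 * p + 34 * (r′ + p))) * Q
    bounded = ≤-trans (+-mono-≤ (+-monoʳ-≤ 1 counters≤)
        (+-monoʳ-≤ 1 (+-mono-≤ (+-monoʳ-≤ 1 crosses≤) (+-monoʳ-≤ 1 (+-monoˡ-≤ 1 (+-monoʳ-≤ 3 (*-monoʳ-≤ 7 last≤)))))))
      (≤-trans (linear ((# 1 :+ v₀) :+ (# 1 :+ ((# 1 :+ v₁) :+ (# 1 :+ ((# 3 :+ 7 :* (4 :* v₂)) :+ # 1)))))
                       ((8 :* # 1 :+ 28 :* v₂) :+ (v₀ :+ v₁)) (24 * p * Q ∷ 34 * (r′ + p) * Q ∷ Q ∷ []))
        (≤-trans (+-monoˡ-≤ (24 * p * Q + 34 * (r′ + p) * Q) (+-monoˡ-≤ (28 * Q) (*-monoʳ-≤ 8 1≤Q)))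
          (≤-reflexive (trans (cong₂ _+_ (sym (*-distribʳ-+ Q 8 28))
              (sym (*-distribʳ-+ Q (24 * p) (34 * (r′ + p))))) (sym (*-distribʳ-+ Q 36 (24 * p + 34 * (r′ + p))))))))
    sq≤ : square ≤ 4 * (d * d)
    sq≤ = ≤-trans (*-mono-≤ 1+d≤ 1+d≤) (≤-reflexive
        (trans (*-assoc 2 d (2 * d)) (trans (cong (2 *_)
        (trans (sym (*-assoc d 2 d)) (trans (cong (_* d) (*-comm d 2)) (*-assoc 2 d d))))
        (sym (*-assoc 2 2 (d * d))))))
      where
      1+d≤ : suc d ≤ 2 * d
      1+d≤ = ≤-trans (+-monoˡ-≤ d 0<d) (≤-reflexive (cong (d +_) (sym (+-identityʳ d))))
    power≤ : square ^ p ≤ 4 ^ p * d ^ (r ^ 2)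
    power≤ = ≤-trans (^-monoˡ-≤ p sq≤) (≤-trans (≤-reflexive (product-power p 4 (d * d))) (*-monoʳ-≤ (4 ^ p)
      (≤-trans (≤-reflexive (trans (cong (λ u → (d * u) ^ p) (sym (*-identityʳ d))) (^-*-assoc d 2 p)))
          (^-monoʳ-≤ d {{>-nonZero 0<d}} (≤-trans (length-pairs r)
          (≤-reflexive (cong (r *_) (sym (*-identityʳ r)))))))))
    Q≤ : Q ≤ 4 ^ p * budget
    Q≤ = ≤-trans (*-monoʳ-≤ n (*-monoʳ-≤ Π power≤)) (≤-reflexive (begin
      n * (Π * (4 ^ p * d ^ (r ^ 2)))  ≡⟨ cong (n *_)
          (trans (sym (*-assoc Π (4 ^ p) _)) (trans (cong (_* d ^ (r ^ 2)) (*-comm Π (4 ^ p)))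
          (*-assoc (4 ^ p) Π _))) ⟩
      n * (4 ^ p * (Π * d ^ (r ^ 2)))  ≡⟨ trans (sym (*-assoc n (4 ^ p) _))
          (trans (cong (_* (Π * d ^ (r ^ 2))) (*-comm n (4 ^ p))) (*-assoc (4 ^ p) n _)) ⟩
      4 ^ p * (n * (Π * d ^ (r ^ 2)))  ≡⟨ cong (4 ^ p *_) (sym (*-assoc n Π _)) ⟩
      4 ^ p * budget                        ∎))
      where open ≡-Reasoning

  diverse⇒satisfiable : Diverse d C ρ D → Satisfiable core-properties
  diverse⇒satisfiable (b , core , _) = tabulate⁺ {f = λ i → CoreProperty (C i) (ρ i) D} (λ i → b i , core i)

  -- The distances impose nothing here, so solutions found core by core can be combined freely.
  satisfiable⇒diverse : d ≡ 0 → Satisfiable core-properties → Diverse d C ρ D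
  satisfiable⇒diverse refl sat = (λ i → proj₁ (witness i)) , (λ i → proj₂ (witness i)) , λ _ _ _ → z≤n
    where
    witness : ∀ i → ∃[ b ] CoreProperty (C i) (ρ i) D b
    witness = tabulate⁻ {f = λ i → CoreProperty (C i) (ρ i) D} sat

  decide-weight : ℕ
  decide-weight = 4 + K * budget

  decide : Prog r
  decide = ifnz var OK then (ifnz inp (const 0) then combine r′ else emit (const 1)) else emit (const 0)

  answered : ∀ s e b → output s ≡ [] → eval xs (memory s) e ≡ bit b → Iff (b ≡ true) (Diverse d C ρ D) →
    {h : T (suc (cost e) ≤ᵇ 1000)} → Run (emit e) s 1 Answer
  answered s e b silent ev correct {h} = emit-run e {h = h}
      (b , trans (cong (_++ _) silent) (cong (_∷ []) ev) , correct)

  checked-run : ∀ {s₁ S g gs Q Rs z zs} → (Q ∷ Rs) ≡ core-properties → (z ∷ zs) ≡ sizes → Factor D⁺ 0 b₀ s₁ g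
      Q → Factors D⁺ 1 s₁ S gs Rs →
    Sized (g ∷ gs) (z ∷ zs) → entriesIn (g ∷ gs) ≤ T₂ → ∀ s → Common s → memory s SC 0 ≡ S →
    Seg (memory s) 0 (poolOf (g ∷ gs)) → memory s TOP 0 ≡ length (poolOf (g ∷ gs)) →
    Run (check-all r′ ⨾ decide) s ((8 + 12 * T₂) + decide-weight) Answer
  checked-run {s₁} {S} {g} {gs} {Q} {Rs} {z} {zs} eqQ eqz fa fas sz total s cm scl lists top≡ =
    seq-runs checked (decide-run (final checked) (post checked))
    where
    b₀≤S : b₀ ≤ S
    b₀≤S = ≤-trans (Factor.s≤s′ fa) (factors-≤ fas)
    open Checked S b₀≤S g gs (Q ∷ Rs)
    len : length gs ≡ r′
    len = suc-injective (trans (sized-length sz) (trans (cong length eqz) (length-tabulate (λ i → Size (C i) D))))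
    checked : Run (check-all r′) s (8 + 12 * T₂) CheckedAll
    checked = weaken (+-monoʳ-≤ 8 (*-monoʳ-≤ 12 total))
      (check-all-run refl b₀>0 fa fas len s (record { common = cm ; scale = scl ; lists = lists ; top≡ = top≡ }))
    decide-run : ∀ s₃ → CheckedAll s₃ → Run decide s₃ decide-weight Answer
    decide-run s₃ ck with memory s₃ OK 0 ≟ 0
    ... | yes z≡ = if-run (λ h → ⊥-elim (h z≡)) (λ _ → weaken {w = 1} (s≤s z≤n)
          (answered s₃ (const 0) false (CheckedAll.silent ck) refl
            ((λ ()) , λ dv → ⊥-elim (CheckedAll.⇒ok ck (subst Satisfiable (sym eqQ) (diverse⇒satisfiable dv)) z≡))))
    ... | no nz = if-run (λ _ → satisfiable (subst Satisfiable eqQ (CheckedAll.ok⇒ ck nz))) (λ z≡ → ⊥-elim (nz z≡))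
      where
      satisfiable : Satisfiable core-properties → Run (ifnz inp (const 0) then combine r′ else emit (const 1))
          s₃ (3 + K * budget) Answer
      satisfiable sat with d ≟ 0
      ... | yes d≡0 = if-run (λ h → ⊥-elim (h d≡0)) (λ _ → weaken {w = 1} (s≤s z≤n)
            (answered s₃ (const 1) true (CheckedAll.silent ck) refl
                ((λ _ → satisfiable⇒diverse d≡0 sat) , λ _ → refl)))
      ... | no d≢0 = if-run (λ _ → weaken (≤-trans
          (subst (λ u → combine-weight (product u * square ^ p) ≤ K * budget) (sym eqz)
                (combine-weight≤ (n≢0⇒n>0 d≢0) (satisfiable⇒sizes sat) {S} {b₀≤S} {g} {gs} {Q ∷ Rs})) (m≤n+m _ 2))
              (combine-run refl eqQ b₀>0 fa fas sz len (n≢0⇒n>0 d≢0)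
                  (subst (All (1 ≤_)) (sym eqz) (satisfiable⇒sizes sat)) s₃ ck))
            (λ h → ⊥-elim (d≢0 h))

  -- Each list has an end mark. The cells filled by one core thus outnumber the nodes, and terms
  -- linear in the tree can be charged to the running times of the cores even when the product term
  -- vanishes.
  entriesIn≥ : ∀ g gs → suc n ≤ entriesIn (g ∷ gs)
  entriesIn≥ g gs = ≤-trans (≤-trans (≤-reflexive (sym n⁺≡)) (per-node nds)) (m≤m+n _ (entriesIn gs))
    where
    per-node : ∀ ts → length ts ≤ entry-count (map g ts)
    per-node []       = z≤n
    per-node (t ∷ ts) = s≤s (≤-trans (per-node ts) (m≤n+m _ (length (g t))))

  main-run : Run (main r′ C) initial ((2 * (L + 51) + K) * (Στ + budget)) Answer
  main-run = weaken weight (seq-runs initialised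
      (seq-runs staged (proceed (AllStaged.factorLists st) (AllStaged.factors st) (AllStaged.sized st)
      (AllStaged.total st) lists top≡)))
    where
    initialised : Run (initialise r′) initial (L + (5 + n * 5)) Initialised
    initialised = initialise-run
    ini : Initialised (final initialised)
    ini = post initialised
    s₁ : State
    s₁ = final initialised
    staged : Run (stages C id) s₁ (1 + 32 * Στ) (AllStaged C id 0 b₀ s₁)
    staged = stages-run C id 0 s₁ b₀ (λ j → sym (+-identityʳ (toℕ j))) (Initialised.common ini)
        (Initialised.fresh ini) (Initialised.scale ini) b₀>0 (λ j _ → Initialised.acc ini j)
    s₂ : State
    s₂ = final staged
    st : AllStaged C id 0 b₀ s₁ s₂
    st = post staged
    lists : Seg (memory s₂) 0 (poolOf (AllStaged.factorLists st))
    lists = Seg-at (Initialised.top0 ini) (segment (AllStaged.appended st))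
    top≡ : memory s₂ TOP 0 ≡ length (poolOf (AllStaged.factorLists st))
    top≡ = trans (top (AllStaged.appended st))
        (trans (cong (length (poolOf (AllStaged.factorLists st)) +_) (Initialised.top0 ini)) (+-identityʳ _))
    proceed : ∀ gl → Factors D⁺ 0 b₀ (memory s₂ SC 0) gl core-properties → Sized gl sizes → entriesIn gl ≤ T₂ →
      Seg (memory s₂) 0 (poolOf gl) → memory s₂ TOP 0 ≡ length (poolOf gl) → Run (check-all r′ ⨾ decide) s₂
          ((8 + 12 * T₂) + decide-weight) Answer
    proceed (g ∷ gs) (fa ∷ fas) (hg ∷ hgs) total sg t = checked-run refl refl fa fas (hg ∷ hgs) total s₂
        (AllStaged.common st) refl sg t
    suc-n≤ : suc n ≤ T₂
    suc-n≤ = go (AllStaged.factorLists st) (AllStaged.factors st) (AllStaged.total st)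
      where
      go : ∀ gl → Factors D⁺ 0 b₀ (memory s₂ SC 0) gl core-properties → entriesIn gl ≤ T₂ → suc n ≤ T₂
      go (g ∷ gs) (_ ∷ _) le = ≤-trans (entriesIn≥ g gs) le
    1≤T₂ : 1 ≤ T₂
    1≤T₂ = ≤-trans (s≤s z≤n) suc-n≤
    -- Everything but the combination is charged to `T₂`, which is at least `suc n`: 5 for reading
    -- the tree, 18 for constants, and 28 = 16 + 12 for the simulations with parsing and for the
    -- separate evaluations, together 51. The label table contributes `L` further multiples.
    weight : (L + (5 + n * 5)) + ((1 + 32 * Στ) + ((8 + 12 * T₂) + decide-weight)) ≤ (2 * (L + 51) + K) *
        (Στ + budget)
    weight = begin
      (L + (5 + n * 5)) + ((1 + 32 * Στ) + ((8 + 12 * T₂) + (4 + K * budget)))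
        ≤⟨ +-mono-≤ (+-monoʳ-≤ L (+-monoʳ-≤ 5 (≤-reflexive (*-comm n 5))))
            (+-monoˡ-≤ ((8 + 12 * T₂) + (4 + K * budget)) (+-monoʳ-≤ 1 (≤-reflexive (*-assoc 16 2 Στ)))) ⟩
      (L + (5 + 5 * n)) + ((1 + 16 * T₂) + ((8 + 12 * T₂) + (4 + K * budget)))
        ≤⟨ linear ((v₀ :+ (# 5 :+ 5 :* v₁)) :+ ((# 1 :+ 16 :* v₂) :+ ((# 8 :+ 12 :* v₂) :+ (# 4 :+ v₃))))
             (v₀ :+ (5 :* (# 1 :+ v₁) :+ (18 :* # 1 :+ (28 :* v₂ :+ v₃)))) (L ∷ n ∷ T₂ ∷ K * budget ∷ []) ⟩
      L + (5 * suc n + (18 * 1 + (28 * T₂ + K * budget)))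
        ≤⟨ +-mono-≤ (≤-trans (≤-reflexive (sym (*-identityʳ L))) (*-monoʳ-≤ L 1≤T₂))
            (+-mono-≤ (*-monoʳ-≤ 5 suc-n≤) (+-monoˡ-≤ (28 * T₂ + K * budget) (*-monoʳ-≤ 18 1≤T₂))) ⟩
      L * T₂ + (5 * T₂ + (18 * T₂ + (28 * T₂ + K * budget)))
        ≤⟨ linear (v₀ :+ (5 :* v₁ :+ (18 :* v₁ :+ (28 :* v₁ :+ v₂)))) ((v₀ :+ 51 :* v₁) :+ v₂)
            (L * T₂ ∷ T₂ ∷ K * budget ∷ []) ⟩
      (L * T₂ + 51 * T₂) + K * budget
        ≡⟨ cong (_+ K * budget) (trans (sym (*-distribʳ-+ T₂ L 51))
            (trans (sym (*-assoc (L + 51) 2 Στ)) (cong (_* Στ) (*-comm (L + 51) 2)))) ⟩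
      2 * (L + 51) * Στ + K * budget
        ≤⟨ +-mono-≤ (*-monoˡ-≤ Στ (m≤m+n (2 * (L + 51)) K)) (*-monoˡ-≤ budget (m≤n+m K (2 * (L + 51)))) ⟩
      (2 * (L + 51) + K) * Στ + (2 * (L + 51) + K) * budget
        ≡⟨ sym (*-distribˡ-+ (2 * (L + 51) + K) Στ budget) ⟩
      (2 * (L + 51) + K) * (Στ + budget) ∎
      where open ≤-Reasoning

-- Every decomposition mentions a colour, so the width is positive and the additional root can be
-- formed.
anyColor : ∀ {ω} → Decomp ω → Fin ω
anyColor (intro v a)      = a
anyColor (t₁ ⊕ t₂)        = anyColor t₁
anyColor (recolor t a b)  = a
anyColor (addEdges t a b) = a

-- The constants of the analysis written out in terms of `r` alone, since the factor has to be fixed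
-- before the cores are given; the cores influence only the program.
timeFactor : ℕ → ℕ
timeFactor zero     = 2
timeFactor (suc r′) = stepFactor * (2 * (length (labels (suc r′)) + 51) +
  (36 + (24 * length (pairs (suc r′)) + 34 * (r′ + length (pairs (suc r′))))) * 4 ^ length (pairs (suc r′)))

theorem6 : ∀ {ℓ} (r : ℕ) → ∃[ c ]
    ((P : Fin r → VertexProblem ℓ) (C : Fin r → Core) (ρ : Fin r → Bits → Bool) →
    (∀ i → Solves (C i) (ρ i) (P i)) →
    ∃[ A ] (∀ (d : ℕ) (G : Graph) {ω} (D : Decomp ω) → D IsDecompositionOf G →
    ∃[ k ] ∃[ answer ]
    Computes ρ A (d ∷ encodeDecomp D) k (bit answer ∷ []) ×
    k ≤ c * (Σ[τ] C D + ∣V D ∣ * ∏[Size] C D * d ^ (r ^ 2)) ×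
    (answer ≡ true ⇔ (∃[ S ] DivMinProblem d P G S))))
-- The empty family is always a solution, the minimum over no pairs being `⊤⁺`. Empty product and
-- exponent 0 reduce the product term to the number of nodes, which is at least 1 and pays for the
-- two steps.
theorem6 zero = timeFactor 0 , λ P C ρ solves → emit (const 1) , λ d G D isD →
  2 , true , (_ , emit , refl) ,
  ≤-trans (*-monoʳ-≤ 2 (1≤∣V∣ D)) (≤-reflexive (cong (2 *_) (sym (trans (*-identityʳ (∣V D ∣ * 1)) (*-identityʳ ∣V D ∣))))) ,
  mk⇔ (λ _ → (λ ()) , (λ ()) , ([ d ] ≤⊤⁺)) (λ _ → refl)
  where open Semantics
theorem6 (suc r′) = timeFactor (suc r′) , λ P C ρ solves → main r′ C , λ d G D isD →
  let open Final r′ C ρ d D (anyColor D) (_IsDecompositionOf_.wellFormed isD)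
      open Logic ρ (d ∷ encodeDecomp D) using (final; steps; execution; bound; post)
      (answer , output≡ , correct) = post main-run
  in steps main-run , answer , (final main-run , execution main-run , output≡) ,
     ≤-trans (bound main-run) (≤-reflexive (sym (*-assoc stepFactor _ (Στ + budget)))) ,
     mk⇔ (λ e → diverse⇒solution P C ρ solves d G D isD (proj₁ correct e))
         (λ sol → proj₂ correct (solution⇒diverse P C ρ solves d G D isD sol))
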